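{- Let $n\geq 2$, $q=p^h$ with $p$ prime and $h\geq 1$, and $1\leq k\leq n-1$. Suppose that one of the following holds: (i) $h=1$, $q\geq 11$, and $\delta=\frac12\left((\sqrt{2}-1)q^k-3\theta_{k-1}-8\right)\geq 0$; (ii) $h\geq 2$, $k\geq 2$, $q\geq 25$, and $\delta=\frac12\left(q^{k-1}-\theta_{k-2}-3\right)$. Let $\mathcal{H}(n,n-k,q)$ be the hypergraph whose vertices are the points of $\mathrm{PG}(n,q)$ and whose hyperedges are the $(n-k)$-dimensional subspaces. Then: a) If $k<\frac{n}{2}$, then any rainbow-free strict $N$-coloring of $\mathcal{H}(n,n-k,q)$ with \[N\geq \theta_n-\tau_2(\mathcal{H}(n,n-k,q))+1-\delta=\theta_n-2\theta_k+1-\delta\] has a color class containing two disjoint $k$-dimensional subspaces (and hence the coloring has a monochromatic $2$-transversal). b) If $k\geq \frac{n}{2}$, then $\bar\chi(\mathcal{H}(n,n-k,q))<\theta_n-2\theta_k+1-\delta$.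
   Context: For a hypergraph $\mathcal{H}=(V;E)$, a strict $N$-coloring is a partition of $V$ into exactly $N$ nonempty color classes. A hyperedge is rainbow if no two of its vertices have the same color; a coloring is rainbow-free if no hyperedge is rainbow. The upper chromatic number $\bar\chi(\mathcal{H})$ is the largest $N$ such that $\mathcal{H}$ admits a rainbow-free strict $N$-coloring. A $2$-transversal is a vertex set meeting every hyperedge in at least $2$ vertices, and $\tau_2(\mathcal{H})$ is the minimum size of a $2$-transversal. Dimensions are projective, and $\theta_m=\frac{q^{m+1}-1}{q-1}$ is the number of points of an $m$-dimensional projective space of order $q$. -}

module Defs where

open import Level using (0ℓ)
open import Data.Nat as ℕ using (ℕ; zero; suc; _^_)
open import Data.Integer as ℤ using (ℤ; +_)
open import Data.Fin using (Fin)
open import Data.Vec using (Vec; []; _∷_; replicate; zipWith; map)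
open import Data.Product using (Σ; ∃; ∃-syntax; _×_; _,_)
open import Data.Sum using (_⊎_)
open import Relation.Nullary using (¬_)
open import Relation.Binary.PropositionalEquality using (_≡_; _≢_)
open import Algebra.Structures using (IsCommutativeRing)
open import Function.Bundles using (_↔_)

-- Finite fields of order q (every finite field of order q is GF(q), so
-- quantifying over all of them is the same as working with GF(q)).

record FiniteField (q : ℕ) : Set₁ where
  field
    Carrier : Set
    _+_ _*_ : Carrier → Carrier → Carrier
    -_      : Carrier → Carrier
    0# 1#   : Carrier
    isCommutativeRing : IsCommutativeRing _≡_ _+_ _*_ -_ 0# 1#
    0≢1     : 0# ≢ 1#
    inverse : ∀ x → x ≢ 0# → ∃[ y ] (x * y ≡ 1#)
    enum    : Carrier ↔ Fin q

-- The projective space PG(n,q) = PG(F^{n+1}), via homogeneous coordinates.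

module Geometry {q : ℕ} (F : FiniteField q) where
  open FiniteField F

  Vect : ℕ → Set
  Vect n = Vec Carrier (suc n)

  zeroV : ∀ {n} → Vect n
  zeroV = replicate _ 0#

  _+ᵥ_ : ∀ {n} → Vect n → Vect n → Vect n
  _+ᵥ_ = zipWith _+_

  _·_ : ∀ {n} → Carrier → Vect n → Vect n
  a · v = map (a *_) v

  linComb : ∀ {m n} → Vec Carrier m → Vec (Vect n) m → Vect n
  linComb []       []       = zeroV
  linComb (a ∷ as) (b ∷ bs) = (a · b) +ᵥ linComb as bs

  LinIndep : ∀ {m n} → Vec (Vect n) m → Set
  LinIndep {m} bs = ∀ as → linComb as bs ≡ zeroV → as ≡ replicate m 0#

  -- a d-dimensional (projective) subspace of PG(n,q): the span of d+1
  -- linearly independent vectors of F^{n+1}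
  record Subspace (n d : ℕ) : Set where
    field
      basis : Vec (Vect n) (suc d)
      indep : LinIndep basis

  _∈_ : ∀ {n d} → Vect n → Subspace n d → Set
  v ∈ W = ∃[ as ] (linComb as (Subspace.basis W) ≡ v)

  Nonzero : ∀ {n} → Vect n → Set
  Nonzero v = v ≢ zeroV

  SamePoint : ∀ {n} → Vect n → Vect n → Set
  SamePoint u v = ∃[ a ] (u ≡ a · v)

  -- A colouring of the points of PG(n,q) with colours Fin N, given on
  -- homogeneous coordinates (the value on the zero vector is irrelevant).
  Coloring : ℕ → ℕ → Set
  Coloring n N = Vect n → Fin N

  WellDefined : ∀ {n N} → Coloring n N → Set
  WellDefined c = ∀ u v → Nonzero u → Nonzero v → SamePoint u v → c u ≡ c v

  AllColorsUsed : ∀ {n N} → Coloring n N → Set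
  AllColorsUsed {N = N} c = ∀ (i : Fin N) → ∃[ v ] (Nonzero v × c v ≡ i)

  StrictColoring : ∀ {n N} → Coloring n N → Set
  StrictColoring c = WellDefined c × AllColorsUsed c

  Rainbow : ∀ {n d N} → Coloring n N → Subspace n d → Set
  Rainbow c W = ∀ u v → u ∈ W → v ∈ W → Nonzero u → Nonzero v →
                c u ≡ c v → SamePoint u v

  RainbowFree : ∀ {n N} (d : ℕ) → Coloring n N → Set
  RainbowFree {n} d c = ∀ (W : Subspace n d) → ¬ Rainbow c W

  ClassContains : ∀ {n d N} → Coloring n N → Fin N → Subspace n d → Set
  ClassContains c i U = ∀ v → v ∈ U → Nonzero v → c v ≡ i

  Disjoint : ∀ {n d e} → Subspace n d → Subspace n e → Set
  Disjoint U U' = ∀ v → v ∈ U → v ∈ U' → v ≡ zeroV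

  ClassIs2Transversal : ∀ {n N} (d : ℕ) → Coloring n N → Fin N → Set
  ClassIs2Transversal {n} d c i =
    ∀ (W : Subspace n d) → ∃[ u ] ∃[ v ]
      (u ∈ W × v ∈ W × Nonzero u × Nonzero v × ¬ SamePoint u v ×
       c u ≡ i × c v ≡ i)

θ : ℕ → ℕ → ℕ
θ q zero    = 1
θ q (suc m) = θ q m ℕ.+ q ^ suc m

-- Case (i): δ = ((√2-1) q^k - 3 θ_{k-1} - 8)/2.
-- "δ ≥ 0"  ⇔  √2 q^k ≥ q^k + 3θ_{k-1} + 8  ⇔  (q^k + 3θ_{k-1} + 8)² ≤ 2 (q^k)²
DeltaNonneg-i : (q k : ℕ) → Set
DeltaNonneg-i q k =
  let A = q ^ k ℕ.+ 3 ℕ.* θ q (k ℕ.∸ 1) ℕ.+ 8 in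
  A ℕ.* A ℕ.≤ 2 ℕ.* (q ^ k ℕ.* q ^ k)

-- Case (i): "N ≥ θ_n - 2θ_k + 1 - δ"
--   ⇔ 2N ≥ 2θ_n - 4θ_k + 2 - (√2-1)q^k + 3θ_{k-1} + 8
--   ⇔ √2 q^k ≥ T,  T := 2θ_n - 4θ_k + q^k + 3θ_{k-1} + 10 - 2N   (in ℤ)
--   ⇔ T ≤ 0  or  T² ≤ 2 (q^k)²
AboveBound-i : (q n k N : ℕ) → Set
AboveBound-i q n k N =
  let Q = + (q ^ k)
      T = (+ 2) ℤ.* + θ q n ℤ.- (+ 4) ℤ.* + θ q k ℤ.+ Q
          ℤ.+ (+ 3) ℤ.* + θ q (k ℕ.∸ 1) ℤ.+ + 10 ℤ.- (+ 2) ℤ.* + N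
  in (T ℤ.≤ + 0) ⊎ (T ℤ.* T ℤ.≤ (+ 2) ℤ.* (Q ℤ.* Q))

-- Case (ii): δ = (q^{k-1} - θ_{k-2} - 3)/2.
-- "N ≥ θ_n - 2θ_k + 1 - δ"  ⇔  2N + 4θ_k + q^{k-1} ≥ 2θ_n + θ_{k-2} + 5
AboveBound-ii : (q n k N : ℕ) → Set
AboveBound-ii q n k N =
  2 ℕ.* θ q n ℕ.+ θ q (k ℕ.∸ 2) ℕ.+ 5
    ℕ.≤ 2 ℕ.* N ℕ.+ 4 ℕ.* θ q k ℕ.+ q ^ (k ℕ.∸ 1)

module _ {q : ℕ} (F : FiniteField q) where
  open Geometry F

  ConclusionA : (n k : ℕ) → (ℕ → Set) → Set
  ConclusionA n k AboveBound =
    ∀ (N : ℕ) (c : Coloring n N) → StrictColoring c → RainbowFree (n ℕ.∸ k) c →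
      AboveBound N →
      ∃[ i ] (Σ (Subspace n k) λ U → Σ (Subspace n k) λ U' →
                Disjoint U U' × ClassContains c i U × ClassContains c i U')
      × ∃[ i ] ClassIs2Transversal (n ℕ.∸ k) c i

  -- b) upper chromatic number < bound: no rainbow-free strict N-colouring
  --    has N ≥ bound
  ConclusionB : (n k : ℕ) → (ℕ → Set) → Set
  ConclusionB n k AboveBound =
    ∀ (N : ℕ) (c : Coloring n N) → StrictColoring c → RainbowFree (n ℕ.∸ k) c →
      ¬ AboveBound N

{-# OPTIONS --safe #-}
-- Let β be the set of the points whose colour occurs at least twice. Since the colouring is rainbow-free, every
-- (n-k)-space meets β in at least two points. Call a point P of β essential if it lies on a 2-secant, an (n-k)-space
-- with exactly two points in β. After projection, the Rédei polynomial of β at such a point is a fully reducible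
-- lacunary polynomial X^q g + h; when β is small, comparing degrees in a divisibility involving derivatives forces
-- h to be a multiple of g. Hence β contains many lines through P, and, gluing these together, a k-space through P;
-- a minimal part of β that still meets every (n-k)-space twice contains two disjoint ones.
--
-- On a 2-secant through P some colour repeats, so the other point has the colour of P; as there are many 2-secants,
-- a class containing an essential point is large. The first two moments of the intersection of the colour classes
-- with a random (n-k)-space leave no room for two large classes, so that all essential points, and with them the two
-- k-spaces, have one colour. Two disjoint k-spaces exist in PG(n,q) only if 2 k < n, and both of them meet every
-- (n-k)-space.

module Submission where

open import Defs
open import Algebra.Bundles using (CommutativeRing; RawRing)
import Algebra.Properties.AbelianGroup as AbelianGroupProperties
import Algebra.Properties.Ring as RingProperties
import Algebra.Properties.Semiring.Mult as Mult
import Algebra.Solver.Ring as RingSolver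
import Algebra.Solver.Ring.AlmostCommutativeRing as ACR
open import Algebra.Structures using (IsCommutativeRing)
open import Data.Bool using (Bool; true; false; if_then_else_; _∧_; _∨_; not)
import Data.Bool.Properties as Boolₚ
open import Data.Empty using (⊥; ⊥-elim)
open import Data.Fin as Fin using (Fin)
open import Data.Integer as ℤ using (ℤ) renaming (+_ to int)
import Data.Integer.Properties as ℤₚ
open import Data.List using (List; []; _∷_; _++_; map; length; allFin; concatMap)
open import Data.List.Membership.Propositional using (_∈_)
import Data.List.Properties as Listₚ
open import Data.List.Relation.Binary.Permutation.Propositional using (_↭_; ↭-refl; ↭-trans; ↭-prep)
  renaming (refl to ↭-base; prep to ↭-cons; swap to ↭-exchange; trans to ↭-tr)
open import Data.List.Relation.Binary.Permutation.Propositional.Properties using (↭-length)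
open import Data.List.Relation.Unary.Any using (here; there)
open import Data.Maybe using (Maybe; just; nothing)
open import Data.Nat
open import Data.Nat.Coprimality using (coprime-Bézout; prime⇒coprime)
open import Data.Nat.Divisibility using (_∣_; divides)
open import Data.Nat.GCD using (module Bézout)
open import Data.Nat.Primality using (Prime; prime⇒irreducible)
open import Data.Nat.Properties
open import Data.Product using (_×_; _,_; proj₁; proj₂; Σ; ∃-syntax)
open import Data.Sum using (_⊎_; inj₁; inj₂)
open import Data.Unit using (⊤; tt)
open import Data.Vec as Vec using (Vec; []; _∷_; replicate; zipWith)
open import Data.Vec.N-ary using (N-ary; _$ⁿ_; curryⁿ; Eq; curryⁿ-cong)
open import Function.Base using (_∘_; _$_; id; case_of_)
open import Function.Bundles using (Inverse)
open import Level using (0ℓ)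
open import Relation.Binary.Definitions using (tri<; tri≈; tri>)
open import Relation.Binary.PropositionalEquality
import Relation.Binary.Reasoning.Setoid as SetoidReasoning
open import Relation.Nullary using (Dec; yes; no; ¬_; does)

-- Three constants let one argument serve both cases. `E` says how far a fibre of the projection may
-- exceed `2 q + 1` points: the derivative argument compares degrees that differ by at most `E`, so
-- the numbers from 1 to `E` must be nonzero in the field, and `2 E < q`. This allows
-- `E = (q - 1) / 2` for prime `q`, but only `E = 1` when the characteristic may be small. `κ / 24`
-- is the excess over `2 θ_k`, in units of `θ_{k-1}`, that the hypothesis on `N` permits. `G` weighs
-- ordinary fibres against oversized ones, about which the polynomial argument says nothing. Two
-- circularities shape the proof. Gluing wants every point to be essential, while colours speak only
-- about 2-secants of the whole of β; so the reduction must never create essential points. And `N`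
-- controls the size of β well only once the essential points share a colour, whereas excluding a
-- second colour involves β itself; the inequality that refutes a second class yields, by its
-- failure, the missing bound.

-- Unlike the reflective solver of the library, this one is cheap to check.
module SemiringSolver where

  infixl 6 _⊹_
  infixl 7 _⋆_
  infix 9 #_

  data Exp : Set where
    var #_  : ℕ → Exp
    _⊹_ _⋆_ : Exp → Exp → Exp

  1⊹_ : Exp → Exp
  1⊹ e = # 1 ⊹ e

  lookup : ∀ {n} → Vec ℕ n → ℕ → ℕ
  lookup []      _       = 0
  lookup (x ∷ ρ) zero    = x
  lookup (x ∷ ρ) (suc i) = lookup ρ i

  ⟦_⟧ᵉ : Exp → ∀ {n} → Vec ℕ n → ℕ
  ⟦ var i ⟧ᵉ ρ = lookup ρ i
  ⟦ # c ⟧ᵉ   ρ = c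
  ⟦ a ⊹ b ⟧ᵉ ρ = ⟦ a ⟧ᵉ ρ + ⟦ b ⟧ᵉ ρ
  ⟦ a ⋆ b ⟧ᵉ ρ = ⟦ a ⟧ᵉ ρ * ⟦ b ⟧ᵉ ρ

  Monomial Poly : Set
  Monomial = List ℕ
  Poly = List (ℕ × Monomial)

  _≼_ : Monomial → Monomial → Bool
  []      ≼ _       = true
  (x ∷ m) ≼ []      = false
  (x ∷ m) ≼ (y ∷ n) = if x ≡ᵇ y then m ≼ n else x <ᵇ y

  insertᵛ : ℕ → Monomial → Monomial
  insertᵛ x []      = x ∷ []
  insertᵛ x (y ∷ m) = if x ≤ᵇ y then x ∷ y ∷ m else y ∷ insertᵛ x m

  _·ᵐ_ : Monomial → Monomial → Monomial
  []      ·ᵐ n = n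
  (x ∷ m) ·ᵐ n = insertᵛ x (m ·ᵐ n)

  insert : ℕ → Monomial → Poly → Poly
  insert c m []            = (c , m) ∷ []
  insert c m ((d , n) ∷ p) with Listₚ.≡-dec _≟_ m n
  ... | yes _ = (c + d , m) ∷ p
  ... | no _  = if m ≼ n then (c , m) ∷ (d , n) ∷ p else (d , n) ∷ insert c m p

  _+ᵖ_ : Poly → Poly → Poly
  []            +ᵖ r = r
  ((c , m) ∷ p) +ᵖ r = insert c m (p +ᵖ r)

  scale : ℕ → Monomial → Poly → Poly
  scale c m []            = []
  scale c m ((d , n) ∷ p) = insert (c * d) (m ·ᵐ n) (scale c m p)

  _*ᵖ_ : Poly → Poly → Poly
  []            *ᵖ r = []
  ((c , m) ∷ p) *ᵖ r = scale c m r +ᵖ (p *ᵖ r)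

  normalForm : Exp → Poly
  normalForm (var i) = (1 , i ∷ []) ∷ []
  normalForm (# 0)   = []
  normalForm (# c)   = (c , []) ∷ []
  normalForm (a ⊹ b) = normalForm a +ᵖ normalForm b
  normalForm (a ⋆ b) = normalForm a *ᵖ normalForm b

  module _ {n} (ρ : Vec ℕ n) where

    ⟦_⟧ᵐ : Monomial → ℕ
    ⟦ [] ⟧ᵐ    = 1
    ⟦ x ∷ m ⟧ᵐ = lookup ρ x * ⟦ m ⟧ᵐ

    ⟦_⟧ᵖ : Poly → ℕ
    ⟦ [] ⟧ᵖ          = 0
    ⟦ (c , m) ∷ p ⟧ᵖ = c * ⟦ m ⟧ᵐ + ⟦ p ⟧ᵖ

    swap-* : ∀ a b c → a * (b * c) ≡ b * (a * c)
    swap-* a b c = trans (sym (*-assoc a b c)) (trans (cong (_* c) (*-comm a b)) (*-assoc b a c))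

    swap-+ : ∀ a b c → a + (b + c) ≡ b + (a + c)
    swap-+ a b c = trans (sym (+-assoc a b c)) (trans (cong (_+ c) (+-comm a b)) (+-assoc b a c))

    insertᵛ-sound : ∀ x m → ⟦ insertᵛ x m ⟧ᵐ ≡ lookup ρ x * ⟦ m ⟧ᵐ
    insertᵛ-sound x []      = refl
    insertᵛ-sound x (y ∷ m) with x ≤ᵇ y
    ... | true  = refl
    ... | false = trans (cong (lookup ρ y *_) (insertᵛ-sound x m)) (swap-* (lookup ρ y) (lookup ρ x) ⟦ m ⟧ᵐ)

    ·ᵐ-sound : ∀ m n → ⟦ m ·ᵐ n ⟧ᵐ ≡ ⟦ m ⟧ᵐ * ⟦ n ⟧ᵐ
    ·ᵐ-sound []      n = sym (+-identityʳ _)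
    ·ᵐ-sound (x ∷ m) n = trans (insertᵛ-sound x (m ·ᵐ n)) (trans (cong (lookup ρ x *_) (·ᵐ-sound m n)) (sym (*-assoc (lookup ρ x) _ _)))

    insert-sound : ∀ c m p → ⟦ insert c m p ⟧ᵖ ≡ c * ⟦ m ⟧ᵐ + ⟦ p ⟧ᵖ
    insert-sound c m []            = refl
    insert-sound c m ((d , n) ∷ p) with Listₚ.≡-dec _≟_ m n
    ... | yes refl = trans (cong (_+ ⟦ p ⟧ᵖ) (*-distribʳ-+ ⟦ m ⟧ᵐ c d)) (+-assoc (c * ⟦ m ⟧ᵐ) _ _)
    ... | no _ with m ≼ n
    ...   | true  = refl
    ...   | false = trans (cong (d * ⟦ n ⟧ᵐ +_) (insert-sound c m p)) (swap-+ (d * ⟦ n ⟧ᵐ) (c * ⟦ m ⟧ᵐ) ⟦ p ⟧ᵖ)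

    +ᵖ-sound : ∀ p r → ⟦ p +ᵖ r ⟧ᵖ ≡ ⟦ p ⟧ᵖ + ⟦ r ⟧ᵖ
    +ᵖ-sound []            r = refl
    +ᵖ-sound ((c , m) ∷ p) r = trans (insert-sound c m (p +ᵖ r)) (trans (cong (c * ⟦ m ⟧ᵐ +_) (+ᵖ-sound p r)) (sym (+-assoc (c * ⟦ m ⟧ᵐ) _ _)))

    scale-sound : ∀ c m p → ⟦ scale c m p ⟧ᵖ ≡ c * ⟦ m ⟧ᵐ * ⟦ p ⟧ᵖ
    scale-sound c m []            = sym (*-zeroʳ (c * ⟦ m ⟧ᵐ))
    scale-sound c m ((d , n) ∷ p) = trans (insert-sound (c * d) (m ·ᵐ n) (scale c m p)) (trans (cong₂ _+_ head (scale-sound c m p)) (sym (*-distribˡ-+ (c * ⟦ m ⟧ᵐ) _ _)))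
      where
      head : c * d * ⟦ m ·ᵐ n ⟧ᵐ ≡ c * ⟦ m ⟧ᵐ * (d * ⟦ n ⟧ᵐ)
      head = trans (cong (c * d *_) (·ᵐ-sound m n)) (trans (*-assoc c d _) (trans (cong (c *_) (swap-* d ⟦ m ⟧ᵐ ⟦ n ⟧ᵐ)) (sym (*-assoc c _ _))))

    *ᵖ-sound : ∀ p r → ⟦ p *ᵖ r ⟧ᵖ ≡ ⟦ p ⟧ᵖ * ⟦ r ⟧ᵖ
    *ᵖ-sound []            r = refl
    *ᵖ-sound ((c , m) ∷ p) r = trans (+ᵖ-sound (scale c m r) (p *ᵖ r)) (trans (cong₂ _+_ (scale-sound c m r) (*ᵖ-sound p r)) (sym (*-distribʳ-+ ⟦ r ⟧ᵖ (c * ⟦ m ⟧ᵐ) _)))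

    normalForm-sound : ∀ e → ⟦ normalForm e ⟧ᵖ ≡ ⟦ e ⟧ᵉ ρ
    normalForm-sound (var i) = trans (+-identityʳ _) (trans (+-identityʳ _) (*-identityʳ _))
    normalForm-sound (# 0)   = refl
    normalForm-sound (# c@(suc _)) = trans (+-identityʳ _) (*-identityʳ c)
    normalForm-sound (a ⊹ b) = trans (+ᵖ-sound (normalForm a) (normalForm b)) (cong₂ _+_ (normalForm-sound a) (normalForm-sound b))
    normalForm-sound (a ⋆ b) = trans (*ᵖ-sound (normalForm a) (normalForm b)) (cong₂ _*_ (normalForm-sound a) (normalForm-sound b))

  vars : ∀ n → ℕ → Vec Exp n
  vars zero    i = []
  vars (suc n) i = var i ∷ vars n (suc i)

  semiring-solve : ∀ n (f : N-ary n Exp (Exp × Exp)) → let e = f $ⁿ vars n 0 in normalForm (proj₁ e) ≡ normalForm (proj₂ e) →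
    Eq n _≡_ (curryⁿ (λ (ρ : Vec ℕ n) → ⟦ proj₁ e ⟧ᵉ ρ)) (curryⁿ (λ (ρ : Vec ℕ n) → ⟦ proj₂ e ⟧ᵉ ρ))
  semiring-solve n f eq = curryⁿ-cong _≡_ l r
    (λ ρ → trans (sym (normalForm-sound ρ (proj₁ e))) (trans (cong (⟦_⟧ᵖ ρ) eq) (normalForm-sound ρ (proj₂ e))))
    where
    e = f $ⁿ vars n 0
    l r : Vec ℕ n → ℕ
    l ρ = ⟦ proj₁ e ⟧ᵉ ρ
    r ρ = ⟦ proj₂ e ⟧ᵉ ρ

open SemiringSolver using (_⊹_; _⋆_; #_; 1⊹_; semiring-solve)

-- Indicators and finite sums over lists.

⟦_⟧ : Bool → ℕ
⟦ true ⟧  = 1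
⟦ false ⟧ = 0

⟦⟧-∧ : ∀ a b → ⟦ a ∧ b ⟧ ≡ ⟦ a ⟧ * ⟦ b ⟧
⟦⟧-∧ true  b = sym (+-identityʳ ⟦ b ⟧)
⟦⟧-∧ false b = refl

⟦⟧-guard : ∀ {a b c d} → a ≡ c → (a ≡ true → b ≡ d) → ⟦ a ∧ b ⟧ ≡ ⟦ c ⟧ * ⟦ d ⟧
⟦⟧-guard {true}  refl f rewrite f refl = sym (+-identityʳ _)
⟦⟧-guard {false} refl f = refl

⟦⟧≤1 : ∀ a → ⟦ a ⟧ ≤ 1
⟦⟧≤1 true  = ≤-refl
⟦⟧≤1 false = z≤n

⟦⟧-not : ∀ a → ⟦ a ⟧ + ⟦ not a ⟧ ≡ 1
⟦⟧-not true  = refl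
⟦⟧-not false = refl

∧-true : ∀ {a b} → a ∧ b ≡ true → a ≡ true × b ≡ true
∧-true {true} {true} _ = refl , refl

∧-intro : ∀ {a b} → a ≡ true → b ≡ true → a ∧ b ≡ true
∧-intro refl refl = refl

bool-ext : ∀ {a b : Bool} → (a ≡ true → b ≡ true) → (b ≡ true → a ≡ true) → a ≡ b
bool-ext {true}  {true}  _ _ = refl
bool-ext {true}  {false} f _ = sym (f refl)
bool-ext {false} {true}  _ g = g refl
bool-ext {false} {false} _ _ = refl

⟦⟧-mono : ∀ {a b : Bool} → (a ≡ true → b ≡ true) → ⟦ a ⟧ ≤ ⟦ b ⟧
⟦⟧-mono {true}  f rewrite f refl = ≤-refl
⟦⟧-mono {false} _ = z≤n

≢true : ∀ {a} → ¬ a ≡ true → a ≡ false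
≢true {true}  n = ⊥-elim (n refl)
≢true {false} _ = refl

does-true : ∀ {P : Set} (D : Dec P) → does D ≡ true → P
does-true (yes p) _ = p

does-intro : ∀ {P : Set} (D : Dec P) → P → does D ≡ true
does-intro (yes _) _ = refl
does-intro (no n)  p = ⊥-elim (n p)

does-false : ∀ {P : Set} (D : Dec P) → does D ≡ false → ¬ P
does-false (no n) _ = n

true? : ∀ a → a ≡ true ⊎ a ≡ false
true? true  = inj₁ refl
true? false = inj₂ refl

false≢true : ∀ {a} → a ≡ false → a ≡ true → ⊥
false≢true refl ()

not-false : ∀ {a} → a ≡ false → not a ≡ true
not-false refl = refl

not-true : ∀ {a} → not a ≡ true → a ≡ false
not-true {false} _ = refl

-- The equation says `y - x = (b - a) + s`. A linear consequence of inequalities thus becomes a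
-- single equation between natural numbers, free of subtraction.
by-slack : ∀ {x y a b} s → x + b + s ≡ y + a → a ≤ b → x ≤ y
by-slack {x} {y} {a} {b} s e le = +-cancelʳ-≤ b x y (≤-trans (m≤m+n (x + b) s)
  (≤-trans (≤-reflexive e) (+-monoʳ-≤ y le)))

variable
  A B : Set

∑ : List A → (A → ℕ) → ℕ
∑ []       f = 0
∑ (x ∷ xs) f = f x + ∑ xs f

∑-cong : ∀ (xs : List A) {f g} → (∀ x → f x ≡ g x) → ∑ xs f ≡ ∑ xs g
∑-cong []       e = refl
∑-cong (x ∷ xs) e = cong₂ _+_ (e x) (∑-cong xs e)

∑-cong-∈ : ∀ (xs : List A) {f g} → (∀ x → x ∈ xs → f x ≡ g x) → ∑ xs f ≡ ∑ xs g
∑-cong-∈ []       e = refl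
∑-cong-∈ (x ∷ xs) e = cong₂ _+_ (e x (here refl)) (∑-cong-∈ xs (λ y → e y ∘ there))

∑-mono : ∀ (xs : List A) {f g} → (∀ x → f x ≤ g x) → ∑ xs f ≤ ∑ xs g
∑-mono []       e = z≤n
∑-mono (x ∷ xs) e = +-mono-≤ (e x) (∑-mono xs e)

∑-mono-∈ : ∀ (xs : List A) {f g} → (∀ x → x ∈ xs → f x ≤ g x) → ∑ xs f ≤ ∑ xs g
∑-mono-∈ []       e = z≤n
∑-mono-∈ (x ∷ xs) e = +-mono-≤ (e x (here refl)) (∑-mono-∈ xs (λ y → e y ∘ there))

+-interchange : ∀ a b c d → a + b + (c + d) ≡ a + c + (b + d)
+-interchange = semiring-solve 4 (λ a b c d → a ⊹ b ⊹ (c ⊹ d) , a ⊹ c ⊹ (b ⊹ d)) refl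

∑-+ : ∀ (xs : List A) f g → ∑ xs (λ x → f x + g x) ≡ ∑ xs f + ∑ xs g
∑-+ []       f g = refl
∑-+ (x ∷ xs) f g = trans (cong (f x + g x +_) (∑-+ xs f g)) (+-interchange (f x) (g x) _ _)

∑-*ˡ : ∀ (xs : List A) c f → ∑ xs (λ x → c * f x) ≡ c * ∑ xs f
∑-*ˡ []       c f = sym (*-zeroʳ c)
∑-*ˡ (x ∷ xs) c f = trans (cong (c * f x +_) (∑-*ˡ xs c f)) (sym (*-distribˡ-+ c (f x) _))

∑-*ʳ : ∀ (xs : List A) c f → ∑ xs (λ x → f x * c) ≡ ∑ xs f * c
∑-*ʳ xs c f = trans (∑-cong xs (λ x → *-comm (f x) c)) (trans (∑-*ˡ xs c f) (*-comm c _))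

∑-const : ∀ (xs : List A) c → ∑ xs (λ _ → c) ≡ length xs * c
∑-const []       c = refl
∑-const (x ∷ xs) c = cong (c +_) (∑-const xs c)

∑-0 : ∀ (xs : List A) → ∑ xs (λ _ → 0) ≡ 0
∑-0 []       = refl
∑-0 (x ∷ xs) = ∑-0 xs

∑-swap : ∀ (xs : List A) (ys : List B) (f : A → B → ℕ) →
  ∑ xs (λ x → ∑ ys (f x)) ≡ ∑ ys (λ y → ∑ xs (λ x → f x y))
∑-swap []       ys f = sym (∑-0 ys)
∑-swap (x ∷ xs) ys f = trans (cong (∑ ys (f x) +_) (∑-swap xs ys f)) (sym (∑-+ ys (f x) _))

∑-++ : ∀ (xs ys : List A) f → ∑ (xs ++ ys) f ≡ ∑ xs f + ∑ ys f
∑-++ []       ys f = refl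
∑-++ (x ∷ xs) ys f = trans (cong (f x +_) (∑-++ xs ys f)) (sym (+-assoc (f x) _ _))

∑-map : ∀ (g : A → B) xs f → ∑ (map g xs) f ≡ ∑ xs (f ∘ g)
∑-map g []       f = refl
∑-map g (x ∷ xs) f = cong (f (g x) +_) (∑-map g xs f)

∑-concatMap : ∀ (g : A → List B) xs f → ∑ (concatMap g xs) f ≡ ∑ xs (λ x → ∑ (g x) f)
∑-concatMap g []       f = refl
∑-concatMap g (x ∷ xs) f = trans (∑-++ (g x) _ f) (cong (∑ (g x) f +_) (∑-concatMap g xs f))

∑-1 : ∀ (xs : List A) → ∑ xs (λ _ → 1) ≡ length xs
∑-1 xs = trans (∑-const xs 1) (*-identityʳ _)

∑-∈ : ∀ {xs : List A} {x} f → x ∈ xs → f x ≤ ∑ xs f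
∑-∈ f (here refl) = m≤m+n _ _
∑-∈ {xs = y ∷ _} f (there i) = ≤-trans (∑-∈ f i) (m≤n+m _ (f y))

∑-pick : ∀ (xs : List A) {f g} → ∑ xs f < ∑ xs g → ∃[ x ] (x ∈ xs × f x < g x)
∑-pick (x ∷ xs) {f} {g} lt with f x <? g x
... | yes p = x , here refl , p
... | no ¬p with ∑-pick xs {f} {g} (+-cancelˡ-< (g x) _ _
                  (≤-<-trans (+-monoˡ-≤ _ (≮⇒≥ ¬p)) lt))
... | y , i , q = y , there i , q

∑-pick-≤ : ∀ (xs : List A) {f g} → 0 < length xs → ∑ xs f ≤ ∑ xs g → ∃[ x ] (x ∈ xs × f x ≤ g x)
∑-pick-≤ xs {f} {g} ne le with ∑-pick xs {f} {suc ∘ g} (≤-<-trans le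
    (subst (_≤ ∑ xs (suc ∘ g)) (+-comm _ 1)
      (≤-trans (+-monoʳ-≤ (∑ xs g) ne) (≤-reflexive (trans (+-comm (∑ xs g) _)
        (trans (cong (_+ ∑ xs g) (sym (∑-1 xs))) (sym (∑-+ xs (λ _ → 1) g))))))))
... | x , i , s≤s q = x , i , q

∑-positive : ∀ (xs : List A) {f} → 0 < ∑ xs f → ∃[ x ] (x ∈ xs × 0 < f x)
∑-positive xs {f} lt = ∑-pick xs {λ _ → 0} (subst (_< ∑ xs f) (sym (∑-0 xs)) lt)

⟦⟧-positive : ∀ {b} → 0 < ⟦ b ⟧ → b ≡ true
⟦⟧-positive {true} _ = refl

∑-witness : ∀ (xs : List A) {b : A → Bool} → 0 < ∑ xs (⟦_⟧ ∘ b) → ∃[ x ] (x ∈ xs × b x ≡ true)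
∑-witness xs lt with ∑-positive xs lt
... | x , i , p = x , i , ⟦⟧-positive p

∑-none : ∀ (xs : List A) {b : A → Bool} → (∀ x → x ∈ xs → b x ≡ false) → ∑ xs (⟦_⟧ ∘ b) ≡ 0
∑-none xs n = trans (∑-cong-∈ xs (λ x i → cong ⟦_⟧ (n x i))) (∑-0 xs)

select : (A → Bool) → List A → List A
select b [] = []
select b (x ∷ xs) with b x
... | true  = x ∷ select b xs
... | false = select b xs

∑-select : ∀ (b : A → Bool) xs f → ∑ (select b xs) f ≡ ∑ xs (λ x → ⟦ b x ⟧ * f x)
∑-select b [] f = refl
∑-select b (x ∷ xs) f with b x
... | true  = cong₂ _+_ (sym (+-identityʳ (f x))) (∑-select b xs f)
... | false = ∑-select b xs f

length-select : ∀ (b : A → Bool) xs → length (select b xs) ≡ ∑ xs (⟦_⟧ ∘ b)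
length-select b xs = trans (sym (∑-1 (select b xs))) (trans (∑-select b xs _) (∑-cong xs (λ x → *-identityʳ ⟦ b x ⟧)))

search : ∀ (xs : List A) {P Q : A → Set} → (∀ x → x ∈ xs → P x ⊎ Q x) →
  ∃[ x ] (x ∈ xs × P x) ⊎ (∀ x → x ∈ xs → Q x)
search []       d = inj₂ (λ _ ())
search (x ∷ xs) d with d x (here refl)
... | inj₁ p = inj₁ (x , here refl , p)
... | inj₂ q with search xs (λ y → d y ∘ there)
... | inj₁ (y , i , p) = inj₁ (y , there i , p)
... | inj₂ r = inj₂ λ { .x (here refl) → q ; y (there i) → r y i }

∈-map⁺ : ∀ (g : A → B) {xs x} → x ∈ xs → g x ∈ map g xs
∈-map⁺ g (here refl) = here refl
∈-map⁺ g (there i)   = there (∈-map⁺ g i)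

∈-++ˡ : ∀ {xs ys : List A} {x} → x ∈ xs → x ∈ xs ++ ys
∈-++ˡ (here e)  = here e
∈-++ˡ (there i) = there (∈-++ˡ i)

∈-++ʳ : ∀ (xs : List A) {ys : List A} {x} → x ∈ ys → x ∈ xs ++ ys
∈-++ʳ []       i = i
∈-++ʳ (x ∷ xs) i = there (∈-++ʳ xs i)

∈-concatMap⁺ : ∀ (g : A → List B) {xs x y} → x ∈ xs → y ∈ g x → y ∈ concatMap g xs
∈-concatMap⁺ g (here refl) j = ∈-++ˡ j
∈-concatMap⁺ g {x′ ∷ _} (there i) j = ∈-++ʳ (g x′) (∈-concatMap⁺ g i j)

tuples : List A → (k : ℕ) → List (Vec A k)
tuples xs zero    = [] ∷ []
tuples xs (suc k) = concatMap (λ x → map (x ∷_) (tuples xs k)) xs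

∑-tuples : ∀ (xs : List A) k f →
  ∑ (tuples xs (suc k)) f ≡ ∑ xs (λ x → ∑ (tuples xs k) (λ v → f (x ∷ v)))
∑-tuples xs k f = trans (∑-concatMap _ xs f) (∑-cong xs (λ x → ∑-map (x ∷_) (tuples xs k) f))

∈-tuples : ∀ {xs : List A} → (∀ x → x ∈ xs) → ∀ {k} (v : Vec A k) → v ∈ tuples xs k
∈-tuples all []      = here refl
∈-tuples all (x ∷ v) = ∈-concatMap⁺ _ (all x) (∈-map⁺ (x ∷_) (∈-tuples all v))

tuples-length : ∀ (xs : List A) k → length (tuples xs k) ≡ length xs ^ k
tuples-length xs zero    = refl
tuples-length xs (suc k) = begin
  length (tuples xs (suc k)) ≡⟨ ∑-1 (tuples xs (suc k)) ⟨
  ∑ (tuples xs (suc k)) (λ _ → 1) ≡⟨ ∑-tuples xs k _ ⟩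
  ∑ xs (λ _ → ∑ (tuples xs k) (λ _ → 1)) ≡⟨ ∑-const xs _ ⟩
  length xs * ∑ (tuples xs k) (λ _ → 1) ≡⟨ cong (length xs *_) (trans (∑-1 (tuples xs k)) (tuples-length xs k)) ⟩
  length xs * length xs ^ k ∎
  where open ≡-Reasoning

∑-allFin-suc : ∀ n (f : Fin (suc n) → ℕ) → ∑ (allFin (suc n)) f ≡ f Fin.zero + ∑ (allFin n) (f ∘ Fin.suc)
∑-allFin-suc n f = cong (f Fin.zero +_) (go n Fin.suc f)
  where
  go : ∀ {m} n (g : Fin n → Fin m) (f : Fin m → ℕ) →
    ∑ (Data.List.tabulate g) f ≡ ∑ (allFin n) (f ∘ g)
  go zero    g f = refl
  go (suc n) g f = cong (f (g Fin.zero) +_)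
    (trans (go n (g ∘ Fin.suc) f) (sym (go n Fin.suc (f ∘ g))))

∈-allFin : ∀ {n} (i : Fin n) → i ∈ allFin n
∈-allFin i = go id i
  where
  go : ∀ {n} {A : Set} (g : Fin n → A) i → g i ∈ Data.List.tabulate g
  go g Fin.zero    = here refl
  go g (Fin.suc i) = there (go (g ∘ Fin.suc) i)

∑-allFin-δ : ∀ {n} (j : Fin n) → ∑ (allFin n) (λ i → ⟦ does (i Fin.≟ j) ⟧) ≡ 1
∑-allFin-δ {suc n} Fin.zero = trans (∑-allFin-suc n (λ i → ⟦ does (i Fin.≟ Fin.zero) ⟧))
  (cong suc (∑-0 (allFin n)))
∑-allFin-δ {suc n} (Fin.suc j) = trans (∑-allFin-suc n (λ i → ⟦ does (i Fin.≟ Fin.suc j) ⟧))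
  (trans (∑-cong (allFin n) δ) (∑-allFin-δ j))
  where
  δ : ∀ i → ⟦ does (Fin.suc i Fin.≟ Fin.suc j) ⟧ ≡ ⟦ does (i Fin.≟ j) ⟧
  δ i with i Fin.≟ j
  ... | yes _ = refl
  ... | no _  = refl

-- With `n` an indicator this verifies injectivity fibre by fibre: an empty fibre imposes nothing, a
-- nonempty one must be a single element over something that is counted.
∑-unique : ∀ (xs : List A) (eq : A → A → Bool) → (∀ y → ∑ xs (λ x → ⟦ eq x y ⟧) ≤ 1) →
  ∀ (b : A → Bool) → (∀ x y → x ∈ xs → y ∈ xs → b x ≡ true → b y ≡ true → eq x y ≡ true) →
  ∀ n → (∀ x → x ∈ xs → b x ≡ true → 1 ≤ n) →
  ∑ xs (⟦_⟧ ∘ b) ≤ n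
∑-unique xs eq once b u n pos with search xs {λ x → b x ≡ true} {λ x → b x ≡ false} (λ x _ → true? (b x))
... | inj₂ none = subst (_≤ n) (sym (∑-none xs none)) z≤n
... | inj₁ (y , i , by) = ≤-trans (∑-mono-∈ xs (λ x j → ⟦⟧-mono (λ bx → u x y j i bx by)))
                            (≤-trans (once y) (pos y i by))

-- Double counting of the relation `r`, which replaces an injection. Relations suit projective
-- points, where an image is a vector determined only up to a scalar.
∑-inject : ∀ (xs : List A) (ys : List B) (p : A → Bool) (g : B → ℕ) (r : A → B → Bool) →
  (∀ x → x ∈ xs → p x ≡ true → ∑ ys (λ y → ⟦ r x y ⟧) ≡ 1) →
  (∀ y → y ∈ ys → ∑ xs (λ x → ⟦ p x ∧ r x y ⟧) ≤ g y) →
  ∑ xs (⟦_⟧ ∘ p) ≤ ∑ ys g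
∑-inject xs ys p g r once le = begin
  ∑ xs (⟦_⟧ ∘ p) ≡⟨ ∑-cong-∈ xs one ⟩
  ∑ xs (λ x → ∑ ys (λ y → ⟦ p x ∧ r x y ⟧)) ≡⟨ ∑-swap xs ys _ ⟩
  ∑ ys (λ y → ∑ xs (λ x → ⟦ p x ∧ r x y ⟧)) ≤⟨ ∑-mono-∈ ys le ⟩
  ∑ ys g ∎
  where
  open ≤-Reasoning
  one : ∀ x → x ∈ xs → ⟦ p x ⟧ ≡ ∑ ys (λ y → ⟦ p x ∧ r x y ⟧)
  one x i with p x in eq
  ... | true  = sym (once x i eq)
  ... | false = sym (∑-0 ys)

-- Ring identities with integer coefficients, an integer being a formal difference of naturals.
module IntegerSolver (R : CommutativeRing 0ℓ 0ℓ) where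
  private
    module R = CommutativeRing R
    open R using (_≈_; 0#; 1#) renaming (_+_ to _⊞_; _*_ to _⊠_; -_ to ⊟_; _-_ to _⊟_)
    open Mult R.semiring using (×-homo-+; ×1-homo-*) renaming (_×_ to _×ᴿ_)
    open RingProperties R.ring
    open AbelianGroupProperties R.+-abelianGroup using (⁻¹-∙-comm; ⁻¹-involutive; ε⁻¹≈ε)
    open SetoidReasoning R.setoid

    ι : ℕ → R.Carrier
    ι n = n ×ᴿ 1#

    ⟪_⟫ : ℕ × ℕ → R.Carrier
    ⟪ a , b ⟫ = ι a ⊟ ι b

    -- A formal difference has many representatives; cancelling the common part makes it canonical,
    -- so that normal forms can be compared as syntax.
    reduce : ℕ × ℕ → ℕ × ℕ
    reduce (a , b) = a ∸ b , b ∸ a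

    coeff : RawRing 0ℓ 0ℓ
    coeff = record
      { Carrier = ℕ × ℕ
      ; _≈_ = _≡_
      ; _+_ = λ (a , b) (c , d) → reduce (a + c , b + d)
      ; _*_ = λ (a , b) (c , d) → reduce (a * c + b * d , a * d + b * c)
      ; -_  = λ (a , b) → b , a
      ; 0#  = 0 , 0
      ; 1#  = 1 , 0
      }

    interchange : ∀ a b c d → (a ⊞ b) ⊞ (c ⊞ d) ≈ (a ⊞ c) ⊞ (b ⊞ d)
    interchange a b c d = begin
      (a ⊞ b) ⊞ (c ⊞ d) ≈⟨ R.+-assoc a b (c ⊞ d) ⟩
      a ⊞ (b ⊞ (c ⊞ d)) ≈⟨ R.+-congˡ (R.sym (R.+-assoc b c d)) ⟩
      a ⊞ ((b ⊞ c) ⊞ d) ≈⟨ R.+-congˡ (R.+-congʳ (R.+-comm b c)) ⟩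
      a ⊞ ((c ⊞ b) ⊞ d) ≈⟨ R.+-congˡ (R.+-assoc c b d) ⟩
      a ⊞ (c ⊞ (b ⊞ d)) ≈⟨ R.sym (R.+-assoc a c (b ⊞ d)) ⟩
      (a ⊞ c) ⊞ (b ⊞ d) ∎

    shift : ∀ a b → ι a ≈ ⟪ a , b ⟫ ⊞ ι b
    shift a b = R.sym (R.trans (R.+-assoc _ _ _) (R.trans (R.+-congˡ (R.-‿inverseˡ (ι b))) (R.+-identityʳ _)))

    cancel : ∀ a b c d → a + d ≡ c + b → ⟪ a , b ⟫ ≈ ⟪ c , d ⟫
    cancel a b c d e = begin
      ι a ⊟ ι b ≈⟨ R.+-congʳ (shift a d) ⟩
      (ι a ⊟ ι d ⊞ ι d) ⊟ ι b ≈⟨ R.+-congʳ (R.trans (R.+-assoc _ _ _) (R.trans (R.+-congˡ (R.+-comm _ _)) (R.sym (R.+-assoc _ _ _)))) ⟩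
      ((ι a ⊞ ι d) ⊟ ι d) ⊟ ι b ≈⟨ R.+-congʳ (R.+-congʳ (R.sym (×-homo-+ 1# a d))) ⟩
      (ι (a + d) ⊟ ι d) ⊟ ι b ≡⟨ cong (λ z → (ι z ⊟ ι d) ⊟ ι b) e ⟩
      (ι (c + b) ⊟ ι d) ⊟ ι b ≈⟨ R.+-congʳ (R.+-congʳ (×-homo-+ 1# c b)) ⟩
      ((ι c ⊞ ι b) ⊟ ι d) ⊟ ι b ≈⟨ R.+-congʳ (R.trans (R.+-assoc _ _ _) (R.trans (R.+-congˡ (R.+-comm _ _)) (R.sym (R.+-assoc _ _ _)))) ⟩
      ((ι c ⊟ ι d) ⊞ ι b) ⊟ ι b ≈⟨ R.trans (R.+-assoc _ _ _) (R.trans (R.+-congˡ (R.-‿inverseʳ (ι b))) (R.+-identityʳ _)) ⟩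
      ι c ⊟ ι d ∎

    reduce-correct : ∀ x → ⟪ reduce x ⟫ ≈ ⟪ x ⟫
    reduce-correct (a , b) = cancel (a ∸ b) (b ∸ a) a b (monus a b)
      where
      monus : ∀ a b → a ∸ b + b ≡ a + (b ∸ a)
      monus zero    zero    = refl
      monus zero    (suc b) = refl
      monus (suc a) zero    = refl
      monus (suc a) (suc b) = trans (+-suc (a ∸ b) b) (cong suc (monus a b))

    homo-+ : ∀ x y → ⟪ RawRing._+_ coeff x y ⟫ ≈ ⟪ x ⟫ ⊞ ⟪ y ⟫
    homo-+ (a , b) (c , d) = begin
      ⟪ reduce (a + c , b + d) ⟫ ≈⟨ reduce-correct (a + c , b + d) ⟩
      ι (a + c) ⊟ ι (b + d) ≈⟨ R.+-cong (×-homo-+ 1# a c) (R.-‿cong (×-homo-+ 1# b d)) ⟩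
      (ι a ⊞ ι c) ⊟ (ι b ⊞ ι d) ≈⟨ R.+-congˡ (R.sym (⁻¹-∙-comm (ι b) (ι d))) ⟩
      (ι a ⊞ ι c) ⊞ (⊟ ι b ⊞ ⊟ ι d) ≈⟨ interchange _ _ _ _ ⟩
      ⟪ a , b ⟫ ⊞ ⟪ c , d ⟫ ∎

    homo-neg : ∀ x → ⟪ RawRing.-_ coeff x ⟫ ≈ ⊟ ⟪ x ⟫
    homo-neg (a , b) = begin
      ι b ⊟ ι a ≈⟨ R.+-comm _ _ ⟩
      ⊟ ι a ⊞ ι b ≈⟨ R.+-congˡ (R.sym (⁻¹-involutive (ι b))) ⟩
      ⊟ ι a ⊞ ⊟ (⊟ ι b) ≈⟨ ⁻¹-∙-comm (ι a) (⊟ ι b) ⟩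
      ⊟ (ι a ⊟ ι b) ∎

    homo-* : ∀ x y → ⟪ RawRing._*_ coeff x y ⟫ ≈ ⟪ x ⟫ ⊠ ⟪ y ⟫
    homo-* (a , b) (c , d) = R.trans (reduce-correct (a * c + b * d , a * d + b * c)) (R.sym (begin
      (α ⊟ β) ⊠ (γ ⊟ δ) ≈⟨ R.distribʳ (γ ⊟ δ) α (⊟ β) ⟩
      α ⊠ (γ ⊟ δ) ⊞ ⊟ β ⊠ (γ ⊟ δ) ≈⟨ R.+-cong (R.distribˡ α γ (⊟ δ)) (R.sym (-‿distribˡ-* β (γ ⊟ δ))) ⟩
      (α ⊠ γ ⊞ α ⊠ ⊟ δ) ⊞ ⊟ (β ⊠ (γ ⊟ δ)) ≈⟨ R.+-cong (R.+-congˡ (R.sym (-‿distribʳ-* α δ))) (R.-‿cong (R.trans (R.distribˡ β γ (⊟ δ)) (R.+-congˡ (R.sym (-‿distribʳ-* β δ))))) ⟩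
      (α ⊠ γ ⊞ ⊟ (α ⊠ δ)) ⊞ ⊟ (β ⊠ γ ⊟ β ⊠ δ) ≈⟨ R.+-congˡ (R.sym (⁻¹-∙-comm (β ⊠ γ) (⊟ (β ⊠ δ)))) ⟩
      (α ⊠ γ ⊞ ⊟ (α ⊠ δ)) ⊞ (⊟ (β ⊠ γ) ⊞ ⊟ (⊟ (β ⊠ δ))) ≈⟨ R.+-congˡ (R.trans (R.+-congˡ (⁻¹-involutive _)) (R.+-comm _ _)) ⟩
      (α ⊠ γ ⊞ ⊟ (α ⊠ δ)) ⊞ (β ⊠ δ ⊞ ⊟ (β ⊠ γ)) ≈⟨ interchange _ _ _ _ ⟩
      (α ⊠ γ ⊞ β ⊠ δ) ⊞ (⊟ (α ⊠ δ) ⊞ ⊟ (β ⊠ γ)) ≈⟨ R.+-congˡ (⁻¹-∙-comm (α ⊠ δ) (β ⊠ γ)) ⟩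
      (α ⊠ γ ⊞ β ⊠ δ) ⊟ (α ⊠ δ ⊞ β ⊠ γ) ≈⟨ R.sym (R.+-cong (sum-* a c b d) (R.-‿cong (sum-* a d b c))) ⟩
      ι (a * c + b * d) ⊟ ι (a * d + b * c) ∎))
      where
      α = ι a ; β = ι b ; γ = ι c ; δ = ι d
      sum-* : ∀ i j k l → ι (i * j + k * l) ≈ ι i ⊠ ι j ⊞ ι k ⊠ ι l
      sum-* i j k l = R.trans (×-homo-+ 1# (i * j) (k * l)) (R.+-cong (×1-homo-* i j) (×1-homo-* k l))

    morphism : coeff ACR.-Raw-AlmostCommutative⟶ ACR.fromCommutativeRing R
    morphism = record
      { ⟦_⟧ = ⟪_⟫ ; +-homo = homo-+ ; *-homo = homo-* ; -‿homo = homo-neg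
      ; 0-homo = R.-‿inverseʳ 0#
      ; 1-homo = R.trans (R.+-cong (R.+-identityʳ 1#) ε⁻¹≈ε) (R.+-identityʳ 1#)
      }

    decide : ∀ x y → Maybe (⟪ x ⟫ ≈ ⟪ y ⟫)
    decide (a , b) (c , d) with a + d ≟ c + b
    ... | yes e = just (cancel a b c d e)
    ... | no _  = nothing

  open RingSolver coeff (ACR.fromCommutativeRing R) morphism decide public
    using (_:=_; _:+_; _:*_; :-_; _:-_)
  private
    module RS = RingSolver coeff (ACR.fromCommutativeRing R) morphism decide

  -- The normal forms are compared as syntax: comparing their values is slow in rings with transparent operations.
  ring-solve : ∀ n (f : N-ary n (RS.Polynomial n) (RS.Polynomial n × RS.Polynomial n)) →
    let e = f $ⁿ Vec.map RS.var (Vec.allFin n) in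
    RS.normalise (proj₁ e) ≡ RS.normalise (proj₂ e) →
    Eq n _≈_ (curryⁿ RS.⟦ proj₁ e ⟧) (curryⁿ RS.⟦ proj₂ e ⟧)
  ring-solve n f eq = curryⁿ-cong _≈_ RS.⟦ l ⟧ RS.⟦ r ⟧
    (λ ρ → RS.prove ρ l r (R.reflexive (cong (λ e → RS.⟦ e ⟧N ρ) eq)))
    where
    e = f $ⁿ Vec.map RS.var (Vec.allFin n)
    l = proj₁ e
    r = proj₂ e

-- The finite field: decidable equality, enumeration, affine equations.

module Field {q : ℕ} (F : FiniteField q) where
  open FiniteField F public using (0≢1; inverse; enum; isCommutativeRing)
    renaming (Carrier to 𝔽; _+_ to infixl 6 _⊕_; _*_ to infixl 7 _⊗_; -_ to infix 8 ⊖_; 0# to 𝟘; 1# to 𝟙)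

  𝔽-ring : CommutativeRing 0ℓ 0ℓ
  𝔽-ring = record { isCommutativeRing = isCommutativeRing }

  open CommutativeRing 𝔽-ring public using ()
    renaming (+-assoc to ⊕-assoc; +-comm to ⊕-comm; +-identityˡ to ⊕-identityˡ; +-identityʳ to ⊕-identityʳ;
      *-assoc to ⊗-assoc; *-comm to ⊗-comm; *-identityˡ to ⊗-identityˡ; *-identityʳ to ⊗-identityʳ;
      zeroˡ to ⊗-zeroˡ; zeroʳ to ⊗-zeroʳ; distribˡ to ⊗-distribˡ; distribʳ to ⊗-distribʳ;
      -‿inverseˡ to ⊖-inverseˡ; -‿inverseʳ to ⊖-inverseʳ; semiring to 𝔽-semiring)
  open IntegerSolver 𝔽-ring public

  private
    to : 𝔽 → Fin q
    to = Inverse.to enum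
    from : Fin q → 𝔽
    from = Inverse.from enum

    from-to : ∀ x → from (to x) ≡ x
    from-to = Inverse.strictlyInverseʳ enum
    to-from : ∀ i → to (from i) ≡ i
    to-from = Inverse.strictlyInverseˡ enum

  infix 5 _==_
  _==_ : 𝔽 → 𝔽 → Bool
  x == y = does (to x Fin.≟ to y)

  ==-sound : ∀ {x y} → (x == y) ≡ true → x ≡ y
  ==-sound {x} {y} e with to x Fin.≟ to y
  ... | yes p = trans (sym (from-to x)) (trans (cong from p) (from-to y))

  ==-refl : ∀ x → (x == x) ≡ true
  ==-refl x with to x Fin.≟ to x
  ... | yes _ = refl
  ... | no n  = ⊥-elim (n refl)

  ==-complete : ∀ {x y} → x ≡ y → (x == y) ≡ true
  ==-complete refl = ==-refl _

  ==-≢ : ∀ {x y} → x ≢ y → (x == y) ≡ false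
  ==-≢ n = ≢true (n ∘ ==-sound)

  ≢-== : ∀ {x y} → (x == y) ≡ false → x ≢ y
  ≢-== e p = false≢true e (==-complete p)

  infix 4 _≟ᶠ_
  _≟ᶠ_ : (x y : 𝔽) → Dec (x ≡ y)
  x ≟ᶠ y with true? (x == y)
  ... | inj₁ e = yes (==-sound e)
  ... | inj₂ e = no (≢-== e)

  Fs : List 𝔽
  Fs = map from (allFin q)

  length-Fs : length Fs ≡ q
  length-Fs = trans (Listₚ.length-map from (allFin q)) (Listₚ.length-tabulate id)

  ∈-Fs : ∀ x → x ∈ Fs
  ∈-Fs x = subst (_∈ Fs) (from-to x) (∈-map⁺ from (∈-allFin (to x)))

  ∑-Fs-δ : ∀ y → ∑ Fs (λ x → ⟦ x == y ⟧) ≡ 1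
  ∑-Fs-δ y = trans (∑-map from (allFin q) _)
    (trans (∑-cong (allFin q) (λ i → cong (λ j → ⟦ does (j Fin.≟ to y) ⟧) (to-from i))) (∑-allFin-δ (to y)))

  ⊗-cancelˡ : ∀ {a x y} → a ≢ 𝟘 → a ⊗ x ≡ a ⊗ y → x ≡ y
  ⊗-cancelˡ {a} {x} {y} a≢0 e with inverse a a≢0
  ... | b , ab = begin
    x ≡⟨ ⊗-identityˡ x ⟨
    𝟙 ⊗ x ≡⟨ cong (_⊗ x) (trans (⊗-comm b a) ab) ⟨
    b ⊗ a ⊗ x ≡⟨ ⊗-assoc b a x ⟩
    b ⊗ (a ⊗ x) ≡⟨ cong (b ⊗_) e ⟩
    b ⊗ (a ⊗ y) ≡⟨ ⊗-assoc b a y ⟨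
    b ⊗ a ⊗ y ≡⟨ cong (_⊗ y) (trans (⊗-comm b a) ab) ⟩
    𝟙 ⊗ y ≡⟨ ⊗-identityˡ y ⟩
    y ∎
    where open ≡-Reasoning

  ⊗-≢0 : ∀ {a b} → a ≢ 𝟘 → b ≢ 𝟘 → a ⊗ b ≢ 𝟘
  ⊗-≢0 {a} a≢0 b≢0 e = b≢0 (⊗-cancelˡ a≢0 (trans e (sym (⊗-zeroʳ a))))

  ⊗-integral : ∀ {a b} → a ⊗ b ≡ 𝟘 → a ≢ 𝟘 → b ≡ 𝟘
  ⊗-integral {a} e a≢0 = ⊗-cancelˡ a≢0 (trans e (sym (⊗-zeroʳ a)))

  1≢0 : 𝟙 ≢ 𝟘
  1≢0 = 0≢1 ∘ sym

  recip : 𝔽 → 𝔽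
  recip x with x ≟ᶠ 𝟘
  -- The value at zero is a convention; reciprocals matter only where the denominator is nonzero.
  ... | yes _  = 𝟘
  ... | no x≢0 = proj₁ (inverse x x≢0)

  recip-inverse : ∀ {x} → x ≢ 𝟘 → x ⊗ recip x ≡ 𝟙
  recip-inverse {x} n with x ≟ᶠ 𝟘
  ... | yes e  = ⊥-elim (n e)
  ... | no x≢0 = proj₂ (inverse x x≢0)

  ⊖-𝟘 : ⊖ 𝟘 ≡ 𝟘
  ⊖-𝟘 = trans (sym (⊕-identityˡ _)) (⊖-inverseʳ 𝟘)

  ⊖-≢0 : ∀ {x} → x ≢ 𝟘 → ⊖ x ≢ 𝟘
  ⊖-≢0 {x} n e = n (trans (ring-solve 1 (λ a → a := :- (:- a)) refl x) (trans (cong ⊖_ e) ⊖-𝟘))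

  ⊕≡0⇒ : ∀ {x y} → x ⊕ y ≡ 𝟘 → x ≡ ⊖ y
  ⊕≡0⇒ {x} {y} e = trans (ring-solve 2 (λ a b → a := (a :+ b) :- b) refl x y)
    (trans (cong (_⊕ ⊖ y) e) (⊕-identityˡ _))

  ∑-Fs-affine : ∀ a b → a ≢ 𝟘 → ∑ Fs (λ x → ⟦ a ⊗ x ⊕ b == 𝟘 ⟧) ≡ 1
  ∑-Fs-affine a b a≢0 with inverse a a≢0
  ... | c , ac = trans (∑-cong Fs (λ x → cong ⟦_⟧ (bool-ext (left x) (right x)))) (∑-Fs-δ (⊖ (c ⊗ b)))
    where
    left : ∀ x → (a ⊗ x ⊕ b == 𝟘) ≡ true → (x == ⊖ (c ⊗ b)) ≡ true
    left x e = ==-complete (⊗-cancelˡ a≢0 (trans (⊕≡0⇒ (==-sound e))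
      (trans (cong ⊖_ (trans (sym (⊗-identityˡ b)) (cong (_⊗ b) (sym ac))))
        (ring-solve 3 (λ a c b → :- (a :* c :* b) := a :* :- (c :* b)) refl a c b))))
    right : ∀ x → (x == ⊖ (c ⊗ b)) ≡ true → (a ⊗ x ⊕ b == 𝟘) ≡ true
    right x e rewrite ==-sound e = ==-complete
      (trans (ring-solve 3 (λ a c b → a :* :- (c :* b) :+ b := b :- a :* c :* b) refl a c b)
        (trans (cong (λ z → b ⊕ ⊖ (z ⊗ b)) ac) (trans (cong (λ z → b ⊕ ⊖ z) (⊗-identityˡ b)) (⊖-inverseʳ b))))

  ∑-Fs-affine-0 : ∀ b → b ≢ 𝟘 → ∑ Fs (λ x → ⟦ 𝟘 ⊗ x ⊕ b == 𝟘 ⟧) ≡ 0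
  ∑-Fs-affine-0 b b≢0 = ∑-none Fs (λ x _ → ==-≢ (λ e → b≢0 (trans (sym (trans (cong (_⊕ b) (⊗-zeroˡ x)) (⊕-identityˡ b))) e)))

  open Mult 𝔽-semiring public using (×-homo-+; ×1-homo-*) renaming (_×_ to _×ᶠ_)

  ℕ→𝔽 : ℕ → 𝔽
  ℕ→𝔽 n = n ×ᶠ 𝟙

  ∑ᶠ : List A → (A → 𝔽) → 𝔽
  ∑ᶠ []       f = 𝟘
  ∑ᶠ (x ∷ xs) f = f x ⊕ ∑ᶠ xs f

-- Polynomials as finitely supported power series.

module Polynomials {q : ℕ} (F : FiniteField q) where
  open Field F

  -- Polynomials over 𝔽 are treated inside the ring of formal power series.
  Series : Set
  Series = ℕ → 𝔽

  infix 4 _≐_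
  _≐_ : Series → Series → Set
  f ≐ g = ∀ i → f i ≡ g i

  tail : Series → Series
  tail f i = f (suc i)

  infixl 6 _⊞_
  infixl 7 _✶_
  _⊞_ _✶_ : Series → Series → Series
  (f ⊞ g) i = f i ⊕ g i
  (f ✶ g) zero    = f 0 ⊗ g 0
  (f ✶ g) (suc i) = f 0 ⊗ g (suc i) ⊕ (tail f ✶ g) i

  neg : Series → Series
  neg f i = ⊖ f i

  const : 𝔽 → Series
  const a zero    = a
  const a (suc i) = 𝟘

  X : Series
  X zero    = 𝟘
  X (suc i) = const 𝟙 i

  0ˢ : Series
  0ˢ _ = 𝟘

  ✶-cong : ∀ {f f′ g g′} → f ≐ f′ → g ≐ g′ → f ✶ g ≐ f′ ✶ g′
  ✶-cong e e′ zero    = cong₂ _⊗_ (e 0) (e′ 0)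
  ✶-cong e e′ (suc i) = cong₂ _⊕_ (cong₂ _⊗_ (e 0) (e′ (suc i))) (✶-cong (e ∘ suc) e′ i)

  ✶-distribʳ : ∀ h f g → (f ⊞ g) ✶ h ≐ f ✶ h ⊞ g ✶ h
  ✶-distribʳ h f g zero    = ⊗-distribʳ (h 0) (f 0) (g 0)
  ✶-distribʳ h f g (suc i) = trans (cong₂ _⊕_ (⊗-distribʳ (h (suc i)) (f 0) (g 0)) (✶-distribʳ h (tail f) (tail g) i))
    (ring-solve 4 (λ a b c d → (a :+ b) :+ (c :+ d) := (a :+ c) :+ (b :+ d)) refl _ _ _ _)

  ✶-scale : ∀ a f g i → ((λ j → a ⊗ f j) ✶ g) i ≡ a ⊗ (f ✶ g) i
  ✶-scale a f g zero    = ⊗-assoc a (f 0) (g 0)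
  ✶-scale a f g (suc i) = trans (cong (a ⊗ f 0 ⊗ g (suc i) ⊕_) (✶-scale a (tail f) g i))
    (ring-solve 4 (λ a b c d → a :* b :* c :+ a :* d := a :* (b :* c :+ d)) refl _ _ _ _)

  ✶-zeroˡ : ∀ {f} g → f ≐ 0ˢ → f ✶ g ≐ 0ˢ
  ✶-zeroˡ g z zero    = trans (cong (_⊗ g 0) (z 0)) (⊗-zeroˡ _)
  ✶-zeroˡ g z (suc i) = trans (cong₂ _⊕_ (trans (cong (_⊗ g (suc i)) (z 0)) (⊗-zeroˡ _)) (✶-zeroˡ g (z ∘ suc) i)) (⊕-identityˡ 𝟘)

  ✶-const : ∀ a f i → (const a ✶ f) i ≡ a ⊗ f i
  ✶-const a f zero    = refl
  ✶-const a f (suc i) = trans (cong (a ⊗ f (suc i) ⊕_) (✶-zeroˡ f (λ _ → refl) i)) (⊕-identityʳ _)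

  ✶-suc : ∀ f g i → (f ✶ g) (suc i) ≡ (f ✶ tail g) i ⊕ f (suc i) ⊗ g 0
  ✶-suc f g zero    = refl
  ✶-suc f g (suc i) = trans (cong (f 0 ⊗ g (suc (suc i)) ⊕_) (✶-suc (tail f) g i)) (sym (⊕-assoc _ _ _))

  ✶-comm : ∀ f g → f ✶ g ≐ g ✶ f
  ✶-comm f g zero    = ⊗-comm _ _
  ✶-comm f g (suc i) = trans (⊕-comm _ _)
    (trans (cong₂ _⊕_ (✶-comm (tail f) g i) (⊗-comm _ _)) (sym (✶-suc g f i)))

  ✶-assoc : ∀ f g h → (f ✶ g) ✶ h ≐ f ✶ (g ✶ h)
  ✶-assoc f g h zero    = ⊗-assoc _ _ _
  ✶-assoc f g h (suc i) = trans (cong (f 0 ⊗ g 0 ⊗ h (suc i) ⊕_)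
    (trans (✶-distribʳ h (λ j → f 0 ⊗ tail g j) (tail f ✶ g) i)
      (cong₂ _⊕_ (✶-scale (f 0) (tail g) h i) (✶-assoc (tail f) g h i))))
    (ring-solve 5 (λ a b c d e → a :* b :* c :+ (a :* d :+ e) := a :* (b :* c :+ d) :+ e) refl _ _ _ _ _)

  series-isCommutativeRing : IsCommutativeRing _≐_ _⊞_ _✶_ neg 0ˢ (const 𝟙)
  series-isCommutativeRing = record
    { isRing = record
      { +-isAbelianGroup = record
        { isGroup = record
          { isMonoid = record
            { isSemigroup = record
              { isMagma = record
                { isEquivalence = record
                  { refl = λ _ → refl ; sym = λ e i → sym (e i) ; trans = λ e e′ i → trans (e i) (e′ i) }
                ; ∙-cong = λ e e′ i → cong₂ _⊕_ (e i) (e′ i) }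
              ; assoc = λ f g h i → ⊕-assoc _ _ _ }
            ; identity = (λ f i → ⊕-identityˡ _) , (λ f i → ⊕-identityʳ _) }
          ; inverse = (λ f i → ⊖-inverseˡ _) , (λ f i → ⊖-inverseʳ _)
          ; ⁻¹-cong = λ e i → cong ⊖_ (e i) }
        ; comm = λ f g i → ⊕-comm _ _ }
      ; *-cong = ✶-cong
      ; *-assoc = ✶-assoc
      ; *-identity = one , (λ f i → trans (✶-comm f (const 𝟙) i) (one f i))
      ; distrib = (λ f g h i → trans (✶-comm f (g ⊞ h) i)
                    (trans (✶-distribʳ f g h i) (cong₂ _⊕_ (✶-comm g f i) (✶-comm h f i))))
                , ✶-distribʳ }
    ; *-comm = ✶-comm }
    where
    one : ∀ f → const 𝟙 ✶ f ≐ f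
    one f i = trans (✶-const 𝟙 f i) (⊗-identityˡ _)

  series-ring : CommutativeRing 0ℓ 0ℓ
  series-ring = record { isCommutativeRing = series-isCommutativeRing }

  private
    module S = CommutativeRing series-ring
    module SSolve = IntegerSolver series-ring
  open SSolve using () renaming (ring-solve to solveˢ; _:+_ to _⟨+⟩_; _:*_ to _⟨*⟩_; _:-_ to _⟨-⟩_; _:=_ to _⟨=⟩_)

  X-zero : ∀ f → (X ✶ f) 0 ≡ 𝟘
  X-zero f = ⊗-zeroˡ _

  X-suc : ∀ f i → (X ✶ f) (suc i) ≡ f i
  X-suc f i = trans (cong (_⊕ (tail X ✶ f) i) (⊗-zeroˡ _)) (trans (⊕-identityˡ _) (S.*-identityˡ f i))

  lin : 𝔽 → Series
  lin a = X ⊞ const a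

  lin-zero : ∀ a f → (lin a ✶ f) 0 ≡ a ⊗ f 0
  lin-zero a f = trans (✶-distribʳ f X (const a) 0) (trans (cong (_⊕ a ⊗ f 0) (X-zero f)) (⊕-identityˡ _))

  lin-suc : ∀ a f i → (lin a ✶ f) (suc i) ≡ f i ⊕ a ⊗ f (suc i)
  lin-suc a f i = trans (✶-distribʳ f X (const a) (suc i)) (cong₂ _⊕_ (X-suc f i) (✶-const a f (suc i)))

  -- Degree less than `d`, phrased as a bound so that the zero polynomial needs no degree of its
  -- own.
  ZeroFrom : ℕ → Series → Set
  ZeroFrom d f = ∀ i → d ≤ i → f i ≡ 𝟘

  ZeroFrom-≐ : ∀ {d f g} → f ≐ g → ZeroFrom d f → ZeroFrom d g
  ZeroFrom-≐ e z i le = trans (sym (e i)) (z i le)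

  ZeroFrom-≤ : ∀ {d d′ f} → d ≤ d′ → ZeroFrom d f → ZeroFrom d′ f
  ZeroFrom-≤ le z i l = z i (≤-trans le l)

  ZeroFrom-⊞ : ∀ {d f g} → ZeroFrom d f → ZeroFrom d g → ZeroFrom d (f ⊞ g)
  ZeroFrom-⊞ zf zg i le = trans (cong₂ _⊕_ (zf i le) (zg i le)) (⊕-identityˡ 𝟘)

  ZeroFrom-neg : ∀ {d f} → ZeroFrom d f → ZeroFrom d (neg f)
  ZeroFrom-neg zf i le = trans (cong ⊖_ (zf i le)) ⊖-𝟘

  ZeroFrom-const : ∀ a → ZeroFrom 1 (const a)
  ZeroFrom-const a (suc i) _ = refl

  -- The formula for the top coefficient holds even if `f a` or `g b` vanishes, so leading terms can
  -- be compared before a degree is known.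
  ✶-degree : ∀ a b {f g} → ZeroFrom (suc a) f → ZeroFrom (suc b) g →
    ZeroFrom (suc (a + b)) (f ✶ g) × (f ✶ g) (a + b) ≡ f a ⊗ g b
  ✶-degree zero b {f} {g} zf zg = (λ i le → trans (low i) (trans (cong (f 0 ⊗_) (zg i le)) (⊗-zeroʳ _))) , low b
    where
    low : ∀ i → (f ✶ g) i ≡ f 0 ⊗ g i
    low zero    = refl
    low (suc i) = trans (cong (f 0 ⊗ g (suc i) ⊕_) (✶-zeroˡ g (λ j → zf (suc j) (s≤s z≤n)) i)) (⊕-identityʳ _)
  ✶-degree (suc a) b {f} {g} zf zg with ✶-degree a b {tail f} {g} (λ i le → zf (suc i) (s≤s le)) zg
  ... | z , t = (λ { (suc i) (s≤s le) → trans (cong₂ _⊕_ (kill i (≤-trans (m≤n⇒m≤1+n (m≤n+m b a)) le)) (z i le)) (⊕-identityˡ 𝟘) })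
              , trans (cong₂ _⊕_ (kill (a + b) (m≤n+m b a)) t) (⊕-identityˡ _)
    where
    kill : ∀ i → b ≤ i → f 0 ⊗ g (suc i) ≡ 𝟘
    kill i le = trans (cong (f 0 ⊗_) (zg (suc i) (s≤s le))) (⊗-zeroʳ _)

  Finite : Series → Set
  Finite f = ∃[ d ] ZeroFrom d f

  Finite-⊞ : ∀ {f g} → Finite f → Finite g → Finite (f ⊞ g)
  Finite-⊞ (a , za) (b , zb) = a + b , ZeroFrom-⊞ (ZeroFrom-≤ (m≤m+n a b) za) (ZeroFrom-≤ (m≤n+m b a) zb)

  Finite-neg : ∀ {f} → Finite f → Finite (neg f)
  Finite-neg (a , za) = a , ZeroFrom-neg za

  Finite-✶ : ∀ {f g} → Finite f → Finite g → Finite (f ✶ g)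
  Finite-✶ (a , za) (b , zb) = suc (a + b) , proj₁ (✶-degree a b (ZeroFrom-≤ (n≤1+n a) za) (ZeroFrom-≤ (n≤1+n b) zb))

  Finite-const : ∀ a → Finite (const a)
  Finite-const a = 1 , ZeroFrom-const a

  Finite-X : Finite X
  Finite-X = 2 , λ { (suc zero) (s≤s ()) ; (suc (suc i)) _ → refl }

  -- Coefficient `i + 1` of `(X + a) f` is `f i + a f (i + 1)`, so once `f` vanishes above `i` it
  -- vanishes at `i`. The bound descends from an arbitrary one, which is why `f` must be finite: the
  -- series inverse of `X + a` would be a counterexample.
  lin-degree : ∀ a {f d} → Finite f → ZeroFrom (suc d) (lin a ✶ f) → ZeroFrom d f
  lin-degree a {f} {d} (b , zb) z = go b (ZeroFrom-≤ (m≤m+n b d) zb)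
    where
    go : ∀ k → ZeroFrom (k + d) f → ZeroFrom d f
    go zero    zk = zk
    go (suc k) zk = go k λ i le → trans (sym (trans (cong (f i ⊕_) (trans (cong (a ⊗_) (zk (suc i) (s≤s le))) (⊗-zeroʳ a))) (⊕-identityʳ _)))
      (trans (sym (lin-suc a f i)) (z (suc i) (s≤s (≤-trans (m≤n+m d k) le))))

  Π : List 𝔽 → Series
  Π []      = const 𝟙
  Π (a ∷ L) = lin a ✶ Π L

  Π-monic : ∀ L → ZeroFrom (suc (length L)) (Π L) × Π L (length L) ≡ 𝟙
  Π-monic []      = ZeroFrom-const 𝟙 , refl
  Π-monic (a ∷ L) with Π-monic L
  ... | z , t = (λ { (suc i) (s≤s le) → trans (lin-suc a (Π L) i) (trans (cong₂ _⊕_ (z i le) (kill (suc i) (m≤n⇒m≤1+n le))) (⊕-identityˡ 𝟘)) })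
              , trans (lin-suc a (Π L) (length L)) (trans (cong₂ _⊕_ t (kill (suc (length L)) ≤-refl)) (⊕-identityʳ 𝟙))
    where
    kill : ∀ i → suc (length L) ≤ i → a ⊗ Π L i ≡ 𝟘
    kill i le = trans (cong (a ⊗_) (z i le)) (⊗-zeroʳ a)

  Π-finite : ∀ L → Finite (Π L)
  Π-finite L = _ , proj₁ (Π-monic L)

  Π-degree : ∀ L {f d} → Finite f → ZeroFrom (length L + d) (Π L ✶ f) → ZeroFrom d f
  Π-degree []      fin z = ZeroFrom-≐ (S.*-identityˡ _) z
  Π-degree (a ∷ L) {f} fin z = Π-degree L fin
    (lin-degree a (Finite-✶ (Π-finite L) fin) (ZeroFrom-≐ (S.*-assoc (lin a) (Π L) f) z))

  Π-constant : ∀ L → (∀ a → a ∈ L → a ≢ 𝟘) → Π L 0 ≢ 𝟘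
  Π-constant []      n = 1≢0
  Π-constant (a ∷ L) n e = ⊗-≢0 (n a (here refl)) (Π-constant L (λ b → n b ∘ there)) (trans (sym (lin-zero a (Π L))) e)

  Π-↭ : ∀ {L M} → L ↭ M → Π L ≐ Π M
  Π-↭ ↭-base           = λ _ → refl
  Π-↭ (↭-cons a p)     = S.*-congˡ (Π-↭ p)
  Π-↭ (↭-exchange {ys = M} a b p) = S.trans (S.*-congˡ (S.*-congˡ (Π-↭ p)))
    (solveˢ 3 (λ a b f → a ⟨*⟩ (b ⟨*⟩ f) ⟨=⟩ b ⟨*⟩ (a ⟨*⟩ f)) refl (lin a) (lin b) (Π M))
  Π-↭ (↭-tr p r) = S.trans (Π-↭ p) (Π-↭ r)

  Π-++ : ∀ L M → Π (L ++ M) ≐ Π L ✶ Π M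
  Π-++ []      M = S.sym (S.*-identityˡ (Π M))
  Π-++ (a ∷ L) M = S.trans (S.*-congˡ (Π-++ L M)) (S.sym (S.*-assoc (lin a) (Π L) (Π M)))

  -- The quotient must be a polynomial: as a power series, anything with nonzero constant term would
  -- divide everything.
  Divides : Series → Series → Set
  Divides f g = ∃[ h ] (Finite h × g ≐ f ✶ h)

  lin-divides : ∀ {a L} → a ∈ L → Divides (lin a) (Π L)
  lin-divides {L = _ ∷ L} (here refl) = Π L , Π-finite L , S.refl
  lin-divides {a} {L = b ∷ L} (there i) with lin-divides i
  ... | h , fin , e = lin b ✶ h , Finite-✶ (Finite-⊞ Finite-X (Finite-const b)) fin ,
    S.trans (S.*-congˡ e) (solveˢ 3 (λ a b f → b ⟨*⟩ (a ⟨*⟩ f) ⟨=⟩ a ⟨*⟩ (b ⟨*⟩ f)) refl (lin a) (lin b) h)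

  -- A nonzero constant term makes `f` a unit among power series. This is the benefit of that ring:
  -- no factorisation argument is called for.
  unit-cancel : ∀ {f g} → f 0 ≢ 𝟘 → f ✶ g ≐ 0ˢ → g ≐ 0ˢ
  unit-cancel {f} {g} n e zero    = ⊗-integral (e 0) n
  unit-cancel {f} {g} n e (suc i) = unit-cancel n (λ j → trans (sym (trans (✶-suc f g j)
    (trans (cong ((f ✶ tail g) j ⊕_) (trans (cong (f (suc j) ⊗_) (unit-cancel {f} n e 0)) (⊗-zeroʳ _))) (⊕-identityʳ _)))) (e (suc j))) i

  count : 𝔽 → List 𝔽 → ℕ
  count x L = ∑ L (λ y → ⟦ y == x ⟧)

  ∑-↭ : ∀ {L M : List A} f → L ↭ M → ∑ L f ≡ ∑ M f
  ∑-↭ f ↭-base         = refl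
  ∑-↭ f (↭-cons x p)   = cong (f x +_) (∑-↭ f p)
  ∑-↭ f (↭-exchange x y p) = trans (cong (λ z → f x + (f y + z)) (∑-↭ f p))
    (comm-head (f x) (f y) _)
    where
    comm-head : ∀ a b c → a + (b + c) ≡ b + (a + c)
    comm-head = semiring-solve 3 (λ a b c → a ⊹ (b ⊹ c) , b ⊹ (a ⊹ c)) refl
  ∑-↭ f (↭-tr p r) = trans (∑-↭ f p) (∑-↭ f r)

  extract : ∀ {x : A} {L} → x ∈ L → ∃[ M ] (L ↭ x ∷ M)
  extract {L = _ ∷ L} (here refl) = L , ↭-refl
  extract {x = x} {L = y ∷ L} (there i) with extract i
  ... | M , p = y ∷ M , ↭-trans (↭-prep y p) (↭-exchange y x ↭-refl)

  extract-all : ∀ xs {L} → (∀ x → count x xs ≤ count x L) → ∃[ r ] (L ↭ xs ++ r)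
  extract-all []       le = _ , ↭-refl
  extract-all (x ∷ xs) {L} le with ∑-witness L {λ y → y == x}
      (≤-trans (subst (λ b → 1 ≤ ⟦ b ⟧ + count x xs) (sym (==-refl x)) (s≤s z≤n)) (le x))
  ... | y , i , e rewrite ==-sound e with extract i
  ... | M , p with extract-all xs {M} (λ z → +-cancelˡ-≤ ⟦ x == z ⟧ _ _ (≤-trans (le z) (≤-reflexive (∑-↭ _ p))))
  ... | r , p′ = r , ↭-trans p (↭-prep x p′)

  permutation : ∀ {L} → length L ≡ q → (∀ x → 1 ≤ count x L) → L ↭ Fs
  permutation {L} len le with extract-all Fs {L} (λ x → ≤-trans (≤-reflexive (∑-Fs-δ x)) (le x))
  ... | [] , p = subst (L ↭_) (Listₚ.++-identityʳ Fs) p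
  ... | a ∷ r , p = ⊥-elim (m+1+n≢m q (sym (trans (sym len) (trans (↭-length p)
        (trans (Listₚ.length-++ Fs) (cong (_+ suc (length r)) length-Fs))))))

  map-permutes : ∀ (g : 𝔽 → 𝔽) → (∀ x → ∑ Fs (λ y → ⟦ g y == x ⟧) ≡ 1) → map g Fs ↭ Fs
  map-permutes g once = permutation (trans (Listₚ.length-map g Fs) length-Fs)
    (λ x → ≤-reflexive (sym (trans (∑-map g Fs _) (once x))))

  ==-cong⇔ : ∀ {a b c d} → (a ≡ b → c ≡ d) → (c ≡ d → a ≡ b) → ⟦ a == b ⟧ ≡ ⟦ c == d ⟧
  ==-cong⇔ f g = cong ⟦_⟧ (bool-ext (==-complete ∘ f ∘ ==-sound) (==-complete ∘ g ∘ ==-sound))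

  scaling-permutes : ∀ y → y ≢ 𝟘 → map (y ⊗_) Fs ↭ Fs
  scaling-permutes y y≢0 = map-permutes (y ⊗_) λ x → trans (∑-cong Fs λ z →
      ==-cong⇔ (λ e → trans (cong (_⊕ ⊖ x) e) (⊖-inverseʳ x))
               (λ e → trans (⊕≡0⇒ e) (ring-solve 1 (λ x → :- (:- x) := x) refl x)))
    (∑-Fs-affine y (⊖ x) y≢0)

  translation-permutes : map (_⊕ 𝟙) Fs ↭ Fs
  translation-permutes = map-permutes (_⊕ 𝟙) λ x → trans (∑-cong Fs λ z →
      ==-cong⇔ (λ e → trans (ring-solve 2 (λ z o → z := (z :+ o) :- o) refl z 𝟙) (cong (_⊕ ⊖ 𝟙) e))
               (λ e → trans (cong (_⊕ 𝟙) e) (ring-solve 2 (λ z o → (z :- o) :+ o := z) refl x 𝟙)))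
    (∑-Fs-δ (x ⊕ ⊖ 𝟙))

  ∑ᶠ-↭ : ∀ {L M} → L ↭ M → ∑ᶠ L id ≡ ∑ᶠ M id
  ∑ᶠ-↭ ↭-base         = refl
  ∑ᶠ-↭ (↭-cons x p)   = cong (x ⊕_) (∑ᶠ-↭ p)
  ∑ᶠ-↭ (↭-exchange x y p) = trans (cong (λ z → x ⊕ (y ⊕ z)) (∑ᶠ-↭ p))
    (ring-solve 3 (λ a b c → a :+ (b :+ c) := b :+ (a :+ c)) refl _ _ _)
  ∑ᶠ-↭ (↭-tr p r) = trans (∑ᶠ-↭ p) (∑ᶠ-↭ r)

  -- Adding 1 permutes the field, so the sum `S` of all elements satisfies `S + q · 1 = S`.
  q·1≡0 : ℕ→𝔽 q ≡ 𝟘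
  q·1≡0 = trans (sym (⊕-identityˡ _)) (trans (cong (_⊕ ℕ→𝔽 q) (sym (⊖-inverseˡ (∑ᶠ Fs id))))
    (trans (⊕-assoc _ _ _) (trans (cong (⊖ ∑ᶠ Fs id ⊕_) total) (⊖-inverseˡ _))))
    where
    translate : ∀ L → ∑ᶠ (map (_⊕ 𝟙) L) id ≡ ∑ᶠ L id ⊕ ℕ→𝔽 (length L)
    translate []      = sym (⊕-identityˡ 𝟘)
    translate (x ∷ L) = trans (cong (x ⊕ 𝟙 ⊕_) (translate L))
      (ring-solve 4 (λ a b c d → a :+ b :+ (c :+ d) := a :+ c :+ (b :+ d)) refl _ _ _ _)
    total : ∑ᶠ Fs id ⊕ ℕ→𝔽 q ≡ ∑ᶠ Fs id
    total = trans (cong (λ n → ∑ᶠ Fs id ⊕ ℕ→𝔽 n) (sym length-Fs)) (trans (sym (translate Fs)) (∑ᶠ-↭ translation-permutes))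

-- Fully reducible lacunary polynomials.

module Lacunary {q : ℕ} (F : FiniteField q) where
  open Field F
  open Polynomials F

  private
    module S = CommutativeRing series-ring
    module SSolve = IntegerSolver series-ring
  open SSolve using () renaming (ring-solve to solveˢ; _:+_ to _⟨+⟩_; _:*_ to _⟨*⟩_; _:-_ to _⟨-⟩_; _:=_ to _⟨=⟩_; :-_ to ⟨-⟩_)

  -- PolyFn j f ℓ: the function f is a polynomial of degree at most j whose coefficient of degree j is ℓ.
  data PolyFn : ℕ → (𝔽 → 𝔽) → 𝔽 → Set where
    constant : ∀ {f} c → (∀ y → f y ≡ c) → PolyFn 0 f c
    horner   : ∀ {j f g ℓ} c → PolyFn j g ℓ → (∀ y → f y ≡ c ⊕ y ⊗ g y) → PolyFn (suc j) f ℓ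

  PolyFn-cong : ∀ {j f g ℓ} → (∀ y → g y ≡ f y) → PolyFn j f ℓ → PolyFn j g ℓ
  PolyFn-cong e (constant c h) = constant c (λ y → trans (e y) (h y))
  PolyFn-cong e (horner c p h) = horner c p (λ y → trans (e y) (h y))

  PolyFn-⊕ : ∀ {j f g ℓ m} → PolyFn j f ℓ → PolyFn j g m → PolyFn j (λ y → f y ⊕ g y) (ℓ ⊕ m)
  PolyFn-⊕ (constant c e) (constant d e′) = constant (c ⊕ d) (λ y → cong₂ _⊕_ (e y) (e′ y))
  PolyFn-⊕ (horner c p e) (horner d p′ e′) = horner (c ⊕ d) (PolyFn-⊕ p p′) λ y →
    trans (cong₂ _⊕_ (e y) (e′ y))
      (ring-solve 5 (λ a b y f g → a :+ y :* f :+ (b :+ y :* g) := a :+ b :+ y :* (f :+ g)) refl c d y _ _)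

  PolyFn-scale : ∀ {j f ℓ} a → PolyFn j f ℓ → PolyFn j (λ y → a ⊗ f y) (a ⊗ ℓ)
  PolyFn-scale a (constant c e) = constant (a ⊗ c) (λ y → cong (a ⊗_) (e y))
  PolyFn-scale a (horner c p e) = horner (a ⊗ c) (PolyFn-scale a p) λ y → trans (cong (a ⊗_) (e y))
    (ring-solve 4 (λ a c y f → a :* (c :+ y :* f) := a :* c :+ y :* (a :* f)) refl a c y _)

  PolyFn-lift : ∀ {j f ℓ} → PolyFn j f ℓ → PolyFn (suc j) f 𝟘
  PolyFn-lift (constant c e) = horner c (constant 𝟘 (λ _ → refl))
    (λ y → trans (e y) (sym (trans (cong (c ⊕_) (⊗-zeroʳ y)) (⊕-identityʳ c))))
  PolyFn-lift (horner c p e) = horner c (PolyFn-lift p) e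

  PolyFn-shift : ∀ {j f ℓ} → PolyFn j f ℓ → PolyFn (suc j) (λ y → y ⊗ f y) ℓ
  PolyFn-shift p = horner 𝟘 p (λ y → sym (⊕-identityˡ _))

  PolyFn-affine : ∀ {j f ℓ} a b → PolyFn j f ℓ → PolyFn (suc j) (λ y → (b ⊕ y ⊗ a) ⊗ f y) (a ⊗ ℓ)
  PolyFn-affine {ℓ = ℓ} a b p = subst (PolyFn _ _) (⊕-identityˡ (a ⊗ ℓ))
    (PolyFn-cong (λ y → ring-solve 4 (λ a b y f → (b :+ y :* a) :* f := b :* f :+ y :* (a :* f)) refl a b y _)
      (PolyFn-⊕ (PolyFn-lift (PolyFn-scale b p)) (PolyFn-shift (PolyFn-scale a p))))

  PolyFn-factor : ∀ {j f ℓ} → PolyFn (suc j) f ℓ → ∀ r →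
    ∃[ g ] (PolyFn j g ℓ × (∀ y → f y ≡ f r ⊕ (y ⊕ ⊖ r) ⊗ g y))
  PolyFn-factor (horner {g = g} c (constant ℓ h) e) r = _ , constant ℓ (λ _ → refl) , λ y →
    trans (e y) (trans (cong (λ z → c ⊕ y ⊗ z) (h y))
      (trans (ring-solve 4 (λ c y l r → c :+ y :* l := (c :+ r :* l) :+ (y :- r) :* l) refl c y ℓ r)
        (cong (_⊕ (y ⊕ ⊖ r) ⊗ ℓ) (sym (trans (e r) (cong (λ z → c ⊕ r ⊗ z) (h r)))))))
  PolyFn-factor {f = f} (horner {g = g} c p@(horner _ _ _) e) r with PolyFn-factor p r
  ... | g′ , p′ , e′ = _ , horner (g r) p′ (λ _ → refl) , λ y →
    trans (e y) (trans (cong (λ z → c ⊕ y ⊗ z) (e′ y))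
      (trans (ring-solve 5 (λ c y a b r → c :+ y :* (a :+ (y :- r) :* b) := (c :+ r :* a) :+ (y :- r) :* (a :+ y :* b)) refl c y (g r) (g′ y) r)
        (cong (_⊕ (y ⊕ ⊖ r) ⊗ (g r ⊕ y ⊗ g′ y)) (sym (e r)))))

  -- Dividing out one zero after another lowers the degree and keeps the top coefficient, until a
  -- constant with a zero is left.
  PolyFn-vanish : ∀ {j f ℓ} → PolyFn j f ℓ → ∀ (b : 𝔽 → Bool) → j < ∑ Fs (⟦_⟧ ∘ b) →
    (∀ y → b y ≡ true → f y ≡ 𝟘) → ℓ ≡ 𝟘
  PolyFn-vanish {zero} (constant c e) b lt v with ∑-witness Fs {b} lt
  ... | y , _ , by = trans (sym (e y)) (v y by)
  PolyFn-vanish {suc j} p b lt v with ∑-witness Fs {b} (≤-<-trans z≤n lt)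
  ... | r , _ , br with PolyFn-factor p r
  ... | g , p′ , e = PolyFn-vanish p′ (λ y → b y ∧ not (y == r))
      (+-cancelʳ-≤ 1 _ _ (≤-trans (subst (_≤ ∑ Fs (⟦_⟧ ∘ b)) (+-comm 1 (suc j)) lt) split)) v′
    where
    split : ∑ Fs (⟦_⟧ ∘ b) ≤ ∑ Fs (λ y → ⟦ b y ∧ not (y == r) ⟧) + 1
    split = ≤-trans (∑-mono Fs pointwise) (≤-reflexive (trans (∑-+ Fs _ _) (cong (∑ Fs (λ y → ⟦ b y ∧ not (y == r) ⟧) +_) (∑-Fs-δ r))))
      where
      pointwise : ∀ y → ⟦ b y ⟧ ≤ ⟦ b y ∧ not (y == r) ⟧ + ⟦ y == r ⟧
      pointwise y with b y | y == r
      ... | true  | true  = ≤-refl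
      ... | true  | false = ≤-refl
      ... | false | _     = z≤n
    v′ : ∀ y → b y ∧ not (y == r) ≡ true → g y ≡ 𝟘
    v′ y e′ with ∧-true {b y} e′
    ... | by , ny = ⊗-integral (trans (sym (trans (e y) (trans (cong (_⊕ _) (v r br)) (⊕-identityˡ _)))) (v y by))
      λ z → ≢-== (not-true ny) (trans (⊕≡0⇒ z) (ring-solve 1 (λ r → :- (:- r) := r) refl r))

  -- Homogeneity: the coefficient of `X^i` is the elementary symmetric function of degree `j` of the
  -- linear forms `β z + y α z`, and its top part in `y` is the same symmetric function of the
  -- `α z`. Through this, facts about many `y` become facts about `α`.
  Π-PolyFn : ∀ (α β : A → 𝔽) L i j → i + j ≡ length L →
    PolyFn j (λ y → Π (map (λ z → β z ⊕ y ⊗ α z) L) i) (Π (map α L) i)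
  Π-PolyFn α β []      zero zero e = constant 𝟙 (λ _ → refl)
  Π-PolyFn α β (z ∷ L) zero (suc j) e = subst (PolyFn _ _) (sym (lin-zero (α z) (Π (map α L))))
    (PolyFn-cong (λ y → lin-zero (β z ⊕ y ⊗ α z) (Π (map (λ z → β z ⊕ y ⊗ α z) L)))
      (PolyFn-affine (α z) (β z) (Π-PolyFn α β L zero j (suc-injective e))))
  Π-PolyFn α β (z ∷ L) (suc i) zero e = subst (PolyFn 0 _) (sym (low (α z) α))
    (PolyFn-cong (λ y → low (β z ⊕ y ⊗ α z) (λ z → β z ⊕ y ⊗ α z)) (Π-PolyFn α β L i zero (suc-injective e)))
    where
    low : ∀ c (g : _ → 𝔽) → (lin c ✶ Π (map g L)) (suc i) ≡ Π (map g L) i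
    low c g = trans (lin-suc c _ i) (trans (cong (Π (map g L) i ⊕_)
      (trans (cong (c ⊗_) (proj₁ (Π-monic (map g L)) (suc i)
        (s≤s (≤-reflexive (trans (Listₚ.length-map g L) (sym (trans (sym (+-identityʳ i)) (suc-injective e)))))))) (⊗-zeroʳ c))) (⊕-identityʳ _))
  Π-PolyFn α β (z ∷ L) (suc i) (suc j) e = subst (PolyFn _ _) (sym (lin-suc (α z) (Π (map α L)) i))
    (PolyFn-cong (λ y → lin-suc (β z ⊕ y ⊗ α z) (Π (map (λ z → β z ⊕ y ⊗ α z) L)) i)
      (PolyFn-⊕ (Π-PolyFn α β L i (suc j) (suc-injective e))
        (PolyFn-affine (α z) (β z) (Π-PolyFn α β L (suc i) j (trans (sym (+-suc i j)) (suc-injective e))))))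

  count-nonzero : ∑ Fs (λ y → ⟦ not (y == 𝟘) ⟧) + 1 ≡ q
  count-nonzero = begin
    ∑ Fs (λ y → ⟦ not (y == 𝟘) ⟧) + 1 ≡⟨ cong (∑ Fs (λ y → ⟦ not (y == 𝟘) ⟧) +_) (∑-Fs-δ 𝟘) ⟨
    ∑ Fs (λ y → ⟦ not (y == 𝟘) ⟧) + ∑ Fs (λ y → ⟦ y == 𝟘 ⟧) ≡⟨ ∑-+ Fs _ _ ⟨
    ∑ Fs (λ y → ⟦ not (y == 𝟘) ⟧ + ⟦ y == 𝟘 ⟧) ≡⟨ ∑-cong Fs (λ y → trans (+-comm ⟦ not (y == 𝟘) ⟧ _) (⟦⟧-not (y == 𝟘))) ⟩
    ∑ Fs (λ _ → 1) ≡⟨ trans (∑-1 Fs) length-Fs ⟩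
    q ∎
    where open ≡-Reasoning

  1≤q : 1 ≤ q
  1≤q = subst (1 ≤_) count-nonzero (m≤n+m 1 _)

  -- Classically `X^q - X`; below it appears as `X^q + Ψ₁ X` with `Ψ₁` nonzero.
  Ψ : Series
  Ψ = Π Fs

  Ψ-0 : Ψ 0 ≡ 𝟘
  Ψ-0 with lin-divides (∈-Fs 𝟘)
  ... | h , _ , e = trans (e 0) (trans (lin-zero 𝟘 h) (⊗-zeroˡ _))

  Ψ-top : Ψ q ≡ 𝟙
  Ψ-top = subst (λ n → Ψ n ≡ 𝟙) length-Fs (proj₂ (Π-monic Fs))

  Ψ-above : ZeroFrom (suc q) Ψ
  Ψ-above = subst (λ n → ZeroFrom (suc n) Ψ) length-Fs (proj₁ (Π-monic Fs))

  -- The coefficients of Π(X+x) are homogeneous and invariant under scaling of 𝔽.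
  Ψ-middle : ∀ i → 1 < i → i < q → Ψ i ≡ 𝟘
  Ψ-middle i 1<i i<q = PolyFn-vanish p (λ y → not (y == 𝟘))
      (+-cancelʳ-< 1 _ _ (subst (j + 1 <_) (sym count-nonzero) (subst₂ _<_ (+-comm 1 j) i+j (+-monoˡ-< j 1<i)))) v
    where
    j = q ∸ i
    i+j : i + j ≡ q
    i+j = m+[n∸m]≡n (<⇒≤ i<q)
    f : 𝔽 → 𝔽
    f y = Π (map (λ z → 𝟘 ⊕ y ⊗ z) Fs) i
    p₀ : PolyFn j f (Ψ i)
    p₀ = subst (λ L → PolyFn j f (Π L i)) (Listₚ.map-id Fs) (Π-PolyFn id (λ _ → 𝟘) Fs i j (trans i+j (sym length-Fs)))
    const-fn : ∀ n c → 1 ≤ n → PolyFn n (λ _ → c) 𝟘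
    const-fn (suc zero) c _ = PolyFn-lift (constant c (λ _ → refl))
    const-fn (suc (suc n)) c _ = PolyFn-lift (const-fn (suc n) c (s≤s z≤n))
    p : PolyFn j (λ y → f y ⊕ ⊖ Ψ i) (Ψ i)
    p = subst (PolyFn j _) (⊕-identityʳ _) (PolyFn-⊕ p₀ (const-fn j (⊖ Ψ i) (m<n⇒0<n∸m i<q)))
    v : ∀ y → not (y == 𝟘) ≡ true → f y ⊕ ⊖ Ψ i ≡ 𝟘
    v y e = trans (cong (_⊕ ⊖ Ψ i) (trans (cong (λ L → Π L i) (Listₚ.map-cong (λ z → ⊕-identityˡ (y ⊗ z)) Fs))
      (Π-↭ (scaling-permutes y (≢-== (not-true e))) i))) (⊖-inverseʳ (Ψ i))

  Ψ₁ : 𝔽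
  Ψ₁ = Ψ 1

  -- The root 0 occurs only once in `Fs`, so removing its factor leaves a product with nonzero
  -- constant term, which is `Ψ₁`.
  Ψ₁≢0 : Ψ₁ ≢ 𝟘
  Ψ₁≢0 with extract (∈-Fs 𝟘)
  ... | r , p = λ e → Π-constant r nz (trans (sym (trans (lin-suc 𝟘 (Π r) 0)
      (trans (cong (Π r 0 ⊕_) (⊗-zeroˡ _)) (⊕-identityʳ _)))) (trans (sym (Π-↭ p 1)) e))
    where
    nz : ∀ a → a ∈ r → a ≢ 𝟘
    nz a i a≡0 = 1+n≰n (≤-trans (s≤s (subst (_≤ count 𝟘 r) (cong ⟦_⟧ (==-complete a≡0)) (∑-∈ (λ y → ⟦ y == 𝟘 ⟧) i)))
      (≤-reflexive (trans (cong (λ b → ⟦ b ⟧ + count 𝟘 r) (sym (==-refl 𝟘))) (trans (sym (∑-↭ (λ y → ⟦ y == 𝟘 ⟧) p)) (∑-Fs-δ 𝟘)))))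

  pow : ℕ → Series
  pow zero    = const 𝟙
  pow (suc n) = X ✶ pow n

  pow-high : ∀ n f i → (pow n ✶ f) (n + i) ≡ f i
  pow-high zero    f i = S.*-identityˡ f i
  pow-high (suc n) f i = trans (S.*-assoc X (pow n) f (suc (n + i))) (trans (X-suc (pow n ✶ f) (n + i)) (pow-high n f i))

  pow-low : ∀ n f i → i < n → (pow n ✶ f) i ≡ 𝟘
  pow-low (suc n) f zero    _ = trans (S.*-assoc X (pow n) f 0) (X-zero (pow n ✶ f))
  pow-low (suc n) f (suc i) (s≤s lt) = trans (S.*-assoc X (pow n) f (suc i)) (trans (X-suc (pow n ✶ f) i) (pow-low n f i lt))

  2≤q : 2 ≤ q
  2≤q = begin
    1 + 1 ≡⟨ cong₂ _+_ (∑-Fs-δ 𝟘) (∑-Fs-δ 𝟙) ⟨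
    ∑ Fs (λ y → ⟦ y == 𝟘 ⟧) + ∑ Fs (λ y → ⟦ y == 𝟙 ⟧) ≡⟨ ∑-+ Fs _ _ ⟨
    ∑ Fs (λ y → ⟦ y == 𝟘 ⟧ + ⟦ y == 𝟙 ⟧) ≤⟨ ∑-mono Fs exclusive ⟩
    ∑ Fs (λ _ → 1) ≡⟨ trans (∑-1 Fs) length-Fs ⟩
    q ∎
    where
    open ≤-Reasoning
    exclusive : ∀ y → ⟦ y == 𝟘 ⟧ + ⟦ y == 𝟙 ⟧ ≤ 1
    exclusive y with true? (y == 𝟘)
    ... | inj₂ e rewrite e = ⟦⟧≤1 (y == 𝟙)
    ... | inj₁ e rewrite ==-sound {y} e | ==-refl 𝟘 | ==-≢ 0≢1 = ≤-refl

  Ψ-split : Ψ ≐ pow q ⊞ const Ψ₁ ✶ X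
  Ψ-split i with <-cmp i q
  ... | tri≈ _ refl _ = trans Ψ-top (sym (trans (cong₂ _⊕_ (trans (sym (S.*-identityʳ (pow q) q))
          (trans (cong (pow q ✶ const 𝟙) (sym (+-identityʳ q))) (pow-high q (const 𝟙) 0)))
        (trans (✶-const Ψ₁ X q) (trans (cong (Ψ₁ ⊗_) (X-above q 2≤q)) (⊗-zeroʳ Ψ₁)))) (⊕-identityʳ 𝟙)))
    where
    X-above : ∀ i → 2 ≤ i → X i ≡ 𝟘
    X-above (suc (suc i)) _ = refl
    X-above (suc zero) (s≤s ())
  ... | tri< i<q _ _ = trans (go i i<q) (sym (trans (cong (_⊕ (const Ψ₁ ✶ X) i)
        (trans (sym (S.*-identityʳ (pow q) i)) (pow-low q (const 𝟙) i i<q))) (⊕-identityˡ _)))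
    where
    go : ∀ i → i < q → Ψ i ≡ (const Ψ₁ ✶ X) i
    go zero _ = trans Ψ-0 (sym (trans (✶-const Ψ₁ X 0) (⊗-zeroʳ Ψ₁)))
    go (suc zero) _ = sym (trans (✶-const Ψ₁ X 1) (⊗-identityʳ Ψ₁))
    go (suc (suc i)) lt = trans (Ψ-middle (suc (suc i)) (s≤s (s≤s z≤n)) lt) (sym (trans (✶-const Ψ₁ X (suc (suc i))) (⊗-zeroʳ Ψ₁)))
  ... | tri> _ _ q<i = trans (Ψ-above i q<i) (sym (trans (cong₂ _⊕_ (above i q<i) (const-X i (≤-<-trans 1≤q q<i))) (⊕-identityˡ 𝟘)))
    where
    above : ∀ i → q < i → pow q i ≡ 𝟘
    above i lt = trans (sym (S.*-identityʳ (pow q) i)) (trans (cong (pow q ✶ const 𝟙) (sym (m+[n∸m]≡n (<⇒≤ lt))))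
      (trans (pow-high q (const 𝟙) (i ∸ q)) (ZeroFrom-const 𝟙 (i ∸ q) (m<n⇒0<n∸m lt))))
    const-X : ∀ i → 1 < i → (const Ψ₁ ✶ X) i ≡ 𝟘
    const-X (suc (suc i)) _ = trans (✶-const Ψ₁ X (suc (suc i))) (⊗-zeroʳ Ψ₁)
    const-X (suc zero) (s≤s ())

  -- The operator X d/dX.
  ϑ : Series → Series
  ϑ f i = ℕ→𝔽 i ⊗ f i

  ϑ-cong : ∀ {f g} → f ≐ g → ϑ f ≐ ϑ g
  ϑ-cong e i = cong (ℕ→𝔽 i ⊗_) (e i)

  ϑ-⊞ : ∀ f g → ϑ (f ⊞ g) ≐ ϑ f ⊞ ϑ g
  ϑ-⊞ f g i = ⊗-distribˡ _ _ _

  ϑ-lin : ∀ a f → ϑ (lin a ✶ f) ≐ X ✶ f ⊞ lin a ✶ ϑ f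
  ϑ-lin a f zero = trans (⊗-zeroˡ _) (sym (trans (cong₂ _⊕_ (X-zero f) (trans (lin-zero a (ϑ f)) (trans (cong (a ⊗_) (⊗-zeroˡ _)) (⊗-zeroʳ a)))) (⊕-identityˡ 𝟘)))
  ϑ-lin a f (suc i) = trans (cong (ℕ→𝔽 (suc i) ⊗_) (lin-suc a f i))
    (trans (trans (ring-solve 5 (λ o n a x y → (o :+ n) :* (x :+ a :* y) := o :* x :+ (n :* x :+ a :* ((o :+ n) :* y))) refl 𝟙 (ℕ→𝔽 i) a (f i) (f (suc i)))
      (cong (_⊕ (ℕ→𝔽 i ⊗ f i ⊕ a ⊗ (ℕ→𝔽 (suc i) ⊗ f (suc i)))) (⊗-identityˡ (f i))))
      (sym (cong₂ _⊕_ (X-suc f i) (lin-suc a (ϑ f) i))))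

  ϑ-const : ∀ κ f → ϑ (const κ ✶ f) ≐ const κ ✶ ϑ f
  ϑ-const κ f i = trans (cong (ℕ→𝔽 i ⊗_) (✶-const κ f i))
    (trans (ring-solve 3 (λ a b c → a :* (b :* c) := b :* (a :* c)) refl _ _ _) (sym (✶-const κ (ϑ f) i)))

  -- Since `q · 1 = 0`, the power `X^q` is a constant for this derivation.
  ϑ-pow : ∀ f → ϑ (pow q ✶ f) ≐ pow q ✶ ϑ f
  ϑ-pow f i with i <? q
  ... | yes lt = trans (cong (ℕ→𝔽 i ⊗_) (pow-low q f i lt)) (trans (⊗-zeroʳ _) (sym (pow-low q (ϑ f) i lt)))
  ... | no ¬lt = subst (λ i → ϑ (pow q ✶ f) i ≡ (pow q ✶ ϑ f) i) (m+[n∸m]≡n (≮⇒≥ ¬lt))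
        (trans (cong₂ _⊗_ (trans (×-homo-+ 𝟙 q j) (trans (cong (_⊕ ℕ→𝔽 j) q·1≡0) (⊕-identityˡ _))) (pow-high q f j))
          (sym (pow-high q (ϑ f) j)))
    where j = i ∸ q

  ϑ-degree : ∀ {d f} → ZeroFrom d f → ZeroFrom d (ϑ f)
  ϑ-degree z i le = trans (cong (ℕ→𝔽 i ⊗_) (z i le)) (⊗-zeroʳ _)

  -- A root of f of multiplicity m is a root of ϑ f of multiplicity at least m - 1, and a root of s.
  divides-ϑ : ∀ s L → (∀ a → a ∈ L → Divides (lin a) s) → Divides (Π L) (s ✶ ϑ (Π L))
  divides-ϑ s [] d = 0ˢ , (0 , λ _ _ → refl) , S.trans (S.*-congˡ ϑ1) (S.trans (S.zeroʳ s) (S.sym (S.zeroʳ _)))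
    where
    ϑ1 : ϑ (const 𝟙) ≐ 0ˢ
    ϑ1 zero    = ⊗-zeroˡ 𝟙
    ϑ1 (suc i) = ⊗-zeroʳ _
  divides-ϑ s (a ∷ L) d with d a (here refl) | divides-ϑ s L (λ b → d b ∘ there)
  ... | t , fin-t , e | r , fin-r , e′ = X ✶ t ⊞ r , Finite-⊞ (Finite-✶ Finite-X fin-t) fin-r ,
    S.trans (S.*-congˡ (ϑ-lin a (Π L)))
    (S.trans (solveˢ 5 (λ s x f l g → s ⟨*⟩ (x ⟨*⟩ f ⟨+⟩ l ⟨*⟩ g) ⟨=⟩ s ⟨*⟩ (x ⟨*⟩ f) ⟨+⟩ l ⟨*⟩ (s ⟨*⟩ g)) refl s X (Π L) (lin a) (ϑ (Π L)))
    (S.trans (S.+-cong (S.*-congʳ e) (S.*-congˡ e′))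
      (solveˢ 5 (λ l t x f r → l ⟨*⟩ t ⟨*⟩ (x ⟨*⟩ f) ⟨+⟩ l ⟨*⟩ (f ⟨*⟩ r) ⟨=⟩ l ⟨*⟩ f ⟨*⟩ (x ⟨*⟩ t ⟨+⟩ r)) refl (lin a) t X (Π L) r)))

  Divides-combine : ∀ {f g h} c → Finite c → Divides f g → Divides f h → Divides f (g ⊞ neg (h ✶ c))
  Divides-combine {f} {g} {h} c fc (a , fa , ea) (b , fb , eb) = a ⊞ neg (b ✶ c) , Finite-⊞ fa (Finite-neg (Finite-✶ fb fc)) ,
    S.trans (S.+-cong ea (S.-‿cong (S.*-congʳ eb)))
      (solveˢ 4 (λ f a b c → f ⟨*⟩ a ⟨-⟩ f ⟨*⟩ b ⟨*⟩ c ⟨=⟩ f ⟨*⟩ (a ⟨-⟩ b ⟨*⟩ c)) refl f a b c)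

  -- Here `tf`, `tg`, `th` are the derivatives and `p` is `X^q`. The terms in `p` cancel in the
  -- Wronskian of `g` and `h`, which therefore equals `g tf - f tg`; times `s` this is a multiple of
  -- `f`.
  wronskian-divides : ∀ s g f h tf th tg p r → h ≐ f ⊞ neg (p ✶ g) → th ≐ tf ⊞ neg (p ✶ tg) → s ✶ tf ≐ f ✶ r →
    s ✶ (g ✶ th ⊞ neg (h ✶ tg)) ≐ f ✶ (g ✶ r ⊞ neg (s ✶ tg))
  wronskian-divides s g f h tf th tg p r eh eth e =
    S.trans (S.*-congˡ {s} (S.+-cong (S.*-congˡ {g} eth) (S.-‿cong (S.*-congʳ {tg} eh))))
    (S.trans (solveˢ 6 (λ s g tf p tg f → s ⟨*⟩ (g ⟨*⟩ (tf ⟨-⟩ p ⟨*⟩ tg) ⟨-⟩ (f ⟨-⟩ p ⟨*⟩ g) ⟨*⟩ tg) ⟨=⟩ g ⟨*⟩ (s ⟨*⟩ tf) ⟨-⟩ f ⟨*⟩ (s ⟨*⟩ tg)) refl s g tf p tg f)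
    (S.trans (S.+-congʳ {neg (f ✶ (s ✶ tg))} (S.*-congˡ {g} e))
      (solveˢ 5 (λ g f r s tg → g ⟨*⟩ (f ⟨*⟩ r) ⟨-⟩ f ⟨*⟩ (s ⟨*⟩ tg) ⟨=⟩ f ⟨*⟩ (g ⟨*⟩ r ⟨-⟩ s ⟨*⟩ tg)) refl g f r s tg)))

  wronskian-shift : ∀ g h th tg k h₁ th₁ → h₁ ≐ h ⊞ neg (k ✶ g) → th₁ ≐ th ⊞ neg (k ✶ tg) →
    g ✶ th₁ ⊞ neg (h₁ ✶ tg) ≐ g ✶ th ⊞ neg (h ✶ tg)
  wronskian-shift g h th tg k h₁ th₁ eh eth = S.trans (S.+-cong (S.*-congˡ {g} eth) (S.-‿cong (S.*-congʳ {tg} eh)))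
    (solveˢ 5 (λ g th k tg h → g ⟨*⟩ (th ⟨-⟩ k ⟨*⟩ tg) ⟨-⟩ (h ⟨-⟩ k ⟨*⟩ g) ⟨*⟩ tg ⟨=⟩ g ⟨*⟩ th ⟨-⟩ h ⟨*⟩ tg) refl g th k tg h)

  remainder-zero : ∀ f p k g h → h ≐ f ⊞ neg (p ✶ g) → h ⊞ neg (k ✶ g) ≐ 0ˢ → f ≐ (p ⊞ k) ✶ g
  remainder-zero f p k g h eh e =
    S.trans (solveˢ 4 (λ f p k g → f ⟨=⟩ (p ⟨+⟩ k) ⟨*⟩ g ⟨+⟩ (f ⟨-⟩ p ⟨*⟩ g ⟨-⟩ k ⟨*⟩ g)) refl f p k g)
    (S.trans (S.+-congˡ {(p ⊞ k) ✶ g} (S.trans (S.+-congʳ {neg (k ✶ g)} (S.sym eh)) e)) (S.+-identityʳ ((p ⊞ k) ✶ g)))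

  expand-remainder : ∀ f P p k x g → P ≐ p ⊞ k ✶ x → f ⊞ neg (P ✶ g) ≐ (f ⊞ neg (p ✶ g)) ⊞ neg (k ✶ (x ✶ g))
  expand-remainder f P p k x g e = S.trans (S.+-congˡ {f} (S.-‿cong (S.*-congʳ {g} e)))
    (solveˢ 5 (λ f p k x g → f ⟨-⟩ (p ⟨+⟩ k ⟨*⟩ x) ⟨*⟩ g ⟨=⟩ f ⟨-⟩ p ⟨*⟩ g ⟨-⟩ k ⟨*⟩ (x ⟨*⟩ g)) refl f p k x g)

  -- Modulo `x + a` one has `P = - p x = p a`, so `P + k` becomes the scalar `d`, and divisibility
  -- of `(P + k) t` turns into divisibility of `d t`.
  scale-remainder : ∀ k p x a ψ t z P d → P ≐ (x ⊞ a) ✶ ψ ⊞ neg (p ✶ x) → d ≐ k ⊞ p ✶ a → (x ⊞ a) ✶ z ≐ (P ⊞ k) ✶ t →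
    d ✶ t ≐ (x ⊞ a) ✶ (z ⊞ neg ((ψ ⊞ neg p) ✶ t))
  scale-remainder k p x a ψ t z P d eP ed e = S.trans (S.*-congʳ {t} ed)
    (S.trans (solveˢ 6 (λ k p x a ψ t → (k ⟨+⟩ p ⟨*⟩ a) ⟨*⟩ t ⟨=⟩
        (((x ⟨+⟩ a) ⟨*⟩ ψ ⟨-⟩ p ⟨*⟩ x) ⟨+⟩ k) ⟨*⟩ t ⟨-⟩ (x ⟨+⟩ a) ⟨*⟩ ((ψ ⟨-⟩ p) ⟨*⟩ t)) refl k p x a ψ t)
    (S.trans (S.+-congʳ {neg ((x ⊞ a) ✶ ((ψ ⊞ neg p) ✶ t))} (S.trans (S.*-congʳ {t} (S.+-congʳ {k} (S.sym eP))) (S.sym e)))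
      (solveˢ 3 (λ l z y → l ⟨*⟩ z ⟨-⟩ l ⟨*⟩ y ⟨=⟩ l ⟨*⟩ (z ⟨-⟩ y)) refl (x ⊞ a) z ((ψ ⊞ neg p) ✶ t))))

  cancel-factor : ∀ l z t t′ P → l 0 ≢ 𝟘 → l ✶ z ≐ P ✶ t → t ≐ l ✶ t′ → z ≐ P ✶ t′
  cancel-factor l z t t′ P n e et = S.trans (solveˢ 2 (λ z y → z ⟨=⟩ (z ⟨-⟩ y) ⟨+⟩ y) refl z (P ✶ t′))
    (S.trans (S.+-congʳ {P ✶ t′} (unit-cancel n
      (S.trans (solveˢ 3 (λ l z y → l ⟨*⟩ (z ⟨-⟩ y) ⟨=⟩ l ⟨*⟩ z ⟨-⟩ l ⟨*⟩ y) refl l z (P ✶ t′))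
        (S.trans (S.+-congʳ {neg (l ✶ (P ✶ t′))} (S.trans e (S.trans (S.*-congˡ {P} et)
           (solveˢ 3 (λ p l t → p ⟨*⟩ (l ⟨*⟩ t) ⟨=⟩ l ⟨*⟩ (p ⟨*⟩ t)) refl P l t′))))
          (S.-‿inverseʳ (l ✶ (P ✶ t′))))))) (S.+-identityˡ (P ✶ t′)))

  divide-scalar : ∀ d⁻¹ d t l w → const 𝟙 ≐ d⁻¹ ✶ d → d ✶ t ≐ l ✶ w → t ≐ l ✶ (d⁻¹ ✶ w)
  divide-scalar d⁻¹ d t l w e et = S.trans (S.sym (S.*-identityˡ t)) (S.trans (S.*-congʳ {t} e)
    (S.trans (S.*-assoc d⁻¹ d t) (S.trans (S.*-congˡ {d⁻¹} et)
      (solveˢ 3 (λ d l w → d ⟨*⟩ (l ⟨*⟩ w) ⟨=⟩ l ⟨*⟩ (d ⟨*⟩ w)) refl d⁻¹ l w))))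

  ϑ-neg : ∀ f → ϑ (neg f) ≐ neg (ϑ f)
  ϑ-neg f i = ring-solve 2 (λ a b → a :* :- b := :- (a :* b)) refl _ _

  ϑ-remainder : ∀ f g h → h ≐ f ⊞ neg (pow q ✶ g) → ϑ h ≐ ϑ f ⊞ neg (pow q ✶ ϑ g)
  ϑ-remainder f g h e i = trans (ϑ-cong e i) (trans (ϑ-⊞ f (neg (pow q ✶ g)) i)
    (cong (ϑ f i ⊕_) (trans (ϑ-neg (pow q ✶ g) i) (cong ⊖_ (ϑ-pow g i)))))

  -- If all coefficients of Π L strictly between c + u and q vanish, then Π L = X^q g + h with deg g and deg h small;
  -- comparing degrees in the divisibility Π L ∣ (h - Ψ₁ X g)(g ϑh - h ϑg) forces h to be a multiple of g.
  module Few (c u : ℕ) (L : List 𝔽) (len : length L ≡ q + c) (1≤u : 1 ≤ u) (small : (c + u) + (c + u) < q)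
    (char : ∀ j → 1 ≤ j → j ≤ c + u → ℕ→𝔽 j ≢ 𝟘) (nonzero : ∀ a → a ∈ L → a ≢ 𝟘)
    (lacunary : ∀ i → c + u < i → i < q → Π L i ≡ 𝟘) where

    private
      f : Series
      f = Π L

      abstract
        g h s W h₁ : Series
        g i = f (q + i)
        h = f ⊞ neg (pow q ✶ g)
        s = f ⊞ neg (Ψ ✶ g)
        W = g ✶ ϑ h ⊞ neg (h ✶ ϑ g)
        -- As `g` is monic of degree `c`, this removes the coefficient of degree `c`, the one degree
        -- at which the Wronskian gives no information.
        h₁ = h ⊞ neg (const (h c) ✶ g)

        g-def : ∀ i → g i ≡ f (q + i)
        g-def i = refl

        h-def : h ≐ f ⊞ neg (pow q ✶ g)
        h-def i = refl

        s-def : s ≐ f ⊞ neg (Ψ ✶ g)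
        s-def i = refl

        W-def : W ≐ g ✶ ϑ h ⊞ neg (h ✶ ϑ g)
        W-def i = refl

        h₁-def : h₁ ≐ h ⊞ neg (const (h c) ✶ g)
        h₁-def i = refl

      g-degree : ZeroFrom (suc c) g
      g-degree i le = trans (g-def i) $ proj₁ (Π-monic L) (q + i) (subst (λ n → suc n ≤ q + i) (sym len) (subst (_≤ q + i) (+-suc q c) (+-monoʳ-≤ q le)))

      g-top : g c ≡ 𝟙
      g-top = trans (g-def c) $ subst (λ n → f n ≡ 𝟙) len (proj₂ (Π-monic L))

      g-finite : Finite g
      g-finite = _ , g-degree

      h-degree : ZeroFrom (suc (c + u)) h
      h-degree i le with i <? q
      ... | yes lt = trans (h-def i) $ trans (cong₂ _⊕_ (lacunary i le lt) (trans (cong ⊖_ (pow-low q g i lt)) ⊖-𝟘)) (⊕-identityˡ 𝟘)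
      ... | no ¬lt = subst (λ i → h i ≡ 𝟘) (m+[n∸m]≡n (≮⇒≥ ¬lt))
            (trans (h-def (q + (i ∸ q))) $ trans (cong (λ z → f (q + (i ∸ q)) ⊕ ⊖ z) (trans (pow-high q g (i ∸ q)) (g-def (i ∸ q)))) (⊖-inverseʳ _))

      -- This form shows that the degree is at most `c + u`. The form `f - Ψ g` shows that every
      -- root of `f` is a root of `s`, because all field elements are roots of `Ψ`.
      s≐ : s ≐ h ⊞ neg (const Ψ₁ ✶ (X ✶ g))
      s≐ = S.trans s-def (S.trans (expand-remainder f Ψ (pow q) (const Ψ₁) X g Ψ-split) (S.+-congʳ {neg (const Ψ₁ ✶ (X ✶ g))} (S.sym h-def)))

      s-0 : s 0 ≢ 𝟘
      s-0 e = Π-constant L nonzero (trans (sym (trans (s-def 0) $ trans (cong (λ z → f 0 ⊕ ⊖ z) (trans (cong (_⊗ g 0) Ψ-0) (⊗-zeroˡ _)))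
        (trans (cong (f 0 ⊕_) ⊖-𝟘) (⊕-identityʳ _)))) e)

      s-degree : ZeroFrom (suc (c + u)) s
      s-degree = ZeroFrom-≐ (S.sym s≐) (ZeroFrom-⊞ h-degree (ZeroFrom-neg (λ i le → trans (✶-const Ψ₁ (X ✶ g) i)
        (trans (cong (Ψ₁ ⊗_) (Xg i (≤-trans (s≤s (subst (_≤ c + u) (+-comm c 1) (+-monoʳ-≤ c 1≤u))) le))) (⊗-zeroʳ _)))))
        where
        Xg : ∀ i → suc (suc c) ≤ i → (X ✶ g) i ≡ 𝟘
        Xg (suc i) (s≤s le) = trans (X-suc g i) (g-degree i le)

      f∣sϑf : Divides f (s ✶ ϑ f)
      f∣sϑf = divides-ϑ s L (λ a i → case Divides-combine g g-finite (lin-divides i) (lin-divides (∈-Fs a)) of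
        λ { (t , ft , e) → t , ft , S.trans s-def e })

      f∣sW : Divides f (s ✶ W)
      f∣sW = case f∣sϑf of λ { (r , fin , e) → g ✶ r ⊞ neg (s ✶ ϑ g) ,
        Finite-⊞ {g ✶ r} {neg (s ✶ ϑ g)} (Finite-✶ {g} {r} g-finite fin)
          (Finite-neg {s ✶ ϑ g} (Finite-✶ {s} {ϑ g} (_ , s-degree) (_ , ϑ-degree {f = g} g-degree))) ,
        S.trans {s ✶ W} {s ✶ (g ✶ ϑ h ⊞ neg (h ✶ ϑ g))} {f ✶ (g ✶ r ⊞ neg (s ✶ ϑ g))} (✶-cong {s} {s} {W} (λ _ → refl) W-def) (wronskian-divides s g f h (ϑ f) (ϑ h) (ϑ g) (pow q) r h-def (ϑ-remainder f g h h-def) e) }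

      W-degree : ZeroFrom (suc (c + (c + u))) W
      W-degree = ZeroFrom-≐ {f = g ✶ ϑ h ⊞ neg (h ✶ ϑ g)} (S.sym W-def) (ZeroFrom-⊞ {f = g ✶ ϑ h} {neg (h ✶ ϑ g)} (proj₁ (✶-degree c (c + u) {g} {ϑ h} g-degree (ϑ-degree {f = h} h-degree)))
        (ZeroFrom-neg {f = h ✶ ϑ g} (ZeroFrom-≐ {f = ϑ g ✶ h} (✶-comm (ϑ g) h) (proj₁ (✶-degree c (c + u) {ϑ g} {h} (ϑ-degree {f = g} g-degree) h-degree)))))

      -- `f` has degree `q + c`, but `s W` has degree at most `3 c + 2 u`, which is smaller because
      -- `2 (c + u) < q`. So the quotient is zero, and `s`, whose constant term is that of `f`, can
      -- be cancelled.
      W≐0 : W ≐ 0ˢ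
      W≐0 = case f∣sW of λ { (z , fin , e) → unit-cancel {s} {W} s-0 (S.trans {s ✶ W} {f ✶ z} {0ˢ} e
          (S.trans {f ✶ z} {f ✶ 0ˢ} {0ˢ} (✶-cong {f} {f} {z} (λ _ → refl) (quotient-zero z fin e)) (S.zeroʳ f))) }
        where
        bound : suc (c + u + (c + (c + u))) ≤ length L + 0
        bound = subst (suc (c + u + (c + (c + u))) ≤_) (sym (trans (+-identityʳ _) len))
          (subst (_≤ q + c) (rearrange c u) (+-monoˡ-≤ c small))
          where
          rearrange = semiring-solve 2 (λ c u → 1⊹ (c ⊹ u ⊹ (c ⊹ u)) ⊹ c , 1⊹ (c ⊹ u ⊹ (c ⊹ (c ⊹ u)))) refl
        quotient-zero : ∀ z → Finite z → s ✶ W ≐ f ✶ z → z ≐ 0ˢ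
        quotient-zero z fin e i = Π-degree L {z} fin (ZeroFrom-≤ {f = f ✶ z} bound (ZeroFrom-≐ {f = s ✶ W} e
          (proj₁ (✶-degree (c + u) (c + (c + u)) {s} {W} s-degree W-degree)))) i z≤n

      κ : 𝔽
      κ = h c

      wronskian₁ : g ✶ ϑ h₁ ⊞ neg (h₁ ✶ ϑ g) ≐ 0ˢ
      wronskian₁ = S.trans (wronskian-shift g h (ϑ h) (ϑ g) (const κ) h₁ (ϑ h₁) h₁-def ϑh₁) (S.trans (S.sym W-def) W≐0)
        where
        ϑh₁ : ϑ h₁ ≐ ϑ h ⊞ neg (const κ ✶ ϑ g)
        ϑh₁ i = trans (cong (ℕ→𝔽 i ⊗_) (h₁-def i)) $ trans (ring-solve 3 (λ n a b → n :* (a :- b) := n :* a :- n :* b) refl _ _ _)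
          (cong (λ z → ϑ h i ⊕ ⊖ z) (ϑ-const κ g i))

      h₁-c : h₁ c ≡ 𝟘
      h₁-c = trans (h₁-def c) $ trans (cong (λ z → κ ⊕ ⊖ z) (trans (✶-const κ g c) (trans (cong (κ ⊗_) g-top) (⊗-identityʳ κ)))) (⊖-inverseʳ κ)

      h₁-degree : ZeroFrom (suc (c + u)) h₁
      h₁-degree = ZeroFrom-≐ (S.sym h₁-def) $ ZeroFrom-⊞ h-degree (ZeroFrom-neg (λ i le → trans (✶-const κ g i)
        (trans (cong (κ ⊗_) (g-degree i (≤-trans (s≤s (m≤m+n c u)) le))) (⊗-zeroʳ κ))))

      -- In degree `c + e` the Wronskian of `g` and `h₁` has this coefficient, because `g` is monic
      -- of degree `c`.
      top-coefficient : ∀ e → ZeroFrom (suc e) h₁ → (ℕ→𝔽 e ⊕ ⊖ ℕ→𝔽 c) ⊗ h₁ e ≡ 𝟘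
      top-coefficient e z = begin
        (ℕ→𝔽 e ⊕ ⊖ ℕ→𝔽 c) ⊗ h₁ e ≡⟨ ring-solve 3 (λ m n x → (m :- n) :* x := m :* x :- n :* x) refl (ℕ→𝔽 e) (ℕ→𝔽 c) (h₁ e) ⟩
        ℕ→𝔽 e ⊗ h₁ e ⊕ ⊖ (ℕ→𝔽 c ⊗ h₁ e) ≡⟨ cong₂ (λ a b → a ⊕ ⊖ b) (trans (sym (⊗-identityˡ _)) (cong (_⊗ (ℕ→𝔽 e ⊗ h₁ e)) (sym g-top)))
                                                                     (cong (_⊗ h₁ e) (trans (sym (⊗-identityʳ _)) (cong (ℕ→𝔽 c ⊗_) (sym g-top)))) ⟩
        g c ⊗ ϑ h₁ e ⊕ ⊖ (ϑ g c ⊗ h₁ e) ≡⟨ cong₂ (λ a b → a ⊕ ⊖ b) (proj₂ (✶-degree c e g-degree (ϑ-degree z))) (trans (✶-comm h₁ (ϑ g) (c + e)) (proj₂ (✶-degree c e (ϑ-degree g-degree) z))) ⟨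
        (g ✶ ϑ h₁ ⊞ neg (h₁ ✶ ϑ g)) (c + e) ≡⟨ wronskian₁ (c + e) ⟩
        𝟘 ∎
        where open ≡-Reasoning

      difference : ∀ m n → ℕ→𝔽 (m + n) ⊕ ⊖ ℕ→𝔽 m ≡ ℕ→𝔽 n
      difference m n = trans (cong (_⊕ ⊖ ℕ→𝔽 m) (×-homo-+ 𝟙 m n))
        (ring-solve 2 (λ a b → a :+ b :- a := b) refl (ℕ→𝔽 m) (ℕ→𝔽 n))

      -- The numbers `e` and `c` differ by at most `c + u`: this is where the small multiples of 1
      -- have to be nonzero.
      distinct : ∀ e → e ≤ c + u → e ≢ c → ℕ→𝔽 e ⊕ ⊖ ℕ→𝔽 c ≢ 𝟘
      distinct e le ne z with <-cmp e c
      ... | tri≈ _ e≡c _ = ne e≡c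
      ... | tri< lt _ _ = char (c ∸ e) (m<n⇒0<n∸m lt) (≤-trans (m∸n≤m c e) (m≤m+n c u))
            (trans (sym (difference e (c ∸ e))) (trans (cong (λ n → ℕ→𝔽 n ⊕ ⊖ ℕ→𝔽 e) (m+[n∸m]≡n (<⇒≤ lt)))
              (trans (ring-solve 2 (λ a b → a :- b := :- (b :- a)) refl (ℕ→𝔽 c) (ℕ→𝔽 e)) (trans (cong ⊖_ z) ⊖-𝟘))))
      ... | tri> _ _ lt = char (e ∸ c) (m<n⇒0<n∸m lt) (≤-trans (m∸n≤m e c) le)
            (trans (sym (difference c (e ∸ c))) (trans (cong (λ n → ℕ→𝔽 n ⊕ ⊖ ℕ→𝔽 c) (m+[n∸m]≡n (<⇒≤ lt))) z))

      descend : ∀ d → d ≤ suc (c + u) → ZeroFrom d h₁ → ZeroFrom 0 h₁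
      descend zero    _ z = z
      descend (suc e) (s≤s le) z = descend e (≤-trans le (n≤1+n _)) z′
        where
        h₁-e : h₁ e ≡ 𝟘
        h₁-e with e ≟ c
        ... | yes refl = h₁-c
        ... | no ne = ⊗-integral (top-coefficient e z) (distinct e le ne)
        z′ : ZeroFrom e h₁
        z′ i l with m≤n⇒m<n∨m≡n l
        ... | inj₁ lt   = z i lt
        ... | inj₂ refl = h₁-e

      f≐ : f ≐ (pow q ⊞ const κ) ✶ g
      f≐ = remainder-zero f (pow q) (const κ) g h h-def (S.trans (S.sym h₁-def) (λ i → descend _ ≤-refl h₁-degree i z≤n))

      -- X + a divides X^q + κ exactly when excess a = 0.
      excess : 𝔽 → 𝔽
      excess a = κ ⊕ Ψ₁ ⊗ a

      const-* : ∀ a b → const (a ⊗ b) ≐ const a ✶ const b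
      const-* a b zero    = refl
      const-* a b (suc i) = sym (trans (✶-const a (const b) (suc i)) (⊗-zeroʳ a))

      const-+ : ∀ a b → const (a ⊕ b) ≐ const a ⊞ const b
      const-+ a b zero    = refl
      const-+ a b (suc i) = sym (⊕-identityˡ 𝟘)

      -- Since `X + a` is prime to `X^q + κ`, it divides the cofactor `t`.
      remove-factor : ∀ a z t → a ≢ 𝟘 → excess a ≢ 𝟘 → Finite z → Finite t → lin a ✶ z ≐ (pow q ⊞ const κ) ✶ t →
        ∃[ t′ ] (Finite t′ × t ≐ lin a ✶ t′ × z ≐ (pow q ⊞ const κ) ✶ t′)
      remove-factor a z t a≢0 d≢0 fz ft e = t′ , fin , t≐ , z≐
        where
        ψ = proj₁ (lin-divides (∈-Fs a))
        fψ = proj₁ (proj₂ (lin-divides (∈-Fs a)))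
        eψ = proj₂ (proj₂ (lin-divides (∈-Fs a)))
        d⁻¹ = proj₁ (inverse (excess a) d≢0)
        dd⁻¹ = proj₂ (inverse (excess a) d≢0)
        w = z ⊞ neg ((ψ ⊞ neg (const Ψ₁)) ✶ t)
        t′ = const d⁻¹ ✶ w
        fin : Finite t′
        fin = Finite-✶ (Finite-const d⁻¹) (Finite-⊞ fz (Finite-neg (Finite-✶ (Finite-⊞ fψ (Finite-neg (Finite-const Ψ₁))) ft)))
        pow≐ : pow q ≐ lin a ✶ ψ ⊞ neg (const Ψ₁ ✶ X)
        pow≐ = S.trans (solveˢ 2 (λ p k → p ⟨=⟩ (p ⟨+⟩ k) ⟨-⟩ k) refl (pow q) (const Ψ₁ ✶ X))
          (S.+-congʳ (S.trans (S.sym Ψ-split) eψ))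
        excess≐ : const (excess a) ≐ const κ ⊞ const Ψ₁ ✶ const a
        excess≐ = S.trans (const-+ κ (Ψ₁ ⊗ a)) (S.+-congˡ (const-* Ψ₁ a))
        scaled : const (excess a) ✶ t ≐ lin a ✶ w
        scaled = scale-remainder (const κ) (const Ψ₁) X (const a) ψ t z (pow q) (const (excess a)) pow≐ excess≐ e
        t≐ : t ≐ lin a ✶ t′
        t≐ = divide-scalar (const d⁻¹) (const (excess a)) t (lin a) w
          (λ i → trans (cong (λ o → const o i) (trans (sym dd⁻¹) (⊗-comm (excess a) d⁻¹))) (const-* d⁻¹ (excess a) i)) scaled
        z≐ : z ≐ (pow q ⊞ const κ) ✶ t′
        z≐ = cancel-factor (lin a) z t t′ (pow q ⊞ const κ) (λ l → a≢0 (trans (sym (⊕-identityˡ a)) l)) e t≐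

      other : List 𝔽 → List 𝔽
      other [] = []
      other (a ∷ M) with excess a == 𝟘
      ... | true  = other M
      ... | false = a ∷ other M

      other-length : ∀ M → length (other M) + ∑ M (λ a → ⟦ excess a == 𝟘 ⟧) ≡ length M
      other-length [] = refl
      other-length (a ∷ M) with excess a == 𝟘
      ... | true  = trans (+-suc _ _) (cong suc (other-length M))
      ... | false = cong suc (other-length M)

      other-root : ∀ a M → (excess a == 𝟘) ≡ true → other (a ∷ M) ≡ other M
      other-root a M e rewrite e = refl

      other-nonroot : ∀ a M → (excess a == 𝟘) ≡ false → other (a ∷ M) ≡ a ∷ other M
      other-nonroot a M e rewrite e = refl

      -- Factors that divide `X^q + κ` are moved into `z`; all others are divided out of `t` one at
      -- a time.
      remove-factors : ∀ M z t → (∀ a → a ∈ M → a ≢ 𝟘) → Finite z → Finite t → Π M ✶ z ≐ (pow q ⊞ const κ) ✶ t →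
        Divides (Π (other M)) t
      remove-step : ∀ a M z t → (∀ b → b ∈ a ∷ M → b ≢ 𝟘) → Finite z → Finite t → Π (a ∷ M) ✶ z ≐ (pow q ⊞ const κ) ✶ t →
        (excess a == 𝟘) ≡ true ⊎ (excess a == 𝟘) ≡ false → Divides (Π (other (a ∷ M))) t
      remove-factors [] z t n fz ft e = t , ft , S.sym (S.*-identityˡ t)
      remove-factors (a ∷ M) z t n fz ft e = remove-step a M z t n fz ft e (true? (excess a == 𝟘))
      remove-step a M z t n fz ft e (inj₁ d) = subst (λ N → Divides (Π N) t) (sym (other-root a M d))
        (remove-factors M (lin a ✶ z) t (λ b → n b ∘ there)
          (Finite-✶ {lin a} {z} (Finite-⊞ {X} {const a} Finite-X (Finite-const a)) fz) ft
          (S.trans {Π M ✶ (lin a ✶ z)} {lin a ✶ Π M ✶ z} {(pow q ⊞ const κ) ✶ t}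
            (solveˢ 3 (λ m l z → m ⟨*⟩ (l ⟨*⟩ z) ⟨=⟩ l ⟨*⟩ m ⟨*⟩ z) refl (Π M) (lin a) z) e))
      remove-step a M z t n fz ft e (inj₂ d) = subst (λ N → Divides (Π N) t) (sym (other-nonroot a M d)) (continue
          (remove-factor a (Π M ✶ z) t (n a (here refl)) (≢-== d) (Finite-✶ {Π M} {z} (Π-finite M) fz) ft
            (S.trans {lin a ✶ (Π M ✶ z)} {lin a ✶ Π M ✶ z} {(pow q ⊞ const κ) ✶ t} (S.sym (S.*-assoc (lin a) (Π M) z)) e)))
        where
        continue : ∃[ t′ ] (Finite t′ × t ≐ lin a ✶ t′ × Π M ✶ z ≐ (pow q ⊞ const κ) ✶ t′) → Divides (Π (a ∷ other M)) t
        continue (t₁ , f₁ , e₁ , e₂) = case remove-factors M z t₁ (λ b → n b ∘ there) fz f₁ e₂ of λ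
          { (t₂ , f₂ , e₃) → t₂ , f₂ , S.trans {t} {lin a ✶ t₁} {Π (a ∷ other M) ✶ t₂} e₁
              (S.trans {lin a ✶ t₁} {lin a ✶ (Π (other M) ✶ t₂)} {Π (a ∷ other M) ✶ t₂} (✶-cong {lin a} {lin a} {t₁} (λ _ → refl) e₃)
                (S.sym (S.*-assoc (lin a) (Π (other M)) t₂))) }

      -- The product over `other L` divides `g`, which is monic of degree `c`.
      other≤c : length (other L) ≤ c
      other≤c = case length (other L) ≤? c of λ
        { (yes le) → le
        ; (no ¬le) → ⊥-elim (absurd (≰⇒> ¬le) (remove-factors L (const 𝟙) g nonzero (Finite-const 𝟙) g-finite
            (S.trans {f ✶ const 𝟙} {f} {(pow q ⊞ const κ) ✶ g} (S.*-identityʳ f) f≐))) }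
        where
        absurd : c < length (other L) → Divides (Π (other L)) g → ⊥
        absurd lt (t , ft , e) = 1≢0 (trans (sym g-top) (trans (e c)
            (trans (✶-cong {Π (other L)} {Π (other L)} {t} (λ _ → refl) t≐0 c) (S.zeroʳ (Π (other L)) c))))
          where
          t≐0 : t ≐ 0ˢ
          t≐0 i = Π-degree (other L) {t} ft (ZeroFrom-≤ {f = Π (other L) ✶ t} (subst (suc c ≤_) (sym (+-identityʳ _)) lt)
            (ZeroFrom-≐ {f = g} e g-degree)) i z≤n

      many : q ≤ ∑ L (λ a → ⟦ excess a == 𝟘 ⟧)
      many = +-cancelˡ-≤ (length (other L)) _ _ (≤-trans (≤-trans (+-monoˡ-≤ q other≤c) (≤-reflexive (trans (+-comm c q) (sym len))))
        (≤-reflexive (sym (other-length L))))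

    -- At least `q` entries of `L` have excess zero, and these coincide because `Ψ₁` is nonzero.
    frequent-root : ∃[ x ] (q ≤ count x L)
    frequent-root = case ∑-witness L {λ a → excess a == 𝟘} (≤-trans 1≤q many) of λ { (x , _ , ex) → x , ≤-trans many (∑-mono L (λ a → ⟦⟧-mono λ ea → ==-complete (⊗-cancelˡ Ψ₁≢0
          (trans (ring-solve 2 (λ k y → y := (k :+ y) :- k) refl κ (Ψ₁ ⊗ a))
            (trans (cong (_⊕ ⊖ κ) (trans (==-sound ea) (sym (==-sound ex))))
              (ring-solve 2 (λ k y → (k :+ y) :- k := y) refl κ (Ψ₁ ⊗ x))))))) }

-- Linear algebra and point counts in coordinates.

module Vectors {q : ℕ} (F : FiniteField q) where
  open Field F

  𝕍 : ℕ → Set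
  𝕍 d = Vec 𝔽 d

  variable
    d m k : ℕ

  infixl 6 _+ᵛ_
  infixr 7 _·_
  infix 9 _∙_

  0ᵛ : 𝕍 d
  0ᵛ = replicate _ 𝟘

  _+ᵛ_ : 𝕍 d → 𝕍 d → 𝕍 d
  _+ᵛ_ = zipWith _⊕_

  _·_ : 𝔽 → 𝕍 d → 𝕍 d
  a · v = Vec.map (a ⊗_) v

  _∙_ : 𝕍 d → 𝕍 d → 𝔽
  []      ∙ []      = 𝟘
  (x ∷ u) ∙ (y ∷ v) = x ⊗ y ⊕ u ∙ v

  ∙-+ʳ : ∀ (h u v : 𝕍 d) → h ∙ (u +ᵛ v) ≡ h ∙ u ⊕ h ∙ v
  ∙-+ʳ [] [] [] = sym (⊕-identityˡ 𝟘)
  ∙-+ʳ (a ∷ h) (x ∷ u) (y ∷ v) = trans (cong (a ⊗ (x ⊕ y) ⊕_) (∙-+ʳ h u v))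
    (ring-solve 5 (λ a x y p r → a :* (x :+ y) :+ (p :+ r) := a :* x :+ p :+ (a :* y :+ r)) refl a x y _ _)

  ∙-·ʳ : ∀ a (h v : 𝕍 d) → h ∙ (a · v) ≡ a ⊗ (h ∙ v)
  ∙-·ʳ a [] [] = sym (⊗-zeroʳ a)
  ∙-·ʳ a (b ∷ h) (x ∷ v) = trans (cong (b ⊗ (a ⊗ x) ⊕_) (∙-·ʳ a h v))
    (ring-solve 4 (λ a b x p → b :* (a :* x) :+ a :* p := a :* (b :* x :+ p)) refl a b x _)

  ∙-comm : ∀ (u v : 𝕍 d) → u ∙ v ≡ v ∙ u
  ∙-comm [] [] = refl
  ∙-comm (x ∷ u) (y ∷ v) = cong₂ _⊕_ (⊗-comm x y) (∙-comm u v)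

  ∙-+ˡ : ∀ (u v h : 𝕍 d) → (u +ᵛ v) ∙ h ≡ u ∙ h ⊕ v ∙ h
  ∙-+ˡ u v h = trans (∙-comm _ h) (trans (∙-+ʳ h u v) (cong₂ _⊕_ (∙-comm h u) (∙-comm h v)))

  ∙-·ˡ : ∀ a (v h : 𝕍 d) → (a · v) ∙ h ≡ a ⊗ (v ∙ h)
  ∙-·ˡ a v h = trans (∙-comm _ h) (trans (∙-·ʳ a h v) (cong (a ⊗_) (∙-comm h v)))

  ∙-0ˡ : ∀ (h : 𝕍 d) → 0ᵛ ∙ h ≡ 𝟘
  ∙-0ˡ [] = refl
  ∙-0ˡ (x ∷ h) = trans (cong₂ _⊕_ (⊗-zeroˡ x) (∙-0ˡ h)) (⊕-identityˡ 𝟘)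

  ∙-0ʳ : ∀ (h : 𝕍 d) → h ∙ 0ᵛ ≡ 𝟘
  ∙-0ʳ h = trans (∙-comm h 0ᵛ) (∙-0ˡ h)

  +ᵛ-comm : ∀ (u v : 𝕍 d) → u +ᵛ v ≡ v +ᵛ u
  +ᵛ-comm [] [] = refl
  +ᵛ-comm (x ∷ u) (y ∷ v) = cong₂ _∷_ (⊕-comm x y) (+ᵛ-comm u v)

  +ᵛ-assoc : ∀ (u v w : 𝕍 d) → u +ᵛ v +ᵛ w ≡ u +ᵛ (v +ᵛ w)
  +ᵛ-assoc [] [] [] = refl
  +ᵛ-assoc (x ∷ u) (y ∷ v) (z ∷ w) = cong₂ _∷_ (⊕-assoc x y z) (+ᵛ-assoc u v w)

  +ᵛ-identityˡ : ∀ (v : 𝕍 d) → 0ᵛ +ᵛ v ≡ v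
  +ᵛ-identityˡ [] = refl
  +ᵛ-identityˡ (x ∷ v) = cong₂ _∷_ (⊕-identityˡ x) (+ᵛ-identityˡ v)

  +ᵛ-identityʳ : ∀ (v : 𝕍 d) → v +ᵛ 0ᵛ ≡ v
  +ᵛ-identityʳ v = trans (+ᵛ-comm v 0ᵛ) (+ᵛ-identityˡ v)

  ·-zeroˡ : ∀ (v : 𝕍 d) → 𝟘 · v ≡ 0ᵛ
  ·-zeroˡ [] = refl
  ·-zeroˡ (x ∷ v) = cong₂ _∷_ (⊗-zeroˡ x) (·-zeroˡ v)

  ·-zeroʳ : ∀ a → a · 0ᵛ {d} ≡ 0ᵛ
  ·-zeroʳ {zero} a = refl
  ·-zeroʳ {suc d} a = cong₂ _∷_ (⊗-zeroʳ a) (·-zeroʳ a)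

  ·-identity : ∀ (v : 𝕍 d) → 𝟙 · v ≡ v
  ·-identity [] = refl
  ·-identity (x ∷ v) = cong₂ _∷_ (⊗-identityˡ x) (·-identity v)

  ·-assoc : ∀ a b (v : 𝕍 d) → a · b · v ≡ (a ⊗ b) · v
  ·-assoc a b [] = refl
  ·-assoc a b (x ∷ v) = cong₂ _∷_ (sym (⊗-assoc a b x)) (·-assoc a b v)

  ·-distribˡ : ∀ a (u v : 𝕍 d) → a · (u +ᵛ v) ≡ a · u +ᵛ a · v
  ·-distribˡ a [] [] = refl
  ·-distribˡ a (x ∷ u) (y ∷ v) = cong₂ _∷_ (⊗-distribˡ a x y) (·-distribˡ a u v)

  ·-distribʳ : ∀ a b (v : 𝕍 d) → (a ⊕ b) · v ≡ a · v +ᵛ b · v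
  ·-distribʳ a b [] = refl
  ·-distribʳ a b (x ∷ v) = cong₂ _∷_ (⊗-distribʳ x a b) (·-distribʳ a b v)

  ·-inverse : ∀ a (v : 𝕍 d) → a · v +ᵛ (⊖ a) · v ≡ 0ᵛ
  ·-inverse a v = trans (sym (·-distribʳ a (⊖ a) v)) (trans (cong (_· v) (⊖-inverseʳ a)) (·-zeroˡ v))

  +ᵛ-interchange : ∀ (a b c e : 𝕍 d) → a +ᵛ b +ᵛ (c +ᵛ e) ≡ a +ᵛ c +ᵛ (b +ᵛ e)
  +ᵛ-interchange a b c e = trans (+ᵛ-assoc a b (c +ᵛ e)) (trans (cong (a +ᵛ_)
    (trans (sym (+ᵛ-assoc b c e)) (trans (cong (_+ᵛ e) (+ᵛ-comm b c)) (+ᵛ-assoc c b e)))) (sym (+ᵛ-assoc a c (b +ᵛ e))))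

  eqᵛ : 𝕍 d → 𝕍 d → Bool
  eqᵛ []      []      = true
  eqᵛ (x ∷ u) (y ∷ v) = (x == y) ∧ eqᵛ u v

  eqᵛ-sound : ∀ {u v : 𝕍 d} → eqᵛ u v ≡ true → u ≡ v
  eqᵛ-sound {u = []} {[]} e = refl
  eqᵛ-sound {u = x ∷ u} {y ∷ v} e with ∧-true {x == y} e
  ... | p , r = cong₂ _∷_ (==-sound p) (eqᵛ-sound r)

  eqᵛ-refl : ∀ (u : 𝕍 d) → eqᵛ u u ≡ true
  eqᵛ-refl []      = refl
  eqᵛ-refl (x ∷ u) = ∧-intro (==-refl x) (eqᵛ-refl u)

  eqᵛ-complete : ∀ {u v : 𝕍 d} → u ≡ v → eqᵛ u v ≡ true
  eqᵛ-complete {u = u} refl = eqᵛ-refl u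

  infix 4 _≟ᵛ_
  _≟ᵛ_ : (u v : 𝕍 d) → Dec (u ≡ v)
  u ≟ᵛ v with true? (eqᵛ u v)
  ... | inj₁ e = yes (eqᵛ-sound e)
  ... | inj₂ e = no (false≢true e ∘ eqᵛ-complete)

  vecs : ∀ d → List (𝕍 d)
  vecs d = tuples Fs d

  ∈-vecs : ∀ (v : 𝕍 d) → v ∈ vecs d
  ∈-vecs = ∈-tuples ∈-Fs

  length-vecs : ∀ d → length (vecs d) ≡ q ^ d
  length-vecs d = trans (tuples-length Fs d) (cong (_^ d) length-Fs)

  ∑-vecs-1 : ∀ d → ∑ (vecs d) (λ _ → 1) ≡ q ^ d
  ∑-vecs-1 d = trans (∑-1 (vecs d)) (length-vecs d)

  ∑-Fs-const : ∀ c → ∑ Fs (λ _ → c) ≡ q * c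
  ∑-Fs-const c = trans (∑-const Fs c) (cong (_* c) length-Fs)

  ∑-vecs-δ : ∀ (w : 𝕍 d) → ∑ (vecs d) (λ v → ⟦ eqᵛ v w ⟧) ≡ 1
  ∑-vecs-δ [] = refl
  ∑-vecs-δ {suc d} (y ∷ w) = begin
    ∑ (vecs (suc d)) (λ v → ⟦ eqᵛ v (y ∷ w) ⟧) ≡⟨ ∑-tuples Fs d _ ⟩
    ∑ Fs (λ x → ∑ (vecs d) (λ v → ⟦ (x == y) ∧ eqᵛ v w ⟧)) ≡⟨ ∑-cong Fs (λ x → trans (∑-cong (vecs d) (λ v → ⟦⟧-∧ (x == y) _)) (∑-*ˡ (vecs d) ⟦ x == y ⟧ _)) ⟩
    ∑ Fs (λ x → ⟦ x == y ⟧ * ∑ (vecs d) (λ v → ⟦ eqᵛ v w ⟧)) ≡⟨ ∑-cong Fs (λ x → trans (cong (⟦ x == y ⟧ *_) (∑-vecs-δ w)) (*-identityʳ _)) ⟩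
    ∑ Fs (λ x → ⟦ x == y ⟧) ≡⟨ ∑-Fs-δ y ⟩
    1 ∎
    where open ≡-Reasoning

  ∷-≢0 : ∀ {v : 𝕍 d} → 𝟘 ∷ v ≢ 0ᵛ → v ≢ 0ᵛ
  ∷-≢0 n refl = n refl

  -- The count is `q^(d-1)`; the factor `q` avoids the predecessor of `d`.
  ∑-vecs-affine : ∀ (y : 𝕍 d) c → y ≢ 0ᵛ → ∑ (vecs d) (λ h → ⟦ h ∙ y ⊕ c == 𝟘 ⟧) * q ≡ q ^ d
  ∑-vecs-affine [] c n = ⊥-elim (n refl)
  ∑-vecs-affine {suc d} (y ∷ ys) c n with y ≟ᶠ 𝟘
  ... | no y≢0 = trans (cong (_* q) (trans (∑-tuples Fs d _) (trans (∑-swap Fs (vecs d) _)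
        (trans (∑-cong (vecs d) λ h → trans (∑-cong Fs λ x → cong (λ z → ⟦ z == 𝟘 ⟧)
            (ring-solve 4 (λ x y h c → x :* y :+ h :+ c := y :* x :+ (h :+ c)) refl x y (h ∙ ys) c))
          (∑-Fs-affine y (h ∙ ys ⊕ c) y≢0)) (∑-vecs-1 d))))) (*-comm (q ^ d) q)
  ... | yes refl = trans (cong (_* q) (trans (∑-tuples Fs d _) (trans (∑-cong Fs λ x → ∑-cong (vecs d) λ h →
          cong (λ z → ⟦ z ⊕ c == 𝟘 ⟧) (trans (cong (_⊕ h ∙ ys) (⊗-zeroʳ x)) (⊕-identityˡ _))) (∑-Fs-const _))))
        (trans (*-assoc q _ q) (cong (q *_) (∑-vecs-affine ys c (∷-≢0 n))))

  Indep : 𝕍 d → 𝕍 d → Set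
  Indep u v = ∀ a b → a · u +ᵛ b · v ≡ 0ᵛ → a ≡ 𝟘 × b ≡ 𝟘

  Indep-sym : ∀ {u v : 𝕍 d} → Indep u v → Indep v u
  Indep-sym i a b e with i b a (trans (+ᵛ-comm _ _) e)
  ... | p , r = r , p

  private
    -- The first equation determines the coordinate at the pivot `p`. Substituting leaves one affine
    -- equation for the other coordinates, whose coefficient vector `r` is nonzero by independence.
    pairs-pivot : ∀ p p′ (u u′ : 𝕍 d) c c′ → p ≢ 𝟘 → Indep (p ∷ u) (p′ ∷ u′) →
      ∑ (vecs (suc d)) (λ h → ⟦ (h ∙ (p ∷ u) ⊕ c == 𝟘) ∧ (h ∙ (p′ ∷ u′) ⊕ c′ == 𝟘) ⟧) * (q * q) ≡ q ^ suc d
    pairs-pivot {d} p p′ u u′ c c′ p≢0 ind with inverse p p≢0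
    ... | p⁻¹ , pp⁻¹ = begin
      ∑ (vecs (suc d)) _ * (q * q) ≡⟨ cong (_* (q * q)) (trans (∑-tuples Fs d _) (trans (∑-swap Fs (vecs d) _) (∑-cong (vecs d) eliminate))) ⟩
      ∑ (vecs d) (λ h → ⟦ h ∙ r ⊕ e == 𝟘 ⟧) * (q * q) ≡⟨ trans (sym (*-assoc (∑ (vecs d) (λ h → ⟦ h ∙ r ⊕ e == 𝟘 ⟧)) q q)) (cong (_* q) (∑-vecs-affine r e r≢0)) ⟩
      q ^ d * q ≡⟨ *-comm (q ^ d) q ⟩
      q ^ suc d ∎
      where
      open ≡-Reasoning
      s = ⊖ (p′ ⊗ p⁻¹)
      r = u′ +ᵛ s · u
      e = c′ ⊕ s ⊗ c
      sp : s ⊗ p ≡ ⊖ p′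
      sp = trans (ring-solve 3 (λ a b c → :- (a :* b) :* c := :- (a :* (c :* b))) refl p′ p⁻¹ p)
        (cong ⊖_ (trans (cong (p′ ⊗_) pp⁻¹) (⊗-identityʳ p′)))
      r≢0 : r ≢ 0ᵛ
      r≢0 z = 1≢0 (proj₂ (ind s 𝟙 (cong₂ _∷_ (trans (cong₂ _⊕_ sp (⊗-identityˡ p′)) (⊖-inverseˡ p′))
        (trans (cong (s · u +ᵛ_) (·-identity u′)) (trans (+ᵛ-comm _ _) z)))))
      same : ∀ x (h : 𝕍 d) → x ⊗ p ⊕ h ∙ u ⊕ c ≡ 𝟘 → x ⊗ p′ ⊕ h ∙ u′ ⊕ c′ ≡ h ∙ r ⊕ e
      same x h z = sym (begin
        h ∙ r ⊕ e ≡⟨ cong (_⊕ e) (trans (∙-+ʳ h u′ (s · u)) (cong (h ∙ u′ ⊕_) (∙-·ʳ s h u))) ⟩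
        h ∙ u′ ⊕ s ⊗ (h ∙ u) ⊕ (c′ ⊕ s ⊗ c) ≡⟨ ring-solve 7 (λ s x p u u′ c c′ → u′ :+ s :* u :+ (c′ :+ s :* c) := s :* (x :* p :+ u :+ c) :+ :- (x :* (s :* p)) :+ u′ :+ c′) refl s x p (h ∙ u) (h ∙ u′) c c′ ⟩
        s ⊗ (x ⊗ p ⊕ h ∙ u ⊕ c) ⊕ ⊖ (x ⊗ (s ⊗ p)) ⊕ h ∙ u′ ⊕ c′ ≡⟨ cong₂ (λ a b → a ⊕ ⊖ (x ⊗ b) ⊕ h ∙ u′ ⊕ c′) (trans (cong (s ⊗_) z) (⊗-zeroʳ s)) sp ⟩
        𝟘 ⊕ ⊖ (x ⊗ ⊖ p′) ⊕ h ∙ u′ ⊕ c′ ≡⟨ cong (λ a → a ⊕ h ∙ u′ ⊕ c′) (trans (⊕-identityˡ _) (ring-solve 2 (λ x p → :- (x :* :- p) := x :* p) refl x p′)) ⟩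
        x ⊗ p′ ⊕ h ∙ u′ ⊕ c′ ∎)
      eliminate : ∀ h → ∑ Fs (λ x → ⟦ (x ⊗ p ⊕ h ∙ u ⊕ c == 𝟘) ∧ (x ⊗ p′ ⊕ h ∙ u′ ⊕ c′ == 𝟘) ⟧) ≡ ⟦ h ∙ r ⊕ e == 𝟘 ⟧
      eliminate h = begin
        ∑ Fs (λ x → ⟦ (x ⊗ p ⊕ h ∙ u ⊕ c == 𝟘) ∧ (x ⊗ p′ ⊕ h ∙ u′ ⊕ c′ == 𝟘) ⟧) ≡⟨ ∑-cong Fs replace ⟩
        ∑ Fs (λ x → ⟦ p ⊗ x ⊕ (h ∙ u ⊕ c) == 𝟘 ⟧ * ⟦ h ∙ r ⊕ e == 𝟘 ⟧) ≡⟨ ∑-*ʳ Fs ⟦ h ∙ r ⊕ e == 𝟘 ⟧ _ ⟩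
        ∑ Fs (λ x → ⟦ p ⊗ x ⊕ (h ∙ u ⊕ c) == 𝟘 ⟧) * ⟦ h ∙ r ⊕ e == 𝟘 ⟧ ≡⟨ trans (cong (_* ⟦ h ∙ r ⊕ e == 𝟘 ⟧) (∑-Fs-affine p (h ∙ u ⊕ c) p≢0)) (+-identityʳ _) ⟩
        ⟦ h ∙ r ⊕ e == 𝟘 ⟧ ∎
        where
        replace : ∀ x → ⟦ (x ⊗ p ⊕ h ∙ u ⊕ c == 𝟘) ∧ (x ⊗ p′ ⊕ h ∙ u′ ⊕ c′ == 𝟘) ⟧ ≡ ⟦ p ⊗ x ⊕ (h ∙ u ⊕ c) == 𝟘 ⟧ * ⟦ h ∙ r ⊕ e == 𝟘 ⟧
        replace x = ⟦⟧-guard (cong (_== 𝟘) (ring-solve 4 (λ x p u c → x :* p :+ u :+ c := p :* x :+ (u :+ c)) refl x p (h ∙ u) c))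
          (λ z → cong (_== 𝟘) (same x h (==-sound z)))

  -- Two independent vectors take independent uniform values under a random functional.
  ∑-vecs-pair : ∀ (u v : 𝕍 d) c c′ → Indep u v →
    ∑ (vecs d) (λ h → ⟦ (h ∙ u ⊕ c == 𝟘) ∧ (h ∙ v ⊕ c′ == 𝟘) ⟧) * (q * q) ≡ q ^ d
  ∑-vecs-pair [] [] c c′ ind = ⊥-elim (1≢0 (proj₁ (ind 𝟙 𝟙 refl)))
  ∑-vecs-pair {suc d} (p ∷ u) (p′ ∷ u′) c c′ ind with p ≟ᶠ 𝟘 | p′ ≟ᶠ 𝟘
  ... | no p≢0 | _ = pairs-pivot p p′ u u′ c c′ p≢0 ind
  ... | yes _ | no p′≢0 = trans (cong (_* (q * q)) (∑-cong (vecs (suc d)) (λ h → cong ⟦_⟧ (Data.Bool.Properties.∧-comm (h ∙ (p ∷ u) ⊕ c == 𝟘) _))))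
        (pairs-pivot p′ p u′ u c′ c p′≢0 (Indep-sym ind))
    where import Data.Bool.Properties
  ... | yes refl | yes refl = trans (cong (_* (q * q)) (trans (∑-tuples Fs d _) (trans (∑-cong Fs λ x → ∑-cong (vecs d) λ h →
            cong₂ (λ y z → ⟦ (y ⊕ c == 𝟘) ∧ (z ⊕ c′ == 𝟘) ⟧) (drop x _) (drop x _)) (∑-Fs-const _))))
          (trans (*-assoc q _ _) (cong (q *_) (∑-vecs-pair u u′ c c′ ind′)))
    where
    drop : ∀ x y → x ⊗ 𝟘 ⊕ y ≡ y
    drop x y = trans (cong (_⊕ y) (⊗-zeroʳ x)) (⊕-identityˡ y)
    ind′ : Indep u u′
    ind′ a b e = ind a b (cong₂ _∷_ (trans (cong₂ _⊕_ (⊗-zeroʳ a) (⊗-zeroʳ b)) (⊕-identityˡ 𝟘)) e)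

  -- Points of the projective space of 𝔽^d: the vectors whose first nonzero coordinate is 1.
  pts : ∀ d → List (𝕍 d)
  pts zero    = []
  pts (suc d) = map (𝟘 ∷_) (pts d) ++ map (𝟙 ∷_) (vecs d)

  data Normal : 𝕍 d → Set where
    pivot : ∀ {v : 𝕍 d} → Normal (𝟙 ∷ v)
    below : ∀ {v : 𝕍 d} → Normal v → Normal (𝟘 ∷ v)

  normal : ∀ {x : 𝕍 d} → x ∈ pts d → Normal x
  normal {suc d} i = go (pts d) (vecs d) (λ _ → normal) i
    where
    go : ∀ L M → (∀ x → x ∈ L → Normal x) → ∀ {x} → x ∈ map (𝟘 ∷_) L ++ map (𝟙 ∷_) M → Normal x
    go [] (y ∷ M) n (here refl) = pivot
    go [] (y ∷ M) n (there i)   = go [] M n i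
    go (y ∷ L) M n (here refl)  = below (n y (here refl))
    go (y ∷ L) M n (there i)    = go L M (λ x → n x ∘ there) i

  ∑-pts : ∀ d f → ∑ (pts (suc d)) f ≡ ∑ (pts d) (λ x → f (𝟘 ∷ x)) + ∑ (vecs d) (λ x → f (𝟙 ∷ x))
  ∑-pts d f = trans (∑-++ (map (𝟘 ∷_) (pts d)) _ f) (cong₂ _+_ (∑-map _ (pts d) f) (∑-map _ (vecs d) f))

  -- Θ m is the number of points of a projective space of dimension m - 1.
  Θ : ℕ → ℕ
  Θ zero    = 0
  Θ (suc m) = Θ m + q ^ m

  ∑-pts-1 : ∀ d → ∑ (pts d) (λ _ → 1) ≡ Θ d
  ∑-pts-1 zero = refl
  ∑-pts-1 (suc d) = trans (∑-pts d _) (cong₂ _+_ (∑-pts-1 d) (∑-vecs-1 d))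

  -- par x z: the vector z is a multiple of the point x.
  par : 𝕍 d → 𝕍 d → Bool
  par []      []      = true
  par (x ∷ u) (z ∷ w) with x == 𝟘
  ... | true  = (z == 𝟘) ∧ par u w
  ... | false = eqᵛ w (z · u)

  par-below : ∀ (u : 𝕍 d) z w → par (𝟘 ∷ u) (z ∷ w) ≡ (z == 𝟘) ∧ par u w
  par-below u z w rewrite ==-refl 𝟘 = refl

  par-pivot : ∀ (u : 𝕍 d) z w → par (𝟙 ∷ u) (z ∷ w) ≡ eqᵛ w (z · u)
  par-pivot u z w rewrite ==-≢ 1≢0 = refl

  par-sound : ∀ {x z : 𝕍 d} → Normal x → par x z ≡ true → ∃[ c ] (z ≡ c · x)
  par-sound {x = _ ∷ u} {z ∷ w} pivot e = z , cong₂ _∷_ (sym (⊗-identityʳ z)) (eqᵛ-sound (trans (sym (par-pivot u z w)) e))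
  par-sound {x = _ ∷ u} {z ∷ w} (below n) e with ∧-true {z == 𝟘} (trans (sym (par-below u z w)) e)
  ... | z0 , p with par-sound n p
  ... | c , r = c , cong₂ _∷_ (trans (==-sound z0) (sym (⊗-zeroʳ c))) r

  par-complete : ∀ {x : 𝕍 d} → Normal x → ∀ c → par x (c · x) ≡ true
  par-complete {x = _ ∷ u} pivot c = trans (par-pivot u _ _) (eqᵛ-complete (cong (_· u) (sym (⊗-identityʳ c))))
  par-complete {x = _ ∷ u} (below n) c = trans (par-below u _ _) (∧-intro (==-complete (⊗-zeroʳ c)) (par-complete n c))

  ∑-par-0 : ∀ d → ∑ (pts d) (λ x → ⟦ par x 0ᵛ ⟧) ≡ Θ d
  ∑-par-0 d = trans (∑-cong-∈ (pts d) (λ x i → cong ⟦_⟧ (trans (cong (par x) (sym (·-zeroˡ x))) (par-complete (normal i) 𝟘)))) (∑-pts-1 d)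

  ∑-par : ∀ (z : 𝕍 d) → z ≢ 0ᵛ → ∑ (pts d) (λ x → ⟦ par x z ⟧) ≡ 1
  ∑-par [] n = ⊥-elim (n refl)
  ∑-par {suc d} (z ∷ w) n with z ≟ᶠ 𝟘
  ... | yes refl = trans (∑-pts d _) (trans (cong₂ _+_
        (trans (∑-cong (pts d) (λ x → cong ⟦_⟧ (trans (par-below x 𝟘 w) (cong (_∧ par x w) (==-refl 𝟘))))) (∑-par w (∷-≢0 n)))
        (∑-none (vecs d) (λ x _ → trans (par-pivot x 𝟘 w) (≢true (λ e → ∷-≢0 n (trans (eqᵛ-sound e) (·-zeroˡ x))))))) refl)
  ... | no z≢0 with inverse z z≢0
  ... | z⁻¹ , zz = trans (∑-pts d _) (cong₂ _+_
        (∑-none (pts d) (λ x _ → trans (par-below x z w) (cong (_∧ par x w) (==-≢ z≢0))))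
        (trans (∑-cong (vecs d) (λ x → cong ⟦_⟧ (trans (par-pivot x z w) (bool-ext (left x) (right x))))) (∑-vecs-δ (z⁻¹ · w))))
    where
    left : ∀ x → eqᵛ w (z · x) ≡ true → eqᵛ x (z⁻¹ · w) ≡ true
    left x e = eqᵛ-complete (sym (trans (cong (z⁻¹ ·_) (eqᵛ-sound e)) (trans (·-assoc z⁻¹ z x) (trans (cong (_· x) (trans (⊗-comm z⁻¹ z) zz)) (·-identity x)))))
    right : ∀ x → eqᵛ x (z⁻¹ · w) ≡ true → eqᵛ w (z · x) ≡ true
    right x e = eqᵛ-complete (sym (trans (cong (z ·_) (eqᵛ-sound e)) (trans (·-assoc z z⁻¹ w) (trans (cong (_· w) zz) (·-identity w)))))

  normal-≢0 : ∀ {x : 𝕍 d} → Normal x → x ≢ 0ᵛ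
  normal-≢0 pivot e = 1≢0 (cong Vec.head e)
  normal-≢0 (below n) e = normal-≢0 n (cong Vec.tail e)

  ·-≢0 : ∀ {a} {v : 𝕍 d} → a · v ≢ 0ᵛ → a ≢ 𝟘
  ·-≢0 {v = v} n refl = n (·-zeroˡ v)

  ·-cancel-0 : ∀ {a} {v : 𝕍 d} → a ≢ 𝟘 → a · v ≡ 0ᵛ → v ≡ 0ᵛ
  ·-cancel-0 {a = a} {v} n e with inverse a n
  ... | b , ab = trans (sym (·-identity v)) (trans (cong (_· v) (sym (trans (⊗-comm b a) ab)))
        (trans (sym (·-assoc b a v)) (trans (cong (b ·_) e) (·-zeroʳ b))))

  normal-unique : ∀ {x y : 𝕍 d} {c} → Normal x → Normal y → y ≡ c · x → y ≡ x
  normal-unique {x = _ ∷ u} {c = c} pivot pivot e = cong (𝟙 ∷_) (trans (cong Vec.tail e)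
    (trans (cong (_· u) (sym (trans (cong Vec.head e) (⊗-identityʳ c)))) (·-identity u)))
  normal-unique (below n) (below n′) e = cong (𝟘 ∷_) (normal-unique n n′ (cong Vec.tail e))
  normal-unique {c = c} (below n) pivot e = ⊥-elim (1≢0 (trans (cong Vec.head e) (⊗-zeroʳ c)))
  normal-unique {x = _ ∷ u} {c = c} pivot (below n) e = ⊥-elim (normal-≢0 n (trans (cong Vec.tail e)
    (trans (cong (_· u) (sym (trans (cong Vec.head e) (⊗-identityʳ c)))) (·-zeroˡ u))))

  par-unique : ∀ {x y : 𝕍 d} {z} → Normal x → Normal y → z ≢ 0ᵛ → par x z ≡ true → par y z ≡ true → x ≡ y
  par-unique {x = x} {y} nx ny z≢0 ex ey with par-sound nx ex | par-sound ny ey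
  ... | a , refl | b , e with inverse a (·-≢0 z≢0)
  ... | a⁻¹ , aa = normal-unique {c = a⁻¹ ⊗ b} ny nx (trans (sym (·-identity x)) (trans (cong (_· x) (sym (trans (⊗-comm a⁻¹ a) aa)))
        (trans (sym (·-assoc a⁻¹ a x)) (trans (cong (a⁻¹ ·_) e) (·-assoc a⁻¹ b y)))))

  normalise : ∀ (z : 𝕍 d) → z ≢ 0ᵛ → ∃[ x ] ∃[ c ] (x ∈ pts d × c ≢ 𝟘 × z ≡ c · x)
  normalise {d} z n with ∑-witness (pts d) {λ x → par x z} (subst (0 <_) (sym (∑-par z n)) (s≤s z≤n))
  ... | x , i , e with par-sound (normal i) e
  ... | c , refl = x , c , i , ·-≢0 n , refl

  distinct-indep : ∀ {x y : 𝕍 d} → Normal x → Normal y → x ≢ y → Indep x y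
  distinct-indep {x = x} {y} nx ny ne a b e with a ≟ᶠ 𝟘
  ... | no a≢0 with inverse a a≢0
  ...   | a⁻¹ , aa = ⊥-elim (ne (normal-unique {c = a⁻¹ ⊗ ⊖ b} ny nx (begin
          x ≡⟨ ·-identity x ⟨
          𝟙 · x ≡⟨ cong (_· x) (trans (⊗-comm a⁻¹ a) aa) ⟨
          (a⁻¹ ⊗ a) · x ≡⟨ ·-assoc a⁻¹ a x ⟨
          a⁻¹ · a · x ≡⟨ cong (a⁻¹ ·_) (+ᵛ-identityʳ (a · x)) ⟨
          a⁻¹ · (a · x +ᵛ 0ᵛ) ≡⟨ cong (λ z → a⁻¹ · (a · x +ᵛ z)) (·-inverse b y) ⟨
          a⁻¹ · (a · x +ᵛ (b · y +ᵛ (⊖ b) · y)) ≡⟨ cong (a⁻¹ ·_) (trans (sym (+ᵛ-assoc _ _ _)) (trans (cong (_+ᵛ (⊖ b) · y) e) (+ᵛ-identityˡ _))) ⟩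
          a⁻¹ · (⊖ b) · y ≡⟨ ·-assoc a⁻¹ (⊖ b) y ⟩
          (a⁻¹ ⊗ ⊖ b) · y ∎)))
    where open ≡-Reasoning
  distinct-indep {x = x} {y} nx ny ne a b e | yes refl with b ≟ᶠ 𝟘
  ... | yes b≡0 = refl , b≡0
  ... | no b≢0 = ⊥-elim (normal-≢0 ny (·-cancel-0 b≢0 (trans (sym (+ᵛ-identityˡ _)) (trans (cong (_+ᵛ b · y) (sym (·-zeroˡ x))) e))))

  ∑-pts-hyperplane : ∀ (c : 𝕍 (suc m)) → c ≢ 0ᵛ → 2 ≤ q → ∑ (pts (suc m)) (λ x → ⟦ c ∙ x == 𝟘 ⟧) ≡ Θ m
  ∑-pts-hyperplane {m} (a ∷ c) n 2≤q with c ≟ᵛ 0ᵛ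
  ... | yes refl = trans (∑-pts m _) (trans (cong₂ _+_
        (trans (∑-cong (pts m) (λ x → cong ⟦_⟧ (==-complete (trans (cong₂ _⊕_ (⊗-zeroʳ a) (∙-0ˡ x)) (⊕-identityˡ 𝟘))))) (∑-pts-1 m))
        (∑-none (vecs m) (λ x _ → ==-≢ (λ e → n (cong (_∷ 0ᵛ) (trans (sym (trans (cong₂ _⊕_ (⊗-identityʳ a) (∙-0ˡ x)) (⊕-identityʳ a))) e)))))) (+-identityʳ _))
  ∑-pts-hyperplane {zero}  (a ∷ []) n 2≤q | no c≢0 = ⊥-elim (c≢0 refl)
  ∑-pts-hyperplane {suc m} (a ∷ c) n 2≤q | no c≢0 = trans (∑-pts (suc m) _) (cong₂ _+_
        (trans (∑-cong (pts (suc m)) (λ x → cong (λ z → ⟦ z == 𝟘 ⟧) (trans (cong (_⊕ c ∙ x) (⊗-zeroʳ a)) (⊕-identityˡ _)))) (∑-pts-hyperplane c c≢0 2≤q))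
        (trans (∑-cong (vecs (suc m)) (λ x → cong (λ z → ⟦ z == 𝟘 ⟧) (trans (⊕-comm _ _) (cong₂ _⊕_ (∙-comm c x) (⊗-identityʳ a))))) vec-count))
    where
    vec-count : ∑ (vecs (suc m)) (λ x → ⟦ x ∙ c ⊕ a == 𝟘 ⟧) ≡ q ^ m
    vec-count = *-cancelʳ-≡ _ _ q {{>-nonZero (≤-trans (s≤s z≤n) 2≤q)}} (trans (∑-vecs-affine c a c≢0) (*-comm q (q ^ m)))

  comb : Vec 𝔽 m → Vec (𝕍 d) m → 𝕍 d
  comb []       []       = 0ᵛ
  comb (a ∷ as) (b ∷ bs) = a · b +ᵛ comb as bs

  Kills : 𝕍 d → Vec (𝕍 d) m → Set
  Kills g []       = ⊤
  Kills g (b ∷ bs) = g ∙ b ≡ 𝟘 × Kills g bs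

  kills-comb : ∀ {g : 𝕍 d} (bs : Vec (𝕍 d) m) as → Kills g bs → g ∙ comb as bs ≡ 𝟘
  kills-comb {g = g} [] [] _ = ∙-0ʳ g
  kills-comb {g = g} (b ∷ bs) (a ∷ as) (z , k) = trans (∙-+ʳ g (a · b) (comb as bs))
    (trans (cong₂ _⊕_ (trans (∙-·ʳ a g b) (trans (cong (a ⊗_) z) (⊗-zeroʳ a))) (kills-comb bs as k)) (⊕-identityˡ 𝟘))

  kills-combine : ∀ {g g′ : 𝕍 d} (bs : Vec (𝕍 d) m) c → Kills g bs → Kills g′ bs → Kills (g′ +ᵛ c · g) bs
  kills-combine [] c _ _ = tt
  kills-combine {g = g} {g′} (b ∷ bs) c (z , k) (z′ , k′) = trans (∙-+ˡ g′ (c · g) b) (trans (cong₂ _⊕_ z′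
    (trans (∙-·ˡ c g b) (trans (cong (c ⊗_) z) (⊗-zeroʳ c)))) (⊕-identityˡ 𝟘)) , kills-combine bs c k k′

  detect : ∀ (x : 𝕍 d) → x ≡ 0ᵛ ⊎ ∃[ g ] (g ∙ x ≢ 𝟘)
  detect [] = inj₁ refl
  detect (x ∷ v) with x ≟ᶠ 𝟘 | detect v
  ... | no x≢0 | _ = inj₂ (𝟙 ∷ 0ᵛ , λ e → x≢0 (trans (sym (trans (cong₂ _⊕_ (⊗-identityˡ x) (∙-0ˡ v)) (⊕-identityʳ x))) e))
  ... | yes refl | inj₁ refl = inj₁ refl
  ... | yes refl | inj₂ (g , n) = inj₂ (𝟘 ∷ g , λ e → n (trans (sym (trans (cong (_⊕ g ∙ v) (⊗-zeroˡ 𝟘)) (⊕-identityˡ _))) e))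

  -- Induction on the list. If `b` depends on the rest it adds nothing. Otherwise a functional `g`
  -- with `g ∙ b` nonzero serves to subtract the `b`-part of `x`, and a functional found for the
  -- reduced vector is corrected by a multiple of `g` so that it vanishes at `b`.
  separate : ∀ (bs : Vec (𝕍 d) m) x → (∃[ as ] (comb as bs ≡ x)) ⊎ (∃[ g ] (Kills g bs × g ∙ x ≢ 𝟘))
  separate [] x with detect x
  ... | inj₁ refl = inj₁ ([] , refl)
  ... | inj₂ (g , n) = inj₂ (g , tt , n)
  separate (b ∷ bs) x with separate bs b
  ... | inj₁ (as , refl) with separate bs x
  ...   | inj₁ (cs , refl) = inj₁ (𝟘 ∷ cs , trans (cong (_+ᵛ comb cs bs) (·-zeroˡ _)) (+ᵛ-identityˡ _))
  ...   | inj₂ (g , k , n) = inj₂ (g , (kills-comb bs as k , k) , n)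
  separate (b ∷ bs) x | inj₂ (g , k , gb≢0) with inverse (g ∙ b) gb≢0
  ... | w , gbw with separate bs (x +ᵛ (⊖ (w ⊗ g ∙ x)) · b)
  ...   | inj₁ (cs , e) = inj₁ (w ⊗ g ∙ x ∷ cs , trans (cong ((w ⊗ g ∙ x) · b +ᵛ_) e)
          (trans (cong ((w ⊗ g ∙ x) · b +ᵛ_) (+ᵛ-comm x _)) (trans (sym (+ᵛ-assoc _ _ _)) (trans (cong (_+ᵛ x) (·-inverse (w ⊗ g ∙ x) b)) (+ᵛ-identityˡ x)))))
  ...   | inj₂ (g′ , k′ , n) = inj₂ (g″ , (g″b , kills-combine bs (⊖ e) k k′) , λ z → n (trans (sym value) z))
    where
    e = g′ ∙ b ⊗ w
    g″ = g′ +ᵛ (⊖ e) · g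
    g″b : g″ ∙ b ≡ 𝟘
    g″b = trans (∙-+ˡ g′ ((⊖ e) · g) b) (trans (cong (g′ ∙ b ⊕_) (∙-·ˡ (⊖ e) g b))
      (trans (ring-solve 3 (λ p w g → p :+ (:- (p :* w)) :* g := p :- p :* (g :* w)) refl (g′ ∙ b) w (g ∙ b))
        (trans (cong (λ z → g′ ∙ b ⊕ ⊖ (g′ ∙ b ⊗ z)) gbw) (trans (cong (λ z → g′ ∙ b ⊕ ⊖ z) (⊗-identityʳ _)) (⊖-inverseʳ _)))))
    value : g″ ∙ x ≡ g′ ∙ (x +ᵛ (⊖ (w ⊗ g ∙ x)) · b)
    value = trans (trans (∙-+ˡ g′ ((⊖ e) · g) x) (cong (g′ ∙ x ⊕_) (∙-·ˡ (⊖ e) g x)))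
      (trans (ring-solve 4 (λ p b w g → p :+ (:- (b :* w)) :* g := p :+ (:- (w :* g)) :* b) refl (g′ ∙ x) (g′ ∙ b) w (g ∙ x))
        (sym (trans (∙-+ʳ g′ x _) (cong (g′ ∙ x ⊕_) (∙-·ʳ _ g′ b)))))

-- Sets of projective points and their hyperplane sections.

module PointSets {q : ℕ} (F : FiniteField q) (d : ℕ) where
  open Field F
  open Vectors F hiding (d)
  open Lacunary F using (2≤q; 1≤q)

  V : Set
  V = 𝕍 d

  -- A decidable set of points given on homogeneous coordinates. Whether the zero vector belongs to
  -- it is immaterial, as `size` runs over normalised points.
  record PSet : Set where
    field
      mem : V → Bool
      inv : ∀ a v → a ≢ 𝟘 → mem (a · v) ≡ mem v
  open PSet public

  infix 4 _∈ˢ_ _⊆_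
  _∈ˢ_ : V → PSet → Set
  v ∈ˢ β = mem β v ≡ true

  _⊆_ : PSet → PSet → Set
  β ⊆ γ = ∀ v → v ∈ˢ β → v ∈ˢ γ

  ∈-scale : ∀ β {a v} → a ≢ 𝟘 → v ∈ˢ β → a · v ∈ˢ β
  ∈-scale β a≢0 e = trans (inv β _ _ a≢0) e

  infixl 7 _∩_
  _∩_ : PSet → PSet → PSet
  mem (β ∩ γ) v = mem β v ∧ mem γ v
  inv (β ∩ γ) a v n = cong₂ _∧_ (inv β a v n) (inv γ a v n)

  infix 8 ∁_
  ∁_ : PSet → PSet
  mem (∁ β) v = not (mem β v)
  inv (∁ β) a v n = cong not (inv β a v n)

  hyp : V → PSet
  mem (hyp h) v = h ∙ v == 𝟘
  inv (hyp h) a v n = bool-ext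
    (λ e → ==-complete (⊗-integral (trans (sym (∙-·ʳ a h v)) (==-sound e)) n))
    (λ e → ==-complete (trans (∙-·ʳ a h v) (trans (cong (a ⊗_) (==-sound e)) (⊗-zeroʳ a))))

  -- Dependent functionals are allowed. They give a larger kernel, so a condition on all kernels of
  -- `k` functionals concerns all subspaces of codimension at most `k`.
  ker : Vec V k → PSet
  mem (ker []) v = true
  mem (ker (h ∷ φ)) v = (h ∙ v == 𝟘) ∧ mem (ker φ) v
  inv (ker []) a v n = refl
  inv (ker (h ∷ φ)) a v n = cong₂ _∧_ (inv (hyp h) a v n) (inv (ker φ) a v n)

  point : ∀ {T : V} → Normal T → PSet
  mem (point {T} n) v = par T v
  inv (point {T} nT) a v n = bool-ext from (λ e → to a v (par-sound nT e))
    where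
    to : ∀ b w → ∃[ c ] (w ≡ c · T) → par T (b · w) ≡ true
    to b w (c , refl) = subst (λ z → par T z ≡ true) (sym (·-assoc b c T)) (par-complete nT (b ⊗ c))
    from : par T (a · v) ≡ true → par T v ≡ true
    from e with inverse a n
    ... | b , ab = subst (λ z → par T z ≡ true) (trans (·-assoc b a v) (trans (cong (_· v) (trans (⊗-comm b a) ab)) (·-identity v)))
                     (to b (a · v) (par-sound nT e))

  size : PSet → ℕ
  size β = ∑ (pts d) (λ v → ⟦ mem β v ⟧)

  size-cong : ∀ {β γ} → (∀ v → mem β v ≡ mem γ v) → size β ≡ size γ
  size-cong e = ∑-cong (pts d) (λ v → cong ⟦_⟧ (e v))

  size-⊆ : ∀ {β γ} → (∀ v → v ∈ pts d → v ∈ˢ β → v ∈ˢ γ) → size β ≤ size γ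
  size-⊆ f = ∑-mono-∈ (pts d) (λ v i → ⟦⟧-mono (f v i))

  size-split : ∀ β γ → size β ≡ size (β ∩ γ) + size (β ∩ ∁ γ)
  size-split β γ = trans (∑-cong (pts d) (λ v → split (mem β v) (mem γ v))) (∑-+ (pts d) _ _)
    where
    split : ∀ a b → ⟦ a ⟧ ≡ ⟦ a ∧ b ⟧ + ⟦ a ∧ not b ⟧
    split true true   = refl
    split true false  = refl
    split false _     = refl

  size-∩≤ : ∀ β γ → size (β ∩ γ) ≤ size β
  size-∩≤ β γ = size-⊆ {β ∩ γ} {β} (λ v _ e → proj₁ (∧-true e))

  size-∩≤ʳ : ∀ β γ → size (β ∩ γ) ≤ size γ
  size-∩≤ʳ β γ = size-⊆ {β ∩ γ} {γ} (λ v _ e → proj₂ (∧-true e))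

  ∩-mono : ∀ {β β′ γ} → β ⊆ β′ → size (β ∩ γ) ≤ size (β′ ∩ γ)
  ∩-mono {β} {β′} {γ} s = size-⊆ {β ∩ γ} {β′ ∩ γ} (λ v _ e → ∧-intro (s v (proj₁ (∧-true e))) (proj₂ (∧-true e)))

  1≤size : ∀ β {P} → P ∈ pts d → P ∈ˢ β → 1 ≤ size β
  1≤size β i e = ≤-trans (≤-reflexive (cong ⟦_⟧ (sym e))) (∑-∈ (λ v → ⟦ mem β v ⟧) i)

  1≤size′ : ∀ β {v} → v ≢ 0ᵛ → v ∈ˢ β → 1 ≤ size β
  1≤size′ β {v} n e with normalise v n
  ... | x , c , i , c≢0 , refl = 1≤size β i (trans (sym (inv β c x c≢0)) e)

  inhabitant : ∀ β → 1 ≤ size β → ∃[ P ] (P ∈ pts d × P ∈ˢ β)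
  inhabitant β le = ∑-witness (pts d) {mem β} le

  par-≡ : ∀ {x y : V} → Normal x → Normal y → par x y ≡ true → y ≡ x
  par-≡ nx ny e with par-sound nx e
  ... | c , r = normal-unique {c = c} nx ny r

  par-refl : ∀ {x : V} → Normal x → par x x ≡ true
  par-refl {x} n = subst (λ z → par x z ≡ true) (·-identity x) (par-complete n 𝟙)

  size-point : ∀ {P} (i : P ∈ pts d) → size (point (normal i)) ≡ 1
  size-point {P} i = trans (∑-cong-∈ (pts d) (λ v j → cong ⟦_⟧ (bool-ext
      (λ e → subst (λ z → par v z ≡ true) (par-≡ (normal i) (normal j) e) (par-refl (normal j)))
      (λ e → subst (λ z → par P z ≡ true) (par-≡ (normal j) (normal i) e) (par-refl (normal i))))))
    (∑-par P (normal-≢0 (normal i)))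

  remove : PSet → ∀ {P} → P ∈ pts d → PSet
  remove β i = β ∩ ∁ point (normal i)

  ∈-remove : ∀ β {P v} (i : P ∈ pts d) → v ∈ pts d → v ∈ˢ β → v ≢ P → v ∈ˢ remove β i
  ∈-remove β i j e n = ∧-intro e (not-false (≢true (λ p → n (par-≡ (normal i) (normal j) p))))

  remove-≢ : ∀ β {P v} (i : P ∈ pts d) → v ∈ˢ remove β i → v ≢ P
  remove-≢ β {P} i e refl = false≢true (not-true (proj₂ (∧-true {mem β P} e))) (par-refl (normal i))

  size-remove≤ : ∀ β {P} (i : P ∈ pts d) → size β ≤ suc (size (remove β i))
  size-remove≤ β i = ≤-trans (≤-reflexive (size-split β (point (normal i))))
    (+-monoˡ-≤ (size (remove β i)) (≤-trans (size-∩≤ʳ β (point (normal i))) (≤-reflexive (size-point i))))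

  size-remove : ∀ β {P} (i : P ∈ pts d) → P ∈ˢ β → size β ≡ suc (size (remove β i))
  size-remove β {P} i e = trans (size-split β (point (normal i))) (cong (_+ size (remove β i))
    (trans (∑-cong-∈ (pts d) same) (size-point i)))
    where
    same : ∀ v → v ∈ pts d → ⟦ mem β v ∧ par P v ⟧ ≡ ⟦ par P v ⟧
    same v j = cong ⟦_⟧ (bool-ext (λ p → proj₂ (∧-true {mem β v} p))
      (λ p → ∧-intro (subst (_∈ˢ β) (sym (par-≡ (normal i) (normal j) p)) e) p))

  second : ∀ β {P} → P ∈ pts d → 2 ≤ size β → ∃[ R ] (R ∈ pts d × R ∈ˢ β × R ≢ P)
  second β i le with inhabitant (remove β i) (s≤s⁻¹ (≤-trans le (size-remove≤ β i)))
  ... | R , j , e = R , j , proj₁ (∧-true e) , remove-≢ β i e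

  size≤1-unique : ∀ β {P R} → size β ≤ 1 → P ∈ pts d → R ∈ pts d → P ∈ˢ β → R ∈ˢ β → P ≡ R
  size≤1-unique β {P} {R} le i j p r with P ≟ᵛ R
  ... | yes e = e
  ... | no n = ⊥-elim (1+n≰n (≤-trans (s≤s (1≤size (remove β j) i (∈-remove β j i p n)))
                 (≤-trans (≤-reflexive (sym (size-remove β j r))) le)))

  size≤2-unique : ∀ β {P R S} → size β ≤ 2 → P ∈ pts d → R ∈ pts d → S ∈ pts d → P ∈ˢ β → R ∈ˢ β → S ∈ˢ β →
    R ≢ P → S ≢ P → R ≡ S
  size≤2-unique β le i j k p r s rp sp = size≤1-unique (remove β i) (s≤s⁻¹ (≤-trans (≤-reflexive (sym (size-remove β i p))) le))
    j k (∈-remove β i j r rp) (∈-remove β i k s sp)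

  pencil-∙ : ∀ (g h : V) x v → (g +ᵛ x · h) ∙ v ≡ h ∙ v ⊗ x ⊕ g ∙ v
  pencil-∙ g h x v = trans (∙-+ˡ g (x · h) v) (trans (⊕-comm _ _) (cong (_⊕ g ∙ v) (trans (∙-·ˡ x h v) (⊗-comm x _))))

  -- The `q + 1` hyperplanes of a pencil cover each point off the axis once and each point of the
  -- axis `q + 1` times.
  pencil : ∀ β g h → size (β ∩ hyp h) + ∑ Fs (λ x → size (β ∩ hyp (g +ᵛ x · h))) ≡ size β + q * size (β ∩ hyp h ∩ hyp g)
  pencil β g h = begin
    size (β ∩ hyp h) + ∑ Fs (λ x → size (β ∩ hyp (g +ᵛ x · h))) ≡⟨ cong (size (β ∩ hyp h) +_) (∑-swap Fs (pts d) _) ⟩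
    size (β ∩ hyp h) + ∑ (pts d) (λ v → ∑ Fs (λ x → ⟦ mem (β ∩ hyp (g +ᵛ x · h)) v ⟧)) ≡⟨ ∑-+ (pts d) _ _ ⟨
    ∑ (pts d) (λ v → ⟦ mem (β ∩ hyp h) v ⟧ + ∑ Fs (λ x → ⟦ mem (β ∩ hyp (g +ᵛ x · h)) v ⟧)) ≡⟨ ∑-cong (pts d) pointwise ⟩
    ∑ (pts d) (λ v → ⟦ mem β v ⟧ + q * ⟦ mem (β ∩ hyp h ∩ hyp g) v ⟧) ≡⟨ trans (∑-+ (pts d) _ _) (cong (size β +_) (∑-*ˡ (pts d) q _)) ⟩
    size β + q * size (β ∩ hyp h ∩ hyp g) ∎
    where
    open ≡-Reasoning
    inner : ∀ a b → ⟦ a == 𝟘 ⟧ + ∑ Fs (λ x → ⟦ a ⊗ x ⊕ b == 𝟘 ⟧) ≡ 1 + q * ⟦ (a == 𝟘) ∧ (b == 𝟘) ⟧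
    inner a b with a ≟ᶠ 𝟘
    ... | no a≢0 rewrite ==-≢ a≢0 = trans (∑-Fs-affine a b a≢0) (sym (trans (cong suc (*-zeroʳ q)) refl))
    ... | yes refl rewrite ==-refl 𝟘 with b ≟ᶠ 𝟘
    ...   | no b≢0 rewrite ==-≢ b≢0 = trans (cong suc (∑-Fs-affine-0 b b≢0)) (cong suc (sym (*-zeroʳ q)))
    ...   | yes refl rewrite ==-refl 𝟘 = cong suc (trans (∑-cong Fs (λ x → cong ⟦_⟧ (==-complete (trans (⊕-identityʳ _) (⊗-zeroˡ x)))))
              (∑-Fs-const 1))
    pointwise : ∀ v → ⟦ mem (β ∩ hyp h) v ⟧ + ∑ Fs (λ x → ⟦ mem (β ∩ hyp (g +ᵛ x · h)) v ⟧) ≡ ⟦ mem β v ⟧ + q * ⟦ mem (β ∩ hyp h ∩ hyp g) v ⟧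
    pointwise v with mem β v
    ... | false = trans (∑-0 Fs) (sym (*-zeroʳ q))
    ... | true  = trans (cong (⟦ h ∙ v == 𝟘 ⟧ +_) (∑-cong Fs (λ x → cong (λ z → ⟦ z == 𝟘 ⟧) (pencil-∙ g h x v)))) (inner (h ∙ v) (g ∙ v))

  functional-at : ∀ {P R : V} → Indep P R → ∃[ h ] (h ∙ P ≡ 𝟘 × h ∙ R ≢ 𝟘)
  functional-at {P} {R} ind with separate (P ∷ []) R
  ... | inj₂ (g , (z , _) , n) = g , z , n
  ... | inj₁ (a ∷ [] , e) = ⊥-elim (1≢0 (trans (ring-solve 1 (λ a → a := :- (:- a)) refl 𝟙) (trans (cong ⊖_ (proj₂ (ind a (⊖ 𝟙)
        (trans (cong (λ z → a · P +ᵛ (⊖ 𝟙) · z) (sym (trans (sym (+ᵛ-identityʳ (a · P))) e)))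
          (trans (cong (a · P +ᵛ_) (trans (·-assoc (⊖ 𝟙) a P) (cong (_· P) (trans (ring-solve 2 (λ o a → (:- o) :* a := :- (o :* a)) refl 𝟙 a) (cong ⊖_ (⊗-identityˡ a)))))) (·-inverse a P)))))) ⊖-𝟘)))

  -- If neither of the functionals for `R` and for `S` serves both points, their sum does.
  functional-at₂ : ∀ {P R S : V} → Indep P R → Indep P S → ∃[ h ] (h ∙ P ≡ 𝟘 × h ∙ R ≢ 𝟘 × h ∙ S ≢ 𝟘)
  functional-at₂ {P} {R} {S} iR iS with functional-at iR | functional-at iS
  ... | g , gP , gR | h , hP , hS with g ∙ S ≟ᶠ 𝟘 | h ∙ R ≟ᶠ 𝟘
  ... | no gS | _ = g , gP , gR , gS
  ... | yes _ | no hR = h , hP , hR , hS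
  ... | yes gS | yes hR = g +ᵛ h , trans (∙-+ˡ g h P) (trans (cong₂ _⊕_ gP hP) (⊕-identityˡ 𝟘))
      , (λ e → gR (trans (sym (trans (∙-+ˡ g h R) (trans (cong (g ∙ R ⊕_) hR) (⊕-identityʳ _)))) e))
      , (λ e → hS (trans (sym (trans (∙-+ˡ g h S) (trans (cong (_⊕ h ∙ S) gS) (⊕-identityˡ _)))) e))

  pts-indep : ∀ {P R : V} → P ∈ pts d → R ∈ pts d → R ≢ P → Indep P R
  pts-indep i j n = distinct-indep (normal i) (normal j) (n ∘ sym)

-- Multisets that cover the field several times.

module Coverings {q : ℕ} (F : FiniteField q) where
  open Field F
  open Polynomials F
  open Lacunary F

  -- The associated polynomial is `Ψ^t` times that of `L`.
  copies : ℕ → List 𝔽 → List 𝔽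
  copies zero    L = L
  copies (suc t) L = Fs ++ copies t L

  count-++ : ∀ x L M → count x (L ++ M) ≡ count x L + count x M
  count-++ x L M = ∑-++ L M _

  count-copies : ∀ x t L → count x (copies t L) ≡ t + count x L
  count-copies x zero    L = refl
  count-copies x (suc t) L = trans (count-++ x Fs (copies t L)) (cong₂ _+_ (trans (∑-cong Fs (λ y → ==-cong⇔ id id)) (∑-Fs-δ x)) (count-copies x t L))

  length-copies : ∀ t L → length (copies t L) ≡ t * q + length L
  length-copies zero    L = refl
  length-copies (suc t) L = trans (Listₚ.length-++ Fs) (trans (cong₂ _+_ length-Fs (length-copies t L)) (sym (+-assoc q (t * q) _)))

  cover : ∀ t L → (∀ x → t ≤ count x L) → ∃[ r ] (L ↭ copies t r)
  cover zero    L _  = L , ↭-refl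
  cover (suc t) L le with extract-all Fs {L} (λ x → ≤-trans (≤-reflexive (∑-Fs-δ x)) (≤-trans (s≤s z≤n) (le x)))
  ... | M , p with cover t M (λ x → +-cancelˡ-≤ 1 _ _ (≤-trans (le x) (≤-reflexive (trans (∑-↭ _ p)
                     (trans (count-++ x Fs M) (cong (_+ count x M) (∑-Fs-δ x)))))))
  ... | r , p′ = r , ↭-trans p (↭-++ Fs p′)
    where
    ↭-++ : ∀ (L : List 𝔽) {M N} → M ↭ N → L ++ M ↭ L ++ N
    ↭-++ []      p = p
    ↭-++ (x ∷ L) p = ↭-prep x (↭-++ L p)

  Ψ-low : ∀ f i → suc i < q → (Ψ ✶ f) (suc i) ≡ Ψ₁ ⊗ f i
  Ψ-low f i lt = trans (✶-cong Ψ-split (λ _ → refl) (suc i)) (trans (✶-distribʳ f (pow q) (const Ψ₁ ✶ X) (suc i))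
    (trans (cong₂ _⊕_ (pow-low q f (suc i) lt) (trans (✶-assoc (const Ψ₁) X f (suc i)) (trans (✶-const Ψ₁ (X ✶ f) (suc i)) (cong (Ψ₁ ⊗_) (X-suc f i)))))
      (⊕-identityˡ _)))

  Ψ-high : ∀ f i → (Ψ ✶ f) (q + i) ≡ f i ⊕ Ψ₁ ⊗ f (q + i ∸ 1)
  Ψ-high f i = trans (✶-cong Ψ-split (λ _ → refl) (q + i)) (trans (✶-distribʳ f (pow q) (const Ψ₁ ✶ X) (q + i))
    (cong₂ _⊕_ (pow-high q f i) (trans (✶-assoc (const Ψ₁) X f (q + i)) (trans (✶-const Ψ₁ (X ✶ f) (q + i)) (cong (Ψ₁ ⊗_) (X-pred (q + i) (≤-trans 1≤q (m≤m+n q i))))))))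
    where
    X-pred : ∀ n → 1 ≤ n → (X ✶ f) n ≡ f (n ∸ 1)
    X-pred (suc n) _ = X-suc f n

  Π-Fs++ : ∀ L i → Π (Fs ++ L) i ≡ (Ψ ✶ Π L) i
  Π-Fs++ L i = Π-++ Fs L i

  -- The exponents of `Ψ^t = (X^q + Ψ₁ X)^t` are `t q`, then `(t - 1) q + 1`, then smaller ones.
  -- After multiplication by a polynomial of degree `length L`, the leading term still starts at
  -- `t q` and all others end at `(t - 1) q + 1 + length L`; between them lies a gap.
  lacunary-copies : ∀ t L i → t * q + length L + 1 < i + q → i < t * q → Π (copies t L) i ≡ 𝟘
  lacunary-copies (suc t) L zero a b = trans (Π-Fs++ (copies t L) 0) (trans (cong (_⊗ Π (copies t L) 0) Ψ-0) (⊗-zeroˡ _))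
  lacunary-copies (suc t) L (suc i) a b = trans (Π-Fs++ (copies t L) (suc i)) (by-cases (suc i <? q))
    where
    f = Π (copies t L)
    top : t * q + length L < i
    top = +-cancelʳ-< q _ _ (s≤s⁻¹ (subst (_< suc (i + q)) (arith q (t * q) (length L)) a))
      where
      arith : ∀ q a l → q + a + l + 1 ≡ suc (a + l + q)
      arith = semiring-solve 3 (λ q a l → q ⊹ a ⊹ l ⊹ # 1 , 1⊹ (a ⊹ l ⊹ q)) refl
    fi≡0 : f i ≡ 𝟘
    fi≡0 = proj₁ (Π-monic (copies t L)) i (subst (_< i) (sym (length-copies t L)) top)
    by-cases : Dec (suc i < q) → (Ψ ✶ f) (suc i) ≡ 𝟘
    by-cases (yes lt) = trans (Ψ-low f i lt) (trans (cong (Ψ₁ ⊗_) fi≡0) (⊗-zeroʳ Ψ₁))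
    by-cases (no ¬lt) = subst (λ n → (Ψ ✶ f) n ≡ 𝟘) q+j (trans (Ψ-high f j) (trans (cong₂ (λ a b → a ⊕ Ψ₁ ⊗ b) fj≡0
        (trans (cong (λ n → f (n ∸ 1)) q+j) fi≡0)) (trans (⊕-identityˡ _) (⊗-zeroʳ Ψ₁))))
      where
      j = suc i ∸ q
      q+j : q + j ≡ suc i
      q+j = m+[n∸m]≡n (≮⇒≥ ¬lt)
      fj≡0 : f j ≡ 𝟘
      fj≡0 = lacunary-copies t L j (subst (t * q + length L + 1 <_) (trans (sym q+j) (+-comm q j))
          (subst (_< suc i) (+-comm 1 _) (s≤s top)))
        (+-cancelˡ-< q _ _ (subst (_< q + t * q) (sym q+j) b))

  -- A gap of `Ψ f` is inherited by `f`: coefficient `q + i` of the product is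
  -- `f i + Ψ₁ f (q + i - 1)`, and the second term lies above the degree of `f` because `w < q`.
  lacunary-quotient : ∀ t L w b → suc w ≤ q → (∀ i → t * q + length L < i + w → i < t * q + b → Π (copies t L) i ≡ 𝟘) →
    ∀ i → length L < i + w → i < b → Π L i ≡ 𝟘
  lacunary-quotient zero    L w b le z = z
  lacunary-quotient (suc t) L w b le z = lacunary-quotient t L w b le λ i lo hi →
      trans (sym (trans (Ψ-high f i) (trans (cong (λ x → f i ⊕ Ψ₁ ⊗ x) (above i lo)) (trans (cong (f i ⊕_) (⊗-zeroʳ Ψ₁)) (⊕-identityʳ _)))))
        (trans (sym (Π-Fs++ (copies t L) (q + i))) (z (q + i) (subst₂ _<_ (sym (+-assoc q (t * q) (length L))) (sym (+-assoc q i w)) (+-monoʳ-< q lo))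
          (subst (q + i <_) (sym (+-assoc q (t * q) b)) (+-monoʳ-< q hi))))
    where
    f = Π (copies t L)
    above : ∀ i → t * q + length L < i + w → f (q + i ∸ 1) ≡ 𝟘
    above i lo = proj₁ (Π-monic (copies t L)) (q + i ∸ 1) (subst (λ n → suc n ≤ q + i ∸ 1) (sym (length-copies t L))
      (≤-trans lo (subst (_≤ q + i ∸ 1) (+-comm w i) (≤-trans (m≤n+m (w + i) 0) (∸-monoˡ-≤ 1 (+-monoˡ-≤ i le))))))

-- The Rédei polynomial at a point of the set.

-- A set met by every hyperplane in at least t + 1 points, met by v in exactly t + 1 points, one of them P;
-- the functionals v and ℓ both vanish at P, and at no other point of the set.
module Redei {q : ℕ} (F : FiniteField q) (d : ℕ) where
  open Field F
  open Polynomials F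
  open Lacunary F
  open Coverings F
  open Vectors F hiding (d; m; k)
  open PointSets F d

  module Pencil (β : PSet) (t : ℕ) (blocking : ∀ h → suc t ≤ size (β ∩ hyp h)) (v ℓ : V)
    {P : V} (P∈pts : P ∈ pts d) (P∈β : P ∈ˢ β) (vP : v ∙ P ≡ 𝟘) (ℓP : ℓ ∙ P ≡ 𝟘)
    (v-size : size (β ∩ hyp v) ≤ suc t) (vℓ-size : size (β ∩ hyp v ∩ hyp ℓ) ≤ 1)
    (E : ℕ) (β-size : size β ≤ suc t * q + 1 + E) (E-small : E + E < q) (char : ∀ j → 1 ≤ j → j ≤ E → ℕ→𝔽 j ≢ 𝟘)
    (ℓ-low : 2 ≤ size (β ∩ hyp ℓ)) (ℓ-high : size (β ∩ hyp ℓ) ≤ q) where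

    private
      -- `ℓ` serves as the hyperplane at infinity.
      affine : List V
      affine = select (λ Z → mem β Z ∧ not (ℓ ∙ Z == 𝟘)) (pts d)

      ratio : V → V → 𝔽
      ratio h Z = h ∙ Z ⊗ recip (ℓ ∙ Z)

      affine-count : ∀ h (f : V → 𝔽) x → (∀ Z → ℓ ∙ Z ≢ 𝟘 → (h ∙ Z == 𝟘) ≡ (f Z == x)) →
        size (β ∩ hyp h) ≡ size (β ∩ hyp h ∩ hyp ℓ) + count x (map f affine)
      affine-count h f x eq = trans (size-split (β ∩ hyp h) (hyp ℓ)) (cong (size (β ∩ hyp h ∩ hyp ℓ) +_)
        (sym (trans (∑-map f affine _) (trans (∑-select _ (pts d) _) (∑-cong (pts d) pointwise)))))
        where
        pointwise : ∀ Z → ⟦ mem β Z ∧ not (ℓ ∙ Z == 𝟘) ⟧ * ⟦ f Z == x ⟧ ≡ ⟦ (mem β Z ∧ (h ∙ Z == 𝟘)) ∧ not (ℓ ∙ Z == 𝟘) ⟧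
        pointwise Z with mem β Z
        ... | false = refl
        ... | true with true? (ℓ ∙ Z == 𝟘)
        ...   | inj₁ e rewrite e = cong ⟦_⟧ (sym (Data.Bool.Properties.∧-zeroʳ (h ∙ Z == 𝟘)))
          where import Data.Bool.Properties
        ...   | inj₂ e rewrite e | eq Z (≢-== e) = trans (+-identityʳ _) (cong ⟦_⟧ (sym (Data.Bool.Properties.∧-identityʳ (f Z == x))))
          where import Data.Bool.Properties

      ratio-∙ : ∀ h x Z → ℓ ∙ Z ≢ 𝟘 → ((h +ᵛ (⊖ x) · ℓ) ∙ Z == 𝟘) ≡ (ratio h Z == x)
      ratio-∙ h x Z n = bool-ext
        (λ e → ==-complete (trans (cong (_⊗ recip (ℓ ∙ Z)) (trans (solve-for (==-sound e)) (⊗-comm x _)))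
          (trans (ring-solve 3 (λ a x r → a :* x :* r := x :* (a :* r)) refl (ℓ ∙ Z) x (recip (ℓ ∙ Z))) (trans (cong (x ⊗_) (recip-inverse n)) (⊗-identityʳ x)))))
        (λ e → ==-complete (trans value (trans (cong (λ y → h ∙ Z ⊕ ⊖ (y ⊗ ℓ ∙ Z)) (sym (==-sound e)))
          (trans (ring-solve 3 (λ h l r → h :- h :* r :* l := h :- h :* (l :* r)) refl (h ∙ Z) (ℓ ∙ Z) (recip (ℓ ∙ Z)))
            (trans (cong (λ y → h ∙ Z ⊕ ⊖ (h ∙ Z ⊗ y)) (recip-inverse n)) (trans (cong (λ y → h ∙ Z ⊕ ⊖ y) (⊗-identityʳ _)) (⊖-inverseʳ _)))))))
        where
        value : (h +ᵛ (⊖ x) · ℓ) ∙ Z ≡ h ∙ Z ⊕ ⊖ (x ⊗ ℓ ∙ Z)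
        value = trans (∙-+ˡ h _ Z) (cong (h ∙ Z ⊕_) (trans (∙-·ˡ (⊖ x) ℓ Z) (ring-solve 2 (λ x l → (:- x) :* l := :- (x :* l)) refl x (ℓ ∙ Z))))
        solve-for : (h +ᵛ (⊖ x) · ℓ) ∙ Z ≡ 𝟘 → h ∙ Z ≡ x ⊗ ℓ ∙ Z
        solve-for e = trans (⊕≡0⇒ (trans (sym value) e)) (ring-solve 1 (λ x → :- (:- x) := x) refl (x ⊗ ℓ ∙ Z))

      α : V → 𝔽
      α = ratio v

      μ : V
      μ = [ (λ e → ⊥-elim (normal-≢0 (normal P∈pts) e)) , proj₁ ]′ (detect P)
        where open import Data.Sum using ([_,_]′)

      μP : μ ∙ P ≢ 𝟘
      μP with detect P
      ... | inj₁ e = ⊥-elim (normal-≢0 (normal P∈pts) e)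
      ... | inj₂ (g , n) = n

      -- `X + γ y Z` is the factor of `Z` in the Rédei polynomial. For fixed `y` its values tell how
      -- the affine points are distributed over the hyperplanes `μ + y v - x ℓ`, and `α` is the
      -- coefficient of `y`.
      γ : 𝔽 → V → 𝔽
      γ y Z = ratio μ Z ⊕ y ⊗ α Z

      γ-ratio : ∀ y Z → ratio (μ +ᵛ y · v) Z ≡ γ y Z
      γ-ratio y Z = trans (cong (_⊗ recip (ℓ ∙ Z)) (trans (∙-+ˡ μ (y · v) Z) (cong (μ ∙ Z ⊕_) (∙-·ˡ y v Z))))
        (ring-solve 4 (λ m y v r → (m :+ y :* v) :* r := m :* r :+ y :* (v :* r)) refl (μ ∙ Z) y (v ∙ Z) (recip (ℓ ∙ Z)))

      bad : 𝔽 → ℕ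
      bad y = size (β ∩ hyp ℓ ∩ hyp (μ +ᵛ y · v))

      -- For these `y` the axis of the pencil spanned by `μ + y v` and `ℓ` misses `β`, so the
      -- `t + 1` points guaranteed on each `μ + y v - x ℓ` are all affine.
      good : 𝔽 → Bool
      good y = bad y ≡ᵇ 0

      u : ℕ
      u = size (remove (β ∩ hyp ℓ) P∈pts)

      u+1 : size (β ∩ hyp ℓ) ≡ suc u
      u+1 = size-remove (β ∩ hyp ℓ) P∈pts (∧-intro P∈β (==-complete ℓP))

      1≤u : 1 ≤ u
      1≤u = s≤s⁻¹ (subst (2 ≤_) u+1 ℓ-low)

      u<q : u < q
      u<q = subst (_≤ q) u+1 ℓ-high

      w : ℕ
      w = q ∸ u

      w+u : w + u ≡ q
      w+u = m∸n+n≡m (<⇒≤ u<q)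

      only-P : ∀ Z → Z ∈ pts d → Z ∈ˢ β → ℓ ∙ Z ≡ 𝟘 → v ∙ Z ≡ 𝟘 → Z ≡ P
      only-P Z i b e e′ = size≤1-unique (β ∩ hyp v ∩ hyp ℓ) vℓ-size i P∈pts
        (∧-intro (∧-intro b (==-complete e′)) (==-complete e)) (∧-intro (∧-intro P∈β (==-complete vP)) (==-complete ℓP))

      -- A point of `β` on `ℓ` other than `P` is off `v` and spoils exactly one `y`. The point `P`
      -- spoils none, as `v` vanishes there and `μ` does not.
      ∑-bad : ∑ Fs bad ≤ u
      ∑-bad = ≤-trans (≤-reflexive (∑-swap Fs (pts d) _)) (∑-mono-∈ (pts d) pointwise)
        where
        value : ∀ y Z → (μ +ᵛ y · v) ∙ Z ≡ v ∙ Z ⊗ y ⊕ μ ∙ Z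
        value y Z = pencil-∙ μ v y Z
        pointwise : ∀ Z → Z ∈ pts d → ∑ Fs (λ y → ⟦ mem (β ∩ hyp ℓ ∩ hyp (μ +ᵛ y · v)) Z ⟧) ≤ ⟦ mem (remove (β ∩ hyp ℓ) P∈pts) Z ⟧
        pointwise Z i with true? (mem (β ∩ hyp ℓ) Z)
        ... | inj₂ e rewrite e = ≤-reflexive (∑-0 Fs)
        ... | inj₁ e with Z ≟ᵛ P
        ...   | yes refl rewrite e = ≤-trans (≤-reflexive (trans (∑-cong Fs (λ y → cong (λ z → ⟦ z == 𝟘 ⟧)
                  (trans (value y P) (cong (λ z → z ⊗ y ⊕ μ ∙ P) vP)))) (∑-Fs-affine-0 (μ ∙ P) μP))) z≤n
        ...   | no n = ≤-trans (≤-reflexive (trans (∑-cong Fs (λ y → trans (cong (λ b → ⟦ b ∧ ((μ +ᵛ y · v) ∙ Z == 𝟘) ⟧) e) (cong (λ z → ⟦ z == 𝟘 ⟧) (value y Z))))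
                  (∑-Fs-affine (v ∙ Z) (μ ∙ Z) (λ vZ → n (only-P Z i (proj₁ (∧-true e)) (==-sound (proj₂ (∧-true {mem β Z} e))) vZ)))))
                (≤-reflexive (cong ⟦_⟧ (sym (∈-remove (β ∩ hyp ℓ) P∈pts i e n))))

      many-good : w ≤ ∑ Fs (⟦_⟧ ∘ good)
      many-good = +-cancelʳ-≤ u _ _ (begin
        w + u ≡⟨ trans w+u (sym (trans (∑-1 Fs) length-Fs)) ⟩
        ∑ Fs (λ _ → 1) ≤⟨ ∑-mono Fs (λ y → either (bad y)) ⟩
        ∑ Fs (λ y → ⟦ good y ⟧ + bad y) ≡⟨ ∑-+ Fs _ bad ⟩
        ∑ Fs (⟦_⟧ ∘ good) + ∑ Fs bad ≤⟨ +-monoʳ-≤ (∑ Fs (⟦_⟧ ∘ good)) ∑-bad ⟩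
        ∑ Fs (⟦_⟧ ∘ good) + u ∎)
        where
        open ≤-Reasoning
        either : ∀ n → 1 ≤ ⟦ n ≡ᵇ 0 ⟧ + n
        either zero    = ≤-refl
        either (suc n) = s≤s z≤n

      good-covers : ∀ y → good y ≡ true → ∀ x → suc t ≤ count x (map (γ y) affine)
      good-covers y g x = ≤-trans (blocking h) (≤-reflexive (trans (affine-count h (γ y) x (λ Z n →
          trans (ratio-∙ (μ +ᵛ y · v) x Z n) (cong (_== x) (γ-ratio y Z)))) (cong (_+ count x (map (γ y) affine)) none)))
        where
        h = μ +ᵛ y · v +ᵛ (⊖ x) · ℓ
        none : size (β ∩ hyp h ∩ hyp ℓ) ≡ 0
        none = n≤0⇒n≡0 (≤-trans (size-⊆ {β ∩ hyp h ∩ hyp ℓ} {β ∩ hyp ℓ ∩ hyp (μ +ᵛ y · v)} sub) (≤-reflexive (≡ᵇ⇒≡ (bad y) 0 (subst T (sym g) tt))))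
          where
          open import Data.Bool using (T)
          open import Data.Unit using (tt)
          sub : ∀ Z → Z ∈ pts d → Z ∈ˢ β ∩ hyp h ∩ hyp ℓ → Z ∈ˢ β ∩ hyp ℓ ∩ hyp (μ +ᵛ y · v)
          sub Z _ e = ∧-intro (∧-intro (proj₁ (∧-true {mem β Z} (proj₁ e′))) (proj₂ e′)) (==-complete (trans (sym (trans (∙-+ˡ (μ +ᵛ y · v) ((⊖ x) · ℓ) Z)
              (trans (cong ((μ +ᵛ y · v) ∙ Z ⊕_) (trans (∙-·ˡ (⊖ x) ℓ Z) (trans (cong (⊖ x ⊗_) (==-sound (proj₂ e′))) (⊗-zeroʳ _)))) (⊕-identityʳ _))))
              (==-sound (proj₂ (∧-true {mem β Z} (proj₁ e′))))))
            where e′ = ∧-true {mem (β ∩ hyp h) Z} e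

      M : ℕ
      M = length affine

      M+L : M + suc u ≡ size β
      M+L = trans (+-comm M (suc u)) (sym (trans (size-split β (hyp ℓ)) (cong₂ _+_ u+1 (sym (length-select _ (pts d))))))

      y₀ : ∃[ y ] (y ∈ Fs × good y ≡ true)
      y₀ = ∑-witness Fs {good} (≤-trans (m<n⇒0<n∸m u<q) many-good)

      residue : ∀ y → good y ≡ true → ∃[ r ] (map (γ y) affine ↭ copies (suc t) r)
      residue y g = cover (suc t) (map (γ y) affine) (good-covers y g)

      length-residue : ∀ y g → suc t * q + length (proj₁ (residue y g)) ≡ M
      length-residue y g = trans (sym (length-copies (suc t) (proj₁ (residue y g)))) (trans (sym (↭-length (proj₂ (residue y g)))) (Listₚ.length-map (γ y) affine))

      m : ℕ
      m = length (proj₁ (residue (proj₁ y₀) (proj₂ (proj₂ y₀))))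

      M≡ : suc t * q + m ≡ M
      M≡ = length-residue (proj₁ y₀) (proj₂ (proj₂ y₀))

      m+u≤E : m + u ≤ E
      m+u≤E = +-cancelˡ-≤ (suc t * q + 1) _ _ (≤-trans (≤-reflexive (trans (arith (suc t * q) m u) (trans (cong (_+ suc u) M≡) M+L))) β-size)
        where
        arith : ∀ a m u → a + 1 + (m + u) ≡ a + m + suc u
        arith = semiring-solve 3 (λ a m u → a ⊹ # 1 ⊹ (m ⊹ u) , a ⊹ m ⊹ 1⊹ u) refl

      -- As a function of `y`, coefficient `i` has degree at most `M - i`, which is less than `w`,
      -- and it vanishes at the good `y`, of which there are at least `w`. So its top coefficient,
      -- which belongs to the polynomial of `α`, is zero.
      α-lacunary : ∀ i → M < i + w → i < suc t * q → Π (map α affine) i ≡ 𝟘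
      α-lacunary i lo hi = PolyFn-vanish (Π-PolyFn α (ratio μ) affine i j i+j) good
          (≤-trans (+-cancelˡ-< i _ _ (subst (_< i + w) (sym i+j) lo)) many-good)
          (λ y g → trans (Π-↭ (proj₂ (residue y g)) i) (lacunary-copies (suc t) (proj₁ (residue y g)) i
            (subst (λ n → n + 1 < i + q) (sym (length-residue y g)) (subst₂ _<_ (+-comm 1 M) (trans (+-assoc i w u) (cong (i +_) w+u))
              (≤-trans (s≤s lo) (subst (_≤ i + w + u) (+-comm (i + w) 1) (+-monoʳ-≤ (i + w) 1≤u))))) hi))
        where
        i≤M : i ≤ M
        i≤M = ≤-trans (<⇒≤ hi) (subst (suc t * q ≤_) M≡ (m≤m+n _ m))
        j = M ∸ i
        i+j : i + j ≡ M
        i+j = m+[n∸m]≡n i≤M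

      α-count : ∀ x → size (β ∩ hyp (v +ᵛ (⊖ x) · ℓ)) ≡ size (β ∩ hyp (v +ᵛ (⊖ x) · ℓ) ∩ hyp ℓ) + count x (map α affine)
      α-count x = affine-count (v +ᵛ (⊖ x) · ℓ) α x (ratio-∙ v x)

      shared : ∀ x → size (β ∩ hyp (v +ᵛ (⊖ x) · ℓ) ∩ hyp ℓ) ≤ 1
      shared x = ≤-trans (size-⊆ {β ∩ hyp (v +ᵛ (⊖ x) · ℓ) ∩ hyp ℓ} {β ∩ hyp v ∩ hyp ℓ} (λ Z _ e →
          let e′ = ∧-true {mem (β ∩ hyp (v +ᵛ (⊖ x) · ℓ)) Z} e ; e″ = ∧-true {mem β Z} (proj₁ e′) in
          ∧-intro (∧-intro (proj₁ e″) (==-complete (trans (sym (trans (∙-+ˡ v _ Z) (trans (cong (v ∙ Z ⊕_)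
            (trans (∙-·ˡ (⊖ x) ℓ Z) (trans (cong (⊖ x ⊗_) (==-sound (proj₂ e′))) (⊗-zeroʳ _)))) (⊕-identityʳ _)))) (==-sound (proj₂ e″))))) (proj₂ e′))) vℓ-size

      P∈pencil : ∀ x → P ∈ˢ β ∩ hyp (v +ᵛ (⊖ x) · ℓ) ∩ hyp ℓ
      P∈pencil x = ∧-intro (∧-intro P∈β (==-complete (trans (∙-+ˡ v _ P) (trans (cong₂ _⊕_ vP
        (trans (∙-·ˡ (⊖ x) ℓ P) (trans (cong (⊖ x ⊗_) ℓP) (⊗-zeroʳ _)))) (⊕-identityˡ 𝟘))))) (==-complete ℓP)

      -- The hyperplanes `v - x ℓ` have only `P` in common with `β` at infinity, so all but one of
      -- their `t + 1` points are affine.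
      α-covers : ∀ x → t ≤ count x (map α affine)
      α-covers x = s≤s⁻¹ (≤-trans (blocking (v +ᵛ (⊖ x) · ℓ)) (≤-trans (≤-reflexive (α-count x)) (+-monoˡ-≤ _ (shared x))))

      α-residue : ∃[ L ] (map α affine ↭ copies t L)
      α-residue = cover t (map α affine) α-covers

      L : List 𝔽
      L = proj₁ α-residue

      L-length : length L ≡ q + m
      L-length = +-cancelˡ-≡ (t * q) _ _ (trans (sym (length-copies t L)) (trans (sym (↭-length (proj₂ α-residue)))
        (trans (Listₚ.length-map α affine) (trans (sym M≡) (arith q (t * q) m)))))
        where
        arith : ∀ q a m → q + a + m ≡ a + (q + m)
        arith = semiring-solve 3 (λ q a m → q ⊹ a ⊹ m , a ⊹ (q ⊹ m)) refl

      count-L : ∀ x → count x (map α affine) ≡ t + count x L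
      count-L x = trans (∑-↭ _ (proj₂ α-residue)) (count-copies x t L)

      zero-v : v +ᵛ (⊖ 𝟘) · ℓ ≡ v
      zero-v = trans (cong (v +ᵛ_) (trans (cong (_· ℓ) ⊖-𝟘) (·-zeroˡ ℓ))) (+ᵛ-identityʳ v)

      -- The value 0 belongs to `v` itself, which has at most `t` affine points; the `t` copies of
      -- the field already use them up.
      L-nonzero : ∀ a → a ∈ L → a ≢ 𝟘
      L-nonzero a i refl = 1+n≰n (begin
        2 + t ≤⟨ +-monoʳ-≤ 1 (subst (_≤ t + count 𝟘 L) (+-comm t 1) (+-monoʳ-≤ t (subst (_≤ count 𝟘 L) (cong ⟦_⟧ (==-refl 𝟘)) (∑-∈ (λ y → ⟦ y == 𝟘 ⟧) i)))) ⟩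
        1 + (t + count 𝟘 L) ≡⟨ cong suc (count-L 𝟘) ⟨
        1 + count 𝟘 (map α affine) ≤⟨ +-monoˡ-≤ _ (1≤size (β ∩ hyp (v +ᵛ (⊖ 𝟘) · ℓ) ∩ hyp ℓ) P∈pts (P∈pencil 𝟘)) ⟩
        _ ≡⟨ α-count 𝟘 ⟨
        size (β ∩ hyp (v +ᵛ (⊖ 𝟘) · ℓ)) ≡⟨ cong (λ h → size (β ∩ hyp h)) zero-v ⟩
        size (β ∩ hyp v) ≤⟨ v-size ⟩
        suc t ∎)
        where open ≤-Reasoning

      L-lacunary : ∀ i → m + u < i → i < q → Π L i ≡ 𝟘
      L-lacunary i lo hi = lacunary-quotient t L w q (subst (suc w ≤_) w+u (subst (_≤ w + u) (+-comm w 1) (+-monoʳ-≤ w 1≤u)))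
        (λ j a b → trans (sym (Π-↭ (proj₂ α-residue) j)) (α-lacunary j
           (subst (_< j + w) (trans (cong (t * q +_) L-length) (trans (arith q (t * q) m) M≡)) a) (subst (j <_) (+-comm (t * q) q) b)))
        i (subst (_< i + w) (sym L-length) (subst₂ _<_ (trans (arith′ m u w) (cong (_+ m) w+u)) refl (+-monoˡ-< w lo))) hi
        where
        arith : ∀ q a m → a + (q + m) ≡ q + a + m
        arith = semiring-solve 3 (λ q a m → a ⊹ (q ⊹ m) , q ⊹ a ⊹ m) refl
        arith′ : ∀ m u w → m + u + w ≡ w + u + m
        arith′ = semiring-solve 3 (λ m u w → m ⊹ u ⊹ w , w ⊹ u ⊹ m) refl

      root : ∃[ x ] (q ≤ count x L)
      root = Few.frequent-root m u L L-length 1≤u (≤-<-trans (+-mono-≤ m+u≤E m+u≤E) E-small)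
        (λ j lo hi → char j lo (≤-trans hi m+u≤E)) L-nonzero L-lacunary

    -- Multiplicity `q` on top of the `t` copies, together with `P`, makes `q + t + 1` points.
    rich : ∃[ x ] (q + suc t ≤ size (β ∩ hyp (v +ᵛ x · ℓ)))
    rich = ⊖ x , (begin
      q + suc t ≡⟨ trans (+-suc q t) (cong suc (+-comm q t)) ⟩
      1 + (t + q) ≤⟨ +-mono-≤ (1≤size (β ∩ hyp (v +ᵛ (⊖ x) · ℓ) ∩ hyp ℓ) P∈pts (P∈pencil x)) (+-monoʳ-≤ t (proj₂ root)) ⟩
      size (β ∩ hyp (v +ᵛ (⊖ x) · ℓ) ∩ hyp ℓ) + (t + count x L) ≡⟨ cong (size (β ∩ hyp (v +ᵛ (⊖ x) · ℓ) ∩ hyp ℓ) +_) (count-L x) ⟨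
      _ ≡⟨ α-count x ⟨
      size (β ∩ hyp (v +ᵛ (⊖ x) · ℓ)) ∎)
      where
      open ≤-Reasoning
      x = proj₁ root

-- Full lines in small simple and double blocking sets.

module Lines {q : ℕ} (F : FiniteField q) (d : ℕ)
  (E : ℕ) (E-small : E + E < q) (2<q : 2 < q) (char : ∀ j → 1 ≤ j → j ≤ E → Field.ℕ→𝔽 F j ≢ Field.𝟘 F) where
  open Field F
  open Lacunary F using (count-nonzero)
  open Vectors F hiding (d; m; k)
  open PointSets F d
  open Redei F d

  Full : PSet → V → V → Set
  Full β P R = ∀ a b → a · P +ᵛ b · R ≢ 0ᵛ → a · P +ᵛ b · R ∈ˢ β

  LineThrough : PSet → V → Set
  LineThrough β P = ∃[ R ] (R ∈ pts d × R ∈ˢ β × R ≢ P × Full β P R)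

  E<q : E < q
  E<q = ≤-<-trans (m≤m+n E E) E-small

  combine-0 : ∀ (g h : V) x Z → h ∙ Z ≡ 𝟘 → (g +ᵛ x · h) ∙ Z ≡ g ∙ Z
  combine-0 g h x Z e = trans (∙-+ˡ g (x · h) Z) (trans (cong (g ∙ Z ⊕_) (trans (∙-·ˡ x h Z) (trans (cong (x ⊗_) e) (⊗-zeroʳ x)))) (⊕-identityʳ _))

  -- If `g` missed the section, the other `q` hyperplanes of the pencil of `g` and `h` would carry
  -- `q t` points of `β` off `h`.
  section-blocking : ∀ β t → (∀ h → t ≤ size (β ∩ hyp h)) → ∀ h r → r ≤ size (β ∩ hyp h) → size β < r + q * t →
    ∀ g → 1 ≤ size (β ∩ hyp h ∩ hyp g)
  section-blocking β t blocking h r large small g with size (β ∩ hyp h ∩ hyp g) in eq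
  ... | suc n = s≤s z≤n
  ... | zero = ⊥-elim (1+n≰n (≤-trans small (begin
    r + q * t ≤⟨ +-mono-≤ large (≤-trans (≤-reflexive (sym (∑-Fs-const t))) (∑-mono Fs (λ x → blocking (g +ᵛ x · h)))) ⟩
    size (β ∩ hyp h) + ∑ Fs (λ x → size (β ∩ hyp (g +ᵛ x · h))) ≡⟨ pencil β g h ⟩
    size β + q * size (β ∩ hyp h ∩ hyp g) ≡⟨ trans (cong (λ n → size β + q * n) eq) (trans (cong (size β +_) (*-zeroʳ q)) (+-identityʳ _)) ⟩
    size β ∎)))
    where open ≤-Reasoning

  private
    -- Every point `w` of the line lies on a hyperplane `h` that meets the line only there, namely a
    -- combination of functionals vanishing at `P` and at `R`. The point of `β` on `h` can only be
    -- `w`.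
    line-from-span : ∀ β → (∀ h → 1 ≤ size (β ∩ hyp h)) → ∀ {P R} → P ∈ pts d → R ∈ pts d → R ∈ˢ β → R ≢ P →
      (∀ Z → Z ∈ pts d → Z ∈ˢ β → ∃[ as ] (comb as (P ∷ R ∷ []) ≡ Z)) → Full β P R
    line-from-span β blocking {P} {R} iP iR R∈β R≢P span a b w≢0 =
      conclude (inhabitant (β ∩ hyp h) (blocking h))
      where
      ind : Indep P R
      ind = pts-indep iP iR R≢P
      f = proj₁ (functional-at ind)
      fP = proj₁ (proj₂ (functional-at ind))
      fR = proj₂ (proj₂ (functional-at ind))
      g = proj₁ (functional-at (Indep-sym ind))
      gR = proj₁ (proj₂ (functional-at (Indep-sym ind)))
      gP = proj₂ (proj₂ (functional-at (Indep-sym ind)))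
      w = a · P +ᵛ b · R
      h = (a ⊗ g ∙ P) · f +ᵛ (⊖ (b ⊗ f ∙ R)) · g
      at : ∀ c e → h ∙ (c · P +ᵛ e · R) ≡ (g ∙ P ⊗ f ∙ R) ⊗ (a ⊗ e ⊕ ⊖ (b ⊗ c))
      at c e = begin
        h ∙ (c · P +ᵛ e · R) ≡⟨ ∙-+ˡ ((a ⊗ g ∙ P) · f) ((⊖ (b ⊗ f ∙ R)) · g) (c · P +ᵛ e · R) ⟩
        ((a ⊗ g ∙ P) · f) ∙ (c · P +ᵛ e · R) ⊕ ((⊖ (b ⊗ f ∙ R)) · g) ∙ (c · P +ᵛ e · R) ≡⟨ cong₂ _⊕_ (∙-·ˡ _ f _) (∙-·ˡ _ g _) ⟩
        (a ⊗ g ∙ P) ⊗ f ∙ (c · P +ᵛ e · R) ⊕ (⊖ (b ⊗ f ∙ R)) ⊗ g ∙ (c · P +ᵛ e · R) ≡⟨ cong₂ (λ y z → (a ⊗ g ∙ P) ⊗ y ⊕ (⊖ (b ⊗ f ∙ R)) ⊗ z) valf valg ⟩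
        (a ⊗ g ∙ P) ⊗ (e ⊗ f ∙ R) ⊕ (⊖ (b ⊗ f ∙ R)) ⊗ (c ⊗ g ∙ P) ≡⟨ ring-solve 6 (λ a b c e g f → (a :* g) :* (e :* f) :+ (:- (b :* f)) :* (c :* g) := (g :* f) :* (a :* e :- b :* c)) refl a b c e (g ∙ P) (f ∙ R) ⟩
        (g ∙ P ⊗ f ∙ R) ⊗ (a ⊗ e ⊕ ⊖ (b ⊗ c)) ∎
        where
        open ≡-Reasoning
        valf : f ∙ (c · P +ᵛ e · R) ≡ e ⊗ f ∙ R
        valf = trans (∙-+ʳ f (c · P) (e · R)) (trans (cong₂ _⊕_ (trans (∙-·ʳ c f P) (trans (cong (c ⊗_) fP) (⊗-zeroʳ c))) (∙-·ʳ e f R)) (⊕-identityˡ _))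
        valg : g ∙ (c · P +ᵛ e · R) ≡ c ⊗ g ∙ P
        valg = trans (∙-+ʳ g (c · P) (e · R)) (trans (cong₂ _⊕_ (∙-·ʳ c g P) (trans (∙-·ʳ e g R) (trans (cong (e ⊗_) gR) (⊗-zeroʳ e)))) (⊕-identityʳ _))
      finish : ∀ c e → c · P +ᵛ e · R ≢ 0ᵛ → c · P +ᵛ e · R ∈ˢ β → a ⊗ e ≡ b ⊗ c → w ∈ˢ β
      finish c e Z≢0 Z∈β ae with c ≟ᶠ 𝟘 | a ≟ᶠ 𝟘
      ... | no c≢0 | no a≢0 = trans (sym (inv β c w c≢0)) (subst (_∈ˢ β) (sym proportional) (∈-scale β a≢0 Z∈β))
        where
        proportional : c · w ≡ a · (c · P +ᵛ e · R)
        proportional = trans (·-distribˡ c (a · P) (b · R)) (trans (cong₂ _+ᵛ_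
          (trans (·-assoc c a P) (trans (cong (_· P) (⊗-comm c a)) (sym (·-assoc a c P))))
          (trans (·-assoc c b R) (trans (cong (_· R) (trans (⊗-comm c b) (sym ae))) (sym (·-assoc a e R)))))
          (sym (·-distribˡ a (c · P) (e · R))))
      ... | no c≢0 | yes refl = ⊥-elim (w≢0 (trans (cong₂ _+ᵛ_ (·-zeroˡ P)
              (trans (cong (_· R) (⊗-integral (trans (⊗-comm c b) (trans (sym ae) (⊗-zeroˡ e))) c≢0)) (·-zeroˡ R))) (+ᵛ-identityˡ 0ᵛ)))
      ... | yes refl | _ = subst (_∈ˢ β) (sym w≡) (∈-scale β b≢0 R∈β)
        where
        e≢0 : e ≢ 𝟘
        e≢0 refl = Z≢0 (trans (cong₂ _+ᵛ_ (·-zeroˡ P) (·-zeroˡ R)) (+ᵛ-identityˡ 0ᵛ))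
        a≡0 : a ≡ 𝟘
        a≡0 = ⊗-integral (trans (⊗-comm e a) (trans ae (⊗-zeroʳ b))) e≢0
        w≡ : w ≡ b · R
        w≡ = trans (cong (_+ᵛ b · R) (trans (cong (_· P) a≡0) (·-zeroˡ P))) (+ᵛ-identityˡ _)
        b≢0 : b ≢ 𝟘
        b≢0 refl = w≢0 (trans w≡ (·-zeroˡ R))
      conclude : ∃[ Z ] (Z ∈ pts d × Z ∈ˢ β ∩ hyp h) → w ∈ˢ β
      conclude (Z , iZ , e) with ∧-true {mem β Z} e
      ... | Z∈β , hZ with span Z iZ Z∈β
      ... | c ∷ e′ ∷ [] , eq = finish c e′ (λ z → normal-≢0 (normal iZ) (trans Z≡ z)) (subst (_∈ˢ β) Z≡ Z∈β)
            (trans (⊕≡0⇒ (⊗-integral (trans (sym (at c e′)) (trans (cong (h ∙_) (sym Z≡)) (==-sound hZ))) (⊗-≢0 gP fR)))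
              (ring-solve 1 (λ x → :- (:- x) := x) refl (b ⊗ c)))
        where
        Z≡ : Z ≡ c · P +ᵛ e′ · R
        Z≡ = trans (sym eq) (cong (c · P +ᵛ_) (+ᵛ-identityʳ _))

    -- Induction on the size. Unless `β` lies on a line through `P`, some hyperplane through `P`
    -- contains at least `q + 1` of its points but not all of them, and the section satisfies the
    -- same hypotheses.
    line-fuel : ∀ n β → size β ≤ n → (∀ h → 1 ≤ size (β ∩ hyp h)) → size β ≤ q + 1 + E → ∀ v {P} → P ∈ pts d → P ∈ˢ β →
      v ∙ P ≡ 𝟘 → size (β ∩ hyp v) ≤ 1 → LineThrough β P
    line-fuel zero β le _ _ _ i e _ _ = ⊥-elim (1+n≰n (≤-trans (1≤size β i e) le))
    line-fuel (suc n) β le blocking small v {P} iP P∈β vP tangent = from-second (inhabitant (β ∩ hyp μ) (blocking μ))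
      where
      μ : V
      μ = proj₁ (other-functional (detect P))
        where
        other-functional : P ≡ 0ᵛ ⊎ ∃[ g ] (g ∙ P ≢ 𝟘) → ∃[ g ] (g ∙ P ≢ 𝟘)
        other-functional (inj₁ e) = ⊥-elim (normal-≢0 (normal iP) e)
        other-functional (inj₂ r) = r
      μP : μ ∙ P ≢ 𝟘
      μP with detect P
      ... | inj₁ e = ⊥-elim (normal-≢0 (normal iP) e)
      ... | inj₂ (_ , r) = r
      recurse : ∀ h → h ∙ P ≡ 𝟘 → q + 1 ≤ size (β ∩ hyp h) → ∀ {Z} → Z ∈ pts d → Z ∈ˢ β → h ∙ Z ≢ 𝟘 → LineThrough β P
      recurse h hP rich iZ Z∈β hZ = restrict (line-fuel n (β ∩ hyp h) smaller
          (section-blocking β 1 blocking h (q + 1) rich (≤-<-trans small (+-monoʳ-< (q + 1) (subst (E <_) (sym (*-identityʳ q)) E<q))))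
          (≤-trans (size-∩≤ β (hyp h)) small) v iP (∧-intro P∈β (==-complete hP)) vP
          (≤-trans (∩-mono {β ∩ hyp h} {β} {hyp v} (λ _ e → proj₁ (∧-true e))) tangent))
        where
        smaller : size (β ∩ hyp h) ≤ n
        smaller = s≤s⁻¹ (≤-trans (subst (_≤ size (β ∩ hyp h) + size (β ∩ ∁ hyp h)) (+-comm _ 1)
          (+-monoʳ-≤ (size (β ∩ hyp h)) (1≤size (β ∩ ∁ hyp h) iZ (∧-intro Z∈β (not-false (==-≢ hZ))))))
          (≤-trans (≤-reflexive (sym (size-split β (hyp h)))) le))
        restrict : LineThrough (β ∩ hyp h) P → LineThrough β P
        restrict (R , iR , R∈ , R≢P , full) = R , iR , proj₁ (∧-true R∈) , R≢P , λ a b ne → proj₁ (∧-true (full a b ne))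
      from-second : ∃[ P′ ] (P′ ∈ pts d × P′ ∈ˢ β ∩ hyp μ) → LineThrough β P
      from-second (P′ , i′ , e′) = split (search (pts d) decide)
        where
        P′∈β : P′ ∈ˢ β
        P′∈β = proj₁ (∧-true e′)
        P′≢P : P′ ≢ P
        P′≢P refl = μP (==-sound (proj₂ (∧-true {mem β P′} e′)))
        vP′ : v ∙ P′ ≢ 𝟘
        vP′ z = P′≢P (size≤1-unique (β ∩ hyp v) tangent i′ iP (∧-intro P′∈β (==-complete z)) (∧-intro P∈β (==-complete vP)))
        Outside InSpan : V → Set
        Outside Z = Z ∈ˢ β × ∃[ ℓ ] (ℓ ∙ P ≡ 𝟘 × ℓ ∙ P′ ≡ 𝟘 × ℓ ∙ Z ≢ 𝟘)
        InSpan Z = Z ∈ˢ β → ∃[ as ] (comb as (P ∷ P′ ∷ []) ≡ Z)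
        decide : ∀ Z → Z ∈ pts d → Outside Z ⊎ InSpan Z
        decide Z _ with true? (mem β Z) | separate (P ∷ P′ ∷ []) Z
        ... | inj₂ Z∉β | _ = inj₂ (λ Z∈β → ⊥-elim (false≢true Z∉β Z∈β))
        ... | _ | inj₁ s = inj₂ (λ _ → s)
        ... | inj₁ Z∈β | inj₂ (g , (gP , gP′ , _) , gZ) = inj₁ (Z∈β , g , gP , gP′ , gZ)
        split : (∃[ Z ] (Z ∈ pts d × Outside Z)) ⊎ (∀ Z → Z ∈ pts d → InSpan Z) → LineThrough β P
        split (inj₂ span) = P′ , i′ , P′∈β , P′≢P , line-from-span β blocking iP i′ P′∈β P′≢P span
        split (inj₁ (Z , iZ , Z∈β , ℓ , ℓP , ℓP′ , ℓZ)) with size (β ∩ hyp ℓ) ≤? q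
        ... | no high = recurse ℓ ℓP (subst (_≤ size (β ∩ hyp ℓ)) (+-comm 1 q) (≰⇒> high)) iZ Z∈β ℓZ
        ... | yes low = use-rich (Pencil.rich β 0 blocking v ℓ iP P∈β vP ℓP tangent (≤-trans (size-∩≤ (β ∩ hyp v) (hyp ℓ)) tangent) E
                  (≤-trans small (≤-reflexive (cong (λ n → n + 1 + E) (sym (+-identityʳ q))))) E-small char two low)
          where
          two : 2 ≤ size (β ∩ hyp ℓ)
          two = ≤-trans (s≤s (1≤size (remove (β ∩ hyp ℓ) iP) i′ (∈-remove (β ∩ hyp ℓ) iP i′ (∧-intro P′∈β (==-complete ℓP′)) P′≢P)))
            (≤-reflexive (sym (size-remove (β ∩ hyp ℓ) iP (∧-intro P∈β (==-complete ℓP)))))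
          use-rich : ∃[ x ] (q + 1 ≤ size (β ∩ hyp (v +ᵛ x · ℓ))) → LineThrough β P
          -- At `P′` the functional `v + x ℓ` has the value of `v`, which is nonzero, so the section
          -- is proper.
          use-rich (x , r) = recurse (v +ᵛ x · ℓ) (trans (combine-0 v ℓ x P ℓP) vP) r i′ P′∈β (λ z → vP′ (trans (sym (combine-0 v ℓ x P′ ℓP′)) z))

  line-through-tangent : ∀ β → (∀ h → 1 ≤ size (β ∩ hyp h)) → size β ≤ q + 1 + E → ∀ v {P} → P ∈ pts d → P ∈ˢ β →
    v ∙ P ≡ 𝟘 → size (β ∩ hyp v) ≤ 1 → LineThrough β P
  line-through-tangent β = line-fuel (size β) β ≤-refl

  -- The case `t = 1`: `ℓ` contains `P` but not the second point of the 2-secant `v`.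
  module Double (β : PSet) (blocking : ∀ h → 2 ≤ size (β ∩ hyp h)) (small : size β ≤ 2 * q + 1 + E)
    (v ℓ : V) {P : V} (iP : P ∈ pts d) (P∈β : P ∈ˢ β) (vP : v ∙ P ≡ 𝟘) (ℓP : ℓ ∙ P ≡ 𝟘)
    (secant : size (β ∩ hyp v) ≤ 2) (only : size (β ∩ hyp v ∩ hyp ℓ) ≤ 1) where

    private
      -- The Rédei argument asks for at most `q` points of `β` at infinity. Averaging finds such a
      -- member among the `ℓ + x v`, and on `v` it agrees with `ℓ`.
      average : ∑ Fs (λ x → size (β ∩ hyp (ℓ +ᵛ x · v))) < ∑ Fs (λ _ → suc q)
      average = begin-strict
        ∑ Fs (λ x → size (β ∩ hyp (ℓ +ᵛ x · v))) ≤⟨ m≤n+m _ (size (β ∩ hyp v)) ⟩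
        size (β ∩ hyp v) + ∑ Fs (λ x → size (β ∩ hyp (ℓ +ᵛ x · v))) ≡⟨ pencil β ℓ v ⟩
        size β + q * size (β ∩ hyp v ∩ hyp ℓ) ≤⟨ +-mono-≤ small (*-monoʳ-≤ q only) ⟩
        2 * q + 1 + E + q * 1 <⟨ ≤-reflexive (arith q E) ⟩
        3 * q + (1 + suc E) ≤⟨ +-mono-≤ (*-monoˡ-≤ q 2<q) (2+e≤ E E-small 2<q) ⟩
        q * q + q ≡⟨ trans (∑-Fs-const (suc q)) (trans (*-suc q q) (+-comm q _)) ⟨
        ∑ Fs (λ _ → suc q) ∎
        where
        open ≤-Reasoning
        arith : ∀ q E → suc (2 * q + 1 + E + q * 1) ≡ 3 * q + (1 + suc E)
        arith = semiring-solve 2 (λ q E → 1⊹ (# 2 ⋆ q ⊹ # 1 ⊹ E ⊹ q ⋆ # 1) , # 3 ⋆ q ⊹ (# 1 ⊹ 1⊹ E)) refl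
        2+e≤ : ∀ e {n} → e + e < n → 2 < n → 2 + e ≤ n
        2+e≤ zero          _  lt = ≤-trans (s≤s (s≤s z≤n)) lt
        2+e≤ (suc zero)    _  lt = lt
        2+e≤ (suc (suc e)) lt _  = ≤-trans (s≤s (s≤s (s≤s (subst (suc e ≤_) (sym (+-suc e (suc e))) (≤-trans (m≤n+m (suc e) e) (n≤1+n _)))))) lt

      abstract
       sparse : ∃[ x ] (x ∈ Fs × size (β ∩ hyp (ℓ +ᵛ x · v)) < suc q)
       sparse = ∑-pick Fs {λ x → size (β ∩ hyp (ℓ +ᵛ x · v))} {λ _ → suc q} average

      ℓ′ : V
      ℓ′ = ℓ +ᵛ proj₁ sparse · v

      ℓ′-on-v : ∀ {Z} → v ∙ Z ≡ 𝟘 → ℓ′ ∙ Z ≡ ℓ ∙ Z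
      ℓ′-on-v {Z} = combine-0 ℓ v (proj₁ sparse) Z

      only′ : size (β ∩ hyp v ∩ hyp ℓ′) ≤ 1
      only′ = ≤-trans (size-⊆ {β ∩ hyp v ∩ hyp ℓ′} {β ∩ hyp v ∩ hyp ℓ} λ Z _ e → let e′ = ∧-true {mem (β ∩ hyp v) Z} e in
        ∧-intro (proj₁ e′) (==-complete (trans (sym (ℓ′-on-v (==-sound (proj₂ (∧-true {mem β Z} (proj₁ e′)))))) (==-sound (proj₂ e′))))) only

      abstract
       rich-x : ∃[ x ] (q + 2 ≤ size (β ∩ hyp (v +ᵛ x · ℓ′)))
       rich-x = Pencil.rich β 1 blocking v ℓ′ iP P∈β vP (trans (ℓ′-on-v vP) ℓP) secant only′ E small E-small char (blocking ℓ′)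
         (s≤s⁻¹ (proj₂ (proj₂ sparse)))

      x₀ : 𝔽
      x₀ = proj₁ rich-x

    h : V
    h = v +ᵛ x₀ · ℓ′

    rich : q + 2 ≤ size (β ∩ hyp h)
    rich = proj₂ rich-x

    private
      x₀≢0 : x₀ ≢ 𝟘
      x₀≢0 e = 1+n≰n (≤-trans (s≤s (≤-trans secant (≤-trans (n≤1+n 2) 2<q))) (≤-trans (≤-trans (≤-reflexive (+-comm 1 q)) (+-monoʳ-≤ q (s≤s z≤n)))
        (≤-trans rich (≤-reflexive (cong (λ z → size (β ∩ hyp z)) (trans (cong (λ x → v +ᵛ x · ℓ′) e)
          (trans (cong (v +ᵛ_) (·-zeroˡ ℓ′)) (+ᵛ-identityʳ v))))))))

      h-on-v : ∀ {Z} → v ∙ Z ≡ 𝟘 → h ∙ Z ≡ x₀ ⊗ ℓ ∙ Z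
      h-on-v {Z} e = trans (∙-+ˡ v (x₀ · ℓ′) Z) (trans (cong₂ _⊕_ e (trans (∙-·ˡ x₀ ℓ′ Z) (cong (x₀ ⊗_) (ℓ′-on-v e)))) (⊕-identityˡ _))

      hP : h ∙ P ≡ 𝟘
      hP = trans (h-on-v vP) (trans (cong (x₀ ⊗_) ℓP) (⊗-zeroʳ x₀))

      tangent : size (β ∩ hyp h ∩ hyp v) ≤ 1
      tangent = ≤-trans (size-⊆ {β ∩ hyp h ∩ hyp v} {β ∩ hyp v ∩ hyp ℓ} λ Z _ e →
        let e′ = ∧-true {mem (β ∩ hyp h) Z} e ; e″ = ∧-true {mem β Z} (proj₁ e′) in
        ∧-intro (∧-intro (proj₁ e″) (proj₂ e′)) (==-complete (⊗-integral (trans (sym (h-on-v (==-sound (proj₂ e′)))) (==-sound (proj₂ e″))) x₀≢0))) only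

      lower : ∀ c f → (∀ x → c ≤ f x) → q * c ≤ ∑ Fs f
      lower c f le = ≤-trans (≤-reflexive (sym (∑-Fs-const c))) (∑-mono Fs le)

      β-pencil : size (β ∩ hyp h) + ∑ Fs (λ x → size (β ∩ hyp (v +ᵛ x · h))) ≤ size β + q
      β-pencil = ≤-trans (≤-reflexive (pencil β v h)) (+-monoʳ-≤ (size β) (≤-trans (*-monoʳ-≤ q tangent) (≤-reflexive (*-identityʳ q))))

      pencil-P : ∀ x → (v +ᵛ x · h) ∙ P ≡ 𝟘
      pencil-P x = trans (combine-0 v h x P hP) vP

    -- In the pencil of `h` and `v` only `P` lies on the axis; `h` has `q + 2` points and each of
    -- the other `q` hyperplanes at least two.
    size≥ : 2 * q + 2 ≤ size β
    size≥ = +-cancelʳ-≤ q _ _ (≤-trans (≤-reflexive (arith q)) (≤-trans (+-mono-≤ rich (lower 2 _ (λ x → blocking (v +ᵛ x · h)))) β-pencil))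
      where
      arith : ∀ q → 2 * q + 2 + q ≡ q + 2 + q * 2
      arith = semiring-solve 1 (λ q → # 2 ⋆ q ⊹ # 2 ⊹ q , q ⊹ # 2 ⊹ q ⋆ # 2) refl

    -- The section by `h` meets every hyperplane. It is small, since each of the `q` other members
    -- of the pencil takes two points, and `v` is tangent to it at `P`: the result for simple
    -- blocking sets applies.
    full-line : ∃[ R ] (R ∈ pts d × v ∙ R ≢ 𝟘 × Full β P R)
    full-line = use (line-through-tangent (β ∩ hyp h)
        (section-blocking β 2 blocking h (q + 2) rich (≤-<-trans small
          (subst₂ _<_ (sym (arith q E)) (arith′ q) (+-monoʳ-< (q * 2) (≤-trans (s≤s (s≤s (<⇒≤ E<q))) (≤-reflexive (+-comm 2 q)))))))
        bound v iP (∧-intro P∈β (==-complete hP)) vP tangent)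
      where
      arith : ∀ q E → 2 * q + 1 + E ≡ q * 2 + suc E
      arith = semiring-solve 2 (λ q E → # 2 ⋆ q ⊹ # 1 ⊹ E , q ⋆ # 2 ⊹ 1⊹ E) refl
      arith′ : ∀ q → q * 2 + (q + 2) ≡ q + 2 + q * 2
      arith′ = semiring-solve 1 (λ q → q ⋆ # 2 ⊹ (q ⊹ # 2) , q ⊹ # 2 ⊹ q ⋆ # 2) refl
      bound : size (β ∩ hyp h) ≤ q + 1 + E
      bound = +-cancelʳ-≤ (q * 2) _ _ (≤-trans (+-monoʳ-≤ (size (β ∩ hyp h)) (lower 2 _ (λ x → blocking (v +ᵛ x · h))))
        (≤-trans β-pencil (≤-trans (+-monoˡ-≤ q small) (≤-reflexive (arith″ q E)))))
        where
        arith″ : ∀ q E → 2 * q + 1 + E + q ≡ q + 1 + E + q * 2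
        arith″ = semiring-solve 2 (λ q E → # 2 ⋆ q ⊹ # 1 ⊹ E ⊹ q , q ⊹ # 1 ⊹ E ⊹ q ⋆ # 2) refl
      use : LineThrough (β ∩ hyp h) P → ∃[ R ] (R ∈ pts d × v ∙ R ≢ 𝟘 × Full β P R)
      use (R , iR , R∈ , R≢P , full) = R , iR
        , (λ z → R≢P (size≤1-unique (β ∩ hyp h ∩ hyp v) tangent iR iP (∧-intro R∈ (==-complete z)) (∧-intro (∧-intro P∈β (==-complete hP)) (==-complete vP))))
        , λ a b ne → proj₁ (∧-true (full a b ne))

    -- In the pencil through `h` and `v`, every hyperplane other than `h` adds at least four to the
    -- two sizes together: two and two on a 2-secant of `β`, otherwise `P` and at least three
    -- points. To this `h` adds `P` and `q + 2` points.
    partners : ∀ γ → P ∈ˢ γ → (∀ g → g ∙ P ≡ 𝟘 → size (β ∩ hyp g) ≤ 2 → 2 ≤ size (γ ∩ hyp g)) →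
      γ ⊆ β → 3 * q + 3 ≤ size γ + size β
    partners γ P∈γ closed γ⊆β = +-cancelʳ-≤ (q + q) _ _ (begin
      3 * q + 3 + (q + q) ≡⟨ arith q ⟩
      1 + (q + 2) + q * 4 ≤⟨ +-mono-≤ (+-mono-≤ (1≤size (γ ∩ hyp h) iP (∧-intro P∈γ (==-complete hP))) rich)
                                                               (≤-trans (lower 4 _ four) (≤-reflexive (∑-+ Fs _ _))) ⟩
      size (γ ∩ hyp h) + size (β ∩ hyp h) + (∑ Fs (λ x → size (γ ∩ hyp (v +ᵛ x · h))) + ∑ Fs (λ x → size (β ∩ hyp (v +ᵛ x · h))))
                                                           ≡⟨ +-interchange (size (γ ∩ hyp h)) (size (β ∩ hyp h)) _ _ ⟩
      size (γ ∩ hyp h) + ∑ Fs (λ x → size (γ ∩ hyp (v +ᵛ x · h))) + (size (β ∩ hyp h) + ∑ Fs (λ x → size (β ∩ hyp (v +ᵛ x · h))))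
                                                           ≤⟨ +-mono-≤ γ-pencil β-pencil ⟩
      size γ + q + (size β + q) ≡⟨ +-interchange (size γ) q (size β) q ⟩
      size γ + size β + (q + q) ∎)
      where
      open ≤-Reasoning
      arith : ∀ q → 3 * q + 3 + (q + q) ≡ 1 + (q + 2) + q * 4
      arith = semiring-solve 1 (λ q → # 3 ⋆ q ⊹ # 3 ⊹ (q ⊹ q) , # 1 ⊹ (q ⊹ # 2) ⊹ q ⋆ # 4) refl
      γ-pencil : size (γ ∩ hyp h) + ∑ Fs (λ x → size (γ ∩ hyp (v +ᵛ x · h))) ≤ size γ + q
      γ-pencil = ≤-trans (≤-reflexive (pencil γ v h)) (+-monoʳ-≤ (size γ) (≤-trans (*-monoʳ-≤ q (≤-trans
        (size-⊆ {γ ∩ hyp h ∩ hyp v} {β ∩ hyp h ∩ hyp v} λ Z _ e → let e′ = ∧-true {mem (γ ∩ hyp h) Z} e ; e″ = ∧-true {mem γ Z} (proj₁ e′) in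
          ∧-intro (∧-intro (γ⊆β Z (proj₁ e″)) (proj₂ e″)) (proj₂ e′)) tangent)) (≤-reflexive (*-identityʳ q))))
      four : ∀ x → 4 ≤ size (γ ∩ hyp (v +ᵛ x · h)) + size (β ∩ hyp (v +ᵛ x · h))
      four x with size (β ∩ hyp (v +ᵛ x · h)) ≤? 2
      ... | yes le = +-mono-≤ (closed (v +ᵛ x · h) (pencil-P x) le) (blocking (v +ᵛ x · h))
      ... | no gt  = +-mono-≤ (1≤size (γ ∩ hyp (v +ᵛ x · h)) iP (∧-intro P∈γ (==-complete (pencil-P x)))) (≰⇒> gt)

    -- If all `v + x h` with `x` nonzero had three points, `β` would be too large. None of them
    -- contains `T`, because on `v` the functional `h` is a nonzero multiple of `ℓ`.
    avoiding : ∀ {T} → v ∙ T ≡ 𝟘 → ℓ ∙ T ≢ 𝟘 → ∃[ g ] (g ∙ P ≡ 𝟘 × size (β ∩ hyp g) ≤ 2 × g ∙ T ≢ 𝟘)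
    -- The threshold is 3 except at `x = 0`, where `v` cannot fall below its two points; this forces
    -- the chosen `x` to be nonzero.
    avoiding {T} vT ℓT = use (∑-pick Fs {λ x → size (β ∩ hyp (v +ᵛ x · h))} {λ x → 2 + ⟦ not (x == 𝟘) ⟧}
        (+-cancelˡ-< (q + 2) _ _ (begin-strict
          q + 2 + ∑ Fs (λ x → size (β ∩ hyp (v +ᵛ x · h))) ≤⟨ +-monoˡ-≤ _ rich ⟩
          size (β ∩ hyp h) + ∑ Fs (λ x → size (β ∩ hyp (v +ᵛ x · h))) ≤⟨ β-pencil ⟩
          size β + q ≤⟨ +-monoˡ-≤ q small ⟩
          2 * q + 1 + E + q <⟨ ≤-reflexive (arith q E) ⟩
          q + 1 + q * 2 + suc E ≤⟨ +-monoʳ-≤ (q + 1 + q * 2) (≤-trans E<q (≤-reflexive (sym count-nonzero))) ⟩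
          q + 1 + q * 2 + (∑ Fs (λ x → ⟦ not (x == 𝟘) ⟧) + 1) ≡⟨ arith′ q (∑ Fs (λ x → ⟦ not (x == 𝟘) ⟧)) ⟩
          q + 2 + (q * 2 + ∑ Fs (λ x → ⟦ not (x == 𝟘) ⟧)) ≡⟨ cong (q + 2 +_) (trans (∑-+ Fs (λ _ → 2) _) (cong (_+ ∑ Fs (λ x → ⟦ not (x == 𝟘) ⟧)) (∑-Fs-const 2))) ⟨
          q + 2 + ∑ Fs (λ x → 2 + ⟦ not (x == 𝟘) ⟧) ∎)))
      where
      open ≤-Reasoning
      arith : ∀ q E → suc (2 * q + 1 + E + q) ≡ q + 1 + q * 2 + suc E
      arith = semiring-solve 2 (λ q E → 1⊹ (# 2 ⋆ q ⊹ # 1 ⊹ E ⊹ q) , q ⊹ # 1 ⊹ q ⋆ # 2 ⊹ 1⊹ E) refl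
      arith′ : ∀ q n → q + 1 + q * 2 + (n + 1) ≡ q + 2 + (q * 2 + n)
      arith′ = semiring-solve 2 (λ q n → q ⊹ # 1 ⊹ q ⋆ # 2 ⊹ (n ⊹ # 1) , q ⊹ # 2 ⊹ (q ⋆ # 2 ⊹ n)) refl
      use : ∃[ x ] (x ∈ Fs × size (β ∩ hyp (v +ᵛ x · h)) < 2 + ⟦ not (x == 𝟘) ⟧) → ∃[ g ] (g ∙ P ≡ 𝟘 × size (β ∩ hyp g) ≤ 2 × g ∙ T ≢ 𝟘)
      use (x , _ , lt) with x ≟ᶠ 𝟘
      ... | yes refl = ⊥-elim (1+n≰n (≤-trans (s≤s (blocking (v +ᵛ 𝟘 · h))) (subst (λ b → size (β ∩ hyp (v +ᵛ 𝟘 · h)) < 2 + ⟦ not b ⟧) (==-refl 𝟘) lt)))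
      ... | no x≢0 = v +ᵛ x · h , pencil-P x , s≤s⁻¹ (subst (λ b → size (β ∩ hyp (v +ᵛ x · h)) < 2 + ⟦ not b ⟧) (==-≢ x≢0) lt)
            , λ z → ⊗-≢0 x≢0 (⊗-≢0 x₀≢0 ℓT) (trans (cong (x ⊗_) (sym (h-on-v vT)))
                (trans (sym (trans (∙-+ˡ v (x · h) T) (trans (cong₂ _⊕_ vT (∙-·ˡ x h T)) (⊕-identityˡ _)))) z))

-- Projection from a 2-secant and its fibres.

module Fibres {q : ℕ} (F : FiniteField q) (d : ℕ)
  (E : ℕ) (E-small : E + E < q) (2<q : 2 < q) (char : ∀ j → 1 ≤ j → j ≤ E → Field.ℕ→𝔽 F j ≢ Field.𝟘 F) where
  open Field F
  open Vectors F hiding (d)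
  open PointSets F d
  open Lines F d E E-small 2<q char

  Θ-suc : ∀ n → Θ (suc n) ≡ 1 + q * Θ n
  Θ-suc zero = cong suc (sym (*-zeroʳ q))
  Θ-suc (suc n) = trans (cong (_+ q ^ suc n) (Θ-suc n)) (trans (+-assoc 1 (q * Θ n) _) (cong suc (sym (*-distribˡ-+ q (Θ n) (q ^ n)))))

  ev : Vec V k → V → 𝕍 k
  ev []      v = []
  ev (h ∷ φ) v = h ∙ v ∷ ev φ v

  ker-ev : ∀ (φ : Vec V k) v → mem (ker φ) v ≡ eqᵛ (ev φ v) 0ᵛ
  ker-ev []      v = refl
  ker-ev (h ∷ φ) v = cong ((h ∙ v == 𝟘) ∧_) (ker-ev φ v)

  eliminate : V → 𝕍 k → Vec V k → Vec V k
  eliminate h = zipWith (λ a g → g +ᵛ (⊖ a) · h)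

  eliminate-par : ∀ h (x : 𝕍 k) φ v → mem (ker (eliminate h x φ)) v ≡ eqᵛ (ev φ v) (h ∙ v · x)
  eliminate-par h []      []      v = refl
  eliminate-par h (a ∷ x) (g ∷ φ) v = cong₂ _∧_ (bool-ext
      (λ e → ==-complete (trans (⊕≡0⇒ (trans (sym value) (==-sound e))) (ring-solve 1 (λ z → :- (:- z) := z) refl (h ∙ v ⊗ a))))
      (λ e → ==-complete (trans value (trans (cong (_⊕ ⊖ (h ∙ v ⊗ a)) (==-sound e)) (⊖-inverseʳ _)))))
      (eliminate-par h x φ v)
    where
    value : (g +ᵛ (⊖ a) · h) ∙ v ≡ g ∙ v ⊕ ⊖ (h ∙ v ⊗ a)
    value = trans (∙-+ˡ g _ v) (cong (g ∙ v ⊕_) (trans (∙-·ˡ (⊖ a) h v) (ring-solve 2 (λ a h → (:- a) :* h := :- (h :* a)) refl a (h ∙ v))))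

  -- The common zeros of perp x φ are the vectors that φ maps into the line spanned by x.
  perp : 𝕍 (suc k) → Vec V (suc k) → Vec V k
  perp {zero}  _       _       = []
  perp {suc k} (a ∷ x) (h ∷ φ) with a == 𝟘
  ... | true  = h ∷ perp x φ
  ... | false = eliminate h x φ

  -- The one further functional that cuts the kernel of `φ` out of the fibre over `x`.
  lead : 𝕍 (suc k) → Vec V (suc k) → V
  lead {zero}  _       (h ∷ [])  = h
  lead {suc k} (a ∷ x) (h ∷ φ) with a == 𝟘
  ... | true  = lead x φ
  ... | false = h

  perp-par : ∀ {x : 𝕍 (suc k)} → Normal x → ∀ φ v → mem (ker (perp x φ)) v ≡ par x (ev φ v)
  perp-par {zero} {_ ∷ []} pivot (h ∷ []) v = sym (par-pivot [] (h ∙ v) [])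
  perp-par {suc k} {_ ∷ x} pivot (h ∷ φ) v rewrite ==-≢ 1≢0 = eliminate-par h x φ v
  perp-par {suc k} {_ ∷ x} (below n) (h ∷ φ) v rewrite ==-refl 𝟘 = cong ((h ∙ v == 𝟘) ∧_) (perp-par n φ v)

  perp-lead : ∀ {x : 𝕍 (suc k)} → Normal x → ∀ φ v → mem (ker (perp x φ)) v ∧ (lead x φ ∙ v == 𝟘) ≡ mem (ker φ) v
  perp-lead {zero} pivot (h ∷ []) v = sym (Boolₚ.∧-identityʳ _)
  perp-lead {suc k} {_ ∷ x} (below n) (h ∷ φ) v rewrite ==-refl 𝟘 = trans (Boolₚ.∧-assoc (h ∙ v == 𝟘) _ _) (cong ((h ∙ v == 𝟘) ∧_) (perp-lead n φ v))
  perp-lead {suc k} {_ ∷ x} pivot (h ∷ φ) v rewrite ==-≢ 1≢0 = trans (Boolₚ.∧-comm (mem (ker (eliminate h x φ)) v) _) (guarded (true? (h ∙ v == 𝟘)))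
    where
    guarded : (h ∙ v == 𝟘) ≡ true ⊎ (h ∙ v == 𝟘) ≡ false → (h ∙ v == 𝟘) ∧ mem (ker (eliminate h x φ)) v ≡ (h ∙ v == 𝟘) ∧ mem (ker φ) v
    guarded (inj₂ e) rewrite e = refl
    guarded (inj₁ e) = cong ((h ∙ v == 𝟘) ∧_) (trans (eliminate-par h x φ v) (trans (cong (eqᵛ (ev φ v)) (trans (cong (_· x) (==-sound e)) (·-zeroˡ x))) (sym (ker-ev φ v))))

  Blocks : ℕ → (k : ℕ) → PSet → Set
  Blocks t k β = ∀ (φ : Vec V k) → t ≤ size (β ∩ ker φ)

  -- A vector off the kernel is mapped to one point and lies in one fibre; a vector of the kernel
  -- lies in all of them.
  fibre-sum : ∀ β (φ : Vec V (suc k)) →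
    ∑ (pts (suc k)) (λ x → size (β ∩ ker (perp x φ))) + size (β ∩ ker φ) ≡ size β + Θ (suc k) * size (β ∩ ker φ)
  fibre-sum {k} β φ = begin
    ∑ (pts (suc k)) (λ x → size (β ∩ ker (perp x φ))) + size (β ∩ ker φ) ≡⟨ cong (_+ size (β ∩ ker φ)) (∑-swap (pts (suc k)) (pts d) _) ⟩
    ∑ (pts d) (λ v → ∑ (pts (suc k)) (λ x → ⟦ mem β v ∧ mem (ker (perp x φ)) v ⟧)) + size (β ∩ ker φ) ≡⟨ ∑-+ (pts d) _ _ ⟨
    ∑ (pts d) (λ v → ∑ (pts (suc k)) (λ x → ⟦ mem β v ∧ mem (ker (perp x φ)) v ⟧) + ⟦ mem (β ∩ ker φ) v ⟧) ≡⟨ ∑-cong (pts d) pointwise ⟩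
    ∑ (pts d) (λ v → ⟦ mem β v ⟧ + Θ (suc k) * ⟦ mem (β ∩ ker φ) v ⟧) ≡⟨ trans (∑-+ (pts d) _ _) (cong (size β +_) (∑-*ˡ (pts d) (Θ (suc k)) _)) ⟩
    size β + Θ (suc k) * size (β ∩ ker φ) ∎
    where
    open ≡-Reasoning
    pointwise : ∀ v → ∑ (pts (suc k)) (λ x → ⟦ mem β v ∧ mem (ker (perp x φ)) v ⟧) + ⟦ mem (β ∩ ker φ) v ⟧ ≡ ⟦ mem β v ⟧ + Θ (suc k) * ⟦ mem (β ∩ ker φ) v ⟧
    pointwise v = by-member (mem β v)
      where
      count : ∑ (pts (suc k)) (λ x → ⟦ mem (ker (perp x φ)) v ⟧) + ⟦ mem (ker φ) v ⟧ ≡ 1 + Θ (suc k) * ⟦ mem (ker φ) v ⟧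
      count = trans (cong₂ _+_ (∑-cong-∈ (pts (suc k)) (λ x i → cong ⟦_⟧ (perp-par (normal i) φ v))) (cong ⟦_⟧ (ker-ev φ v)))
        (trans (value (ev φ v)) (cong (λ b → 1 + Θ (suc k) * ⟦ b ⟧) (sym (ker-ev φ v))))
        where
        value : ∀ z → ∑ (pts (suc k)) (λ x → ⟦ par x z ⟧) + ⟦ eqᵛ z 0ᵛ ⟧ ≡ 1 + Θ (suc k) * ⟦ eqᵛ z 0ᵛ ⟧
        value z with z ≟ᵛ 0ᵛ
        ... | yes refl rewrite eqᵛ-refl {suc k} 0ᵛ = trans (cong (_+ 1) (∑-par-0 (suc k))) (trans (+-comm _ 1) (cong suc (sym (*-identityʳ _))))
        ... | no n rewrite ≢true {eqᵛ z 0ᵛ} (n ∘ eqᵛ-sound) = trans (cong (_+ 0) (∑-par z n)) (cong suc (sym (*-zeroʳ (Θ (suc k)))))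
      by-member : ∀ b → ∑ (pts (suc k)) (λ x → ⟦ b ∧ mem (ker (perp x φ)) v ⟧) + ⟦ b ∧ mem (ker φ) v ⟧ ≡ ⟦ b ⟧ + Θ (suc k) * ⟦ b ∧ mem (ker φ) v ⟧
      by-member true  = count
      by-member false = trans (+-identityʳ _) (trans (∑-0 (pts (suc k))) (sym (*-zeroʳ (Θ (suc k)))))

  -- The line joining `Y` and `R`, without its point `R`, lies in `β`.
  lineᵇ : PSet → V → V → Bool
  lineᵇ β R Y = ∑ Fs (λ a → ⟦ not (mem β (Y +ᵛ a · R)) ⟧) ≡ᵇ 0

  lineᵇ-sound : ∀ β R Y → lineᵇ β R Y ≡ true → ∀ a → Y +ᵛ a · R ∈ˢ β
  lineᵇ-sound β R Y e a with true? (mem β (Y +ᵛ a · R))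
  ... | inj₁ p = p
  ... | inj₂ p = ⊥-elim (1+n≰n (≤-trans (subst (_≤ ∑ Fs (λ a → ⟦ not (mem β (Y +ᵛ a · R)) ⟧)) (cong (λ b → ⟦ not b ⟧) p)
          (∑-∈ (λ a → ⟦ not (mem β (Y +ᵛ a · R)) ⟧) (∈-Fs a))) (≤-reflexive (≡ᵇ⇒≡ _ 0 (subst T (sym e) tt)))))
    where
    open import Data.Bool using (T)
    open import Data.Unit using (tt)

  lineᵇ-complete : ∀ β R Y → (∀ a → Y +ᵛ a · R ∈ˢ β) → lineᵇ β R Y ≡ true
  lineᵇ-complete β R Y f rewrite ∑-none Fs {λ a → not (mem β (Y +ᵛ a · R))} (λ a _ → cong not (f a)) = refl

  lineᵇ-self : ∀ β R Y → lineᵇ β R Y ≡ true → Y ∈ˢ β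
  lineᵇ-self β R Y e = subst (_∈ˢ β) (trans (cong (Y +ᵛ_) (·-zeroˡ R)) (+ᵛ-identityʳ Y)) (lineᵇ-sound β R Y e 𝟘)

  Secant : PSet → Vec V k → V → Set
  Secant β φ P = mem (ker φ) P ≡ true × size (β ∩ ker φ) ≤ 2

  Essential : (k : ℕ) → PSet → V → Set
  Essential k β P = ∃[ φ ] (Secant {k} β φ P)

  ker-∷ : ∀ β (φ : Vec V k) h → size (β ∩ ker φ ∩ hyp h) ≡ size (β ∩ ker (h ∷ φ))
  ker-∷ β φ h = size-cong {β ∩ ker φ ∩ hyp h} {β ∩ ker (h ∷ φ)} (λ v → trans (Boolₚ.∧-assoc (mem β v) _ _) (cong (mem β v ∧_) (Boolₚ.∧-comm (mem (ker φ) v) _)))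

  -- The spaces of one dimension more through the 2-secant `ker φ`. In each of them `β` is a double
  -- blocking set with respect to hyperplanes, and `ker φ` is a hyperplane with two points.
  module Fan (j : ℕ) (β : PSet) (blocking : Blocks 2 (suc j) β) {P : V} (iP : P ∈ pts d) (P∈β : P ∈ˢ β)
    (φ : Vec V (suc j)) (secant : Secant β φ P) where

    private
      kerP = proj₁ secant
      two = proj₂ secant
      K = suc j

      mate : ∃[ R ] (R ∈ pts d × R ∈ˢ β ∩ ker φ × R ≢ P)
      mate = second (β ∩ ker φ) iP (blocking φ)

    P₂ : V
    P₂ = proj₁ mate

    iP₂ : P₂ ∈ pts d
    iP₂ = proj₁ (proj₂ mate)

    P₂∈ : P₂ ∈ˢ β ∩ ker φ
    P₂∈ = proj₁ (proj₂ (proj₂ mate))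

    P₂≢P : P₂ ≢ P
    P₂≢P = proj₂ (proj₂ (proj₂ mate))

    fibre : 𝕍 K → PSet
    fibre x = β ∩ ker (perp x φ)

    Good : 𝕍 K → Set
    Good x = size (fibre x) ≤ 2 * q + 1 + E

    fibre-blocking : ∀ x h → 2 ≤ size (fibre x ∩ hyp h)
    fibre-blocking x h = subst (2 ≤_) (sym (ker-∷ β (perp x φ) h)) (blocking (h ∷ perp x φ))

    fibre-lead : ∀ {x} → x ∈ pts K → ∀ v → mem (fibre x ∩ hyp (lead x φ)) v ≡ mem (β ∩ ker φ) v
    fibre-lead i v = trans (Boolₚ.∧-assoc (mem β v) _ _) (cong (mem β v ∧_) (perp-lead (normal i) φ v))

    kerφ⇒fibre : ∀ {x} → x ∈ pts K → ∀ {v} → mem (ker φ) v ≡ true → mem (ker (perp x φ)) v ≡ true × lead x φ ∙ v ≡ 𝟘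
    kerφ⇒fibre {x} i {v} e with ∧-true {mem (ker (perp x φ)) v} (trans (perp-lead (normal i) φ v) e)
    ... | a , b = a , ==-sound b

    P∈fibre : ∀ {x} → x ∈ pts K → P ∈ˢ fibre x
    P∈fibre i = ∧-intro P∈β (proj₁ (kerφ⇒fibre i kerP))

    abstract
      ℓ-exists : ∃[ ℓ ] (ℓ ∙ P ≡ 𝟘 × ℓ ∙ P₂ ≢ 𝟘)
      ℓ-exists = functional-at (pts-indep iP iP₂ P₂≢P)

    -- `ℓ` stays a parameter because moving a secant off a point `T` requires an `ℓ` that does not
    -- vanish at `T` either.
    module Good-fibre (ℓ : V) (ℓP : ℓ ∙ P ≡ 𝟘) (ℓP₂ : ℓ ∙ P₂ ≢ 𝟘) {x : 𝕍 K} (i : x ∈ pts K) (good : Good x) =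
      Double (fibre x) (fibre-blocking x) good (lead x φ) ℓ iP (P∈fibre i) (proj₂ (kerφ⇒fibre i kerP)) ℓP
        (≤-trans (≤-reflexive (size-cong {fibre x ∩ hyp (lead x φ)} {β ∩ ker φ} (fibre-lead i))) two)
        (≤-trans (size-⊆ {fibre x ∩ hyp (lead x φ) ∩ hyp ℓ} {remove (β ∩ ker φ) iP₂} (λ Z iZ e →
            ∈-remove (β ∩ ker φ) iP₂ iZ (trans (sym (fibre-lead i Z)) (proj₁ (∧-true {mem (fibre x ∩ hyp (lead x φ)) Z} e)))
              (λ Z≡P₂ → ℓP₂ (trans (cong (ℓ ∙_) (sym Z≡P₂)) (==-sound (proj₂ (∧-true {mem (fibre x ∩ hyp (lead x φ)) Z} e)))))))
          (s≤s⁻¹ (≤-trans (≤-reflexive (sym (size-remove (β ∩ ker φ) iP₂ P₂∈))) two)))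

    private
      ℓ₀ = proj₁ ℓ-exists
      module G₀ {x : 𝕍 K} (i : x ∈ pts K) (good : Good x) = Good-fibre ℓ₀ (proj₁ (proj₂ ℓ-exists)) (proj₂ (proj₂ ℓ-exists)) i good

    good? : ∀ x → Good x ⊎ 2 * q + 2 + E ≤ size (fibre x)
    good? x with size (fibre x) ≤? 2 * q + 1 + E
    ... | yes le = inj₁ le
    ... | no gt  = inj₂ (≤-trans (≤-reflexive (arith q E)) (≰⇒> gt))
      where
      arith : ∀ q E → 2 * q + 2 + E ≡ suc (2 * q + 1 + E)
      arith = semiring-solve 2 (λ q E → # 2 ⋆ q ⊹ # 2 ⊹ E , 1⊹ (# 2 ⋆ q ⊹ # 1 ⊹ E)) refl

    fibre≥ : ∀ {x} → x ∈ pts K → 2 * q + 2 ≤ size (fibre x)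
    fibre≥ {x} i with good? x
    ... | inj₁ g  = G₀.size≥ i g
    ... | inj₂ le = ≤-trans (m≤m+n _ E) le

    kerφ-size : size (β ∩ ker φ) ≡ 2
    kerφ-size = ≤-antisym two (blocking φ)

    fibres-total : ∑ (pts K) (λ x → size (fibre x)) + 2 ≡ size β + Θ K * 2
    fibres-total = subst (λ n → ∑ (pts K) (λ x → size (fibre x)) + n ≡ size β + Θ K * n) kerφ-size (fibre-sum β φ)

    ∑-pts-const : ∀ c → ∑ (pts K) (λ _ → c) ≡ Θ K * c
    ∑-pts-const c = trans (∑-const (pts K) c) (cong (_* c) (trans (sym (∑-1 (pts K))) (∑-pts-1 K)))

    -- A lower bound for sets that contain `P` and its partner on every 2-secant. The weight `G`
    -- balances two kinds of fibres. A good one has at least `3 q + 3` points of `γ` and `β`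
    -- together. In a bad one `γ` may have only two points, but `β` has `E` points more than the
    -- minimum `2 q + 2`, and `q ≤ G E + 1` makes up for the loss.
    partner-bound : ∀ G → 1 ≤ G → q ≤ G * E + 1 → ∀ γ → γ ⊆ β → P ∈ˢ γ →
      (∀ (χ : Vec V K) → Secant β χ P → 2 ≤ size (γ ∩ ker χ)) → Θ K * q + 2 + G * (2 * Θ (suc K)) ≤ size γ + G * size β + Θ K
    partner-bound (suc G) _ qGE γ γ⊆β P∈γ closed = +-cancelʳ-≤ (Θ K * 2 + suc G * (Θ K * 2)) _ _ (begin
        Θ K * q + 2 + suc G * (2 * Θ (suc K)) + (Θ K * 2 + suc G * (Θ K * 2)) ≡⟨ cong (λ n → Θ K * q + 2 + suc G * (2 * n) + (Θ K * 2 + suc G * (Θ K * 2))) (Θ-suc K) ⟩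
        Θ K * q + 2 + suc G * (2 * (1 + q * Θ K)) + (Θ K * 2 + suc G * (Θ K * 2)) ≡⟨ arith (Θ K) q G ⟩
        Θ K * (suc G * (2 * q + 2) + q + 1) + 2 + suc G * 2 + Θ K ≤⟨ +-monoˡ-≤ (Θ K) (+-monoˡ-≤ (suc G * 2) (+-monoˡ-≤ 2 per-fibre)) ⟩
        ∑ (pts K) (λ x → size (γ ∩ ker (perp x φ))) + suc G * ∑ (pts K) (λ x → size (fibre x)) + 2 + suc G * 2 + Θ K
                                                                                           ≡⟨ arith′ (∑ (pts K) (λ x → size (γ ∩ ker (perp x φ)))) (∑ (pts K) (λ x → size (fibre x))) G (Θ K) ⟩
        ∑ (pts K) (λ x → size (γ ∩ ker (perp x φ))) + 2 + suc G * (∑ (pts K) (λ x → size (fibre x)) + 2) + Θ K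
                                                                                           ≡⟨ cong₂ (λ a b → a + suc G * b + Θ K) γ-total fibres-total ⟩
        size γ + Θ K * 2 + suc G * (size β + Θ K * 2) + Θ K ≡⟨ arith″ (size γ) (size β) (Θ K) G ⟩
        size γ + suc G * size β + Θ K + (Θ K * 2 + suc G * (Θ K * 2)) ∎)
      where
      open ≤-Reasoning
      arith = semiring-solve 3 (λ t q G → t ⋆ q ⊹ # 2 ⊹ 1⊹ G ⋆ (# 2 ⋆ (# 1 ⊹ q ⋆ t)) ⊹ (t ⋆ # 2 ⊹ 1⊹ G ⋆ (t ⋆ # 2)) , t ⋆ (1⊹ G ⋆ (# 2 ⋆ q ⊹ # 2) ⊹ q ⊹ # 1) ⊹ # 2 ⊹ 1⊹ G ⋆ # 2 ⊹ t) refl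
      arith′ = semiring-solve 4 (λ a b G t → a ⊹ 1⊹ G ⋆ b ⊹ # 2 ⊹ 1⊹ G ⋆ # 2 ⊹ t , a ⊹ # 2 ⊹ 1⊹ G ⋆ (b ⊹ # 2) ⊹ t) refl
      arith″ = semiring-solve 4 (λ c b t G → c ⊹ t ⋆ # 2 ⊹ 1⊹ G ⋆ (b ⊹ t ⋆ # 2) ⊹ t , c ⊹ 1⊹ G ⋆ b ⊹ t ⊹ (t ⋆ # 2 ⊹ 1⊹ G ⋆ (t ⋆ # 2))) refl
      γ-two : size (γ ∩ ker φ) ≡ 2
      γ-two = ≤-antisym (≤-trans (∩-mono {γ} {β} {ker φ} γ⊆β) two) (closed φ secant)
      γ-total : ∑ (pts K) (λ x → size (γ ∩ ker (perp x φ))) + 2 ≡ size γ + Θ K * 2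
      γ-total = subst (λ n → ∑ (pts K) (λ x → size (γ ∩ ker (perp x φ))) + n ≡ size γ + Θ K * n) γ-two (fibre-sum γ φ)
      one-fibre : ∀ x → x ∈ pts K → suc G * (2 * q + 2) + q + 1 ≤ size (γ ∩ ker (perp x φ)) + suc G * size (fibre x)
      one-fibre x i with good? x
      ... | inj₁ g = begin
        suc G * (2 * q + 2) + q + 1 ≡⟨ split G q ⟩
        3 * q + 3 + G * (2 * q + 2) ≤⟨ +-mono-≤ (G₀.partners i g (γ ∩ ker (perp x φ)) (∧-intro P∈γ (proj₁ (kerφ⇒fibre i kerP))) closed′
                                                                                 (λ v e → ∧-intro (γ⊆β v (proj₁ (∧-true e))) (proj₂ (∧-true {mem γ v} e))))
                                                                               (*-monoʳ-≤ G (fibre≥ i)) ⟩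
        size (γ ∩ ker (perp x φ)) + size (fibre x) + G * size (fibre x) ≡⟨ +-assoc (size (γ ∩ ker (perp x φ))) _ _ ⟩
        size (γ ∩ ker (perp x φ)) + suc G * size (fibre x) ∎
        where
        split = semiring-solve 2 (λ G q → 1⊹ G ⋆ (# 2 ⋆ q ⊹ # 2) ⊹ q ⊹ # 1 , # 3 ⋆ q ⊹ # 3 ⊹ G ⋆ (# 2 ⋆ q ⊹ # 2)) refl
        closed′ : ∀ g → g ∙ P ≡ 𝟘 → size (fibre x ∩ hyp g) ≤ 2 → 2 ≤ size (γ ∩ ker (perp x φ) ∩ hyp g)
        closed′ g gP le = subst (2 ≤_) (sym (ker-∷ γ (perp x φ) g)) (closed (g ∷ perp x φ)
          (∧-intro (==-complete gP) (proj₁ (kerφ⇒fibre i kerP)) , ≤-trans (≤-reflexive (sym (ker-∷ β (perp x φ) g))) le))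
      ... | inj₂ big = begin
        suc G * (2 * q + 2) + q + 1 ≡⟨ +-assoc (suc G * (2 * q + 2)) q 1 ⟩
        suc G * (2 * q + 2) + (q + 1) ≤⟨ +-monoʳ-≤ (suc G * (2 * q + 2)) (+-monoˡ-≤ 1 qGE) ⟩
        suc G * (2 * q + 2) + (suc G * E + 1 + 1) ≡⟨ split G q E ⟩
        2 + suc G * (2 * q + 2 + E) ≤⟨ +-mono-≤ γ-two≤ (*-monoʳ-≤ (suc G) big) ⟩
        size (γ ∩ ker (perp x φ)) + suc G * size (fibre x) ∎
        where
        split = semiring-solve 3 (λ G q E → 1⊹ G ⋆ (# 2 ⋆ q ⊹ # 2) ⊹ (1⊹ G ⋆ E ⊹ # 1 ⊹ # 1) , # 2 ⊹ 1⊹ G ⋆ (# 2 ⋆ q ⊹ # 2 ⊹ E)) refl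
        γ-two≤ : 2 ≤ size (γ ∩ ker (perp x φ))
        γ-two≤ = ≤-trans (≤-reflexive (sym γ-two)) (size-⊆ {γ ∩ ker φ} {γ ∩ ker (perp x φ)}
          (λ v _ e → ∧-intro (proj₁ (∧-true e)) (proj₁ (kerφ⇒fibre i (proj₂ (∧-true {mem γ v} e))))))
      per-fibre : Θ K * (suc G * (2 * q + 2) + q + 1) ≤ ∑ (pts K) (λ x → size (γ ∩ ker (perp x φ))) + suc G * ∑ (pts K) (λ x → size (fibre x))
      per-fibre = begin
        Θ K * (suc G * (2 * q + 2) + q + 1) ≡⟨ ∑-pts-const _ ⟨
        ∑ (pts K) (λ _ → suc G * (2 * q + 2) + q + 1) ≤⟨ ∑-mono-∈ (pts K) one-fibre ⟩
        ∑ (pts K) (λ x → size (γ ∩ ker (perp x φ)) + suc G * size (fibre x)) ≡⟨ trans (∑-+ (pts K) _ _) (cong (∑ (pts K) (λ x → size (γ ∩ ker (perp x φ))) +_) (∑-*ˡ (pts K) (suc G) _)) ⟩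
        _ ∎

    goodᵇ : 𝕍 K → Bool
    goodᵇ x = does (size (fibre x) ≤? 2 * q + 1 + E)

    goodᵇ-sound : ∀ x → goodᵇ x ≡ true → Good x
    goodᵇ-sound x = does-true (size (fibre x) ≤? 2 * q + 1 + E)

    goodᵇ-not : ∀ x → goodᵇ x ≡ false → 2 * q + 2 + E ≤ size (fibre x)
    goodᵇ-not x e with good? x
    ... | inj₂ b = b
    ... | inj₁ g = ⊥-elim (does-false (size (fibre x) ≤? 2 * q + 1 + E) e g)

    -- Every fibre has at least `2 q + 2` points, and a bad one `E` more.
    bad-count : E * ∑ (pts K) (λ x → ⟦ not (goodᵇ x) ⟧) + 2 * Θ (suc K) ≤ size β
    bad-count = +-cancelʳ-≤ (Θ K * 2) _ _ (begin
      E * b + 2 * Θ (suc K) + Θ K * 2 ≡⟨ cong (λ n → E * b + 2 * n + Θ K * 2) (Θ-suc K) ⟩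
      E * b + 2 * (1 + q * Θ K) + Θ K * 2 ≡⟨ arith (E * b) q (Θ K) ⟩
      Θ K * (2 * q + 2) + E * b + 2 ≡⟨ cong (_+ 2) (trans (∑-+ (pts K) _ _) (cong₂ _+_ (∑-pts-const (2 * q + 2)) (∑-*ˡ (pts K) E _))) ⟨
      ∑ (pts K) (λ x → 2 * q + 2 + E * ⟦ not (goodᵇ x) ⟧) + 2 ≤⟨ +-monoˡ-≤ 2 (∑-mono-∈ (pts K) pointwise) ⟩
      ∑ (pts K) (λ x → size (fibre x)) + 2 ≡⟨ fibres-total ⟩
      size β + Θ K * 2 ∎)
      where
      open ≤-Reasoning
      b = ∑ (pts K) (λ x → ⟦ not (goodᵇ x) ⟧)
      arith = semiring-solve 3 (λ e q t → e ⊹ # 2 ⋆ (# 1 ⊹ q ⋆ t) ⊹ t ⋆ # 2 , t ⋆ (# 2 ⋆ q ⊹ # 2) ⊹ e ⊹ # 2) refl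
      pointwise : ∀ x → x ∈ pts K → 2 * q + 2 + E * ⟦ not (goodᵇ x) ⟧ ≤ size (fibre x)
      pointwise x i with true? (goodᵇ x)
      ... | inj₁ e rewrite e = ≤-trans (≤-reflexive (trans (cong (2 * q + 2 +_) (*-zeroʳ E)) (+-identityʳ _))) (fibre≥ i)
      ... | inj₂ e = ≤-trans (≤-reflexive (cong (λ b → 2 * q + 2 + E * ⟦ not b ⟧) e)) (≤-trans (≤-reflexive (cong (2 * q + 2 +_) (*-identityʳ E))) (goodᵇ-not x e))

    double : 2 * Θ (suc K) ≤ size β
    double = ≤-trans (m≤n+m (2 * Θ (suc K)) (E * ∑ (pts K) (λ x → ⟦ not (goodᵇ x) ⟧))) bad-count

    good-exists : size β < 2 * Θ (suc K) + E * Θ K → ∃[ x ] (x ∈ pts K × goodᵇ x ≡ true)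
    good-exists lt with search (pts K) {λ x → goodᵇ x ≡ true} {λ x → goodᵇ x ≡ false} (λ x _ → true? (goodᵇ x))
    ... | inj₁ r = r
    ... | inj₂ none = ⊥-elim (1+n≰n (≤-trans lt (≤-trans (≤-reflexive (trans (+-comm (2 * Θ (suc K)) _) (cong (λ n → E * n + 2 * Θ (suc K))
            (sym (trans (∑-cong-∈ (pts K) (λ x i → cong (λ b → ⟦ not b ⟧) (none x i))) (∑-pts-1 K)))))) bad-count)))

    -- This makes it possible to delete `T` without creating new 2-secant points: a 2-secant of what
    -- remains can be chosen off `T`.
    secant-avoiding : size β < 2 * Θ (suc K) + E * Θ K → ∀ {T} → T ∈ pts d → T ≢ P → mem (ker φ) T ≡ true →
      ∃[ χ ] (Secant {K} β χ P × mem (ker χ) T ≡ false)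
    secant-avoiding lt {T} iT T≢P kerT = use (functional-at₂ (pts-indep iP iP₂ P₂≢P) (pts-indep iP iT T≢P)) (good-exists lt)
      where
      use : ∃[ ℓ ] (ℓ ∙ P ≡ 𝟘 × ℓ ∙ P₂ ≢ 𝟘 × ℓ ∙ T ≢ 𝟘) → ∃[ x ] (x ∈ pts K × goodᵇ x ≡ true) → ∃[ χ ] (Secant {K} β χ P × mem (ker χ) T ≡ false)
      use (ℓ , ℓP , ℓP₂ , ℓT) (x , i , g) = finish (Good-fibre.avoiding ℓ ℓP ℓP₂ i (goodᵇ-sound x g) (proj₂ (kerφ⇒fibre i kerT)) ℓT)
        where
        finish : ∃[ g ] (g ∙ P ≡ 𝟘 × size (fibre x ∩ hyp g) ≤ 2 × g ∙ T ≢ 𝟘) → ∃[ χ ] (Secant {K} β χ P × mem (ker χ) T ≡ false)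
        finish (g , gP , le , gT) = g ∷ perp x φ , (∧-intro (==-complete gP) (proj₁ (kerφ⇒fibre i kerP)) ,
          ≤-trans (≤-reflexive (sym (ker-∷ β (perp x φ) g))) le) , cong (_∧ mem (ker (perp x φ)) T) (==-≢ gT)

    -- Each good fibre contributes a line of β through P, with q further points.
    lines-through : Θ K * q ≤ ∑ (pts d) (λ Y → ⟦ lineᵇ β P Y ⟧) + q * ∑ (pts K) (λ x → ⟦ not (goodᵇ x) ⟧)
    lines-through = begin
      Θ K * q ≡⟨ ∑-pts-const q ⟨
      ∑ (pts K) (λ _ → q) ≤⟨ ∑-mono-∈ (pts K) one-fibre ⟩
      ∑ (pts K) (λ x → ∑ (pts d) (λ Y → ⟦ counted x Y ⟧) + q * ⟦ not (goodᵇ x) ⟧) ≡⟨ trans (∑-+ (pts K) _ _) (cong₂ _+_ (∑-swap (pts K) (pts d) _) (∑-*ˡ (pts K) q _)) ⟩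
      ∑ (pts d) (λ Y → ∑ (pts K) (λ x → ⟦ counted x Y ⟧)) + q * _ ≤⟨ +-monoˡ-≤ _ (∑-mono (pts d) once) ⟩
      ∑ (pts d) (λ Y → ⟦ lineᵇ β P Y ⟧) + q * _ ∎
      where
      open ≤-Reasoning
      counted : 𝕍 K → V → Bool
      -- Points of `ker φ` lie in every fibre and are left out, so that each `Y` is counted only
      -- once.
      counted x Y = lineᵇ β P Y ∧ (mem (ker (perp x φ)) Y ∧ not (mem (ker φ) Y))
      once : ∀ Y → ∑ (pts K) (λ x → ⟦ counted x Y ⟧) ≤ ⟦ lineᵇ β P Y ⟧
      once Y with lineᵇ β P Y
      ... | false = ≤-reflexive (∑-0 (pts K))
      ... | true with true? (mem (ker φ) Y)
      ...   | inj₁ e rewrite e = ≤-trans (≤-reflexive (trans (∑-cong (pts K) (λ x → cong ⟦_⟧ (Boolₚ.∧-zeroʳ (mem (ker (perp x φ)) Y)))) (∑-0 (pts K)))) z≤n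
      ...   | inj₂ e rewrite e = ≤-reflexive (trans (∑-cong-∈ (pts K) (λ x i → cong ⟦_⟧ (trans (Boolₚ.∧-identityʳ _) (perp-par (normal i) φ Y))))
                (∑-par (ev φ Y) (λ z → false≢true e (trans (ker-ev φ Y) (eqᵛ-complete z)))))
      one-fibre : ∀ x → x ∈ pts K → q ≤ ∑ (pts d) (λ Y → ⟦ counted x Y ⟧) + q * ⟦ not (goodᵇ x) ⟧
      one-fibre x i with true? (goodᵇ x)
      ... | inj₂ e = ≤-trans (≤-reflexive (sym (trans (cong (λ b → q * ⟦ not b ⟧) e) (*-identityʳ q)))) (m≤n+m _ (∑ (pts d) (λ Y → ⟦ counted x Y ⟧)))
      ... | inj₁ e = ≤-trans (from-line (G₀.full-line i (goodᵇ-sound x e))) (m≤m+n _ _)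
        where
        v = lead x φ
        from-line : ∃[ R ] (R ∈ pts d × v ∙ R ≢ 𝟘 × Full (fibre x) P R) → q ≤ ∑ (pts d) (λ Y → ⟦ counted x Y ⟧)
        from-line (R , iR , vR , full) = ≤-trans (≤-reflexive (sym (trans (∑-1 Fs) length-Fs)))
          (∑-inject Fs (pts d) (λ _ → true) (λ Y → ⟦ counted x Y ⟧) (λ a Y → par Y (R +ᵛ a · P)) (λ a _ _ → ∑-par _ (nonzero a)) at-most)
          where
          v-value : ∀ a → v ∙ (R +ᵛ a · P) ≡ v ∙ R
          v-value a = trans (∙-+ʳ v R (a · P)) (trans (cong (v ∙ R ⊕_) (trans (∙-·ʳ a v P) (trans (cong (a ⊗_) (proj₂ (kerφ⇒fibre i kerP))) (⊗-zeroʳ a)))) (⊕-identityʳ _))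
          nonzero : ∀ a → R +ᵛ a · P ≢ 0ᵛ
          nonzero a z = vR (trans (sym (v-value a)) (trans (cong (v ∙_) z) (∙-0ʳ v)))
          on-line : ∀ a → R +ᵛ a · P ∈ˢ fibre x
          on-line a = subst (_∈ˢ fibre x) (trans (cong (a · P +ᵛ_) (·-identity R)) (+ᵛ-comm _ R))
            (full a 𝟙 (λ z → nonzero a (trans (+ᵛ-comm R _) (trans (cong (a · P +ᵛ_) (sym (·-identity R))) z))))
          at-most : ∀ Y → Y ∈ pts d → ∑ Fs (λ a → ⟦ par Y (R +ᵛ a · P) ⟧) ≤ ⟦ counted x Y ⟧
          at-most Y iY = ∑-unique Fs _==_ (λ y → ≤-reflexive (∑-Fs-δ y)) (λ a → par Y (R +ᵛ a · P))
              (λ a b _ _ ea eb → ==-complete (same a b (par-sound (normal iY) ea) (par-sound (normal iY) eb)))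
              ⟦ counted x Y ⟧ (λ a _ ea → ≤-reflexive (cong ⟦_⟧ (sym (is-counted a (par-sound (normal iY) ea)))))
            where
            same : ∀ a b → ∃[ c ] (R +ᵛ a · P ≡ c · Y) → ∃[ c ] (R +ᵛ b · P ≡ c · Y) → a ≡ b
            same a b (c , e) (c′ , e′) = difference (trans e (trans (cong (_· Y) c≡c′) (sym e′)))
              where
              cY : ∀ a c → R +ᵛ a · P ≡ c · Y → c ⊗ v ∙ Y ≡ v ∙ R
              cY a c e = trans (sym (∙-·ʳ c v Y)) (trans (cong (v ∙_) (sym e)) (v-value a))
              c≡c′ : c ≡ c′
              c≡c′ = ⊗-cancelˡ (λ z → vR (trans (sym (cY a c e)) (trans (cong (c ⊗_) z) (⊗-zeroʳ c))))
                (trans (⊗-comm _ c) (trans (cY a c e) (trans (sym (cY b c′ e′)) (⊗-comm c′ _))))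
              difference : R +ᵛ a · P ≡ R +ᵛ b · P → a ≡ b
              difference r with detect P
              ... | inj₁ z = ⊥-elim (normal-≢0 (normal iP) z)
              ... | inj₂ (g , gP) = ⊗-cancelˡ gP (trans (⊗-comm _ a) (trans (cancelled a b (trans (sym (value a)) (trans (cong (g ∙_) r) (value b)))) (⊗-comm b _)))
                where
                value : ∀ a → g ∙ (R +ᵛ a · P) ≡ g ∙ R ⊕ a ⊗ g ∙ P
                value a = trans (∙-+ʳ g R (a · P)) (cong (g ∙ R ⊕_) (∙-·ʳ a g P))
                cancelled : ∀ a b → g ∙ R ⊕ a ⊗ g ∙ P ≡ g ∙ R ⊕ b ⊗ g ∙ P → a ⊗ g ∙ P ≡ b ⊗ g ∙ P
                cancelled a b e = trans (ring-solve 2 (λ r x → x := (r :+ x) :- r) refl (g ∙ R) (a ⊗ g ∙ P)) (trans (cong (_⊕ ⊖ g ∙ R) e)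
                  (ring-solve 2 (λ r x → (r :+ x) :- r := x) refl (g ∙ R) (b ⊗ g ∙ P)))
            is-counted : ∀ a → ∃[ c ] (R +ᵛ a · P ≡ c · Y) → counted x Y ≡ true
            is-counted a (c , e) = ∧-intro (lineᵇ-complete β P Y on-β) (∧-intro (proj₂ (∧-true {mem β Y} Y∈)) (not-false (≢true λ kerY →
                vR (trans (sym (v-value a)) (trans (cong (v ∙_) e) (trans (∙-·ʳ c v Y) (trans (cong (c ⊗_) (proj₂ (kerφ⇒fibre i kerY))) (⊗-zeroʳ c))))))))
              where
              c≢0 : c ≢ 𝟘
              c≢0 z = nonzero a (trans e (trans (cong (_· Y) z) (·-zeroˡ Y)))
              Y∈ : Y ∈ˢ fibre x
              Y∈ = trans (sym (inv (fibre x) c Y c≢0)) (subst (_∈ˢ fibre x) e (on-line a))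
              on-β : ∀ b → Y +ᵛ b · P ∈ˢ β
              on-β b = trans (sym (inv β c _ c≢0)) (subst (_∈ˢ β) shifted (proj₁ (∧-true {mem β (R +ᵛ (a ⊕ c ⊗ b) · P)} (on-line (a ⊕ c ⊗ b)))))
                where
                shifted : R +ᵛ (a ⊕ c ⊗ b) · P ≡ c · (Y +ᵛ b · P)
                shifted = trans (cong (R +ᵛ_) (·-distribʳ a (c ⊗ b) P)) (trans (sym (+ᵛ-assoc R _ _)) (trans (cong₂ _+ᵛ_ e (sym (·-assoc c b P))) (sym (·-distribˡ c Y (b · P)))))

-- Spans, dual bases and filled subspaces.

module Subspaces {q : ℕ} (F : FiniteField q) (d : ℕ)
  (E : ℕ) (E-small : E + E < q) (2<q : 2 < q) (char : ∀ j → 1 ≤ j → j ≤ E → Field.ℕ→𝔽 F j ≢ Field.𝟘 F) where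
  open Field F
  open Lacunary F using (1≤q)
  open Vectors F hiding (d)
  open PointSets F d
  open Fibres F d E E-small 2<q char

  LI : Vec V m → Set
  LI bs = ∀ as → comb as bs ≡ 0ᵛ → as ≡ 0ᵛ

  Inside : PSet → Vec V m → Set
  Inside β bs = ∀ as → comb as bs ≢ 0ᵛ → comb as bs ∈ˢ β

  comb-0 : ∀ (bs : Vec V m) → comb 0ᵛ bs ≡ 0ᵛ
  comb-0 []       = refl
  comb-0 (b ∷ bs) = trans (cong₂ _+ᵛ_ (·-zeroˡ b) (comb-0 bs)) (+ᵛ-identityˡ 0ᵛ)

  comb-· : ∀ c as (bs : Vec V m) → comb (c · as) bs ≡ c · comb as bs
  comb-· c []       []       = sym (·-zeroʳ c)
  comb-· c (a ∷ as) (b ∷ bs) = trans (cong₂ _+ᵛ_ (sym (·-assoc c a b)) (comb-· c as bs)) (sym (·-distribˡ c _ _))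

  comb-+ : ∀ as cs (bs : Vec V m) → comb (as +ᵛ cs) bs ≡ comb as bs +ᵛ comb cs bs
  comb-+ []       []       []       = sym (+ᵛ-identityˡ 0ᵛ)
  comb-+ (a ∷ as) (c ∷ cs) (b ∷ bs) = trans (cong₂ _+ᵛ_ (·-distribʳ a c b) (comb-+ as cs bs)) (+ᵛ-interchange _ _ _ _)

  ∙-comb : ∀ h as (bs : Vec V m) → h ∙ comb as bs ≡ as ∙ ev bs h
  ∙-comb h []       []       = ∙-0ʳ h
  ∙-comb h (a ∷ as) (b ∷ bs) = trans (∙-+ʳ h (a · b) _) (cong₂ _⊕_ (trans (∙-·ʳ a h b) (cong (a ⊗_) (∙-comm h b))) (∙-comb h as bs))

  comb-∙ : ∀ as (bs : Vec V m) h → comb as bs ∙ h ≡ as ∙ ev bs h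
  comb-∙ as bs h = trans (∙-comm _ h) (∙-comb h as bs)

  LI-tail : ∀ {b} {bs : Vec V m} → LI (b ∷ bs) → LI bs
  LI-tail {b = b} li as e = cong Vec.tail (li (𝟘 ∷ as) (trans (cong₂ _+ᵛ_ (·-zeroˡ b) e) (+ᵛ-identityˡ 0ᵛ)))

  LI-injective : ∀ {bs : Vec V m} → LI bs → ∀ as cs → comb as bs ≡ comb cs bs → as ≡ cs
  LI-injective {bs = bs} li as cs e = trans (sym (+ᵛ-identityʳ as)) (trans (cong (as +ᵛ_) (sym (trans (+ᵛ-comm _ cs) (minus cs))))
      (trans (sym (+ᵛ-assoc as _ cs)) (trans (cong (_+ᵛ cs) zero′) (+ᵛ-identityˡ cs))))
    where
    minus : ∀ {n} (v : 𝕍 n) → v +ᵛ (⊖ 𝟙) · v ≡ 0ᵛ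
    minus v = trans (cong (_+ᵛ (⊖ 𝟙) · v) (sym (·-identity v))) (·-inverse 𝟙 v)
    zero′ : as +ᵛ (⊖ 𝟙) · cs ≡ 0ᵛ
    zero′ = li _ (trans (comb-+ as _ bs) (trans (cong₂ _+ᵛ_ e (comb-· (⊖ 𝟙) cs bs)) (minus (comb cs bs))))

  ev-+ : ∀ (g : Vec V m) u v → ev g (u +ᵛ v) ≡ ev g u +ᵛ ev g v
  ev-+ []      u v = refl
  ev-+ (h ∷ g) u v = cong₂ _∷_ (∙-+ʳ h u v) (ev-+ g u v)

  ev-· : ∀ (g : Vec V m) c v → ev g (c · v) ≡ c · ev g v
  ev-· []      c v = refl
  ev-· (h ∷ g) c v = cong₂ _∷_ (∙-·ʳ c h v) (ev-· g c v)

  ev-eliminate : ∀ h (x : 𝕍 m) g v → ev (eliminate h x g) v ≡ ev g v +ᵛ (⊖ h ∙ v) · x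
  ev-eliminate h []      []      v = refl
  ev-eliminate h (a ∷ x) (f ∷ g) v = cong₂ _∷_ (trans (∙-+ˡ f _ v) (cong (f ∙ v ⊕_) (trans (∙-·ˡ (⊖ a) h v)
    (ring-solve 2 (λ a h → (:- a) :* h := (:- h) :* a) refl a (h ∙ v))))) (ev-eliminate h x g v)

  Dual : Vec V m → Vec V m → Set
  Dual g bs = ∀ as → ev g (comb as bs) ≡ as

  -- A functional that vanishes on the tail but not at `b` gives, after scaling, the first dual
  -- vector; its multiples then correct the dual vectors of the tail at `b`.
  dual : ∀ (bs : Vec V m) → LI bs → ∃[ g ] Dual g bs
  dual [] li = [] , λ { [] → refl }
  dual (b ∷ bs) li with separate bs b | dual bs (LI-tail li)
  ... | inj₁ (as , e) | _ = ⊥-elim (⊖-≢0 1≢0 (cong Vec.head (li (⊖ 𝟙 ∷ as) (trans (+ᵛ-comm _ _)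
          (trans (cong₂ _+ᵛ_ (trans e (sym (·-identity b))) refl) (·-inverse 𝟙 b))))))
  ... | inj₂ (h , kills , hb) | g , dg = h′ ∷ eliminate h′ (ev g b) g , λ { (a ∷ as) → cong₂ _∷_ (head a as)
          (trans (ev-eliminate h′ (ev g b) g _) (trans (cong₂ (λ y z → y +ᵛ (⊖ z) · ev g b) (trans (ev-+ g _ _) (cong₂ _+ᵛ_ (ev-· g a b) (dg as))) (head a as))
            (trans (cong (_+ᵛ (⊖ a) · ev g b) (+ᵛ-comm _ as)) (trans (+ᵛ-assoc as _ _) (trans (cong (as +ᵛ_) (·-inverse a (ev g b))) (+ᵛ-identityʳ as)))))) }
    where
    h′ = recip (h ∙ b) · h
    head : ∀ a as → h′ ∙ (a · b +ᵛ comb as bs) ≡ a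
    head a as = trans (∙-·ˡ _ h _) (trans (cong (recip (h ∙ b) ⊗_) (trans (∙-+ʳ h _ _) (trans (cong₂ _⊕_ (∙-·ʳ a h b) (kills-comb bs as kills)) (⊕-identityʳ _))))
      (trans (ring-solve 3 (λ r a h → r :* (a :* h) := a :* (h :* r)) refl (recip (h ∙ b)) a (h ∙ b)) (trans (cong (a ⊗_) (recip-inverse hb)) (⊗-identityʳ a))))

  ∑-pts-eq : ∀ {n} (w : 𝕍 n) → ∑ (pts n) (λ x → ⟦ eqᵛ x w ⟧) ≤ 1
  ∑-pts-eq {n} w with w ≟ᵛ 0ᵛ
  ... | yes refl = ≤-trans (≤-reflexive (∑-none (pts n) (λ x i → ≢true (λ e → normal-≢0 (normal i) (eqᵛ-sound e))))) z≤n
  ... | no n≢0 = ≤-trans (∑-mono-∈ (pts n) (λ x i → ⟦⟧-mono (λ e → subst (λ z → par x z ≡ true) (trans (·-identity x) (eqᵛ-sound e)) (par-complete (normal i) 𝟙))))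
      (≤-reflexive (∑-par w n≢0))

  module Span {m : ℕ} (us : Vec V m) (li : LI us) where
    abstract
      dual-basis : ∃[ g ] Dual g us
      dual-basis = dual us li

    g : Vec V m
    g = proj₁ dual-basis

    g-dual : Dual g us
    g-dual = proj₂ dual-basis

    -- The projection onto the span along the common zeros of the dual functionals; it makes
    -- membership in the span decidable.
    proj : V → V
    proj Y = comb (ev g Y) us

    inSpan : V → Bool
    inSpan Y = eqᵛ (proj Y) Y

    inSpan-sound : ∀ {Y} → inSpan Y ≡ true → Y ≡ comb (ev g Y) us
    inSpan-sound e = sym (eqᵛ-sound e)

    inSpan-comb : ∀ as → inSpan (comb as us) ≡ true
    inSpan-comb as = eqᵛ-complete (cong (λ z → comb z us) (g-dual as))

    comb-≢0 : ∀ {as} → as ≢ 0ᵛ → comb as us ≢ 0ᵛ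
    comb-≢0 n e = n (li _ e)

    span-size : ∑ (pts d) (λ Y → ⟦ inSpan Y ⟧) ≤ Θ m
    span-size = ≤-trans (∑-inject (pts d) (pts m) inSpan (λ _ → 1) (λ Y x → par x (ev g Y)) once at-most) (≤-reflexive (∑-pts-1 m))
      where
      once : ∀ Y → Y ∈ pts d → inSpan Y ≡ true → ∑ (pts m) (λ x → ⟦ par x (ev g Y) ⟧) ≡ 1
      once Y i e = ∑-par (ev g Y) (λ z → normal-≢0 (normal i) (trans (inSpan-sound e) (trans (cong (λ z → comb z us) z) (comb-0 us))))
      at-most : ∀ x → x ∈ pts m → ∑ (pts d) (λ Y → ⟦ inSpan Y ∧ par x (ev g Y) ⟧) ≤ 1
      at-most x ix = ∑-unique (pts d) eqᵛ ∑-pts-eq _ (λ Y Z iY iZ eY eZ → eqᵛ-complete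
          (par-unique (normal iY) (normal iZ) (comb-≢0 (normal-≢0 (normal ix))) (along iY eY) (along iZ eZ))) 1 (λ _ _ _ → ≤-refl)
        where
        along : ∀ {Y} → Y ∈ pts d → inSpan Y ∧ par x (ev g Y) ≡ true → par Y (comb x us) ≡ true
        along {Y} iY e with ∧-true {inSpan Y} e
        ... | s , p with par-sound (normal ix) p
        ...   | c , ec with inverse c (λ z → normal-≢0 (normal iY) (trans (inSpan-sound s) (trans (cong (λ z → comb z us) (trans ec (trans (cong (_· x) z) (·-zeroˡ x)))) (comb-0 us))))
        ...     | c⁻¹ , cc = subst (λ z → par Y z ≡ true) scaled (par-complete (normal iY) c⁻¹)
          where
          scaled : c⁻¹ · Y ≡ comb x us
          scaled = trans (cong (c⁻¹ ·_) (trans (inSpan-sound s) (trans (cong (λ z → comb z us) ec) (comb-· c x us))))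
            (trans (·-assoc c⁻¹ c _) (trans (cong (_· comb x us) (trans (⊗-comm c⁻¹ c) cc)) (·-identity _)))

    residual : V → V
    residual Y = Y +ᵛ (⊖ 𝟙) · proj Y

    residual-0 : ∀ {Y} → residual Y ≡ 0ᵛ → inSpan Y ≡ true
    residual-0 {Y} e = eqᵛ-complete (trans (sym (+ᵛ-identityˡ _)) (trans (cong (_+ᵛ proj Y) (sym e)) (trans (+ᵛ-assoc Y _ _)
      (trans (cong (Y +ᵛ_) (trans (+ᵛ-comm _ (proj Y)) (trans (cong (_+ᵛ (⊖ 𝟙) · proj Y) (sym (·-identity _))) (·-inverse 𝟙 (proj Y))))) (+ᵛ-identityʳ Y)))))

    -- The functional that sends `Y` to `h ∙ residual Y`. For random `h` it vanishes on the span and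
    -- is uniformly distributed at every point off it.
    annihilate : V → V
    annihilate h = h +ᵛ (⊖ 𝟙) · comb (ev us h) g

    annihilate-∙ : ∀ h Y → annihilate h ∙ Y ≡ h ∙ residual Y
    annihilate-∙ h Y = trans (∙-+ˡ h _ Y) (trans (cong (h ∙ Y ⊕_) (trans (∙-·ˡ (⊖ 𝟙) (comb (ev us h) g) Y) (cong (⊖ 𝟙 ⊗_)
        (trans (comb-∙ (ev us h) g Y) (trans (∙-comm (ev us h) (ev g Y)) (sym (∙-comb h (ev g Y) us)))))))
      (sym (trans (∙-+ʳ h Y _) (cong (h ∙ Y ⊕_) (∙-·ʳ (⊖ 𝟙) h (proj Y))))))

    annihilate-span : ∀ h {Y} → inSpan Y ≡ true → annihilate h ∙ Y ≡ 𝟘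
    annihilate-span h {Y} e = trans (annihilate-∙ h Y) (trans (cong (h ∙_) (trans (cong (λ z → Y +ᵛ (⊖ 𝟙) · z) (eqᵛ-sound e))
      (trans (cong (_+ᵛ (⊖ 𝟙) · Y) (sym (·-identity Y))) (·-inverse 𝟙 Y)))) (∙-0ʳ h))

    -- Adding functionals that vanish on the span, k functionals can be made to have at most the average
    -- number of common zeros in a set T disjoint from the span.
    generic : ∀ {k} (A : Vec V k) (T : V → Bool) → (∀ Y → T Y ≡ true → inSpan Y ≡ false) →
      ∃[ A′ ] (q ^ k * ∑ (pts d) (λ Y → ⟦ T Y ∧ mem (ker {k} A′) Y ⟧) ≤ ∑ (pts d) (λ Y → ⟦ T Y ⟧)
             × (∀ Y → inSpan Y ≡ true → mem (ker A′) Y ≡ mem (ker A) Y))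
    generic [] T out = [] , ≤-reflexive (trans (+-identityʳ _) (∑-cong (pts d) (λ Y → cong ⟦_⟧ (Boolₚ.∧-identityʳ (T Y))))) , λ _ _ → refl
    generic {suc k} (a ∷ A) T out = choose (∑-pick-≤ (vecs d) (subst (0 <_) (sym (length-vecs d)) (m^n>0 q {{>-nonZero 1≤q}} d)) average)
      where
      hit : V → V → Bool
      hit h Y = (a +ᵛ annihilate h) ∙ Y == 𝟘
      value : ∀ h Y → (a +ᵛ annihilate h) ∙ Y ≡ h ∙ residual Y ⊕ a ∙ Y
      value h Y = trans (∙-+ˡ a _ Y) (trans (⊕-comm _ _) (cong (_⊕ a ∙ Y) (annihilate-∙ h Y)))
      average : ∑ (vecs d) (λ h → ∑ (pts d) (λ Y → ⟦ T Y ∧ hit h Y ⟧) * q) ≤ ∑ (vecs d) (λ _ → ∑ (pts d) (λ Y → ⟦ T Y ⟧))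
      average = ≤-reflexive (begin
        ∑ (vecs d) (λ h → ∑ (pts d) (λ Y → ⟦ T Y ∧ hit h Y ⟧) * q) ≡⟨ ∑-*ʳ (vecs d) q _ ⟩
        ∑ (vecs d) (λ h → ∑ (pts d) (λ Y → ⟦ T Y ∧ hit h Y ⟧)) * q ≡⟨ cong (_* q) (∑-swap (vecs d) (pts d) _) ⟩
        ∑ (pts d) (λ Y → ∑ (vecs d) (λ h → ⟦ T Y ∧ hit h Y ⟧)) * q ≡⟨ ∑-*ʳ (pts d) q _ ⟨
        ∑ (pts d) (λ Y → ∑ (vecs d) (λ h → ⟦ T Y ∧ hit h Y ⟧) * q) ≡⟨ ∑-cong (pts d) (λ Y → pointwise Y (T Y) refl) ⟩
        ∑ (pts d) (λ Y → q ^ d * ⟦ T Y ⟧) ≡⟨ ∑-*ˡ (pts d) (q ^ d) _ ⟩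
        q ^ d * ∑ (pts d) (λ Y → ⟦ T Y ⟧) ≡⟨ cong (_* ∑ (pts d) (λ Y → ⟦ T Y ⟧)) (length-vecs d) ⟨
        length (vecs d) * ∑ (pts d) (λ Y → ⟦ T Y ⟧) ≡⟨ ∑-const (vecs d) _ ⟨
        ∑ (vecs d) (λ _ → ∑ (pts d) (λ Y → ⟦ T Y ⟧)) ∎)
        where
        open ≡-Reasoning
        pointwise : ∀ Y b → T Y ≡ b → ∑ (vecs d) (λ h → ⟦ b ∧ hit h Y ⟧) * q ≡ q ^ d * ⟦ b ⟧
        pointwise Y false _ = trans (cong (_* q) (∑-0 (vecs d))) (sym (*-zeroʳ (q ^ d)))
        pointwise Y true e = trans (cong (_* q) (∑-cong (vecs d) (λ h → cong (λ z → ⟦ z == 𝟘 ⟧) (value h Y))))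
          (trans (∑-vecs-affine (residual Y) (a ∙ Y) (λ z → false≢true (out Y e) (residual-0 z))) (sym (*-identityʳ _)))
      choose : ∃[ h ] (h ∈ vecs d × ∑ (pts d) (λ Y → ⟦ T Y ∧ hit h Y ⟧) * q ≤ ∑ (pts d) (λ Y → ⟦ T Y ⟧)) →
        ∃[ A′ ] (q ^ suc k * ∑ (pts d) (λ Y → ⟦ T Y ∧ mem (ker {suc k} A′) Y ⟧) ≤ ∑ (pts d) (λ Y → ⟦ T Y ⟧)
               × (∀ Y → inSpan Y ≡ true → mem (ker A′) Y ≡ mem (ker (a ∷ A)) Y))
      choose (h , _ , le) = extend (generic A (λ Y → T Y ∧ hit h Y) (λ Y e → out Y (proj₁ (∧-true e))))
        where
        extend : ∃[ A′ ] (q ^ k * ∑ (pts d) (λ Y → ⟦ (T Y ∧ hit h Y) ∧ mem (ker {k} A′) Y ⟧) ≤ ∑ (pts d) (λ Y → ⟦ T Y ∧ hit h Y ⟧)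
                        × (∀ Y → inSpan Y ≡ true → mem (ker A′) Y ≡ mem (ker A) Y)) →
          ∃[ A′ ] (q ^ suc k * ∑ (pts d) (λ Y → ⟦ T Y ∧ mem (ker {suc k} A′) Y ⟧) ≤ ∑ (pts d) (λ Y → ⟦ T Y ⟧)
                 × (∀ Y → inSpan Y ≡ true → mem (ker A′) Y ≡ mem (ker (a ∷ A)) Y))
        extend (A′ , le′ , same) = (a +ᵛ annihilate h) ∷ A′ , bound ,
            λ Y e → cong₂ _∧_ (cong (_== 𝟘) (trans (∙-+ˡ a _ Y) (trans (cong (a ∙ Y ⊕_) (annihilate-span h e)) (⊕-identityʳ _)))) (same Y e)
          where
          open ≤-Reasoning
          bound : q ^ suc k * ∑ (pts d) (λ Y → ⟦ T Y ∧ (hit h Y ∧ mem (ker A′) Y) ⟧) ≤ ∑ (pts d) (λ Y → ⟦ T Y ⟧)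
          bound = begin
            q ^ suc k * ∑ (pts d) (λ Y → ⟦ T Y ∧ (hit h Y ∧ mem (ker A′) Y) ⟧) ≡⟨ cong (q ^ suc k *_) (∑-cong (pts d) (λ Y → cong ⟦_⟧ (sym (Boolₚ.∧-assoc (T Y) _ _)))) ⟩
            q * q ^ k * ∑ (pts d) (λ Y → ⟦ (T Y ∧ hit h Y) ∧ mem (ker A′) Y ⟧) ≡⟨ *-assoc q (q ^ k) _ ⟩
            q * (q ^ k * ∑ (pts d) (λ Y → ⟦ (T Y ∧ hit h Y) ∧ mem (ker A′) Y ⟧)) ≤⟨ *-monoʳ-≤ q le′ ⟩
            q * ∑ (pts d) (λ Y → ⟦ T Y ∧ hit h Y ⟧) ≡⟨ *-comm q _ ⟩
            ∑ (pts d) (λ Y → ⟦ T Y ∧ hit h Y ⟧) * q ≤⟨ le ⟩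
            ∑ (pts d) (λ Y → ⟦ T Y ⟧) ∎

  -- A point of the span of us outside β lies on many (n-k)-spaces that meet the span in this point only.
  fullness : ∀ {K} β → Blocks 2 K β → ∀ (us : Vec V (suc K)) (li : LI us) →
    ∑ (pts d) (λ Y → ⟦ mem β Y ∧ not (Span.inSpan us li Y) ⟧) < 2 * q ^ K → Inside β us
  fullness {K} β blocking us li few as Z≢0 with true? (mem β (comb as us))
  ... | inj₁ e = e
  ... | inj₂ Z∉β = ⊥-elim (from-normal (normalise as (λ z → Z≢0 (trans (cong (λ z → comb z us) z) (comb-0 us)))))
    where
    open Span us li
    T : V → Bool
    T Y = mem β Y ∧ not (inSpan Y)
    from-normal : ∃[ x ] ∃[ c ] (x ∈ pts (suc K) × c ≢ 𝟘 × as ≡ c · x) → ⊥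
    -- Within the span, `perp x g` cuts out only the point with coordinates `x`. `generic` preserves
    -- this and leaves fewer than two points of `β` off the span.
    from-normal (x , c , ix , c≢0 , as≡) = contradict (generic (perp x g) T (λ Y e → not-true (proj₂ (∧-true {mem β Y} e))))
      where
      contradict : ∃[ A′ ] (q ^ K * ∑ (pts d) (λ Y → ⟦ T Y ∧ mem (ker {K} A′) Y ⟧) ≤ ∑ (pts d) (λ Y → ⟦ T Y ⟧)
             × (∀ Y → inSpan Y ≡ true → mem (ker A′) Y ≡ mem (ker (perp x g)) Y)) → ⊥
      contradict (A′ , le , same) = <⇒≱ few (≤-trans (≤-trans (≤-reflexive (*-comm 2 (q ^ K))) (*-monoʳ-≤ (q ^ K) (≤-trans (blocking A′) (∑-mono-∈ (pts d) outside)))) le)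
        where
        outside : ∀ Y → Y ∈ pts d → ⟦ mem β Y ∧ mem (ker A′) Y ⟧ ≤ ⟦ T Y ∧ mem (ker A′) Y ⟧
        outside Y iY = ⟦⟧-mono λ e → let b = ∧-true {mem β Y} e in
          ∧-intro (∧-intro (proj₁ b) (not-false (≢true (λ s → absurd s b)))) (proj₂ b)
          where
          absurd : inSpan Y ≡ true → mem β Y ≡ true × mem (ker A′) Y ≡ true → ⊥
          absurd s (Y∈β , kerY) with par-sound (normal ix) (trans (sym (perp-par (normal ix) g Y)) (trans (sym (same Y s)) kerY))
          ... | e , ev≡ = false≢true Z∉β (trans (cong (mem β) Z≡) (trans (inv β c _ c≢0) (trans (sym (inv β e _ e≢0)) (trans (cong (mem β) (sym Y≡)) Y∈β))))
            where
            Y≡ : Y ≡ e · comb x us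
            Y≡ = trans (inSpan-sound s) (trans (cong (λ z → comb z us) ev≡) (comb-· e x us))
            e≢0 : e ≢ 𝟘
            e≢0 z = normal-≢0 (normal iY) (trans Y≡ (trans (cong (_· comb x us) z) (·-zeroˡ _)))
            Z≡ : comb as us ≡ c · comb x us
            Z≡ = trans (cong (λ z → comb z us) as≡) (comb-· c x us)

-- Reduction to essential points and growth of subspaces.

module Structure {q : ℕ} (F : FiniteField q) (d : ℕ)
  (E : ℕ) (E-small : E + E < q) (2<q : 2 < q) (char : ∀ j → 1 ≤ j → j ≤ E → Field.ℕ→𝔽 F j ≢ Field.𝟘 F)
  (κ : ℕ) (κ-small : κ < 24 * E)
  (glue-inequality : ∀ t ε B → 1 ≤ t → 24 * ε ≤ κ * t → E * B ≤ ε * t →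
    (2 * t + ε) * (2 + 2 * (q * t) + ε) + q * (t * t) + q * q * B < q * q * (t * t)) where
  open Field F
  open Lacunary F using (1≤q)
  open Vectors F hiding (d)
  open PointSets F d
  open Lines F d E E-small 2<q char
  open Fibres F d E E-small 2<q char
  open Subspaces F d E E-small 2<q char

  -- Below this size not all fibres over a 2-secant can be bad.
  Slim : ℕ → PSet → Set
  Slim k β = size β < 2 * Θ (suc k) + E * Θ k

  -- At most `2 θ_k + (κ / 24) θ_{k-1}` points. The denominator comes from `√2 < 17/12`, which
  -- bounds half of `√2 - 1` by `5/24`.
  Small : ℕ → PSet → Set
  Small k β = 24 * size β ≤ 48 * Θ (suc k) + κ * Θ k

  Θ≥1 : ∀ k → 1 ≤ Θ (suc k)
  Θ≥1 k = subst (1 ≤_) (sym (Θ-suc k)) (s≤s z≤n)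

  small⇒slim : ∀ {k} β → Small (suc k) β → Slim (suc k) β
  small⇒slim {k} β le = *-cancelˡ-< 24 _ _ (≤-<-trans le (subst (48 * Θ (suc (suc k)) + κ * t <_) (arith (Θ (suc (suc k))) E t)
      (+-monoʳ-< (48 * Θ (suc (suc k))) (*-monoˡ-< t {{>-nonZero (Θ≥1 k)}} κ-small))))
    where
    t = Θ (suc k)
    arith : ∀ a E t → 48 * a + 24 * E * t ≡ 24 * (2 * a + E * t)
    arith = semiring-solve 3 (λ a E t → # 48 ⋆ a ⊹ # 24 ⋆ E ⋆ t , # 24 ⋆ (# 2 ⋆ a ⊹ E ⋆ t)) refl

  secantᵇ : ∀ {k} → PSet → V → Vec V k → Bool
  secantᵇ β P φ = mem (ker φ) P ∧ does (size (β ∩ ker φ) ≤? 2)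

  essential? : ∀ k β P → Essential k β P ⊎ (∀ (φ : Vec V k) → mem (ker φ) P ≡ true → 3 ≤ size (β ∩ ker φ))
  essential? k β P with search (tuples (vecs d) k) {λ φ → secantᵇ β P φ ≡ true} {λ φ → secantᵇ β P φ ≡ false} (λ φ _ → true? (secantᵇ β P φ))
  ... | inj₁ (φ , _ , e) = inj₁ (φ , proj₁ (∧-true e) , does-true (size (β ∩ ker φ) ≤? 2) (proj₂ (∧-true {mem (ker φ) P} e)))
  ... | inj₂ none = inj₂ λ φ kerP → ≰⇒> (does-false (size (β ∩ ker φ) ≤? 2)
        (trans (cong (_∧ does (size (β ∩ ker φ) ≤? 2)) (sym kerP)) (none φ (∈-tuples ∈-vecs φ))))

  remove-ker : ∀ β {T k} (iT : T ∈ pts d) (φ : Vec V k) → size (β ∩ ker φ) ≤ suc (size (remove β iT ∩ ker φ))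
  remove-ker β iT φ = ≤-trans (size-remove≤ (β ∩ ker φ) iT) (s≤s (≤-reflexive
    (size-cong {remove (β ∩ ker φ) iT} {remove β iT ∩ ker φ} λ v → rearrange (mem β v) (mem (ker φ) v) (not (mem (point (normal iT)) v)))))
    where
    rearrange : ∀ a b c → (a ∧ b) ∧ c ≡ (a ∧ c) ∧ b
    rearrange true  b c = Boolₚ.∧-comm b c
    rearrange false b c = refl

  remove-outside : ∀ β {T k} (iT : T ∈ pts d) (φ : Vec V k) → mem (ker φ) T ≡ false → size (β ∩ ker φ) ≤ size (remove β iT ∩ ker φ)
  remove-outside β {T} iT φ out = size-⊆ {β ∩ ker φ} {remove β iT ∩ ker φ} λ v iv e → let b = ∧-true {mem β v} e in
    ∧-intro (∈-remove β iT iv (proj₁ b) λ { refl → false≢true out (proj₂ b) }) (proj₂ b)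

  remove-blocks : ∀ {k} β {T} (iT : T ∈ pts d) → Blocks 2 k β → (∀ (φ : Vec V k) → mem (ker φ) T ≡ true → 3 ≤ size (β ∩ ker φ)) → Blocks 2 k (remove β iT)
  remove-blocks β {T} iT blocking iness φ with true? (mem (ker φ) T)
  ... | inj₁ e = s≤s⁻¹ (≤-trans (iness φ e) (remove-ker β iT φ))
  ... | inj₂ e = ≤-trans (blocking φ) (remove-outside β iT φ e)

  -- The reduction never makes a point essential: 2-secants of the smaller set can be chosen off the removed point.
  essential-remove : ∀ {k} β {T} (iT : T ∈ pts d) → Blocks 2 (suc k) (remove β iT) → Slim (suc k) β → ∀ {P} → P ∈ pts d → P ∈ˢ remove β iT →
    Essential (suc k) (remove β iT) P → Essential (suc k) β P
  essential-remove {k} β {T} iT blocking slim {P} iP P∈ (φ , sec) with true? (mem (ker φ) T)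
  ... | inj₂ e = φ , proj₁ sec , ≤-trans (remove-outside β iT φ e) (proj₂ sec)
  ... | inj₁ e = lift (Fan.secant-avoiding k (remove β iT) blocking iP P∈ φ sec
        (≤-<-trans (size-∩≤ β (∁ point (normal iT))) slim) iT (λ T≡P → remove-≢ β iT P∈ (sym T≡P)) e)
    where
    lift : ∃[ χ ] (Secant {suc k} (remove β iT) χ P × mem (ker χ) T ≡ false) → Essential (suc k) β P
    lift (χ , s , out) = χ , proj₁ s , ≤-trans (remove-outside β iT χ out) (proj₂ s)

  -- Being essential in the core serves the geometry. Being essential in `β` serves the colours,
  -- which say something only about 2-secants of the set of all repeated points.
  record Core (k : ℕ) (β : PSet) : Set where
    field
      core       : PSet
      core⊆      : core ⊆ β
      core-blocks : Blocks 2 k core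
      tight      : ∀ P → P ∈ pts d → P ∈ˢ core → Essential k core P × Essential k β P
  open Core

  private
    core-fuel : ∀ {k} n β → size β ≤ n → Blocks 2 (suc k) β → Slim (suc k) β → Core (suc k) β
    core-step : ∀ {k} n β → size β ≤ n → Blocks 2 (suc k) β → Slim (suc k) β →
      ∃[ T ] (T ∈ pts d × T ∈ˢ β × (∀ (φ : Vec V (suc k)) → mem (ker φ) T ≡ true → 3 ≤ size (β ∩ ker φ)))
        ⊎ (∀ T → T ∈ pts d → T ∈ˢ β → Essential (suc k) β T) → Core (suc k) β
    core-fuel {k} n β le blocking slim = core-step n β le blocking slim (decide (search (pts d) either))
      where
      Removable Needed : V → Set
      Removable T = T ∈ˢ β × (∀ (φ : Vec V (suc k)) → mem (ker φ) T ≡ true → 3 ≤ size (β ∩ ker φ))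
      Needed T = T ∈ˢ β → Essential (suc k) β T
      either : ∀ T → T ∈ pts d → Removable T ⊎ Needed T
      either T _ with true? (mem β T) | essential? (suc k) β T
      ... | inj₂ out | _       = inj₂ (λ T∈β → ⊥-elim (false≢true out T∈β))
      ... | inj₁ _   | inj₁ e  = inj₂ (λ _ → e)
      ... | inj₁ T∈β | inj₂ i  = inj₁ (T∈β , i)
      decide : ∃[ T ] (T ∈ pts d × Removable T) ⊎ (∀ T → T ∈ pts d → Needed T) → _
      decide (inj₁ (T , i , r)) = inj₁ (T , i , r)
      decide (inj₂ f) = inj₂ f
    core-step n β le blocking slim (inj₂ all) = record
      { core = β ; core⊆ = λ _ e → e ; core-blocks = blocking ; tight = λ P i e → all P i e , all P i e }
    core-step zero β le blocking slim (inj₁ (T , iT , T∈β , _)) = ⊥-elim (1+n≰n (≤-trans (1≤size β iT T∈β) le))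
    core-step {k} (suc n) β le blocking slim (inj₁ (T , iT , T∈β , iness)) = extend
        (core-fuel n (remove β iT) (s≤s⁻¹ (≤-trans (≤-reflexive (sym (size-remove β iT T∈β))) le)) blocking′ (≤-<-trans (size-∩≤ β (∁ point (normal iT))) slim))
      where
      blocking′ = remove-blocks β iT blocking iness
      extend : Core (suc k) (remove β iT) → Core (suc k) β
      extend C = record
        { core = core C ; core⊆ = λ v e → proj₁ (∧-true (core⊆ C v e)) ; core-blocks = core-blocks C
        ; tight = λ P i e → proj₁ (tight C P i e) , essential-remove β iT blocking′ slim i (core⊆ C P e) (proj₂ (tight C P i e)) }

  abstract
    find-core : ∀ {k} β → Blocks 2 (suc k) β → Slim (suc k) β → Core (suc k) β
    find-core β = core-fuel (size β) β ≤-refl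

  -- The 2-secant through `P` has one other point of `β`, and a set without `P` could not meet it
  -- twice.
  essential-persists : ∀ {k} β γ → γ ⊆ β → Blocks 2 k γ → ∀ {P} → P ∈ pts d → P ∈ˢ β → Essential k β P → P ∈ˢ γ
  essential-persists β γ sub blocking {P} iP P∈β (φ , kerP , two) with true? (mem γ P)
  ... | inj₁ e = e
  ... | inj₂ out = ⊥-elim (1+n≰n (≤-trans (s≤s (≤-trans (blocking φ) (size-⊆ {γ ∩ ker φ} {remove (β ∩ ker φ) iP} λ v iv e →
          ∈-remove (β ∩ ker φ) iP iv (∧-intro (sub v (proj₁ (∧-true e))) (proj₂ (∧-true {mem γ v} e))) λ { refl → false≢true out (proj₁ (∧-true e)) })))
          (≤-trans (≤-reflexive (sym (size-remove (β ∩ ker φ) iP (∧-intro P∈β kerP)))) two)))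

  -- Omits the functional at the pivot of `y`, the one that `comb y φ` can replace.
  drop : ∀ {k} → 𝕍 (suc k) → Vec V (suc k) → Vec V k
  drop {zero}  _       _       = []
  drop {suc k} (a ∷ y) (h ∷ φ) with a == 𝟘
  ... | true  = h ∷ drop y φ
  ... | false = φ

  comb-kernel : ∀ {k} (φ : Vec V k) y v → mem (ker φ) v ≡ true → comb y φ ∙ v ≡ 𝟘
  comb-kernel φ y v e = trans (comb-∙ y φ v) (trans (cong (y ∙_) (trans (ev-∙ φ v) (eqᵛ-sound (trans (sym (ker-ev φ v)) e)))) (∙-0ʳ y))
    where
    ev-∙ : ∀ {k} (φ : Vec V k) v → ev φ v ≡ ev φ v
    ev-∙ φ v = refl

  drop-kernel : ∀ {k} {y : 𝕍 (suc k)} → Normal y → ∀ φ v → (comb y φ ∙ v == 𝟘) ∧ mem (ker (drop y φ)) v ≡ mem (ker φ) v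
  drop-kernel {zero} {_ ∷ []} pivot (h ∷ []) v = cong (λ z → (z ∙ v == 𝟘) ∧ true) (trans (+ᵛ-identityʳ _) (·-identity h))
  drop-kernel {suc k} {_ ∷ y} (below n) (h ∷ φ) v rewrite ==-refl 𝟘 = trans (cong (λ z → (z ∙ v == 𝟘) ∧ ((h ∙ v == 𝟘) ∧ mem (ker (drop y φ)) v)) (trans (cong (_+ᵛ comb y φ) (·-zeroˡ h)) (+ᵛ-identityˡ _)))
    (trans (swap-∧ (comb y φ ∙ v == 𝟘) (h ∙ v == 𝟘) _) (cong ((h ∙ v == 𝟘) ∧_) (drop-kernel n φ v)))
    where
    swap-∧ : ∀ a b c → a ∧ (b ∧ c) ≡ b ∧ (a ∧ c)
    swap-∧ true  b c = refl
    swap-∧ false true c = refl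
    swap-∧ false false c = refl
  drop-kernel {suc k} {_ ∷ y} pivot (h ∷ φ) v rewrite ==-≢ 1≢0 = guarded (true? (mem (ker φ) v))
    where
    guarded : mem (ker φ) v ≡ true ⊎ mem (ker φ) v ≡ false → ((𝟙 · h +ᵛ comb y φ) ∙ v == 𝟘) ∧ mem (ker φ) v ≡ (h ∙ v == 𝟘) ∧ mem (ker φ) v
    guarded (inj₁ e) = cong (λ z → (z == 𝟘) ∧ mem (ker φ) v) (trans (∙-+ˡ (𝟙 · h) (comb y φ) v) (trans (cong₂ _⊕_ (cong (_∙ v) (·-identity h)) (comb-kernel φ y v e)) (⊕-identityʳ _)))
    guarded (inj₂ e) rewrite e = trans (Boolₚ.∧-zeroʳ _) (sym (Boolₚ.∧-zeroʳ _))

  -- The sections are those by the combinations of the functionals in `φ`: a point off the kernel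
  -- lies on `Θ k` of them, a point of the kernel on all `Θ k + q^k`.
  section-sum : ∀ {k} β (φ : Vec V (suc k)) →
    ∑ (pts (suc k)) (λ y → size (β ∩ hyp (comb y φ))) ≡ Θ k * size β + q ^ k * size (β ∩ ker φ)
  section-sum {k} β φ = begin
    ∑ (pts (suc k)) (λ y → size (β ∩ hyp (comb y φ))) ≡⟨ ∑-swap (pts (suc k)) (pts d) _ ⟩
    ∑ (pts d) (λ v → ∑ (pts (suc k)) (λ y → ⟦ mem β v ∧ (comb y φ ∙ v == 𝟘) ⟧)) ≡⟨ ∑-cong (pts d) (λ v → pointwise v (mem β v)) ⟩
    ∑ (pts d) (λ v → Θ k * ⟦ mem β v ⟧ + q ^ k * ⟦ mem β v ∧ mem (ker φ) v ⟧) ≡⟨ trans (∑-+ (pts d) _ _) (cong₂ _+_ (∑-*ˡ (pts d) (Θ k) _) (∑-*ˡ (pts d) (q ^ k) _)) ⟩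
    Θ k * size β + q ^ k * size (β ∩ ker φ) ∎
    where
    open ≡-Reasoning
    value : ∀ (z : 𝕍 (suc k)) → ∑ (pts (suc k)) (λ y → ⟦ y ∙ z == 𝟘 ⟧) ≡ Θ k + q ^ k * ⟦ eqᵛ z 0ᵛ ⟧
    value z with z ≟ᵛ 0ᵛ
    ... | yes refl rewrite eqᵛ-refl {suc k} 0ᵛ = trans (∑-cong (pts (suc k)) (λ y → cong ⟦_⟧ (==-complete (∙-0ʳ y)))) (trans (∑-pts-1 (suc k)) (cong (Θ k +_) (sym (*-identityʳ _))))
    ... | no n rewrite ≢true {eqᵛ z 0ᵛ} (n ∘ eqᵛ-sound) = trans (∑-cong (pts (suc k)) (λ y → cong (λ a → ⟦ a == 𝟘 ⟧) (∙-comm y z)))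
            (trans (∑-pts-hyperplane z n (<⇒≤ 2<q)) (sym (trans (cong (Θ k +_) (*-zeroʳ (q ^ k))) (+-identityʳ _))))
    pointwise : ∀ v b → ∑ (pts (suc k)) (λ y → ⟦ b ∧ (comb y φ ∙ v == 𝟘) ⟧) ≡ Θ k * ⟦ b ⟧ + q ^ k * ⟦ b ∧ mem (ker φ) v ⟧
    pointwise v false = trans (∑-0 (pts (suc k))) (sym (cong₂ _+_ (*-zeroʳ (Θ k)) (*-zeroʳ (q ^ k))))
    pointwise v true  = trans (∑-cong (pts (suc k)) (λ y → cong (λ a → ⟦ a == 𝟘 ⟧) (comb-∙ y φ v)))
      (trans (value (ev φ v)) (cong₂ (λ a b → a + q ^ k * ⟦ b ⟧) (sym (*-identityʳ (Θ k))) (sym (ker-ev φ v))))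

  -- On average a hyperplane containing the kernel of φ inherits the bound on the size.
  small-section : ∀ {k} β (φ : Vec V (suc (suc k))) → Small (suc (suc k)) β → size (β ∩ ker φ) ≤ 2 →
    ∃[ y ] (y ∈ pts (suc (suc k)) × Small (suc k) (β ∩ hyp (comb y φ)))
  small-section {k} β φ small two = ∑-pick-≤ (pts (suc (suc k))) (subst (0 <_) (trans (sym (∑-pts-1 (suc (suc k)))) (∑-1 (pts (suc (suc k))))) (Θ≥1 (suc k))) (begin
      ∑ (pts (suc (suc k))) (λ y → 24 * size (β ∩ hyp (comb y φ))) ≡⟨ trans (∑-*ˡ (pts (suc (suc k))) 24 _) (cong (24 *_) (section-sum β φ)) ⟩
      24 * (s * size β + p * size (β ∩ ker φ)) ≤⟨ *-monoʳ-≤ 24 (+-monoʳ-≤ (s * size β) (*-monoʳ-≤ p two)) ⟩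
      24 * (s * size β + p * 2) ≡⟨ arith s (size β) p ⟩
      s * (24 * size β) + 48 * p ≤⟨ +-monoˡ-≤ (48 * p) (*-monoʳ-≤ s small) ⟩
      s * (48 * Θ (suc (suc (suc k))) + κ * Θ (suc (suc k))) + 48 * p ≡⟨ cong (λ n → s * (48 * n + κ * Θ (suc (suc k))) + 48 * p) (Θ-suc (suc (suc k))) ⟩
      s * (48 * (1 + q * t) + κ * t) + 48 * p ≡⟨ arith′ s q t κ p ⟩
      48 * (s + p) + 48 * (q * s * t) + κ * s * t ≡⟨⟩
      48 * t + 48 * (q * s * t) + κ * s * t ≡⟨ arith″ t (q * s) (κ * s) ⟩
      t * (48 * (1 + q * s) + κ * s) ≡⟨ cong (λ n → t * (48 * n + κ * s)) (Θ-suc (suc k)) ⟨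
      t * (48 * t + κ * s) ≡⟨ cong (_* (48 * t + κ * s)) (trans (sym (∑-pts-1 (suc (suc k)))) (∑-1 (pts (suc (suc k))))) ⟩
      length (pts (suc (suc k))) * (48 * t + κ * s) ≡⟨ ∑-const (pts (suc (suc k))) _ ⟨
      ∑ (pts (suc (suc k))) (λ _ → 48 * t + κ * s) ∎)
    where
    open ≤-Reasoning
    s = Θ (suc k)
    t = Θ (suc (suc k))
    p = q ^ suc k
    arith : ∀ s b p → 24 * (s * b + p * 2) ≡ s * (24 * b) + 48 * p
    arith = semiring-solve 3 (λ s b p → # 24 ⋆ (s ⋆ b ⊹ p ⋆ # 2) , s ⋆ (# 24 ⋆ b) ⊹ # 48 ⋆ p) refl
    arith′ = semiring-solve 5 (λ s q t κ p → s ⋆ (# 48 ⋆ (# 1 ⊹ q ⋆ t) ⊹ κ ⋆ t) ⊹ # 48 ⋆ p , # 48 ⋆ (s ⊹ p) ⊹ # 48 ⋆ (q ⋆ s ⋆ t) ⊹ κ ⋆ s ⋆ t) refl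
    arith″ = semiring-solve 3 (λ t a b → # 48 ⋆ t ⊹ # 48 ⋆ (a ⋆ t) ⊹ b ⋆ t , t ⋆ (# 48 ⋆ (# 1 ⊹ a) ⊹ b)) refl

  SpaceThrough : ℕ → PSet → V → Set
  SpaceThrough k β P = ∃[ us ] (LI {suc k} us × Inside β us × ∃[ as ] (comb as us ≡ P))

  lineᵇ-scale : ∀ β R Y {c} → c ≢ 𝟘 → lineᵇ β (c · R) Y ≡ lineᵇ β R Y
  lineᵇ-scale β R Y {c} c≢0 with inverse c c≢0
  ... | c⁻¹ , cc = bool-ext
    (λ e → lineᵇ-complete β R Y (λ a → subst (λ z → Y +ᵛ z ∈ˢ β) (trans (·-assoc (a ⊗ c⁻¹) c R) (cong (_· R) (trans (⊗-assoc a c⁻¹ c) (trans (cong (a ⊗_) (trans (⊗-comm c⁻¹ c) cc)) (⊗-identityʳ a)))))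
      (lineᵇ-sound β (c · R) Y e (a ⊗ c⁻¹))))
    (λ e → lineᵇ-complete β (c · R) Y (λ a → subst (λ z → Y +ᵛ z ∈ˢ β) (sym (·-assoc a c R)) (lineᵇ-sound β R Y e (a ⊗ c))))

  -- Points off a subspace S of β that see many points of S along lines of β span with S a subspace of β.
  module Glue {j : ℕ} (β : PSet) (blocking : Blocks 2 (suc j) β) (small : Small (suc j) β)
    (essential : ∀ P → P ∈ pts d → P ∈ˢ β → Essential (suc j) β P)
    (bs : Vec V (suc j)) (li : LI bs) (inside : Inside β bs) where

    private
      K = suc j
      t = Θ K
      module S = Span bs li

      through : 𝕍 K → V → Bool
      through x Y = lineᵇ β (comb x bs) Y

      degree : V → ℕ
      degree Y = ∑ (pts K) (λ x → ⟦ through x Y ⟧)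

      -- The excess over `2 Θ (suc K)`, the least size that a set with a 2-secant can have here.
      ε : ℕ
      ε = size β ∸ 2 * (1 + q * t)

      abstract
        -- `b` is the number of bad fibres at the point `x` of the subspace. Each loses `q` points
        -- that would lie on lines of `β`, and each uses up `E` of the excess.
        lines-at : ∀ x → x ∈ pts K → ∃[ b ] (t * q ≤ ∑ (pts d) (λ Y → ⟦ through x Y ⟧) + q * b × E * b + 2 * (1 + q * t) ≤ size β)
        lines-at x ix = from-normal (normalise (comb x bs) Rx≢0)
          where
          Rx≢0 : comb x bs ≢ 0ᵛ
          Rx≢0 = S.comb-≢0 (normal-≢0 (normal ix))
          from-normal : ∃[ R ] ∃[ c ] (R ∈ pts d × c ≢ 𝟘 × comb x bs ≡ c · R) → ∃[ b ] (t * q ≤ ∑ (pts d) (λ Y → ⟦ through x Y ⟧) + q * b × E * b + 2 * (1 + q * t) ≤ size β)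
          from-normal (R , c , iR , c≢0 , e) = use (essential R iR R∈β)
            where
            R∈β : R ∈ˢ β
            R∈β = trans (sym (inv β c R c≢0)) (subst (_∈ˢ β) e (inside x Rx≢0))
            use : Essential K β R → ∃[ b ] (t * q ≤ ∑ (pts d) (λ Y → ⟦ through x Y ⟧) + q * b × E * b + 2 * (1 + q * t) ≤ size β)
            use (φ , sec) = b , subst (λ n → t * q ≤ n + q * b) (∑-cong (pts d) (λ Y → cong ⟦_⟧ (trans (sym (lineᵇ-scale β R Y c≢0)) (cong (λ z → lineᵇ β z Y) (sym e)))))
                  (Fan.lines-through j β blocking iR R∈β φ sec)
              , subst (λ n → E * b + 2 * n ≤ size β) (Θ-suc K) (Fan.bad-count j β blocking iR R∈β φ sec)
              where
              b : ℕ
              b = ∑ (pts K) (λ y → ⟦ not (Fan.goodᵇ j β blocking iR R∈β φ sec y) ⟧)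

      size-β : size β ≡ 2 * (1 + q * t) + ε
      size-β = sym (m+[n∸m]≡n (from-witness (∑-witness (pts K) {λ _ → true} (subst (0 <_) (sym (∑-pts-1 K)) (Θ≥1 j)))))
        where
        from-witness : ∃[ x ] (x ∈ pts K × true ≡ true) → 2 * (1 + q * t) ≤ size β
        from-witness (x , ix , _) = ≤-trans (m≤n+m _ _) (proj₂ (proj₂ (lines-at x ix)))

      ε-small : 24 * ε ≤ κ * t
      ε-small = +-cancelˡ-≤ (48 * (1 + q * t)) _ _ (≤-trans (≤-reflexive (trans (arith (1 + q * t) ε) (cong (24 *_) (sym size-β))))
        (subst (λ n → 24 * size β ≤ 48 * n + κ * t) (Θ-suc K) small))
        where
        arith : ∀ a e → 48 * a + 24 * e ≡ 24 * (2 * a + e)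
        arith = semiring-solve 2 (λ a e → # 48 ⋆ a ⊹ # 24 ⋆ e , # 24 ⋆ (# 2 ⋆ a ⊹ e)) refl

      collect : ∀ (L : List (𝕍 K)) → (∀ x → x ∈ L → x ∈ pts K) →
        ∃[ B ] (length L * (t * q) ≤ ∑ L (λ x → ∑ (pts d) (λ Y → ⟦ through x Y ⟧)) + q * B × E * B ≤ length L * ε)
      collect [] _ = 0 , z≤n , ≤-reflexive (*-zeroʳ E)
      collect (x ∷ L) sub = append (lines-at x (sub x (here refl))) (collect L (λ y → sub y ∘ there))
        where
        arith = semiring-solve 5 (λ n m q b B → n ⊹ q ⋆ b ⊹ (m ⊹ q ⋆ B) , n ⊹ m ⊹ q ⋆ (b ⊹ B)) refl
        append : ∃[ b ] (t * q ≤ ∑ (pts d) (λ Y → ⟦ through x Y ⟧) + q * b × E * b + 2 * (1 + q * t) ≤ size β) →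
          ∃[ B ] (length L * (t * q) ≤ ∑ L (λ x → ∑ (pts d) (λ Y → ⟦ through x Y ⟧)) + q * B × E * B ≤ length L * ε) →
          ∃[ B ] (t * q + length L * (t * q) ≤ ∑ (pts d) (λ Y → ⟦ through x Y ⟧) + ∑ L (λ x → ∑ (pts d) (λ Y → ⟦ through x Y ⟧)) + q * B × E * B ≤ ε + length L * ε)
        append (b , le , le′) (B , LE , LE′) = b + B
            , ≤-trans (+-mono-≤ le LE) (≤-reflexive (arith (∑ (pts d) (λ Y → ⟦ through x Y ⟧)) (∑ L (λ x → ∑ (pts d) (λ Y → ⟦ through x Y ⟧))) q b B))
            , ≤-trans (≤-reflexive (*-distribˡ-+ E b B)) (+-mono-≤ (+-cancelʳ-≤ (2 * (1 + q * t)) _ _ (≤-trans le′ (≤-reflexive (trans size-β (+-comm _ ε))))) LE′)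

      length-K : length (pts K) ≡ t
      length-K = trans (sym (∑-1 (pts K))) (∑-pts-1 K)

      -- Off the subspace this says that the lines of `β` from `Y` do not yet leave fewer than
      -- `2 q^K` points outside the join, the bound that `fullness` asks for.
      Light : V → Set
      Light Y = S.inSpan Y ≡ true ⊎ q * degree Y + 2 * q ^ K ≤ size β

      excess : ℕ
      excess = size β ∸ 2 * q ^ K

      excess≤ : excess ≤ 2 * t + ε
      excess≤ = ≤-trans (∸-monoˡ-≤ (2 * q ^ K) (≤-reflexive (trans size-β (trans (cong (λ n → 2 * n + ε) (sym (Θ-suc K))) (arith t (q ^ K) ε)))))
          (≤-reflexive (m+n∸n≡m (2 * t + ε) (2 * q ^ K)))
        where
        arith : ∀ t p e → 2 * (t + p) + e ≡ 2 * t + e + 2 * p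
        arith = semiring-solve 3 (λ t p e → # 2 ⋆ (t ⊹ p) ⊹ e , # 2 ⋆ t ⊹ e ⊹ # 2 ⋆ p) refl

      per-point : ∀ Y → Light Y → q * degree Y ≤ q * t * ⟦ S.inSpan Y ⟧ + excess * ⟦ mem β Y ⟧
      per-point Y (inj₁ e) = ≤-trans (*-monoʳ-≤ q (≤-trans (∑-mono (pts K) (λ x → ⟦⟧≤1 (through x Y))) (≤-reflexive (∑-pts-1 K))))
            (≤-trans (≤-reflexive (trans (sym (*-identityʳ (q * t))) (cong (λ b → q * t * ⟦ b ⟧) (sym e)))) (m≤m+n _ _))
      per-point Y (inj₂ le) = by-member (true? (mem β Y))
        where
        by-member : mem β Y ≡ true ⊎ mem β Y ≡ false → q * degree Y ≤ q * t * ⟦ S.inSpan Y ⟧ + excess * ⟦ mem β Y ⟧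
        by-member (inj₁ e) = ≤-trans (≤-trans (m+n≤o⇒m≤o∸n (q * degree Y) le) (≤-reflexive (trans (sym (*-identityʳ excess)) (cong (λ b → excess * ⟦ b ⟧) (sym e))))) (m≤n+m _ _)
        by-member (inj₂ e) = ≤-trans (≤-reflexive (trans (cong (q *_) (∑-none (pts K) {λ x → through x Y} (λ x _ → ≢true (λ l → false≢true e (lineᵇ-self β (comb x bs) Y l))))) (*-zeroʳ q))) z≤n

      -- If no point works then counting the pairs (R, Y) with R in S, Y off S and the line RY in β gives a contradiction.
      not-all-light : (∀ Y → Y ∈ pts d → Light Y) → ⊥
      not-all-light light = use (collect (pts K) (λ _ i → i))
        where
        use : ∃[ B ] (length (pts K) * (t * q) ≤ ∑ (pts K) (λ x → ∑ (pts d) (λ Y → ⟦ through x Y ⟧)) + q * B × E * B ≤ length (pts K) * ε) → ⊥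
        use (B , lines , bads) = <-irrefl refl (≤-<-trans total (glue-inequality t ε B (Θ≥1 j) ε-small
            (≤-trans bads (≤-reflexive (trans (cong (_* ε) length-K) (*-comm t ε))))))
          where
          open ≤-Reasoning
          arith : ∀ q t → q * q * (t * t) ≡ q * (t * (t * q))
          arith = semiring-solve 2 (λ q t → q ⋆ q ⋆ (t ⋆ t) , q ⋆ (t ⋆ (t ⋆ q))) refl
          arith′ : ∀ q n B → q * (n + q * B) ≡ q * n + q * q * B
          arith′ = semiring-solve 3 (λ q n B → q ⋆ (n ⊹ q ⋆ B) , q ⋆ n ⊹ q ⋆ q ⋆ B) refl
          arith″ : ∀ q t n → q * t * t + n ≡ n + q * (t * t)
          arith″ = semiring-solve 3 (λ q t n → q ⋆ t ⋆ t ⊹ n , n ⊹ q ⋆ (t ⋆ t)) refl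
          arith‴ : ∀ a e → 2 * (1 + a) + e ≡ 2 + 2 * a + e
          arith‴ = semiring-solve 2 (λ a e → # 2 ⋆ (# 1 ⊹ a) ⊹ e , # 2 ⊹ # 2 ⋆ a ⊹ e) refl
          degrees : q * ∑ (pts d) degree ≤ (2 * t + ε) * (2 + 2 * (q * t) + ε) + q * (t * t)
          degrees = begin
            q * ∑ (pts d) degree ≡⟨ ∑-*ˡ (pts d) q degree ⟨
            ∑ (pts d) (λ Y → q * degree Y) ≤⟨ ∑-mono-∈ (pts d) (λ Y i → per-point Y (light Y i)) ⟩
            ∑ (pts d) (λ Y → q * t * ⟦ S.inSpan Y ⟧ + excess * ⟦ mem β Y ⟧) ≡⟨ trans (∑-+ (pts d) _ _) (cong₂ _+_ (∑-*ˡ (pts d) (q * t) _) (∑-*ˡ (pts d) excess _)) ⟩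
            q * t * ∑ (pts d) (λ Y → ⟦ S.inSpan Y ⟧) + excess * size β ≤⟨ +-mono-≤ (*-monoʳ-≤ (q * t) S.span-size) (*-mono-≤ excess≤ (≤-reflexive (trans size-β (arith‴ (q * t) ε)))) ⟩
            q * t * t + (2 * t + ε) * (2 + 2 * (q * t) + ε) ≡⟨ arith″ q t _ ⟩
            (2 * t + ε) * (2 + 2 * (q * t) + ε) + q * (t * t) ∎
          total : q * q * (t * t) ≤ (2 * t + ε) * (2 + 2 * (q * t) + ε) + q * (t * t) + q * q * B
          total = begin
            q * q * (t * t) ≡⟨ arith q t ⟩
            q * (t * (t * q)) ≤⟨ *-monoʳ-≤ q (≤-trans (≤-reflexive (cong (_* (t * q)) (sym length-K))) lines) ⟩
            q * (∑ (pts K) (λ x → ∑ (pts d) (λ Y → ⟦ through x Y ⟧)) + q * B) ≡⟨ cong (λ n → q * (n + q * B)) (∑-swap (pts K) (pts d) _) ⟩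
            q * (∑ (pts d) degree + q * B) ≡⟨ arith′ q (∑ (pts d) degree) B ⟩
            q * ∑ (pts d) degree + q * q * B ≤⟨ +-monoˡ-≤ (q * q * B) degrees ⟩
            (2 * t + ε) * (2 + 2 * (q * t) + ε) + q * (t * t) + q * q * B ∎

      Heavy : V → Set
      Heavy Y = S.inSpan Y ≡ false × size β < q * degree Y + 2 * q ^ K

      abstract
        heavy : ∃[ Y ] (Y ∈ pts d × Heavy Y)
        heavy = resolve (search (pts d) {Heavy} {Light} (λ Y _ → decide Y (true? (S.inSpan Y)) (q * degree Y + 2 * q ^ K ≤? size β)))
          where
          decide : ∀ Y → S.inSpan Y ≡ true ⊎ S.inSpan Y ≡ false → Dec (q * degree Y + 2 * q ^ K ≤ size β) → Heavy Y ⊎ Light Y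
          decide Y (inj₁ e) _        = inj₂ (inj₁ e)
          decide Y (inj₂ _) (yes le) = inj₂ (inj₂ le)
          decide Y (inj₂ e) (no gt)  = inj₁ (e , ≰⇒> gt)
          resolve : ∃[ Y ] (Y ∈ pts d × Heavy Y) ⊎ (∀ Y → Y ∈ pts d → Light Y) → ∃[ Y ] (Y ∈ pts d × Heavy Y)
          resolve (inj₁ r) = r
          resolve (inj₂ l) = ⊥-elim (not-all-light l)

    extension : ∃[ Y ] (LI (Y ∷ bs) × Inside β (Y ∷ bs))
    extension = from-heavy heavy
      where
      from-heavy : ∃[ Y ] (Y ∈ pts d × Heavy Y) → ∃[ Y ] (LI (Y ∷ bs) × Inside β (Y ∷ bs))
      from-heavy (Y , iY , out , big) = Y , liY , fullness β blocking (Y ∷ bs) liY few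
        where
        liY : LI (Y ∷ bs)
        liY (a ∷ as) e with a ≟ᶠ 𝟘
        ... | yes refl = cong (𝟘 ∷_) (li as (trans (sym (+ᵛ-identityˡ _)) (trans (cong (_+ᵛ comb as bs) (sym (·-zeroˡ Y))) e)))
        ... | no a≢0 with inverse a a≢0
        ...   | a⁻¹ , aa = ⊥-elim (false≢true out (subst (λ z → S.inSpan z ≡ true) Y≡ (S.inSpan-comb ((⊖ a⁻¹) · as))))
          where
          Y≡ : comb ((⊖ a⁻¹) · as) bs ≡ Y
          Y≡ = trans (comb-· (⊖ a⁻¹) as bs) (sym (flip e))
            where
            flip : a · Y +ᵛ comb as bs ≡ 0ᵛ → Y ≡ (⊖ a⁻¹) · comb as bs
            flip e = trans (trans (sym (·-identity Y)) (cong (_· Y) (sym (trans (⊗-comm a⁻¹ a) aa))))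
              (trans (sym (·-assoc a⁻¹ a Y)) (trans (sym (+ᵛ-identityʳ _)) (trans (cong (a⁻¹ · a · Y +ᵛ_) (sym (·-inverse a⁻¹ (comb as bs))))
                (trans (sym (+ᵛ-assoc _ _ _)) (trans (cong (_+ᵛ (⊖ a⁻¹) · comb as bs) (trans (sym (·-distribˡ a⁻¹ _ _)) (trans (cong (a⁻¹ ·_) e) (·-zeroʳ a⁻¹)))) (+ᵛ-identityˡ _))))))
        module U = Span (Y ∷ bs) liY
        affs : List (𝕍 (suc K))
        affs = concatMap (λ x → map (_∷ x) Fs) (pts K)
        ∑-affs : ∀ f → ∑ affs f ≡ ∑ (pts K) (λ x → ∑ Fs (λ a → f (a ∷ x)))
        ∑-affs f = trans (∑-concatMap (λ x → map (_∷ x) Fs) (pts K) f) (∑-cong (pts K) (λ x → ∑-map (_∷ x) Fs f))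
        -- A line of `β` from `Y` to the subspace contributes its `q` points other than `Y`, and
        -- different lines share only `Y`. The coordinates `a ∷ x` stand for `a Y` plus the point
        -- `x`.
        covered : q * degree Y ≤ ∑ (pts d) (λ Z → ⟦ mem β Z ∧ U.inSpan Z ⟧)
        covered = ≤-trans (≤-reflexive (sym (trans (∑-affs (λ z → ⟦ through (Vec.tail z) Y ⟧)) (trans (∑-cong (pts K) (λ x → ∑-Fs-const ⟦ through x Y ⟧)) (∑-*ˡ (pts K) q _)))))
            (∑-inject affs (pts d) (λ z → through (Vec.tail z) Y) (λ Z → ⟦ mem β Z ∧ U.inSpan Z ⟧) (λ z Z → par Z (comb z (Y ∷ bs)))
              (λ z i _ → ∑-par _ (U.comb-≢0 (aff-≢0 {z} (aff-normal i)))) at-most)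
          where
          aff-normal : ∀ {z} → z ∈ affs → Normal (Vec.tail z)
          aff-normal = go (pts K) (λ _ → normal)
            where
            row : ∀ x (L : List 𝔽) (M : List (𝕍 (suc K))) → Normal x → (∀ {z} → z ∈ M → Normal (Vec.tail z)) → ∀ {z} → z ∈ map (_∷ x) L ++ M → Normal (Vec.tail z)
            row x []      M n rest i           = rest i
            row x (a ∷ L) M n rest (here refl) = n
            row x (a ∷ L) M n rest (there i)   = row x L M n rest i
            go : ∀ (L : List (𝕍 K)) → (∀ x → x ∈ L → Normal x) → ∀ {z} → z ∈ concatMap (λ x → map (_∷ x) Fs) L → Normal (Vec.tail z)
            go [] n ()
            go (x ∷ L) n i = row x Fs _ (n x (here refl)) (go L (λ y → n y ∘ there)) i
          aff-≢0 : ∀ {z : 𝕍 (suc K)} → Normal (Vec.tail z) → z ≢ 0ᵛ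
          aff-≢0 n refl = normal-≢0 n refl
          at-most : ∀ Z → Z ∈ pts d → ∑ affs (λ z → ⟦ through (Vec.tail z) Y ∧ par Z (comb z (Y ∷ bs)) ⟧) ≤ ⟦ mem β Z ∧ U.inSpan Z ⟧
          at-most Z iZ = ∑-unique affs eqᵛ once (λ z → through (Vec.tail z) Y ∧ par Z (comb z (Y ∷ bs)))
              (λ z w iz iw ez ew → eqᵛ-complete (same z w (aff-normal iz) (aff-normal iw)
                (par-sound (normal iZ) (proj₂ (∧-true {through (Vec.tail z) Y} ez))) (par-sound (normal iZ) (proj₂ (∧-true {through (Vec.tail w) Y} ew)))))
              _ (λ z iz ez → ≤-reflexive (cong ⟦_⟧ (sym (lies z (aff-normal iz) (∧-true {through (Vec.tail z) Y} ez)))))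
            where
            once : ∀ w → ∑ affs (λ z → ⟦ eqᵛ z w ⟧) ≤ 1
            once (b ∷ w) = ≤-trans (≤-reflexive (trans (∑-affs _) (∑-cong (pts K) (λ x → trans (∑-cong Fs (λ a → ⟦⟧-∧ (a == b) (eqᵛ x w)))
              (trans (∑-*ʳ Fs ⟦ eqᵛ x w ⟧ _) (trans (cong (_* ⟦ eqᵛ x w ⟧) (∑-Fs-δ b)) (+-identityʳ _))))))) (∑-pts-eq w)
            same : ∀ z w → Normal (Vec.tail z) → Normal (Vec.tail w) → ∃[ c ] (comb z (Y ∷ bs) ≡ c · Z) → ∃[ c ] (comb w (Y ∷ bs) ≡ c · Z) → z ≡ w
            same (a ∷ x) (b ∷ y) nx ny (c , e) (c′ , e′) with inverse c (λ z → U.comb-≢0 (aff-≢0 {a ∷ x} nx) (trans e (trans (cong (_· Z) z) (·-zeroˡ Z))))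
            ... | c⁻¹ , cc = finish (LI-injective liY (b ∷ y) (r · (a ∷ x)) (trans e′ (sym (trans (comb-· r (a ∷ x) (Y ∷ bs)) (trans (cong (r ·_) e) (trans (·-assoc r c Z) (cong (_· Z) rc)))))))
              where
              r = c′ ⊗ c⁻¹
              rc : r ⊗ c ≡ c′
              rc = trans (⊗-assoc c′ c⁻¹ c) (trans (cong (c′ ⊗_) (trans (⊗-comm c⁻¹ c) cc)) (⊗-identityʳ c′))
              finish : b ∷ y ≡ r · (a ∷ x) → a ∷ x ≡ b ∷ y
              finish eq = sym (trans eq (trans (cong (_· (a ∷ x)) r≡1) (·-identity (a ∷ x))))
                where
                y≡x : y ≡ x
                y≡x = normal-unique {c = r} nx ny (cong Vec.tail eq)
                r≡1 : r ≡ 𝟙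
                r≡1 = one nx (trans (sym y≡x) (cong Vec.tail eq))
                  where
                  one : ∀ {n} {x : 𝕍 n} → Normal x → x ≡ r · x → r ≡ 𝟙
                  one pivot e = sym (trans (cong Vec.head e) (⊗-identityʳ r))
                  one (below n) e = one n (cong Vec.tail e)
            lies : ∀ z → Normal (Vec.tail z) → through (Vec.tail z) Y ≡ true × par Z (comb z (Y ∷ bs)) ≡ true → mem β Z ∧ U.inSpan Z ≡ true
            lies (a ∷ x) nx (line , p) with par-sound (normal iZ) p
            ... | c , e with inverse c (λ z → U.comb-≢0 (aff-≢0 {a ∷ x} nx) (trans e (trans (cong (_· Z) z) (·-zeroˡ Z))))
            ...   | c⁻¹ , cc = ∧-intro (trans (sym (inv β c Z c≢0)) (subst (_∈ˢ β) e (on-line (a ≟ᶠ 𝟘))))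
                (subst (λ w → U.inSpan w ≡ true) (trans (comb-· c⁻¹ (a ∷ x) (Y ∷ bs)) (trans (cong (c⁻¹ ·_) e) (trans (·-assoc c⁻¹ c Z) (trans (cong (_· Z) (trans (⊗-comm c⁻¹ c) cc)) (·-identity Z)))))
                  (U.inSpan-comb (c⁻¹ · (a ∷ x))))
              where
              c≢0 : c ≢ 𝟘
              c≢0 z = U.comb-≢0 (aff-≢0 {a ∷ x} nx) (trans e (trans (cong (_· Z) z) (·-zeroˡ Z)))
              on-line : Dec (a ≡ 𝟘) → comb (a ∷ x) (Y ∷ bs) ∈ˢ β
              on-line (yes refl) = subst (_∈ˢ β) (sym (trans (cong (_+ᵛ comb x bs) (·-zeroˡ Y)) (+ᵛ-identityˡ _))) (inside x (S.comb-≢0 (normal-≢0 nx)))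
              on-line (no a≢0) with inverse a a≢0
              ... | a⁻¹ , aa = subst (_∈ˢ β) (trans (·-distribˡ a Y _) (cong (a · Y +ᵛ_) (trans (·-assoc a a⁻¹ _) (trans (cong (_· comb x bs) aa) (·-identity _)))))
                    (∈-scale β a≢0 (lineᵇ-sound β (comb x bs) Y line a⁻¹))
        few : ∑ (pts d) (λ Z → ⟦ mem β Z ∧ not (U.inSpan Z) ⟧) < 2 * q ^ K
        few = +-cancelˡ-< (∑ (pts d) (λ Z → ⟦ mem β Z ∧ U.inSpan Z ⟧)) _ _ (≤-<-trans (≤-reflexive (trans (sym (∑-+ (pts d) _ _)) (∑-cong (pts d) (λ Z → sym (split (mem β Z) (U.inSpan Z))))))
            (<-≤-trans big (+-monoˡ-≤ _ covered)))
          where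
          split : ∀ a b → ⟦ a ⟧ ≡ ⟦ a ∧ b ⟧ + ⟦ a ∧ not b ⟧
          split true  true  = refl
          split true  false = refl
          split false _     = refl

  private
    -- Induction on `k`, starting from a line in a good fibre. The step passes to a core, whose
    -- points are all essential as gluing requires, cuts it by a hyperplane containing a 2-secant at
    -- `P`, obtains there a space through `P` of one dimension less, and glues inside the core.
    space-through′ : ∀ k β → Blocks 2 (suc k) β → Small (suc k) β → ∀ {P} → P ∈ pts d → P ∈ˢ β → Essential (suc k) β P → SpaceThrough (suc k) β P
    space-through′ zero β blocking small {P} iP P∈β (h ∷ [] , kerP , two) = line (Fan.good-exists 0 β blocking iP P∈β (h ∷ []) (kerP , two) (small⇒slim {0} β small))
      where
      line : ∃[ x ] (x ∈ pts 1 × Fan.goodᵇ 0 β blocking iP P∈β (h ∷ []) (kerP , two) x ≡ true) → SpaceThrough 1 β P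
      line (x , ix , g) = assemble (Fan.Good-fibre.full-line 0 β blocking iP P∈β (h ∷ []) (kerP , two)
          (proj₁ ℓ) (proj₁ (proj₂ ℓ)) (proj₂ (proj₂ ℓ)) ix (Fan.goodᵇ-sound 0 β blocking iP P∈β (h ∷ []) (kerP , two) x g))
        where
        ℓ = Fan.ℓ-exists 0 β blocking iP P∈β (h ∷ []) (kerP , two)
        assemble : ∃[ R ] (R ∈ pts d × lead x (h ∷ []) ∙ R ≢ 𝟘 × Full (β ∩ ker (perp x (h ∷ []))) P R) → SpaceThrough 1 β P
        assemble (R , iR , vR , full) = P ∷ R ∷ [] , independent , inside , 𝟙 ∷ 𝟘 ∷ []
            , trans (cong₂ _+ᵛ_ (·-identity P) (trans (+ᵛ-identityʳ _) (·-zeroˡ R))) (+ᵛ-identityʳ P)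
          where
          v = lead x (h ∷ [])
          vP : v ∙ P ≡ 𝟘
          vP = proj₂ (Fan.kerφ⇒fibre 0 β blocking iP P∈β (h ∷ []) (kerP , two) ix kerP)
          flat : ∀ a b → comb (a ∷ b ∷ []) (P ∷ R ∷ []) ≡ a · P +ᵛ b · R
          flat a b = cong (a · P +ᵛ_) (+ᵛ-identityʳ (b · R))
          independent : LI (P ∷ R ∷ [])
          independent (a ∷ b ∷ []) e with pts-indep iP iR (λ R≡P → vR (trans (cong (v ∙_) R≡P) vP)) a b (trans (sym (flat a b)) e)
          ... | refl , refl = refl
          inside : Inside β (P ∷ R ∷ [])
          inside (a ∷ b ∷ []) n = subst (_∈ˢ β) (sym (flat a b)) (proj₁ (∧-true (full a b (λ z → n (trans (flat a b) z)))))
    space-through′ (suc k) β blocking small {P} iP P∈β ess = from-core (find-core β blocking (small⇒slim {suc k} β small))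
      where
      from-core : Core (suc (suc k)) β → SpaceThrough (suc (suc k)) β P
      from-core C = from-section (proj₁ (tight C P iP P∈γ))
        where
        γ = core C
        P∈γ : P ∈ˢ γ
        P∈γ = essential-persists β γ (core⊆ C) (core-blocks C) iP P∈β ess
        small-γ : Small (suc (suc k)) γ
        small-γ = ≤-trans (*-monoʳ-≤ 24 (size-⊆ {γ} {β} (λ v _ → core⊆ C v))) small
        from-section : Essential (suc (suc k)) γ P → SpaceThrough (suc (suc k)) β P
        from-section (φ , kerP , two) = with-section (small-section γ φ small-γ two)
          where
          with-section : ∃[ y ] (y ∈ pts (suc (suc k)) × Small (suc k) (γ ∩ hyp (comb y φ))) → SpaceThrough (suc (suc k)) β P
          -- `P` stays essential in the section: `comb y φ` and `drop y φ` together have the kernel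
          -- of `φ`.
          with-section (y , iy , small-y) = grow (space-through′ k (γ ∩ hyp (comb y φ)) blocking-y small-y iP
              (∧-intro P∈γ (==-complete (comb-kernel φ y P kerP))) (drop y φ , proj₂ (∧-true {comb y φ ∙ P == 𝟘} (trans (drop-kernel (normal iy) φ P) kerP))
                , ≤-trans (≤-reflexive (size-cong {γ ∩ hyp (comb y φ) ∩ ker (drop y φ)} {γ ∩ ker φ} (λ v → trans (Boolₚ.∧-assoc (mem γ v) _ _) (cong (mem γ v ∧_) (drop-kernel (normal iy) φ v))))) two))
            where
            blocking-y : Blocks 2 (suc k) (γ ∩ hyp (comb y φ))
            blocking-y ψ = subst (2 ≤_) (sym (size-cong {γ ∩ hyp (comb y φ) ∩ ker ψ} {γ ∩ ker (comb y φ ∷ ψ)} (λ v → Boolₚ.∧-assoc (mem γ v) _ _))) (core-blocks C (comb y φ ∷ ψ))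
            grow : SpaceThrough (suc k) (γ ∩ hyp (comb y φ)) P → SpaceThrough (suc (suc k)) β P
            grow (bs , li , inside , as , e) = finish (Glue.extension γ (core-blocks C) small-γ (λ R iR R∈ → proj₁ (tight C R iR R∈)) bs li
                (λ cs n → proj₁ (∧-true (inside cs n))))
              where
              finish : ∃[ Y ] (LI (Y ∷ bs) × Inside γ (Y ∷ bs)) → SpaceThrough (suc (suc k)) β P
              finish (Y , liY , insideY) = Y ∷ bs , liY , (λ cs n → core⊆ C _ (insideY cs n)) , 𝟘 ∷ as , trans (cong (_+ᵛ comb as bs) (·-zeroˡ Y)) (trans (+ᵛ-identityˡ _) e)

  abstract
    space-through : ∀ k β → Blocks 2 (suc k) β → Small (suc k) β → ∀ {P} → P ∈ pts d → P ∈ˢ β → Essential (suc k) β P → SpaceThrough (suc k) β P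
    space-through = space-through′

-- Dimension arguments by counting vectors.

module Dimension {q : ℕ} (F : FiniteField q) (d : ℕ)
  (E : ℕ) (E-small : E + E < q) (2<q : 2 < q) (char : ∀ j → 1 ≤ j → j ≤ E → Field.ℕ→𝔽 F j ≢ Field.𝟘 F) where
  open Field F
  open Lacunary F using (1≤q)
  open Vectors F hiding (d)
  open PointSets F d
  open Fibres F d E E-small 2<q char
  open Subspaces F d E E-small 2<q char

  -- By counting, such a map is not injective.
  kernel-vector : ∀ {m e} (L : 𝕍 m → 𝕍 e) → (∀ u c v → L (u +ᵛ c · v) ≡ L u +ᵛ c · L v) → e < m → ∃[ w ] (w ≢ 0ᵛ × L w ≡ 0ᵛ)
  kernel-vector {m} {e} L linear lt with search (vecs m) {λ w → w ≢ 0ᵛ × L w ≡ 0ᵛ} {λ w → L w ≡ 0ᵛ → w ≡ 0ᵛ} decide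
    where
    decide : ∀ w → w ∈ vecs m → (w ≢ 0ᵛ × L w ≡ 0ᵛ) ⊎ (L w ≡ 0ᵛ → w ≡ 0ᵛ)
    decide w _ with w ≟ᵛ 0ᵛ | L w ≟ᵛ 0ᵛ
    ... | yes z | _    = inj₂ (λ _ → z)
    ... | no n  | yes z = inj₁ (n , z)
    ... | no n  | no n′ = inj₂ (λ z → ⊥-elim (n′ z))
  ... | inj₁ (w , _ , r) = w , r
  ... | inj₂ none = ⊥-elim (<⇒≱ (^-monoʳ-< q (≤-trans (s≤s (s≤s z≤n)) (<⇒≤ 2<q)) lt) (≤-trans (≤-reflexive (sym (∑-vecs-1 m)))
      (≤-trans (∑-inject (vecs m) (vecs e) (λ _ → true) (λ _ → 1) (λ v x → eqᵛ x (L v)) (λ v _ _ → ∑-vecs-δ (L v)) at-most) (≤-reflexive (∑-vecs-1 e)))))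
    where
    minus : ∀ {n} (v : 𝕍 n) → v +ᵛ (⊖ 𝟙) · v ≡ 0ᵛ
    minus v = trans (cong (_+ᵛ (⊖ 𝟙) · v) (sym (·-identity v))) (·-inverse 𝟙 v)
    minus-0 : ∀ {n} (u v : 𝕍 n) → u +ᵛ (⊖ 𝟙) · v ≡ 0ᵛ → u ≡ v
    minus-0 u v e = trans (sym (trans (+ᵛ-assoc u _ v) (trans (cong (u +ᵛ_) (trans (+ᵛ-comm _ v) (minus v))) (+ᵛ-identityʳ u)))) (trans (cong (_+ᵛ v) e) (+ᵛ-identityˡ v))
    at-most : ∀ x → x ∈ vecs e → ∑ (vecs m) (λ v → ⟦ true ∧ eqᵛ x (L v) ⟧) ≤ 1
    at-most x _ = ∑-unique (vecs m) eqᵛ (λ w → ≤-reflexive (∑-vecs-δ w)) (λ v → eqᵛ x (L v))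
      (λ u v _ _ eu ev′ → eqᵛ-complete (minus-0 u v (none _ (∈-vecs _) (trans (linear u (⊖ 𝟙) v)
        (trans (cong (λ z → z +ᵛ (⊖ 𝟙) · L v) (trans (sym (eqᵛ-sound {u = x} {L u} eu)) (eqᵛ-sound {u = x} {L v} ev′))) (minus (L v))))))) 1 (λ _ _ _ → ≤-refl)

  combs : ∀ {a b} → 𝕍 (a + b) → Vec V a → Vec V b → V
  combs {zero}  z       []       ws = comb z ws
  combs {suc a} (c ∷ z) (u ∷ us) ws = c · u +ᵛ combs z us ws

  combs-linear : ∀ {a b} (us : Vec V a) (ws : Vec V b) u c v → combs (u +ᵛ c · v) us ws ≡ combs u us ws +ᵛ c · combs v us ws
  combs-linear [] ws u c v = trans (comb-+ u (c · v) ws) (cong (comb u ws +ᵛ_) (comb-· c v ws))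
  combs-linear (x ∷ us) ws (a ∷ u) c (b ∷ v) = trans (cong₂ _+ᵛ_ (trans (·-distribʳ a (c ⊗ b) x) (cong (a · x +ᵛ_) (sym (·-assoc c b x)))) (combs-linear us ws u c v))
    (trans (+ᵛ-interchange (a · x) (c · b · x) (combs u us ws) (c · combs v us ws)) (cong (a · x +ᵛ combs u us ws +ᵛ_) (sym (·-distribˡ c (b · x) (combs v us ws)))))

  combs-split : ∀ {a b} (us : Vec V a) (ws : Vec V b) z →
    ∃[ as ] ∃[ bs ] (combs z us ws ≡ comb as us +ᵛ comb bs ws × (as ≡ 0ᵛ → bs ≡ 0ᵛ → z ≡ 0ᵛ))
  combs-split [] ws z = [] , z , sym (+ᵛ-identityˡ _) , λ _ e → e
  combs-split (u ∷ us) ws (c ∷ z) with combs-split us ws z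
  ... | as , bs , e , f = c ∷ as , bs , trans (cong (c · u +ᵛ_) e) (sym (+ᵛ-assoc _ _ _)) , λ e₁ e₂ → cong₂ _∷_ (cong Vec.head e₁) (f (cong Vec.tail e₁) e₂)

  -- More than `d` vectors satisfy a relation, and independence of `ws` prevents its part on `us`
  -- from being trivial.
  meets : ∀ {a b} (us : Vec V a) (ws : Vec V b) → LI us → LI ws → d < a + b →
    ∃[ as ] ∃[ bs ] (as ≢ 0ᵛ × comb as us ≡ comb bs ws)
  meets us ws liu liw lt with kernel-vector (λ z → combs z us ws) (combs-linear us ws) lt
  ... | z , z≢0 , e with combs-split us ws z
  ...   | as , bs , e′ , f = as , (⊖ 𝟙) · bs , nonzero , trans (⊕-cancel (trans (sym e′) e)) (sym (comb-· (⊖ 𝟙) bs ws))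
    where
    ⊕-cancel : ∀ {x y : V} → x +ᵛ y ≡ 0ᵛ → x ≡ (⊖ 𝟙) · y
    ⊕-cancel {x} {y} e = trans (sym (trans (+ᵛ-assoc x y _) (trans (cong (x +ᵛ_) (trans (cong (_+ᵛ (⊖ 𝟙) · y) (sym (·-identity y))) (·-inverse 𝟙 y))) (+ᵛ-identityʳ x))))
      (trans (cong (_+ᵛ (⊖ 𝟙) · y) e) (+ᵛ-identityˡ _))
    nonzero : as ≢ 0ᵛ
    nonzero refl = z≢0 (f refl (liw bs (trans (sym (trans (cong (_+ᵛ comb bs ws) (comb-0 us)) (+ᵛ-identityˡ _))) (trans (sym e′) e))))

  ev-++ : ∀ {a b} → Vec V a → Vec V b → V → 𝕍 (a + b)
  ev-++ []      φ v = ev φ v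
  ev-++ (h ∷ g) φ v = h ∙ v ∷ ev-++ g φ v

  ev-++-linear : ∀ {a b} (g : Vec V a) (φ : Vec V b) u c v → ev-++ g φ (u +ᵛ c · v) ≡ ev-++ g φ u +ᵛ c · ev-++ g φ v
  ev-++-linear []      φ u c v = trans (ev-+ φ u (c · v)) (cong (ev φ u +ᵛ_) (ev-· φ c v))
  ev-++-linear (h ∷ g) φ u c v = cong₂ _∷_ (trans (∙-+ʳ h u (c · v)) (cong (h ∙ u ⊕_) (∙-·ʳ c h v))) (ev-++-linear g φ u c v)

  ev-++-0 : ∀ {a b} (g : Vec V a) (φ : Vec V b) v → ev-++ g φ v ≡ 0ᵛ → ev g v ≡ 0ᵛ × ev φ v ≡ 0ᵛ
  ev-++-0 []      φ v e = refl , e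
  ev-++-0 (h ∷ g) φ v e with ev-++-0 g φ v (cong Vec.tail e)
  ... | p , r = cong₂ _∷_ (cong Vec.head e) p , r

  -- Each new vector is killed by `φ` and by the functionals dual to the vectors already found,
  -- which gives independence at once.
  kernel-basis : ∀ {k} (φ : Vec V k) r → r + k ≤ d → ∃[ bs ] (LI {r} bs × (∀ as → ev φ (comb as bs) ≡ 0ᵛ))
  kernel-basis φ zero le = [] , (λ { [] _ → refl }) , λ { [] → ev-0 φ }
    where
    ev-0 : ∀ {k} (φ : Vec V k) → ev φ 0ᵛ ≡ 0ᵛ
    ev-0 []      = refl
    ev-0 (h ∷ φ) = cong₂ _∷_ (∙-0ʳ h) (ev-0 φ)
  kernel-basis φ (suc r) le with kernel-basis φ r (≤-trans (n≤1+n _) le)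
  ... | bs , li , zeros with dual bs li
  ...   | g , dg with kernel-vector (ev-++ g φ) (ev-++-linear g φ) le
  ...     | w , w≢0 , e = w ∷ bs , li′ , λ { (a ∷ as) → trans (ev-+ φ (a · w) _) (trans (cong₂ _+ᵛ_
              (trans (ev-· φ a w) (trans (cong (a ·_) (proj₂ (ev-++-0 g φ w e))) (·-zeroʳ a))) (zeros as)) (+ᵛ-identityˡ 0ᵛ)) }
    where
    li′ : LI (w ∷ bs)
    li′ (a ∷ as) z = conclude as≡0 (a ≟ᶠ 𝟘)
      where
      as≡0 : as ≡ 0ᵛ
      as≡0 = trans (sym (dg as)) (trans (sym (+ᵛ-identityˡ _)) (trans (cong (_+ᵛ ev g (comb as bs)) (sym (trans (ev-· g a w)
        (trans (cong (a ·_) (proj₁ (ev-++-0 g φ w e))) (·-zeroʳ a))))) (trans (sym (ev-+ g (a · w) (comb as bs))) (trans (cong (ev g) z) (ev-zero g)))))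
        where
        ev-zero : ∀ {k} (g : Vec V k) → ev g 0ᵛ ≡ 0ᵛ
        ev-zero []      = refl
        ev-zero (h ∷ g) = cong₂ _∷_ (∙-0ʳ h) (ev-zero g)
      conclude : as ≡ 0ᵛ → Dec (a ≡ 𝟘) → a ∷ as ≡ 0ᵛ
      conclude refl (yes refl) = refl
      conclude refl (no a≢0) = ⊥-elim (w≢0 (·-cancel-0 a≢0 (trans (sym (+ᵛ-identityʳ _)) (trans (cong (a · w +ᵛ_) (sym (comb-0 bs))) z))))

-- Two disjoint k-spaces in a set of essential points.

module Pairs {q : ℕ} (F : FiniteField q) (d : ℕ)
  (E : ℕ) (E-small : E + E < q) (2<q : 2 < q) (char : ∀ j → 1 ≤ j → j ≤ E → Field.ℕ→𝔽 F j ≢ Field.𝟘 F)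
  (κ : ℕ) (κ-small : κ < 24 * E)
  (glue-inequality : ∀ t ε B → 1 ≤ t → 24 * ε ≤ κ * t → E * B ≤ ε * t →
    (2 * t + ε) * (2 + 2 * (q * t) + ε) + q * (t * t) + q * q * B < q * q * (t * t))
  (G : ℕ) (1≤G : 1 ≤ G) (G-large : q ≤ G * E + 1) (G-small : (1 + G) * κ + 48 ≤ 24 * q) where
  open Field F
  open Lacunary F using (1≤q)
  open Vectors F hiding (d)
  open PointSets F d
  open Fibres F d E E-small 2<q char
  open Subspaces F d E E-small 2<q char
  open Structure F d E E-small 2<q char κ κ-small glue-inequality

  module SpanSet {m : ℕ} (us : Vec V m) (li : LI us) where
    open Span us li public

    span : PSet
    mem span = inSpan
    inv span a v a≢0 = bool-ext
      (λ e → eqᵛ-complete (unscale (trans (sym (proj-· a v)) (eqᵛ-sound e))))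
      (λ e → eqᵛ-complete (trans (proj-· a v) (cong (a ·_) (eqᵛ-sound e))))
      where
      proj-· : ∀ a v → proj (a · v) ≡ a · proj v
      proj-· a v = trans (cong (λ z → comb z us) (ev-· g a v)) (comb-· a (ev g v) us)
      unscale : ∀ {x y : V} → a · x ≡ a · y → x ≡ y
      unscale {x} {y} e with inverse a a≢0
      ... | b , ab = trans (sym (inverted x)) (trans (cong (b ·_) e) (inverted y))
        where
        inverted : ∀ x → b · a · x ≡ x
        inverted x = trans (·-assoc b a x) (trans (cong (_· x) (trans (⊗-comm b a) ab)) (·-identity x))

    span⊆ : ∀ β → Inside β us → ∀ v → v ∈ pts d → v ∈ˢ span → v ∈ˢ β
    span⊆ β inside v i e = subst (_∈ˢ β) (sym (inSpan-sound e)) (inside (ev g v) (λ z → normal-≢0 (normal i) (trans (inSpan-sound e) z)))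

    from-coordinates : ∀ (b : 𝕍 m → Bool) (β : PSet) → (∀ x → x ∈ pts m → b x ≡ true → comb x us ∈ˢ β) → ∑ (pts m) (⟦_⟧ ∘ b) ≤ size (span ∩ β)
    from-coordinates b β sound = ∑-inject (pts m) (pts d) b (λ Y → ⟦ mem (span ∩ β) Y ⟧) (λ x Y → par Y (comb x us))
      (λ x i _ → ∑-par (comb x us) (comb-≢0 (normal-≢0 (normal i)))) at-most
      where
      at-most : ∀ Y → Y ∈ pts d → ∑ (pts m) (λ x → ⟦ b x ∧ par Y (comb x us) ⟧) ≤ ⟦ mem (span ∩ β) Y ⟧
      at-most Y iY = ∑-unique (pts m) eqᵛ ∑-pts-eq (λ x → b x ∧ par Y (comb x us))
          (λ x y ix iy ex ey → eqᵛ-complete (same x y (normal ix) (normal iy) (par-sound (normal iY) (proj₂ (∧-true {b x} ex))) (par-sound (normal iY) (proj₂ (∧-true {b y} ey)))))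
          _ (λ x ix ex → ≤-reflexive (cong ⟦_⟧ (sym (member x ix (par-sound (normal iY) (proj₂ (∧-true {b x} ex))) (proj₁ (∧-true ex))))))
        where
        unit : ∀ x → Normal x → ∀ {c} → comb x us ≡ c · Y → c ≢ 𝟘
        unit x nx e z = comb-≢0 (normal-≢0 nx) (trans e (trans (cong (_· Y) z) (·-zeroˡ Y)))
        member : ∀ x → x ∈ pts m → ∃[ c ] (comb x us ≡ c · Y) → b x ≡ true → mem (span ∩ β) Y ≡ true
        member x ix (c , e) bx = ∧-intro (trans (sym (inv span c Y c≢0)) (trans (cong inSpan (sym e)) (inSpan-comb x))) (trans (sym (inv β c Y c≢0)) (trans (cong (mem β) (sym e)) (sound x ix bx)))
          where c≢0 = unit x (normal ix) e
        same : ∀ x y → Normal x → Normal y → ∃[ c ] (comb x us ≡ c · Y) → ∃[ c ] (comb y us ≡ c · Y) → x ≡ y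
        same x y nx ny (c , e) (c′ , e′) with inverse c (unit x nx e)
        ... | c⁻¹ , cc = sym (normal-unique {c = c′ ⊗ c⁻¹} nx ny (LI-injective li y ((c′ ⊗ c⁻¹) · x) (trans e′ (sym (trans (comb-· (c′ ⊗ c⁻¹) x us)
              (trans (cong ((c′ ⊗ c⁻¹) ·_) e) (trans (·-assoc (c′ ⊗ c⁻¹) c Y) (cong (_· Y) (trans (⊗-assoc c′ c⁻¹ c) (trans (cong (c′ ⊗_) (trans (⊗-comm c⁻¹ c) cc)) (⊗-identityʳ c′)))))))))))

  infixl 6 _∪_
  _∪_ : PSet → PSet → PSet
  mem (β ∪ γ) v = mem β v ∨ mem γ v
  inv (β ∪ γ) a v n = cong₂ _∨_ (inv β a v n) (inv γ a v n)

  -- `X + T` would be a third point. Applied to a subspace inside a set, cut by a 2-secant at `X`,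
  -- this puts the partner of `X` outside the subspace.
  third-point : ∀ β {X T} (σ : PSet) → X ∈ pts d → T ∈ pts d → T ≢ X → X ∈ˢ σ → T ∈ˢ σ → (∀ a b → a · X +ᵛ b · T ∈ˢ σ) → (∀ v → v ∈ pts d → v ∈ˢ σ → v ∈ˢ β) → size β ≤ 2 → ⊥
  third-point β {X} {T} σ iX iT T≢X Xσ Tσ closed sub two = from-normal (normalise (𝟙 · X +ᵛ 𝟙 · T) (λ z → 1≢0 (proj₁ (ind 𝟙 𝟙 z))))
    where
    ind : Indep X T
    ind = pts-indep iX iT T≢X
    from-normal : ∃[ Z ] ∃[ c ] (Z ∈ pts d × c ≢ 𝟘 × 𝟙 · X +ᵛ 𝟙 · T ≡ c · Z) → ⊥
    from-normal (Z , c , iZ , c≢0 , e) = absurd-T (size≤2-unique β two iX iT iZ (sub X iX Xσ) (sub T iT Tσ) (sub Z iZ Zσ) T≢X absurd-X)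
      where
      Zσ : Z ∈ˢ σ
      Zσ = trans (sym (inv σ c Z c≢0)) (trans (cong (mem σ) (sym e)) (closed 𝟙 𝟙))
      absurd-X : Z ≢ X
      absurd-X refl = 1≢0 (proj₂ (ind (𝟙 ⊕ ⊖ c) 𝟙 (trans (cong (_+ᵛ 𝟙 · T) (·-distribʳ 𝟙 (⊖ c) X)) (trans (+ᵛ-assoc _ _ _) (trans (cong (𝟙 · X +ᵛ_) (+ᵛ-comm _ (𝟙 · T)))
        (trans (sym (+ᵛ-assoc _ _ _)) (trans (cong (_+ᵛ (⊖ c) · X) e) (·-inverse c X))))))))
      absurd-T : T ≡ Z → ⊥
      absurd-T refl = 1≢0 (proj₁ (ind 𝟙 (𝟙 ⊕ ⊖ c) (trans (cong (𝟙 · X +ᵛ_) (·-distribʳ 𝟙 (⊖ c) T)) (trans (sym (+ᵛ-assoc _ _ _)) (trans (cong (_+ᵛ (⊖ c) · T) e) (·-inverse c T))))))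

  -- Here `p` is `q^K`, `g` the size of the set of partners and `s` that of `β`. Adding the first
  -- two inequalities eliminates `g`; the bound on `s` then leaves
  -- `24 q t + 24 ≤ ((1 + G) κ + 48) t`, against `G-small`.
  meeting-arithmetic : ∀ t p g s → t * q + 2 + G * (2 * (t + p)) ≤ g + G * s + t → g + (t + p) + p ≤ s + 1 →
    24 * s ≤ 48 * (t + p) + κ * t → ⊥
  meeting-arithmetic t p g s partners union small = absurd c (begin
    c + 24 ≡⟨ arith t q G p g ⟩
    24 * (t * q + 2 + G * (2 * (t + p))) + 24 * (g + (t + p) + p) + 24 * t ≤⟨ +-monoˡ-≤ (24 * t) (+-mono-≤ (*-monoʳ-≤ 24 partners) (*-monoʳ-≤ 24 union)) ⟩
    24 * (g + G * s + t) + 24 * (s + 1) + 24 * t ≡⟨ arith′ t G g s ⟩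
    (1 + G) * (24 * s) + 24 * g + 48 * t + 24 ≤⟨ +-monoˡ-≤ 24 (+-monoˡ-≤ (48 * t) (+-monoˡ-≤ (24 * g) (*-monoʳ-≤ (1 + G) small))) ⟩
    (1 + G) * (48 * (t + p) + κ * t) + 24 * g + 48 * t + 24 ≡⟨ arith″ t G g p κ ⟩
    48 * (1 + G) * (t + p) + 24 * g + 24 + ((1 + G) * κ + 48) * t ≤⟨ +-monoʳ-≤ (48 * (1 + G) * (t + p) + 24 * g + 24) (*-monoˡ-≤ t G-small) ⟩
    c ∎)
    where
    open ≤-Reasoning
    c = 48 * (1 + G) * (t + p) + 24 * g + 24 + 24 * q * t
    arith = semiring-solve 5 (λ t q G p g → # 48 ⋆ (# 1 ⊹ G) ⋆ (t ⊹ p) ⊹ # 24 ⋆ g ⊹ # 24 ⊹ # 24 ⋆ q ⋆ t ⊹ # 24 , # 24 ⋆ (t ⋆ q ⊹ # 2 ⊹ G ⋆ (# 2 ⋆ (t ⊹ p))) ⊹ # 24 ⋆ (g ⊹ (t ⊹ p) ⊹ p) ⊹ # 24 ⋆ t) refl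
    arith′ = semiring-solve 4 (λ t G g s → # 24 ⋆ (g ⊹ G ⋆ s ⊹ t) ⊹ # 24 ⋆ (s ⊹ # 1) ⊹ # 24 ⋆ t , (# 1 ⊹ G) ⋆ (# 24 ⋆ s) ⊹ # 24 ⋆ g ⊹ # 48 ⋆ t ⊹ # 24) refl
    arith″ = semiring-solve 5 (λ t G g p κ → (# 1 ⊹ G) ⋆ (# 48 ⋆ (t ⊹ p) ⊹ κ ⋆ t) ⊹ # 24 ⋆ g ⊹ # 48 ⋆ t ⊹ # 24 , # 48 ⋆ (# 1 ⊹ G) ⋆ (t ⊹ p) ⊹ # 24 ⋆ g ⊹ # 24 ⊹ ((# 1 ⊹ G) ⋆ κ ⊹ # 48) ⋆ t) refl
    absurd : ∀ c → ¬ c + 24 ≤ c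
    absurd c le = <⇒≱ (m<m+n c {24} (s≤s z≤n)) le

  Disjoint-spaces : ℕ → PSet → Set
  Disjoint-spaces k β = ∃[ us ] ∃[ ws ] (LI {suc k} us × LI {suc k} ws × Inside β us × Inside β ws × (∀ as bs → comb as us ≡ comb bs ws → comb as us ≡ 0ᵛ))

  module Final {j : ℕ} (β : PSet) (blocking : Blocks 2 (suc j) β) (small : Small (suc j) β)
    (essential : ∀ P → P ∈ pts d → P ∈ˢ β → Essential (suc j) β P) where

    private
      K = suc j
      t = Θ K

    -- A common point X of two subspaces of β would have all its secant partners outside both of them.
    module Meeting (us ws : Vec V (suc K)) (liu : LI us) (liw : LI ws) (inu : Inside β us) (inw : Inside β ws)
      {R : V} (iR : R ∈ pts d) (R∈ws : Span.inSpan ws liw R ≡ true) (R∉us : Span.inSpan us liu R ≡ false)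
      {X : V} (iX : X ∈ pts d) (X∈us : Span.inSpan us liu X ≡ true) (X∈ws : Span.inSpan ws liw X ≡ true) where

      private
        module U = SpanSet us liu
        module W = SpanSet ws liw

        γ : PSet
        γ = β ∩ (point (normal iX) ∪ ∁ (U.span ∪ W.span))

        X∈β : X ∈ˢ β
        X∈β = U.span⊆ β inu X iX X∈us

        X∈γ : X ∈ˢ γ
        X∈γ = ∧-intro X∈β (cong (_∨ not (mem (U.span ∪ W.span) X)) (par-refl (normal iX)))

        off : ∀ {m} (vs : Vec V m) (li : LI vs) → Inside β vs → Span.inSpan vs li X ≡ true → ∀ {T} → T ∈ pts d → T ≢ X →
          ∀ (χ : Vec V K) → Secant β χ X → mem (ker χ) T ≡ true → Span.inSpan vs li T ≡ false
        off vs li inside X∈ {T} iT T≢X χ (kerX , two) kerT = ≢true λ T∈ → third-point (β ∩ ker χ) (S.span ∩ ker χ) iX iT T≢X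
            (∧-intro X∈ kerX) (∧-intro T∈ kerT) (λ a b → ∧-intro (in-span T∈ a b) (in-ker a b))
            (λ v iv e → ∧-intro (S.span⊆ β inside v iv (proj₁ (∧-true e))) (proj₂ (∧-true {S.inSpan v} e))) two
          where
          module S = SpanSet vs li
          in-span : S.inSpan T ≡ true → ∀ a b → S.inSpan (a · X +ᵛ b · T) ≡ true
          in-span T∈ a b = subst (λ z → S.inSpan z ≡ true) (trans (comb-+ (a · ev S.g X) (b · ev S.g T) vs) (cong₂ _+ᵛ_
            (trans (comb-· a (ev S.g X) vs) (cong (a ·_) (sym (S.inSpan-sound X∈)))) (trans (comb-· b (ev S.g T) vs) (cong (b ·_) (sym (S.inSpan-sound T∈))))))
            (S.inSpan-comb (a · ev S.g X +ᵛ b · ev S.g T))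
          in-ker : ∀ a b → mem (ker χ) (a · X +ᵛ b · T) ≡ true
          in-ker a b = trans (ker-ev χ _) (eqᵛ-complete (trans (ev-+ χ _ _) (trans (cong₂ _+ᵛ_
            (trans (ev-· χ a X) (trans (cong (a ·_) (eqᵛ-sound (trans (sym (ker-ev χ X)) kerX))) (·-zeroʳ a)))
            (trans (ev-· χ b T) (trans (cong (b ·_) (eqᵛ-sound (trans (sym (ker-ev χ T)) kerT))) (·-zeroʳ b)))) (+ᵛ-identityˡ 0ᵛ))))

        closed : ∀ (χ : Vec V K) → Secant β χ X → 2 ≤ size (γ ∩ ker χ)
        closed χ sec = use (second (β ∩ ker χ) iX (blocking χ))
          where
          use : ∃[ T ] (T ∈ pts d × T ∈ˢ β ∩ ker χ × T ≢ X) → 2 ≤ size (γ ∩ ker χ)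
          use (T , iT , e , T≢X) = ≤-trans (s≤s (1≤size (remove (γ ∩ ker χ) iX) iT (∈-remove (γ ∩ ker χ) iX iT (∧-intro T∈γ (proj₂ b)) T≢X)))
              (≤-reflexive (sym (size-remove (γ ∩ ker χ) iX (∧-intro X∈γ (proj₁ sec)))))
            where
            b = ∧-true {mem β T} e
            T∈γ : T ∈ˢ γ
            T∈γ = ∧-intro (proj₁ b) (trans (cong (par X T ∨_) (cong not (cong₂ _∨_ (off us liu inu X∈us iT T≢X χ sec (proj₂ b)) (off ws liw inw X∈ws iT T≢X χ sec (proj₂ b))))) (Boolₚ.∨-zeroʳ (par X T)))

        U-size : Θ (suc K) ≤ size U.span
        U-size = ≤-trans (≤-reflexive (sym (∑-pts-1 (suc K)))) (≤-trans (U.from-coordinates (λ _ → true) U.span (λ x _ _ → U.inSpan-comb x)) (size-∩≤ U.span U.span))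

        -- A functional vanishing on `us` but not at `R` is a nonzero functional on the span of
        -- `ws`, and `q^K` points of that span lie off its zeros.
        W-size : q ^ K ≤ size (W.span ∩ ∁ U.span)
        W-size = from-functional (separate us R)
          where
          from-functional : (∃[ as ] (comb as us ≡ R)) ⊎ (∃[ f ] (Kills f us × f ∙ R ≢ 𝟘)) → q ^ K ≤ size (W.span ∩ ∁ U.span)
          from-functional (inj₁ (as , e)) = ⊥-elim (false≢true R∉us (subst (λ z → U.inSpan z ≡ true) e (U.inSpan-comb as)))
          from-functional (inj₂ (f , kills , fR)) = +-cancelˡ-≤ t _ _ (begin
            t + q ^ K ≡⟨ ∑-pts-1 (suc K) ⟨
            ∑ (pts (suc K)) (λ _ → 1) ≡⟨ ∑-cong (pts (suc K)) (λ x → sym (⟦⟧-not (c ∙ x == 𝟘))) ⟩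
            ∑ (pts (suc K)) (λ x → ⟦ c ∙ x == 𝟘 ⟧ + ⟦ not (c ∙ x == 𝟘) ⟧) ≡⟨ trans (∑-+ (pts (suc K)) _ _) (cong (_+ ∑ (pts (suc K)) (λ x → ⟦ not (c ∙ x == 𝟘) ⟧)) (∑-pts-hyperplane c c≢0 (<⇒≤ 2<q))) ⟩
            t + ∑ (pts (suc K)) (λ x → ⟦ not (c ∙ x == 𝟘) ⟧) ≤⟨ +-monoʳ-≤ t (W.from-coordinates (λ x → not (c ∙ x == 𝟘)) (∁ U.span) outside) ⟩
            t + size (W.span ∩ ∁ U.span) ∎)
            where
            open ≤-Reasoning
            c = ev ws f
            f-value : ∀ x → f ∙ comb x ws ≡ c ∙ x
            f-value x = trans (∙-comb f x ws) (∙-comm x c)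
            c≢0 : c ≢ 0ᵛ
            c≢0 z = fR (trans (cong (f ∙_) (W.inSpan-sound R∈ws)) (trans (f-value (ev W.g R)) (trans (cong (_∙ ev W.g R) z) (∙-0ˡ (ev W.g R)))))
            outside : ∀ x → x ∈ pts (suc K) → not (c ∙ x == 𝟘) ≡ true → not (U.inSpan (comb x ws)) ≡ true
            outside x _ e = not-false (≢true λ s → ≢-== (not-true e) (trans (sym (f-value x)) (trans (cong (f ∙_) (U.inSpan-sound s)) (kills-comb us (ev U.g (comb x ws)) kills))))

        total : size γ + Θ (suc K) + q ^ K ≤ size β + 1
        total = begin
          size γ + Θ (suc K) + q ^ K ≤⟨ +-mono-≤ (+-monoʳ-≤ (size γ) U-size) W-size ⟩
          size γ + size U.span + size (W.span ∩ ∁ U.span) ≡⟨ trans (∑-+ (pts d) _ _) (cong (_+ size (W.span ∩ ∁ U.span)) (∑-+ (pts d) _ _)) ⟨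
          ∑ (pts d) (λ v → ⟦ mem γ v ⟧ + ⟦ U.inSpan v ⟧ + ⟦ W.inSpan v ∧ not (U.inSpan v) ⟧) ≤⟨ ∑-mono-∈ (pts d) (λ v i → pointwise (mem β v) (par X v) (U.inSpan v) (W.inSpan v) (U.span⊆ β inu v i) (W.span⊆ β inw v i)
                                                                                              (λ p → subst (λ z → W.inSpan z ≡ true) (sym (par-≡ (normal iX) (normal i) p)) X∈ws)
                                                                                              (λ p → subst (λ z → U.inSpan z ≡ true) (sym (par-≡ (normal iX) (normal i) p)) X∈us)) ⟩
          ∑ (pts d) (λ v → ⟦ mem β v ⟧ + ⟦ par X v ⟧) ≡⟨ trans (∑-+ (pts d) _ _) (cong (size β +_) (size-point iX)) ⟩
          size β + 1 ∎
          where
          open ≤-Reasoning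
          pointwise : ∀ b p u w → (u ≡ true → b ≡ true) → (w ≡ true → b ≡ true) → (p ≡ true → w ≡ true) → (p ≡ true → u ≡ true) →
            ⟦ b ∧ (p ∨ not (u ∨ w)) ⟧ + ⟦ u ⟧ + ⟦ w ∧ not u ⟧ ≤ ⟦ b ⟧ + ⟦ p ⟧
          pointwise false p     true  w     f g h k = case f refl of λ ()
          pointwise false p     false true  f g h k = case g refl of λ ()
          pointwise false p     false false f g h k = z≤n
          pointwise true  true  true  true  f g h k = s≤s (s≤s z≤n)
          pointwise true  true  true  false f g h k = s≤s (s≤s z≤n)
          pointwise true  true  false w     f g h k = case k refl of λ ()
          pointwise true  false true  true  f g h k = s≤s z≤n
          pointwise true  false true  false f g h k = s≤s z≤n
          pointwise true  false false true  f g h k = s≤s z≤n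
          pointwise true  false false false f g h k = s≤s z≤n

      contradiction : ⊥
      contradiction = use (essential X iX X∈β)
        where
        use : Essential K β X → ⊥
        use (φ , sec) = meeting-arithmetic t (q ^ K) (size γ) (size β)
          (Fan.partner-bound j β blocking iX X∈β φ sec G 1≤G G-large γ (λ v e → proj₁ (∧-true e)) X∈γ closed) total small

    abstract
      disjoint-spaces : Disjoint-spaces K β
      disjoint-spaces = from-point (inhabitant β (≤-trans (s≤s z≤n) (≤-trans (blocking (replicate K 0ᵛ)) (size-∩≤ β (ker (replicate K 0ᵛ))))))
        where
        from-point : ∃[ P ] (P ∈ pts d × P ∈ˢ β) → Disjoint-spaces K β
        from-point (P , iP , P∈β) = from-space (space-through j β blocking small iP P∈β (essential P iP P∈β))
          where
          from-space : SpaceThrough K β P → Disjoint-spaces K β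
          from-space (us , liu , inu , _) = from-outside (∑-witness (pts d) {mem (β ∩ ∁ U.span)} outside)
            where
            module U = SpanSet us liu
            outside : 0 < size (β ∩ ∁ U.span)
            outside = +-cancelˡ-< (size (β ∩ U.span)) _ _ (subst₂ _<_ (sym (+-identityʳ _)) (size-split β U.span)
              (≤-<-trans (≤-trans (size-∩≤ʳ β U.span) U.span-size) (≤-trans (+-mono-≤ (Θ≥1 K) ≤-refl) (from-essential (essential P iP P∈β)))))
              where
              from-essential : Essential K β P → Θ (suc K) + Θ (suc K) ≤ size β
              from-essential (φ , sec) = ≤-trans (≤-reflexive (cong (Θ (suc K) +_) (sym (+-identityʳ _)))) (Fan.double j β blocking iP P∈β φ sec)
            from-outside : ∃[ R ] (R ∈ pts d × R ∈ˢ β ∩ ∁ U.span) → Disjoint-spaces K β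
            from-outside (R , iR , e) = from-second (space-through j β blocking small iR (proj₁ (∧-true e)) (essential R iR (proj₁ (∧-true e))))
              where
              from-second : SpaceThrough K β R → Disjoint-spaces K β
              from-second (ws , liw , inw , cs , cs≡) = us , ws , liu , liw , inu , inw , disjoint
                where
                module W = SpanSet ws liw
                disjoint : ∀ as bs → comb as us ≡ comb bs ws → comb as us ≡ 0ᵛ
                disjoint as bs eq = by-zero (comb as us ≟ᵛ 0ᵛ)
                  where
                  by-zero : Dec (comb as us ≡ 0ᵛ) → comb as us ≡ 0ᵛ
                  by-zero (yes z) = z
                  by-zero (no n) = ⊥-elim (meet (normalise (comb as us) n))
                    where
                    meet : ∃[ X ] ∃[ c ] (X ∈ pts d × c ≢ 𝟘 × comb as us ≡ c · X) → ⊥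
                    meet (X , c , iX , c≢0 , e′) = Meeting.contradiction us ws liu liw inu inw iR
                      (subst (λ z → W.inSpan z ≡ true) cs≡ (W.inSpan-comb cs)) (not-true (proj₂ (∧-true {mem β R} e))) iX
                      (trans (sym (inv U.span c X c≢0)) (trans (cong U.inSpan (sym e′)) (U.inSpan-comb as)))
                      (trans (sym (inv W.span c X c≢0)) (trans (cong W.inSpan (trans (sym e′) eq)) (W.inSpan-comb bs)))

-- Moments of point sets in random subspaces.

-- The number of ordered pairs of distinct elements.
pr : ℕ → ℕ
pr n = n * (n ∸ 1)

-- From `(a - b)² ≥ 0`. The coefficient 4 is the one of `two-classes-rich`, so that both
-- inequalities can be averaged together.
two-classes : ∀ a b → 2 * (a * b) ≤ pr a + pr b + 4 * (a + b)
two-classes zero    b       = z≤n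
two-classes (suc a) zero    = ≤-trans (≤-reflexive (cong (2 *_) (*-zeroʳ (suc a)))) z≤n
two-classes (suc a) (suc b) = ≤-trans (≤-reflexive (arith a b)) (≤-trans (+-monoˡ-≤ (2 * a + 2 * b + 2) (two-squares a b))
    (≤-trans (m≤m+n _ (3 * a + 3 * b + 6)) (≤-reflexive (arith′ a b))))
  where
  arith = semiring-solve 2 (λ a b → # 2 ⋆ (1⊹ a ⋆ 1⊹ b) , # 2 ⋆ (a ⋆ b) ⊹ (# 2 ⋆ a ⊹ # 2 ⋆ b ⊹ # 2)) refl
  arith′ = semiring-solve 2 (λ a b → a ⋆ a ⊹ b ⋆ b ⊹ (# 2 ⋆ a ⊹ # 2 ⋆ b ⊹ # 2) ⊹ (# 3 ⋆ a ⊹ # 3 ⋆ b ⊹ # 6) , 1⊹ a ⋆ a ⊹ 1⊹ b ⋆ b ⊹ # 4 ⋆ (1⊹ a ⊹ 1⊹ b)) refl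
  two-squares : ∀ a b → 2 * (a * b) ≤ a * a + b * b
  two-squares zero    b       = z≤n
  two-squares (suc a) zero    = ≤-trans (≤-reflexive (cong (2 *_) (*-zeroʳ (suc a)))) z≤n
  two-squares (suc a) (suc b) = ≤-trans (≤-reflexive (arith a b)) (≤-trans (+-monoˡ-≤ (2 * a + 2 * b + 2) (two-squares a b)) (≤-reflexive (arith″ a b)))
    where
    arith″ = semiring-solve 2 (λ a b → a ⋆ a ⊹ b ⋆ b ⊹ (# 2 ⋆ a ⊹ # 2 ⋆ b ⊹ # 2) , 1⊹ a ⋆ 1⊹ a ⊹ 1⊹ b ⋆ 1⊹ b) refl

-- This amounts to `(a - b)² + 3 (a + b) ≥ 10`; equality at `a = 2` with `b = 0` or `b = 1` makes 10
-- the best constant.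
two-classes-rich : ∀ a b → 2 ≤ a → 10 + 2 * (a * b) ≤ pr a + pr b + 4 * (a + b)
two-classes-rich (suc zero) _ (s≤s ())
two-classes-rich (suc (suc a)) zero    _ = ≤-trans (m≤m+n _ (a * a + 7 * a)) (≤-reflexive (arith a))
  where
  arith = semiring-solve 1 (λ a → # 10 ⊹ # 2 ⋆ (1⊹ (1⊹ a) ⋆ # 0) ⊹ (a ⋆ a ⊹ # 7 ⋆ a) , 1⊹ (1⊹ a) ⋆ 1⊹ a ⊹ # 0 ⊹ # 4 ⋆ (1⊹ (1⊹ a) ⊹ # 0)) refl
two-classes-rich (suc (suc a)) (suc zero) _ = ≤-trans (m≤m+n _ (a * a + 5 * a)) (≤-reflexive (arith a))
  where
  arith = semiring-solve 1 (λ a → # 10 ⊹ # 2 ⋆ (1⊹ (1⊹ a) ⋆ # 1) ⊹ (a ⋆ a ⊹ # 5 ⋆ a) , 1⊹ (1⊹ a) ⋆ 1⊹ a ⊹ # 0 ⊹ # 4 ⋆ (1⊹ (1⊹ a) ⊹ # 1)) refl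
two-classes-rich (suc (suc a)) (suc (suc b)) _ = ≤-trans (≤-reflexive (arith a b)) (≤-trans (+-monoˡ-≤ (4 * a + 4 * b + 18) (two-classes a b))
    (≤-trans (m≤m+n _ 2) (≤-reflexive (arith′ a b (pr-suc a) (pr-suc b)))))
  where
  arith = semiring-solve 2 (λ a b → # 10 ⊹ # 2 ⋆ (1⊹ (1⊹ a) ⋆ 1⊹ (1⊹ b)) , # 2 ⋆ (a ⋆ b) ⊹ (# 4 ⋆ a ⊹ # 4 ⋆ b ⊹ # 18)) refl
  pr-suc : ∀ a → suc (suc a) * suc a ≡ pr a + 4 * a + 2
  pr-suc zero    = refl
  pr-suc (suc a) = pr-suc′ a
    where
    pr-suc′ = semiring-solve 1 (λ a → 1⊹ (1⊹ (1⊹ a)) ⋆ 1⊹ (1⊹ a) , 1⊹ a ⋆ a ⊹ # 4 ⋆ 1⊹ a ⊹ # 2) refl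
  arith′ : ∀ a b → suc (suc a) * suc a ≡ pr a + 4 * a + 2 → suc (suc b) * suc b ≡ pr b + 4 * b + 2 →
    pr a + pr b + 4 * (a + b) + (4 * a + 4 * b + 18) + 2 ≡ suc (suc a) * suc a + suc (suc b) * suc b + 4 * (suc (suc a) + suc (suc b))
  arith′ a b e e′ = trans (rearrange (pr a) (pr b) a b) (cong₂ (λ x y → x + y + 4 * (suc (suc a) + suc (suc b))) (sym e) (sym e′))
    where
    rearrange = semiring-solve 4 (λ x y a b → x ⊹ y ⊹ # 4 ⋆ (a ⊹ b) ⊹ (# 4 ⋆ a ⊹ # 4 ⋆ b ⊹ # 18) ⊹ # 2 , (x ⊹ # 4 ⋆ a ⊹ # 2) ⊹ (y ⊹ # 4 ⋆ b ⊹ # 2) ⊹ # 4 ⋆ (1⊹ (1⊹ a) ⊹ 1⊹ (1⊹ b))) refl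

pr≥2 : ∀ {n} → 2 ≤ n → 2 ≤ pr n
pr≥2 {suc (suc n)} _ = ≤-trans (s≤s (s≤s z≤n)) (≤-trans (m≤m*n (suc (suc n)) (suc n)) ≤-refl)
pr≥2 {suc zero} (s≤s ())

module Moments {q : ℕ} (F : FiniteField q) (d : ℕ)
  (E : ℕ) (E-small : E + E < q) (2<q : 2 < q) (char : ∀ j → 1 ≤ j → j ≤ E → Field.ℕ→𝔽 F j ≢ Field.𝟘 F) where
  open Field F
  open Vectors F hiding (d)
  open PointSets F d
  open Fibres F d E E-small 2<q char

  q≢0 : NonZero q
  q≢0 = >-nonZero (≤-trans (s≤s z≤n) 2<q)

  tups : (k : ℕ) → List (Vec V k)
  tups = tuples (vecs d)

  -- The size of the sample space. Means over random tuples of functionals are written as sums, with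
  -- all denominators multiplied out.
  T : ℕ → ℕ
  T k = (q ^ d) ^ k

  length-tups : ∀ k → length (tups k) ≡ T k
  length-tups k = trans (tuples-length (vecs d) k) (cong (_^ k) (length-vecs d))

  T≢0 : ∀ k → NonZero (T k)
  T≢0 k = m^n≢0 (q ^ d) k {{m^n≢0 q d {{q≢0}}}}

  ==-shift : ∀ a z → (a == z) ≡ (a ⊕ ⊖ z == 𝟘)
  ==-shift a z = bool-ext (λ e → ==-complete (trans (cong (_⊕ ⊖ z) (==-sound e)) (⊖-inverseʳ z)))
    (λ e → ==-complete (trans (⊕≡0⇒ (==-sound e)) (ring-solve 1 (λ z → :- (:- z) := z) refl z)))

  first-moment : ∀ {k} u z → u ≢ 0ᵛ → ∑ (tups k) (λ φ → ⟦ eqᵛ (ev φ u) z ⟧) * q ^ k ≡ T k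
  first-moment {zero}  u []      n = refl
  first-moment {suc k} u (a ∷ z) n = begin
    ∑ (tups (suc k)) (λ φ → ⟦ eqᵛ (ev φ u) (a ∷ z) ⟧) * q ^ suc k ≡⟨ cong (_* q ^ suc k) (trans (∑-tuples (vecs d) k _) (trans (∑-cong (vecs d) (λ h →
                                                                                                   trans (∑-cong (tups k) (λ φ → ⟦⟧-∧ (h ∙ u == a) (eqᵛ (ev φ u) z))) (∑-*ˡ (tups k) ⟦ h ∙ u == a ⟧ _))) (∑-*ʳ (vecs d) _ _))) ⟩
    ∑ (vecs d) (λ h → ⟦ h ∙ u == a ⟧) * ∑ (tups k) (λ φ → ⟦ eqᵛ (ev φ u) z ⟧) * (q * q ^ k) ≡⟨ arith (∑ (vecs d) (λ h → ⟦ h ∙ u == a ⟧)) (∑ (tups k) (λ φ → ⟦ eqᵛ (ev φ u) z ⟧)) q (q ^ k) ⟩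
    ∑ (vecs d) (λ h → ⟦ h ∙ u == a ⟧) * q * (∑ (tups k) (λ φ → ⟦ eqᵛ (ev φ u) z ⟧) * q ^ k) ≡⟨ cong₂ _*_ (trans (cong (_* q) (∑-cong (vecs d) (λ h → cong ⟦_⟧ (==-shift (h ∙ u) a)))) (∑-vecs-affine u (⊖ a) n)) (first-moment u z n) ⟩
    T (suc k) ∎
    where
    open ≡-Reasoning
    arith : ∀ a b c e → a * b * (c * e) ≡ a * c * (b * e)
    arith = semiring-solve 4 (λ a b c e → a ⋆ b ⋆ (c ⋆ e) , a ⋆ c ⋆ (b ⋆ e)) refl

  second-moment : ∀ {k} u v z w → Indep u v → ∑ (tups k) (λ φ → ⟦ eqᵛ (ev φ u) z ∧ eqᵛ (ev φ v) w ⟧) * (q * q) ^ k ≡ T k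
  second-moment {zero}  u v []      []      ind = refl
  second-moment {suc k} u v (a ∷ z) (b ∷ w) ind = begin
    ∑ (tups (suc k)) (λ φ → ⟦ eqᵛ (ev φ u) (a ∷ z) ∧ eqᵛ (ev φ v) (b ∷ w) ⟧) * (q * q) ^ suc k ≡⟨ cong (_* (q * q) ^ suc k) (trans (∑-tuples (vecs d) k _) (trans (∑-cong (vecs d) (λ h →
                                                                                                   trans (∑-cong (tups k) (λ φ → regroup (h ∙ u == a) (eqᵛ (ev φ u) z) (h ∙ v == b) (eqᵛ (ev φ v) w))) (∑-*ˡ (tups k) ⟦ (h ∙ u == a) ∧ (h ∙ v == b) ⟧ _))) (∑-*ʳ (vecs d) _ _))) ⟩
    M₁ * M₂ * (q * q * (q * q) ^ k) ≡⟨ arith M₁ M₂ (q * q) ((q * q) ^ k) ⟩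
    M₁ * (q * q) * (M₂ * (q * q) ^ k) ≡⟨ cong₂ _*_ (trans (cong (_* (q * q)) (∑-cong (vecs d) (λ h → cong₂ (λ x y → ⟦ x ∧ y ⟧) (==-shift (h ∙ u) a) (==-shift (h ∙ v) b)))) (∑-vecs-pair u v (⊖ a) (⊖ b) ind)) (second-moment u v z w ind) ⟩
    T (suc k) ∎
    where
    open ≡-Reasoning
    M₁ = ∑ (vecs d) (λ h → ⟦ (h ∙ u == a) ∧ (h ∙ v == b) ⟧)
    M₂ = ∑ (tups k) (λ φ → ⟦ eqᵛ (ev φ u) z ∧ eqᵛ (ev φ v) w ⟧)
    arith : ∀ a b c e → a * b * (c * e) ≡ a * c * (b * e)
    arith = semiring-solve 4 (λ a b c e → a ⋆ b ⋆ (c ⋆ e) , a ⋆ c ⋆ (b ⋆ e)) refl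
    regroup : ∀ a b c e → ⟦ (a ∧ b) ∧ (c ∧ e) ⟧ ≡ ⟦ a ∧ c ⟧ * ⟦ b ∧ e ⟧
    regroup true  b true  e = sym (+-identityʳ _)
    regroup true  b false e = cong ⟦_⟧ (Boolₚ.∧-zeroʳ b)
    regroup false b c     e = refl

  sq-pow : ∀ k → (q * q) ^ k ≡ q ^ k * q ^ k
  sq-pow k = ^-distribʳ-* k q q
    where
    ^-distribʳ-* : ∀ k m n → (m * n) ^ k ≡ m ^ k * n ^ k
    ^-distribʳ-* zero    m n = refl
    ^-distribʳ-* (suc k) m n = trans (cong (m * n *_) (^-distribʳ-* k m n)) (arith m n (m ^ k) (n ^ k))
      where
      arith : ∀ m n a b → m * n * (a * b) ≡ m * a * (n * b)
      arith = semiring-solve 4 (λ m n a b → m ⋆ n ⋆ (a ⋆ b) , m ⋆ a ⋆ (n ⋆ b)) refl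

  ker-mean : ∀ k α → ∑ (tups k) (λ φ → size (α ∩ ker φ)) * q ^ k ≡ T k * size α
  ker-mean k α = begin
    ∑ (tups k) (λ φ → size (α ∩ ker φ)) * q ^ k ≡⟨ cong (_* q ^ k) (∑-swap (tups k) (pts d) _) ⟩
    ∑ (pts d) (λ u → ∑ (tups k) (λ φ → ⟦ mem α u ∧ mem (ker φ) u ⟧)) * q ^ k ≡⟨ ∑-*ʳ (pts d) (q ^ k) _ ⟨
    ∑ (pts d) (λ u → ∑ (tups k) (λ φ → ⟦ mem α u ∧ mem (ker φ) u ⟧) * q ^ k) ≡⟨ ∑-cong-∈ (pts d) (λ u i → pointwise u i (mem α u)) ⟩
    ∑ (pts d) (λ u → T k * ⟦ mem α u ⟧) ≡⟨ ∑-*ˡ (pts d) (T k) _ ⟩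
    T k * size α ∎
    where
    open ≡-Reasoning
    pointwise : ∀ u → u ∈ pts d → ∀ b → ∑ (tups k) (λ φ → ⟦ b ∧ mem (ker φ) u ⟧) * q ^ k ≡ T k * ⟦ b ⟧
    pointwise u i false = trans (cong (_* q ^ k) (∑-0 (tups k))) (sym (*-zeroʳ (T k)))
    pointwise u i true  = trans (cong (_* q ^ k) (∑-cong (tups k) (λ φ → cong ⟦_⟧ (ker-ev φ u))))
      (trans (first-moment {k} u 0ᵛ (normal-≢0 (normal i))) (sym (*-identityʳ (T k))))

  -- Covers kernels and fibres alike: all that enters is that two independent vectors lie together
  -- in a fraction `1 / c` of the `t` sample sets, or in at most that fraction.
  module Pairwise {I : Set} (xs : List I) (σ : I → PSet) (c t : ℕ) where

    expand : ∀ α α′ → ∑ xs (λ φ → size (α ∩ σ φ) * size (α′ ∩ σ φ)) ≡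
      ∑ (pts d) (λ u → ∑ (pts d) (λ v → ⟦ mem α u ∧ mem α′ v ⟧ * ∑ xs (λ φ → ⟦ mem (σ φ) u ∧ mem (σ φ) v ⟧)))
    expand α α′ = begin
      ∑ xs (λ φ → size (α ∩ σ φ) * size (α′ ∩ σ φ)) ≡⟨ ∑-cong xs (λ φ → trans (sym (∑-*ʳ (pts d) (size (α′ ∩ σ φ)) _)) (∑-cong (pts d) (λ u → sym (∑-*ˡ (pts d) ⟦ mem (α ∩ σ φ) u ⟧ (λ v → ⟦ mem (α′ ∩ σ φ) v ⟧))))) ⟩
      ∑ xs (λ φ → ∑ (pts d) (λ u → ∑ (pts d) (λ v → ⟦ mem (α ∩ σ φ) u ⟧ * ⟦ mem (α′ ∩ σ φ) v ⟧))) ≡⟨ ∑-swap xs (pts d) _ ⟩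
      ∑ (pts d) (λ u → ∑ xs (λ φ → ∑ (pts d) (λ v → ⟦ mem (α ∩ σ φ) u ⟧ * ⟦ mem (α′ ∩ σ φ) v ⟧))) ≡⟨ ∑-cong (pts d) (λ u → trans (∑-swap xs (pts d) _) (∑-cong (pts d) (λ v →
                                                                                                                  trans (∑-cong xs (λ φ → regroup (mem α u) (mem (σ φ) u) (mem α′ v) (mem (σ φ) v))) (∑-*ˡ xs ⟦ mem α u ∧ mem α′ v ⟧ _)))) ⟩
      ∑ (pts d) (λ u → ∑ (pts d) (λ v → ⟦ mem α u ∧ mem α′ v ⟧ * ∑ xs (λ φ → ⟦ mem (σ φ) u ∧ mem (σ φ) v ⟧))) ∎
      where
      open ≡-Reasoning
      regroup : ∀ a b c e → ⟦ a ∧ b ⟧ * ⟦ c ∧ e ⟧ ≡ ⟦ a ∧ c ⟧ * ⟦ b ∧ e ⟧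
      regroup true  true  true  e = refl
      regroup true  true  false e = refl
      regroup true  false true  e = refl
      regroup true  false false e = refl
      regroup false b     c     e = refl

    cross : (∀ u v → Indep u v → ∑ xs (λ φ → ⟦ mem (σ φ) u ∧ mem (σ φ) v ⟧) * c ≡ t) →
      ∀ α α′ → (∀ v → v ∈ˢ α → v ∈ˢ α′ → ⊥) → ∑ xs (λ φ → size (α ∩ σ φ) * size (α′ ∩ σ φ)) * c ≡ t * (size α * size α′)
    cross indep α α′ disjoint = begin
      ∑ xs (λ φ → size (α ∩ σ φ) * size (α′ ∩ σ φ)) * c ≡⟨ cong (_* c) (expand α α′) ⟩
      ∑ (pts d) (λ u → ∑ (pts d) (λ v → term u v)) * c ≡⟨ trans (sym (∑-*ʳ (pts d) c _)) (∑-cong (pts d) (λ u → sym (∑-*ʳ (pts d) c _))) ⟩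
      ∑ (pts d) (λ u → ∑ (pts d) (λ v → term u v * c)) ≡⟨ ∑-cong-∈ (pts d) (λ u i → ∑-cong-∈ (pts d) (λ v j → pointwise u v i j)) ⟩
      ∑ (pts d) (λ u → ∑ (pts d) (λ v → t * (⟦ mem α u ⟧ * ⟦ mem α′ v ⟧))) ≡⟨ ∑-cong (pts d) (λ u → trans (∑-*ˡ (pts d) t _) (cong (t *_) (∑-*ˡ (pts d) ⟦ mem α u ⟧ _))) ⟩
      ∑ (pts d) (λ u → t * (⟦ mem α u ⟧ * size α′)) ≡⟨ trans (∑-*ˡ (pts d) t _) (cong (t *_) (∑-*ʳ (pts d) (size α′) _)) ⟩
      t * (size α * size α′) ∎
      where
      open ≡-Reasoning
      term : V → V → ℕ
      term u v = ⟦ mem α u ∧ mem α′ v ⟧ * ∑ xs (λ φ → ⟦ mem (σ φ) u ∧ mem (σ φ) v ⟧)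
      pointwise : ∀ u v → u ∈ pts d → v ∈ pts d → term u v * c ≡ t * (⟦ mem α u ⟧ * ⟦ mem α′ v ⟧)
      pointwise u v i j with true? (mem α u) | true? (mem α′ v)
      ... | inj₂ e | _ rewrite e = sym (*-zeroʳ t)
      ... | inj₁ e | inj₂ e′ rewrite e | e′ = sym (*-zeroʳ t)
      ... | inj₁ e | inj₁ e′ = trans (cong (λ b → ⟦ b ⟧ * _ * c) (cong₂ _∧_ e e′)) (trans (cong (_* c) (+-identityʳ (∑ xs (λ φ → ⟦ mem (σ φ) u ∧ mem (σ φ) v ⟧))))
            (trans (indep u v (pts-indep i j (λ { refl → disjoint u e e′ }))) (trans (sym (*-identityʳ t)) (cong₂ (λ a b → t * (⟦ a ⟧ * ⟦ b ⟧)) (sym e) (sym e′)))))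

    pr-size : ∀ α → pr (size α) ≡ ∑ (pts d) (λ u → ∑ (pts d) (λ v → ⟦ mem α u ∧ (mem α v ∧ not (par u v)) ⟧))
    pr-size α = trans (sym (∑-*ʳ (pts d) (size α ∸ 1) _)) (∑-cong-∈ (pts d) pointwise)
      where
      pointwise : ∀ u → u ∈ pts d → ⟦ mem α u ⟧ * (size α ∸ 1) ≡ ∑ (pts d) (λ v → ⟦ mem α u ∧ (mem α v ∧ not (par u v)) ⟧)
      pointwise u i with true? (mem α u)
      ... | inj₂ e rewrite e = sym (∑-0 (pts d))
      ... | inj₁ e = trans (cong (λ b → ⟦ b ⟧ * (size α ∸ 1)) e) (trans (+-identityʳ _) (trans (cong (_∸ 1) (size-remove α i e)) (sym (∑-cong (pts d) (λ v → cong (λ b → ⟦ b ∧ (mem α v ∧ not (par u v)) ⟧) e)))))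

    pair-mean : (∀ u v → Indep u v → ∑ xs (λ φ → ⟦ mem (σ φ) u ∧ mem (σ φ) v ⟧) * c ≤ t) →
      ∀ α → ∑ xs (λ φ → pr (size (α ∩ σ φ))) * c ≤ t * pr (size α)
    pair-mean indep α = begin
      ∑ xs (λ φ → pr (size (α ∩ σ φ))) * c ≡⟨ cong (_* c) (trans (∑-cong xs (λ φ → pr-size (α ∩ σ φ))) (trans (∑-swap xs (pts d) _) (∑-cong (pts d) (λ u → ∑-swap xs (pts d) _)))) ⟩
      ∑ (pts d) (λ u → ∑ (pts d) (λ v → term u v)) * c ≡⟨ trans (sym (∑-*ʳ (pts d) c _)) (∑-cong (pts d) (λ u → sym (∑-*ʳ (pts d) c _))) ⟩
      ∑ (pts d) (λ u → ∑ (pts d) (λ v → term u v * c)) ≤⟨ ∑-mono-∈ (pts d) (λ u i → ∑-mono-∈ (pts d) (λ v j → pointwise u v i j)) ⟩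
      ∑ (pts d) (λ u → ∑ (pts d) (λ v → t * ⟦ mem α u ∧ (mem α v ∧ not (par u v)) ⟧)) ≡⟨ trans (∑-cong (pts d) (λ u → ∑-*ˡ (pts d) t _)) (trans (∑-*ˡ (pts d) t _) (cong (t *_) (sym (pr-size α)))) ⟩
      t * pr (size α) ∎
      where
      open ≤-Reasoning
      term : V → V → ℕ
      term u v = ∑ xs (λ φ → ⟦ mem (α ∩ σ φ) u ∧ (mem (α ∩ σ φ) v ∧ not (par u v)) ⟧)
      regroup : ∀ a b c e p → ⟦ (a ∧ b) ∧ ((c ∧ e) ∧ p) ⟧ ≡ ⟦ a ∧ (c ∧ p) ⟧ * ⟦ b ∧ e ⟧
      regroup true  true  true  e true  = trans (cong ⟦_⟧ (Boolₚ.∧-identityʳ e)) (sym (+-identityʳ _))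
      regroup true  true  true  e false = cong ⟦_⟧ (Boolₚ.∧-zeroʳ e)
      regroup true  true  false e p     = refl
      regroup true  false true  e true  = refl
      regroup true  false true  e false = refl
      regroup true  false false e p     = refl
      regroup false b     c     e p     = refl
      pointwise : ∀ u v → u ∈ pts d → v ∈ pts d → term u v * c ≤ t * ⟦ mem α u ∧ (mem α v ∧ not (par u v)) ⟧
      pointwise u v i j = ≤-trans (≤-reflexive (cong (_* c) (trans (∑-cong xs (λ φ → regroup (mem α u) (mem (σ φ) u) (mem α v) (mem (σ φ) v) (not (par u v))))
          (∑-*ˡ xs ⟦ mem α u ∧ (mem α v ∧ not (par u v)) ⟧ _)))) (by-indicator (mem α u ∧ (mem α v ∧ not (par u v))) refl)
        where
        N = ∑ xs (λ φ → ⟦ mem (σ φ) u ∧ mem (σ φ) v ⟧)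
        by-indicator : ∀ b → mem α u ∧ (mem α v ∧ not (par u v)) ≡ b → ⟦ b ⟧ * N * c ≤ t * ⟦ b ⟧
        by-indicator false _ = z≤n
        by-indicator true e = ≤-trans (≤-reflexive (cong (_* c) (+-identityʳ N))) (≤-trans (indep u v (pts-indep i j (λ { refl → false≢true
            (not-true (proj₂ (∧-true {mem α u} (proj₂ (∧-true {mem α u} e))))) (par-refl (normal i)) }))) (≤-reflexive (sym (*-identityʳ t))))

  ker-pairs : ∀ k u v → Indep u v → ∑ (tups k) (λ φ → ⟦ mem (ker φ) u ∧ mem (ker φ) v ⟧) * (q ^ k * q ^ k) ≡ T k
  ker-pairs k u v ind = trans (cong₂ _*_ (∑-cong (tups k) (λ φ → cong₂ (λ a b → ⟦ a ∧ b ⟧) (ker-ev φ u) (ker-ev φ v))) (sym (sq-pow k))) (second-moment {k} u v 0ᵛ 0ᵛ ind)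

  -- Both images must be multiples of `x`. This allows `q²` pairs of values, each taken with
  -- probability `q^(-2 (k + 1))`.
  perp-pairs : ∀ {k} x → x ∈ pts (suc k) → ∀ u v → Indep u v →
    ∑ (tups (suc k)) (λ φ → ⟦ mem (ker (perp x φ)) u ∧ mem (ker (perp x φ)) v ⟧) * (q ^ k * q ^ k) ≤ T (suc k)
  perp-pairs {k} x i u v ind = *-cancelʳ-≤ _ _ (q * q) {{m*n≢0 q q {{q≢0}} {{q≢0}}}} (begin
    ∑ (tups (suc k)) (λ φ → ⟦ mem (ker (perp x φ)) u ∧ mem (ker (perp x φ)) v ⟧) * (q ^ k * q ^ k) * (q * q) ≤⟨ *-monoˡ-≤ (q * q) (*-monoˡ-≤ (q ^ k * q ^ k) (∑-mono (tups (suc k)) pointwise)) ⟩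
    ∑ (tups (suc k)) (λ φ → ∑ Fs (λ a → ∑ Fs (λ b → term φ a b))) * (q ^ k * q ^ k) * (q * q) ≡⟨ trans (cong (λ n → ∑ (tups (suc k)) (λ φ → ∑ Fs (λ a → ∑ Fs (λ b → term φ a b))) * n * (q * q)) (sym (sq-pow k))) (arith (∑ (tups (suc k)) (λ φ → ∑ Fs (λ a → ∑ Fs (λ b → term φ a b)))) ((q * q) ^ k) (q * q)) ⟩
    ∑ (tups (suc k)) (λ φ → ∑ Fs (λ a → ∑ Fs (λ b → term φ a b))) * (q * q) ^ suc k ≡⟨ cong (_* (q * q) ^ suc k) (trans (∑-swap (tups (suc k)) Fs _) (∑-cong Fs (λ a → ∑-swap (tups (suc k)) Fs _))) ⟩
    ∑ Fs (λ a → ∑ Fs (λ b → ∑ (tups (suc k)) (λ φ → term φ a b))) * (q * q) ^ suc k ≡⟨ trans (sym (∑-*ʳ Fs _ _)) (∑-cong Fs (λ a → trans (sym (∑-*ʳ Fs _ _)) (∑-cong Fs (λ b → second-moment {suc k} u v (a · x) (b · x) ind)))) ⟩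
    ∑ Fs (λ a → ∑ Fs (λ b → T (suc k))) ≡⟨ trans (∑-cong Fs (λ _ → ∑-Fs-const (T (suc k)))) (∑-Fs-const _) ⟩
    q * (q * T (suc k)) ≡⟨ arith′ q (T (suc k)) ⟩
    T (suc k) * (q * q) ∎)
    where
    open ≤-Reasoning
    term : Vec V (suc k) → 𝔽 → 𝔽 → ℕ
    term φ a b = ⟦ eqᵛ (ev φ u) (a · x) ∧ eqᵛ (ev φ v) (b · x) ⟧
    arith : ∀ a b c → a * b * c ≡ a * (c * b)
    arith = semiring-solve 3 (λ a b c → a ⋆ b ⋆ c , a ⋆ (c ⋆ b)) refl
    arith′ : ∀ q t → q * (q * t) ≡ t * (q * q)
    arith′ = semiring-solve 2 (λ q t → q ⋆ (q ⋆ t) , t ⋆ (q ⋆ q)) refl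
    pointwise : ∀ φ → ⟦ mem (ker (perp x φ)) u ∧ mem (ker (perp x φ)) v ⟧ ≤ ∑ Fs (λ a → ∑ Fs (λ b → term φ a b))
    pointwise φ with true? (mem (ker (perp x φ)) u ∧ mem (ker (perp x φ)) v)
    ... | inj₂ e rewrite e = z≤n
    ... | inj₁ e with ∧-true {mem (ker (perp x φ)) u} e
    ...   | eu , ew with par-sound (normal i) (trans (sym (perp-par (normal i) φ u)) eu) | par-sound (normal i) (trans (sym (perp-par (normal i) φ v)) ew)
    ...     | a , za | b , zb = ≤-trans (⟦⟧≤1 _) (≤-trans (≤-reflexive (cong ⟦_⟧ (sym (∧-intro (eqᵛ-complete za) (eqᵛ-complete zb)))))
              (≤-trans (∑-∈ (λ b → term φ a b) (∈-Fs b)) (∑-∈ (λ a → ∑ Fs (λ b → term φ a b)) (∈-Fs a))))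

-- Inequalities forced by a rainbow-free colouring.

module Colouring {q : ℕ} (F : FiniteField q) (d : ℕ)
  (E : ℕ) (E-small : E + E < q) (2<q : 2 < q) (char : ∀ j → 1 ≤ j → j ≤ E → Field.ℕ→𝔽 F j ≢ Field.𝟘 F)
  {N : ℕ} (c : Vec (Field.𝔽 F) d → Fin N) (c-scale : ∀ a v → a ≢ Field.𝟘 F → c (Vectors._·_ F a v) ≡ c v) where
  open Field F
  open Vectors F hiding (d)
  open PointSets F d
  open Fibres F d E E-small 2<q char
  open Moments F d E E-small 2<q char

  class : Fin N → PSet
  mem (class i) v = does (c v Fin.≟ i)
  inv (class i) a v n = cong (λ j → does (j Fin.≟ i)) (c-scale a v n)

  class-self : ∀ v → v ∈ˢ class (c v)
  class-self v = does-intro (c v Fin.≟ c v) refl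

  class-sound : ∀ {i} v → v ∈ˢ class i → c v ≡ i
  class-sound {i} v = does-true (c v Fin.≟ i)

  Fins : List (Fin N)
  Fins = allFin N

  classes-total : ∑ Fins (λ i → size (class i)) ≡ Θ d
  classes-total = trans (∑-swap Fins (pts d) _) (trans (∑-cong (pts d) (λ v → trans (∑-cong Fins (λ i → cong ⟦_⟧ (flip i v))) (∑-allFin-δ (c v)))) (∑-pts-1 d))
    where
    flip : ∀ i v → does (c v Fin.≟ i) ≡ does (i Fin.≟ c v)
    flip i v = bool-ext (λ e → does-intro (i Fin.≟ c v) (sym (does-true (c v Fin.≟ i) e))) (λ e → does-intro (c v Fin.≟ i) (sym (does-true (i Fin.≟ c v) e)))

  RainbowFreeᵏ : ℕ → Set
  RainbowFreeᵏ k = ∀ (φ : Vec V k) → ∃[ i ] (2 ≤ size (class i ∩ ker φ))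

  other : Fin N → Fin N → Bool
  other i₁ i = not (does (i Fin.≟ i₁))

  other-≢ : ∀ {i₁ i} → i ≢ i₁ → other i₁ i ≡ true
  other-≢ {i₁} {i} n = not-false (≢true (λ e → n (does-true (i Fin.≟ i₁) e)))

  -- The average of an inequality valid for each kernel. The colour that repeats there is `i₁` or
  -- `i₂`, and then `two-classes-rich` supplies the 10, or it is a third one, whose two ordered
  -- pairs count five each.
  coarse : ∀ {K} → RainbowFreeᵏ K → ∀ i₁ i₂ → i₁ ≢ i₂ → let Q = q ^ K ; a = size (class i₁) ; b = size (class i₂) in
    10 * (Q * Q) + 2 * (a * b) ≤ pr a + pr b + 4 * (Q * (a + b)) + 5 * ∑ Fins (λ i → ⟦ other i₁ i ∧ other i₂ i ⟧ * pr (size (class i)))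
  coarse {K} rf i₁ i₂ i₁≢i₂ = *-cancelˡ-≤ (T K) {{T≢0 K}} (begin
      T K * (10 * (Q * Q) + 2 * (a * b)) ≡⟨ arith (T K) (Q * Q) (a * b) ⟩
      T K * 10 * (Q * Q) + 2 * (T K * (a * b)) ≡⟨ cong₂ (λ x y → x * (Q * Q) + 2 * y) (trans (cong (_* 10) (sym (length-tups K))) (sym (∑-const (tups K) 10))) (sym (PW.cross (ker-pairs K) (class i₁) (class i₂) disjoint)) ⟩
      ∑ (tups K) (λ _ → 10) * (Q * Q) + 2 * (∑ (tups K) (λ φ → n₁ φ * n₂ φ) * (Q * Q)) ≡⟨ trans (arith′ (∑ (tups K) (λ _ → 10)) (∑ (tups K) (λ φ → n₁ φ * n₂ φ)) (Q * Q)) (cong (_* (Q * Q)) (trans (cong (∑ (tups K) (λ _ → 10) +_) (sym (∑-*ˡ (tups K) 2 _))) (sym (∑-+ (tups K) _ _)))) ⟩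
      ∑ (tups K) (λ φ → 10 + 2 * (n₁ φ * n₂ φ)) * (Q * Q) ≤⟨ *-monoˡ-≤ (Q * Q) (∑-mono (tups K) per-space) ⟩
      ∑ (tups K) (λ φ → pr (n₁ φ) + pr (n₂ φ) + 4 * (n₁ φ + n₂ φ) + 5 * rest φ) * (Q * Q) ≡⟨ cong (_* (Q * Q)) (trans (∑-+ (tups K) _ _) (cong₂ _+_ (trans (∑-+ (tups K) _ _) (cong₂ _+_ (∑-+ (tups K) _ _) (trans (∑-*ˡ (tups K) 4 _) (cong (4 *_) (∑-+ (tups K) _ _))))) (∑-*ˡ (tups K) 5 _))) ⟩
      (∑ (tups K) (pr ∘ n₁) + ∑ (tups K) (pr ∘ n₂) + 4 * (∑ (tups K) n₁ + ∑ (tups K) n₂) + 5 * ∑ (tups K) rest) * (Q * Q)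
                                                                                                              ≡⟨ arith″ (∑ (tups K) (pr ∘ n₁)) (∑ (tups K) (pr ∘ n₂)) (∑ (tups K) n₁) (∑ (tups K) n₂) (∑ (tups K) rest) Q ⟩
      ∑ (tups K) (pr ∘ n₁) * (Q * Q) + ∑ (tups K) (pr ∘ n₂) * (Q * Q) + 4 * (Q * (∑ (tups K) n₁ * Q + ∑ (tups K) n₂ * Q)) + 5 * (∑ (tups K) rest * (Q * Q))
                                                                                                              ≤⟨ +-mono-≤ (+-mono-≤ (+-mono-≤ (mean i₁) (mean i₂)) (≤-reflexive (cong₂ (λ x y → 4 * (Q * (x + y))) (ker-mean K (class i₁)) (ker-mean K (class i₂))))) (*-monoʳ-≤ 5 rest-mean) ⟩
      T K * pr a + T K * pr b + 4 * (Q * (T K * a + T K * b)) + 5 * (T K * R) ≡⟨ arith‴ (T K) (pr a) (pr b) Q a b R ⟩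
      T K * (pr a + pr b + 4 * (Q * (a + b)) + 5 * R) ∎)
    where
    open ≤-Reasoning
    module PW = Pairwise (tups K) ker (q ^ K * q ^ K) (T K)
    Q = q ^ K
    a = size (class i₁)
    b = size (class i₂)
    R = ∑ Fins (λ i → ⟦ other i₁ i ∧ other i₂ i ⟧ * pr (size (class i)))
    n₁ n₂ rest : Vec V K → ℕ
    n₁ φ = size (class i₁ ∩ ker φ)
    n₂ φ = size (class i₂ ∩ ker φ)
    rest φ = ∑ Fins (λ i → ⟦ other i₁ i ∧ other i₂ i ⟧ * pr (size (class i ∩ ker φ)))
    arith : ∀ t q a → t * (10 * q + 2 * a) ≡ t * 10 * q + 2 * (t * a)
    arith = semiring-solve 3 (λ t q a → t ⋆ (# 10 ⋆ q ⊹ # 2 ⋆ a) , t ⋆ # 10 ⋆ q ⊹ # 2 ⋆ (t ⋆ a)) refl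
    arith′ : ∀ x y q → x * q + 2 * (y * q) ≡ (x + 2 * y) * q
    arith′ = semiring-solve 3 (λ x y q → x ⋆ q ⊹ # 2 ⋆ (y ⋆ q) , (x ⊹ # 2 ⋆ y) ⋆ q) refl
    arith″ = semiring-solve 6 (λ x y a b r q → (x ⊹ y ⊹ # 4 ⋆ (a ⊹ b) ⊹ # 5 ⋆ r) ⋆ (q ⋆ q) , x ⋆ (q ⋆ q) ⊹ y ⋆ (q ⋆ q) ⊹ # 4 ⋆ (q ⋆ (a ⋆ q ⊹ b ⋆ q)) ⊹ # 5 ⋆ (r ⋆ (q ⋆ q))) refl
    arith‴ = semiring-solve 7 (λ t x y q a b r → t ⋆ x ⊹ t ⋆ y ⊹ # 4 ⋆ (q ⋆ (t ⋆ a ⊹ t ⋆ b)) ⊹ # 5 ⋆ (t ⋆ r) , t ⋆ (x ⊹ y ⊹ # 4 ⋆ (q ⋆ (a ⊹ b)) ⊹ # 5 ⋆ r)) refl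
    disjoint : ∀ v → v ∈ˢ class i₁ → v ∈ˢ class i₂ → ⊥
    disjoint v e e′ = i₁≢i₂ (trans (sym (class-sound v e)) (class-sound v e′))
    mean : ∀ i → ∑ (tups K) (λ φ → pr (size (class i ∩ ker φ))) * (Q * Q) ≤ T K * pr (size (class i))
    mean i = PW.pair-mean (λ u v ind → ≤-reflexive (ker-pairs K u v ind)) (class i)
    rest-mean : ∑ (tups K) rest * (Q * Q) ≤ T K * R
    rest-mean = begin
      ∑ (tups K) rest * (Q * Q) ≡⟨ cong (_* (Q * Q)) (trans (∑-swap (tups K) Fins _) (∑-cong Fins (λ i → ∑-*ˡ (tups K) ⟦ other i₁ i ∧ other i₂ i ⟧ _))) ⟩
      ∑ Fins (λ i → ⟦ other i₁ i ∧ other i₂ i ⟧ * ∑ (tups K) (λ φ → pr (size (class i ∩ ker φ)))) * (Q * Q) ≡⟨ trans (sym (∑-*ʳ Fins (Q * Q) _)) (∑-cong Fins (λ i → *-assoc ⟦ other i₁ i ∧ other i₂ i ⟧ _ _)) ⟩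
      ∑ Fins (λ i → ⟦ other i₁ i ∧ other i₂ i ⟧ * (∑ (tups K) (λ φ → pr (size (class i ∩ ker φ))) * (Q * Q))) ≤⟨ ∑-mono Fins (λ i → *-monoʳ-≤ ⟦ other i₁ i ∧ other i₂ i ⟧ (mean i)) ⟩
      ∑ Fins (λ i → ⟦ other i₁ i ∧ other i₂ i ⟧ * (T K * pr (size (class i)))) ≡⟨ trans (∑-cong Fins (λ i → swap-* ⟦ other i₁ i ∧ other i₂ i ⟧ (T K) (pr (size (class i))))) (∑-*ˡ Fins (T K) _) ⟩
      T K * R ∎
      where
      swap-* : ∀ a b c → a * (b * c) ≡ b * (a * c)
      swap-* = semiring-solve 3 (λ a b c → a ⋆ (b ⋆ c) , b ⋆ (a ⋆ c)) refl
    per-space : ∀ φ → 10 + 2 * (n₁ φ * n₂ φ) ≤ pr (n₁ φ) + pr (n₂ φ) + 4 * (n₁ φ + n₂ φ) + 5 * rest φ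
    per-space φ with rf φ
    ... | i , two with i Fin.≟ i₁ | i Fin.≟ i₂
    ...   | yes refl | _ = ≤-trans (two-classes-rich (n₁ φ) (n₂ φ) two) (m≤m+n _ _)
    ...   | no _ | yes refl = ≤-trans (≤-trans (≤-reflexive (cong (λ n → 10 + 2 * n) (*-comm (n₁ φ) (n₂ φ)))) (two-classes-rich (n₂ φ) (n₁ φ) two))
              (≤-trans (≤-reflexive (cong₂ (λ x y → x + 4 * y) (+-comm (pr (n₂ φ)) (pr (n₁ φ))) (+-comm (n₂ φ) (n₁ φ)))) (m≤m+n _ _))
    ...   | no n | no n′ = ≤-trans (+-mono-≤ (*-monoʳ-≤ 5 rest≥2) (two-classes (n₁ φ) (n₂ φ))) (≤-reflexive (+-comm (5 * rest φ) _))
      where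
      rest≥2 : 2 ≤ rest φ
      rest≥2 = ≤-trans (≤-trans (pr≥2 two) (≤-reflexive (trans (sym (*-identityˡ _)) (cong (λ b → ⟦ b ⟧ * pr (size (class i ∩ ker φ))) (sym (∧-intro (other-≢ n) (other-≢ n′)))))))
        (∑-∈ (λ i → ⟦ other i₁ i ∧ other i₂ i ⟧ * pr (size (class i ∩ ker φ))) (∈-allFin i))

  -- Counting over the (k+1)-tuples whose kernel misses the class i₁ and the fibres over them.
  fine : ∀ {K} → RainbowFreeᵏ K → ∀ i₁ A → A + size (class i₁) ≡ 2 * Θ (suc K) → let Q = q ^ K in
    A * (Q * (q * Q)) ≤ q * (Θ (suc K) * ∑ Fins (λ i → ⟦ other i₁ i ⟧ * pr (size (class i)))) + A * (Q * size (class i₁))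
  fine {K} rf i₁ A A+a = *-cancelˡ-≤ (t * Q) {{m*n≢0 t Q {{T≢0 (suc K)}} {{m^n≢0 q K {{q≢0}}}}}} (begin
      t * Q * (A * (Q * (q * Q))) ≡⟨ arith t Q A q ⟩
      t * A * (Q * Q * (q * Q)) ≡⟨ cong (_* (Q * Q * (q * Q))) (trans (cong (_* A) (sym (length-tups (suc K)))) (sym (∑-const (tups (suc K)) A))) ⟩
      ∑ (tups (suc K)) (λ _ → A) * (Q * Q * (q * Q)) ≤⟨ *-monoˡ-≤ (Q * Q * (q * Q)) (∑-mono (tups (suc K)) per-space) ⟩
      ∑ (tups (suc K)) (λ φ → w φ + A * n₁ φ) * (Q * Q * (q * Q)) ≡⟨ cong (_* (Q * Q * (q * Q))) (trans (∑-+ (tups (suc K)) _ _) (cong (∑ (tups (suc K)) w +_) (∑-*ˡ (tups (suc K)) A _))) ⟩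
      (∑ (tups (suc K)) w + A * ∑ (tups (suc K)) n₁) * (Q * Q * (q * Q)) ≡⟨ arith′ (∑ (tups (suc K)) w) A (∑ (tups (suc K)) n₁) Q q ⟩
      ∑ (tups (suc K)) w * (Q * Q) * (q * Q) + A * (∑ (tups (suc K)) n₁ * (q * Q)) * (Q * Q) ≤⟨ +-mono-≤ (*-monoˡ-≤ (q * Q) w-mean) (≤-reflexive (cong (λ n → A * n * (Q * Q)) (ker-mean (suc K) (class i₁)))) ⟩
      t * (θ′ * W) * (q * Q) + A * (t * a) * (Q * Q) ≡⟨ arith″ t θ′ W q Q A a ⟩
      t * Q * (q * (θ′ * W) + A * (Q * a)) ∎)
    where
    open ≤-Reasoning
    Q = q ^ K
    t = T (suc K)
    θ′ = Θ (suc K)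
    a = size (class i₁)
    W = ∑ Fins (λ i → ⟦ other i₁ i ⟧ * pr (size (class i)))
    n₁ w : Vec V (suc K) → ℕ
    n₁ φ = size (class i₁ ∩ ker φ)
    v : Vec V (suc K) → 𝕍 (suc K) → ℕ
    v φ x = ∑ Fins (λ i → ⟦ other i₁ i ⟧ * pr (size (class i ∩ ker (perp x φ))))
    w φ = ∑ (pts (suc K)) (v φ)
    arith = semiring-solve 4 (λ t Q A q → t ⋆ Q ⋆ (A ⋆ (Q ⋆ (q ⋆ Q))) , t ⋆ A ⋆ (Q ⋆ Q ⋆ (q ⋆ Q))) refl
    arith′ = semiring-solve 5 (λ w A n Q q → (w ⊹ A ⋆ n) ⋆ (Q ⋆ Q ⋆ (q ⋆ Q)) , w ⋆ (Q ⋆ Q) ⋆ (q ⋆ Q) ⊹ A ⋆ (n ⋆ (q ⋆ Q)) ⋆ (Q ⋆ Q)) refl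
    arith″ = semiring-solve 7 (λ t θ W q Q A a → t ⋆ (θ ⋆ W) ⋆ (q ⋆ Q) ⊹ A ⋆ (t ⋆ a) ⋆ (Q ⋆ Q) , t ⋆ Q ⋆ (q ⋆ (θ ⋆ W) ⊹ A ⋆ (Q ⋆ a))) refl
    w-mean : ∑ (tups (suc K)) w * (Q * Q) ≤ t * (θ′ * W)
    w-mean = begin
      ∑ (tups (suc K)) w * (Q * Q) ≡⟨ cong (_* (Q * Q)) (∑-swap (tups (suc K)) (pts (suc K)) v) ⟩
      ∑ (pts (suc K)) (λ x → ∑ (tups (suc K)) (λ φ → v φ x)) * (Q * Q) ≡⟨ ∑-*ʳ (pts (suc K)) (Q * Q) _ ⟨
      ∑ (pts (suc K)) (λ x → ∑ (tups (suc K)) (λ φ → v φ x) * (Q * Q)) ≤⟨ ∑-mono-∈ (pts (suc K)) (λ x i → v-mean x i) ⟩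
      ∑ (pts (suc K)) (λ x → t * W) ≡⟨ trans (∑-const (pts (suc K)) _) (cong (_* (t * W)) (trans (sym (∑-1 (pts (suc K)))) (∑-pts-1 (suc K)))) ⟩
      θ′ * (t * W) ≡⟨ swap-* θ′ t W ⟩
      t * (θ′ * W) ∎
      where
      swap-* : ∀ a b c → a * (b * c) ≡ b * (a * c)
      swap-* = semiring-solve 3 (λ a b c → a ⋆ (b ⋆ c) , b ⋆ (a ⋆ c)) refl
      v-mean : ∀ x → x ∈ pts (suc K) → ∑ (tups (suc K)) (λ φ → v φ x) * (Q * Q) ≤ t * W
      v-mean x ix = begin
        ∑ (tups (suc K)) (λ φ → v φ x) * (Q * Q) ≡⟨ cong (_* (Q * Q)) (trans (∑-swap (tups (suc K)) Fins _) (∑-cong Fins (λ i → ∑-*ˡ (tups (suc K)) ⟦ other i₁ i ⟧ _))) ⟩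
        ∑ Fins (λ i → ⟦ other i₁ i ⟧ * ∑ (tups (suc K)) (λ φ → pr (size (class i ∩ ker (perp x φ))))) * (Q * Q) ≡⟨ trans (sym (∑-*ʳ Fins (Q * Q) _)) (∑-cong Fins (λ i → *-assoc ⟦ other i₁ i ⟧ _ _)) ⟩
        ∑ Fins (λ i → ⟦ other i₁ i ⟧ * (∑ (tups (suc K)) (λ φ → pr (size (class i ∩ ker (perp x φ)))) * (Q * Q))) ≤⟨ ∑-mono Fins (λ i → *-monoʳ-≤ ⟦ other i₁ i ⟧ (Pairwise.pair-mean (tups (suc K)) (λ φ → ker (perp x φ)) (Q * Q) t (perp-pairs x ix) (class i))) ⟩
        ∑ Fins (λ i → ⟦ other i₁ i ⟧ * (t * pr (size (class i)))) ≡⟨ trans (∑-cong Fins (λ i → swap-* ⟦ other i₁ i ⟧ t (pr (size (class i))))) (∑-*ˡ Fins t _) ⟩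
        t * W ∎
    per-space : ∀ φ → A ≤ w φ + A * n₁ φ
    per-space φ with n₁ φ in eq
    ... | suc n = ≤-trans (m≤m*n A (suc n)) (m≤n+m _ (w φ))
    -- Each of the `Θ (suc K)` fibres has two points of one colour. As the kernel misses `i₁`, the
    -- fibres share out the `a` points of this class, and other colours must supply the remaining
    -- `A`.
    ... | zero = ≤-trans (+-cancelʳ-≤ a _ _ (begin
        A + a ≡⟨ trans A+a (*-comm 2 θ′) ⟩
        θ′ * 2 ≡⟨ trans (cong (_* 2) (trans (sym (∑-pts-1 (suc K))) (∑-1 (pts (suc K))))) (sym (∑-const (pts (suc K)) 2)) ⟩
        ∑ (pts (suc K)) (λ _ → 2) ≤⟨ ∑-mono (pts (suc K)) per-fibre ⟩
        ∑ (pts (suc K)) (λ x → v φ x + size (class i₁ ∩ ker (perp x φ))) ≡⟨ ∑-+ (pts (suc K)) _ _ ⟩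
        w φ + ∑ (pts (suc K)) (λ x → size (class i₁ ∩ ker (perp x φ))) ≡⟨ cong (w φ +_) (trans (sym (+-identityʳ _)) (trans (subst (λ n → ∑ (pts (suc K)) (λ x → size (class i₁ ∩ ker (perp x φ))) + n ≡ a + θ′ * n) eq (fibre-sum (class i₁) φ)) (trans (cong (a +_) (*-zeroʳ θ′)) (+-identityʳ a)))) ⟩
        w φ + a ∎)) (m≤m+n (w φ) _)
      where
      per-fibre : ∀ x → 2 ≤ v φ x + size (class i₁ ∩ ker (perp x φ))
      per-fibre x with rf (perp x φ)
      ... | i , two with i Fin.≟ i₁
      ...   | yes refl = ≤-trans two (m≤n+m _ (v φ x))
      ...   | no n = ≤-trans (≤-trans (≤-trans (pr≥2 two) (≤-reflexive (trans (sym (*-identityˡ _)) (cong (λ b → ⟦ b ⟧ * pr (size (class i ∩ ker (perp x φ)))) (sym (other-≢ n))))))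
                (∑-∈ (λ i → ⟦ other i₁ i ⟧ * pr (size (class i ∩ ker (perp x φ)))) (∈-allFin i))) (m≤m+n (v φ x) _)

-- Numerical exclusion of a second large class.

clash : ∀ {a b} s → a ≤ b → a ≡ b + suc s → ⊥
clash {a} {b} s le e = 1+n≰n (≤-trans (≤-trans (m≤m+n (suc b) s) (≤-reflexive (trans (sym (+-suc b s)) (sym e)))) le)

-- Throughout, t = θ_{k-1}, q t = v + 4 t, q^k = v + 3 t + 1 and θ_k = v + 4 t + 1.
module Spread (t v : ℕ) where

  private
    u Q θ′ : ℕ
    u = v + 4 * t
    Q = v + 3 * t + 1
    θ′ = v + 4 * t + 1

  -- Multiplication by `t` turns `q t` into `u`. Since `Q u Q - 2 Q θ′ t` is at least `u θ′ v`, the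
  -- factor `u θ′` can then be cancelled.
  fine-simplified : ∀ {q A W a m} → 1 ≤ t → q * t ≡ u → A * (Q * (q * Q)) ≤ q * (θ′ * W) + A * (Q * a) → W ≤ m → a ≤ 2 * θ′ → A * v ≤ m
  fine-simplified {q} {A} {W} {a} {m} 1≤t qt fine W≤m a≤ = *-cancelˡ-≤ (u * θ′) {{m*n≢0 u θ′ {{>-nonZero (≤-trans (≤-trans 1≤t (m≤n*m t 4)) (m≤n+m (4 * t) v))}} {{>-nonZero (m≤n+m 1 (v + 4 * t))}}}} (+-cancelʳ-≤ (A * (2 * Q * θ′ * t)) _ _ (begin
      u * θ′ * (A * v) + A * (2 * Q * θ′ * t) ≤⟨ ≤-trans (m≤m+n _ (A * (u * (v + 2 * t) + 3 * u * (t * t) + (v + 2 * t) + 2 * (t * t)))) (≤-reflexive (arith A v t)) ⟩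
      A * (Q * (u * Q)) ≡⟨ trans (cong (λ n → A * (Q * (n * Q))) (sym qt)) (arith′ A Q q t) ⟩
      t * (A * (Q * (q * Q))) ≤⟨ *-monoʳ-≤ t (≤-trans fine (+-mono-≤ (*-monoʳ-≤ q (*-monoʳ-≤ θ′ W≤m)) (*-monoʳ-≤ A (*-monoʳ-≤ Q a≤)))) ⟩
      t * (q * (θ′ * m) + A * (Q * (2 * θ′))) ≡⟨ arith″ t q θ′ m A Q ⟩
      q * t * θ′ * m + A * (2 * Q * θ′ * t) ≡⟨ cong (λ n → n * θ′ * m + A * (2 * Q * θ′ * t)) qt ⟩
      u * θ′ * m + A * (2 * Q * θ′ * t) ∎))
    where
    open ≤-Reasoning
    arith = semiring-solve 3 (λ A v t → (v ⊹ # 4 ⋆ t) ⋆ (v ⊹ # 4 ⋆ t ⊹ # 1) ⋆ (A ⋆ v) ⊹ A ⋆ (# 2 ⋆ (v ⊹ # 3 ⋆ t ⊹ # 1) ⋆ (v ⊹ # 4 ⋆ t ⊹ # 1) ⋆ t) ⊹ A ⋆ ((v ⊹ # 4 ⋆ t) ⋆ (v ⊹ # 2 ⋆ t) ⊹ # 3 ⋆ (v ⊹ # 4 ⋆ t) ⋆ (t ⋆ t) ⊹ (v ⊹ # 2 ⋆ t) ⊹ # 2 ⋆ (t ⋆ t)) , A ⋆ ((v ⊹ # 3 ⋆ t ⊹ # 1) ⋆ ((v ⊹ # 4 ⋆ t) ⋆ (v ⊹ # 3 ⋆ t ⊹ # 1)))) refl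
    arith′ = semiring-solve 4 (λ A Q q t → A ⋆ (Q ⋆ (q ⋆ t ⋆ Q)) , t ⋆ (A ⋆ (Q ⋆ (q ⋆ Q)))) refl
    arith″ = semiring-solve 6 (λ t q θ m A Q → t ⋆ (q ⋆ (θ ⋆ m) ⊹ A ⋆ (Q ⋆ (# 2 ⋆ θ))) , q ⋆ t ⋆ θ ⋆ m ⊹ A ⋆ (# 2 ⋆ Q ⋆ θ ⋆ t)) refl

  pr-square : ∀ n → pr n + n ≡ n * n
  pr-square zero    = refl
  pr-square (suc n) = arith n
    where
    arith : ∀ n → suc n * n + suc n ≡ suc n * suc n
    arith = semiring-solve 1 (λ n → 1⊹ n ⋆ n ⊹ 1⊹ n , 1⊹ n ⋆ 1⊹ n) refl

  -- With a = b + p, the coarse count bounds a convex function of z, which is too small at both ends of its range.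
  coarse-contradiction : ∀ b p z R → 1 ≤ b → 7 * t ≤ v → 7 * u < 12 * b → 24 * (2 * b + p + z) + 41 * t ≤ 53 * u →
    10 * (Q * Q) + 2 * ((b + p) * b) ≤ pr (b + p) + pr b + 4 * (Q * ((b + p) + b)) + 5 * R → R ≤ b * z → ⊥
  coarse-contradiction b p z R 1≤b 7t≤v large sum coarse R≤ = by-z z refl
    where
    open ≤-Reasoning
    -- `S` and `M` are constant when `z` grows at the expense of `p`. The two ends of the range are
    -- `z = 0`, bounded in `f₀`, and `p = 0`, bounded in `f₁`.
    S = 2 * b + p + z
    M = p + z
    w = v ∸ 7 * t
    v≡ : v ≡ 7 * t + w
    v≡ = sym (m+[n∸m]≡n 7t≤v)
    value : 10 * (Q * Q) ≤ p * p + 4 * Q * (2 * b + p) + 5 * (b * z)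
    value = +-cancelʳ-≤ (2 * ((b + p) * b) + (b + p) + b) _ _ (begin
      10 * (Q * Q) + (2 * ((b + p) * b) + (b + p) + b) ≡⟨ arith (10 * (Q * Q)) (2 * ((b + p) * b)) (b + p) b ⟩
      10 * (Q * Q) + 2 * ((b + p) * b) + (b + p) + b ≤⟨ +-monoˡ-≤ b (+-monoˡ-≤ (b + p) (≤-trans coarse (+-monoʳ-≤ (pr (b + p) + pr b + 4 * (Q * ((b + p) + b))) (*-monoʳ-≤ 5 R≤)))) ⟩
      pr (b + p) + pr b + 4 * (Q * ((b + p) + b)) + 5 * (b * z) + (b + p) + b ≡⟨ arith′ (pr (b + p)) (pr b) (4 * (Q * ((b + p) + b))) (5 * (b * z)) (b + p) b ⟩
      (pr (b + p) + (b + p)) + (pr b + b) + 4 * (Q * ((b + p) + b)) + 5 * (b * z) ≡⟨ cong₂ (λ x y → x + y + 4 * (Q * ((b + p) + b)) + 5 * (b * z)) (pr-square (b + p)) (pr-square b) ⟩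
      (b + p) * (b + p) + b * b + 4 * (Q * ((b + p) + b)) + 5 * (b * z) ≤⟨ m≤m+n _ ((b + p) + b) ⟩
      (b + p) * (b + p) + b * b + 4 * (Q * ((b + p) + b)) + 5 * (b * z) + ((b + p) + b) ≡⟨ arith″ b p Q z ⟩
      p * p + 4 * Q * (2 * b + p) + 5 * (b * z) + (2 * ((b + p) * b) + (b + p) + b) ∎)
      where
      arith : ∀ x y c b → x + (y + c + b) ≡ x + y + c + b
      arith = semiring-solve 4 (λ x y c b → x ⊹ (y ⊹ c ⊹ b) , x ⊹ y ⊹ c ⊹ b) refl
      arith′ = semiring-solve 6 (λ x y r s c b → x ⊹ y ⊹ r ⊹ s ⊹ c ⊹ b , (x ⊹ c) ⊹ (y ⊹ b) ⊹ r ⊹ s) refl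
      arith″ = semiring-solve 4 (λ b p Q z → (b ⊹ p) ⋆ (b ⊹ p) ⊹ b ⋆ b ⊹ # 4 ⋆ (Q ⋆ ((b ⊹ p) ⊹ b)) ⊹ # 5 ⋆ (b ⋆ z) ⊹ ((b ⊹ p) ⊹ b) , p ⋆ p ⊹ # 4 ⋆ Q ⋆ (# 2 ⋆ b ⊹ p) ⊹ # 5 ⋆ (b ⋆ z) ⊹ (# 2 ⋆ ((b ⊹ p) ⋆ b) ⊹ (b ⊹ p) ⊹ b)) refl
    24S : 24 * S ≤ 542 * t + 53 * w
    24S = +-cancelʳ-≤ (41 * t) _ _ (≤-trans sum (≤-reflexive (trans (cong (λ v → 53 * (v + 4 * t)) v≡) (arith t w))))
      where
      arith = semiring-solve 2 (λ t w → # 53 ⋆ (# 7 ⋆ t ⊹ w ⊹ # 4 ⋆ t) , # 542 ⋆ t ⊹ # 53 ⋆ w ⊹ # 41 ⋆ t) refl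
    24M : 24 * M ≤ 234 * t + 25 * w
    24M = +-cancelʳ-≤ (48 * b) _ _ (≤-trans (≤-reflexive (arith b p z)) (≤-trans 24S (by-slack 0 (trans (+-identityʳ _) (arith′ t w b)) (*-monoʳ-≤ 4 (≤-trans (≤-reflexive (cong (λ v → 7 * (v + 4 * t)) (sym v≡))) (<⇒≤ large))))))
      where
      arith : ∀ b p z → 24 * (p + z) + 48 * b ≡ 24 * (2 * b + p + z)
      arith = semiring-solve 3 (λ b p z → # 24 ⋆ (p ⊹ z) ⊹ # 48 ⋆ b , # 24 ⋆ (# 2 ⋆ b ⊹ p ⊹ z)) refl
      arith′ = semiring-solve 3 (λ t w b → # 542 ⋆ t ⊹ # 53 ⋆ w ⊹ # 4 ⋆ (# 12 ⋆ b) , # 234 ⋆ t ⊹ # 25 ⋆ w ⊹ # 48 ⋆ b ⊹ # 4 ⋆ (# 7 ⋆ (# 7 ⋆ t ⊹ w ⊹ # 4 ⋆ t))) refl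
    Q≡ : Q ≡ 10 * t + w + 1
    Q≡ = trans (cong (λ v → v + 3 * t + 1) v≡) (arith t w)
      where
      arith : ∀ t w → 7 * t + w + 3 * t + 1 ≡ 10 * t + w + 1
      arith = semiring-solve 2 (λ t w → # 7 ⋆ t ⊹ w ⊹ # 3 ⋆ t ⊹ # 1 , # 10 ⋆ t ⊹ w ⊹ # 1) refl
    f₀ : M * M + 4 * Q * S < 10 * (Q * Q)
    f₀ = *-cancelˡ-< 576 _ _ (begin-strict
      576 * (M * M + 4 * Q * S) ≡⟨ arith M Q S ⟩
      24 * M * (24 * M) + 96 * Q * (24 * S) ≤⟨ +-mono-≤ (*-mono-≤ 24M 24M) (*-monoʳ-≤ (96 * Q) 24S) ⟩
      (234 * t + 25 * w) * (234 * t + 25 * w) + 96 * Q * (542 * t + 53 * w) ≡⟨ cong (λ n → (234 * t + 25 * w) * (234 * t + 25 * w) + 96 * n * (542 * t + 53 * w)) Q≡ ⟩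
      (234 * t + 25 * w) * (234 * t + 25 * w) + 96 * (10 * t + w + 1) * (542 * t + 53 * w) <⟨ m<m+n _ {924 * (t * t) + 588 * (t * w) + 47 * (w * w) + 63168 * t + 6432 * w + 5760} (≤-trans (s≤s z≤n) (m≤n+m 5760 _)) ⟩
      (234 * t + 25 * w) * (234 * t + 25 * w) + 96 * (10 * t + w + 1) * (542 * t + 53 * w) + (924 * (t * t) + 588 * (t * w) + 47 * (w * w) + 63168 * t + 6432 * w + 5760) ≡⟨ arith′ t w ⟩
      576 * (10 * ((10 * t + w + 1) * (10 * t + w + 1))) ≡⟨ cong (λ n → 576 * (10 * (n * n))) Q≡ ⟨
      576 * (10 * (Q * Q)) ∎)
      where
      arith = semiring-solve 3 (λ M Q S → # 576 ⋆ (M ⋆ M ⊹ # 4 ⋆ Q ⋆ S) , # 24 ⋆ M ⋆ (# 24 ⋆ M) ⊹ # 96 ⋆ Q ⋆ (# 24 ⋆ S)) refl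
      arith′ = semiring-solve 2 (λ t w → (# 234 ⋆ t ⊹ # 25 ⋆ w) ⋆ (# 234 ⋆ t ⊹ # 25 ⋆ w) ⊹ # 96 ⋆ (# 10 ⋆ t ⊹ w ⊹ # 1) ⋆ (# 542 ⋆ t ⊹ # 53 ⋆ w) ⊹ (# 924 ⋆ (t ⋆ t) ⊹ # 588 ⋆ (t ⋆ w) ⊹ # 47 ⋆ (w ⋆ w) ⊹ # 63168 ⋆ t ⊹ # 6432 ⋆ w ⊹ # 5760) , # 576 ⋆ (# 10 ⋆ ((# 10 ⋆ t ⊹ w ⊹ # 1) ⋆ (# 10 ⋆ t ⊹ w ⊹ # 1)))) refl
    5S : 5 * S + 1 ≤ 12 * Q
    5S = *-cancelˡ-≤ 24 (begin
      24 * (5 * S + 1) ≡⟨ arith S ⟩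
      5 * (24 * S) + 24 ≤⟨ +-monoˡ-≤ 24 (*-monoʳ-≤ 5 24S) ⟩
      5 * (542 * t + 53 * w) + 24 ≤⟨ m≤m+n _ (170 * t + 23 * w + 264) ⟩
      5 * (542 * t + 53 * w) + 24 + (170 * t + 23 * w + 264) ≡⟨ arith′ t w ⟩
      24 * (12 * (10 * t + w + 1)) ≡⟨ cong (λ n → 24 * (12 * n)) Q≡ ⟨
      24 * (12 * Q) ∎)
      where
      arith : ∀ S → 24 * (5 * S + 1) ≡ 5 * (24 * S) + 24
      arith = semiring-solve 1 (λ S → # 24 ⋆ (# 5 ⋆ S ⊹ # 1) , # 5 ⋆ (# 24 ⋆ S) ⊹ # 24) refl
      arith′ = semiring-solve 2 (λ t w → # 5 ⋆ (# 542 ⋆ t ⊹ # 53 ⋆ w) ⊹ # 24 ⊹ (# 170 ⋆ t ⊹ # 23 ⋆ w ⊹ # 264) , # 24 ⋆ (# 12 ⋆ (# 10 ⋆ t ⊹ w ⊹ # 1))) refl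
    f₁ : b * (8 * Q + 5 * M) < 10 * (Q * Q)
    f₁ = +-cancelʳ-≤ (10 * (b * b)) _ _ (begin
      suc (b * (8 * Q + 5 * M)) + 10 * (b * b) ≤⟨ +-monoˡ-≤ (10 * (b * b)) (+-monoˡ-≤ (b * (8 * Q + 5 * M)) 1≤b) ⟩
      b + b * (8 * Q + 5 * M) + 10 * (b * b) ≡⟨ arith b Q p z ⟩
      b * (8 * Q + (5 * S + 1)) ≤⟨ *-monoʳ-≤ b (+-monoʳ-≤ (8 * Q) 5S) ⟩
      b * (8 * Q + 12 * Q) ≡⟨ arith′ b Q ⟩
      10 * (2 * (Q * b)) ≤⟨ *-monoʳ-≤ 10 (two-squares Q b) ⟩
      10 * (Q * Q + b * b) ≡⟨ *-distribˡ-+ 10 (Q * Q) (b * b) ⟩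
      10 * (Q * Q) + 10 * (b * b) ∎)
      where
      arith = semiring-solve 4 (λ b Q p z → b ⊹ b ⋆ (# 8 ⋆ Q ⊹ # 5 ⋆ (p ⊹ z)) ⊹ # 10 ⋆ (b ⋆ b) , b ⋆ (# 8 ⋆ Q ⊹ (# 5 ⋆ (# 2 ⋆ b ⊹ p ⊹ z) ⊹ # 1))) refl
      arith′ : ∀ b Q → b * (8 * Q + 12 * Q) ≡ 10 * (2 * (Q * b))
      arith′ = semiring-solve 2 (λ b Q → b ⋆ (# 8 ⋆ Q ⊹ # 12 ⋆ Q) , # 10 ⋆ (# 2 ⋆ (Q ⋆ b))) refl
      two-squares : ∀ a b → 2 * (a * b) ≤ a * a + b * b
      two-squares zero    b       = z≤n
      two-squares (suc a) zero    = ≤-trans (≤-reflexive (cong (2 *_) (*-zeroʳ (suc a)))) z≤n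
      two-squares (suc a) (suc b) = ≤-trans (≤-reflexive (lhs a b)) (≤-trans (+-monoˡ-≤ (2 * a + 2 * b + 2) (two-squares a b)) (≤-reflexive (rhs a b)))
        where
        lhs = semiring-solve 2 (λ a b → # 2 ⋆ (1⊹ a ⋆ 1⊹ b) , # 2 ⋆ (a ⋆ b) ⊹ (# 2 ⋆ a ⊹ # 2 ⋆ b ⊹ # 2)) refl
        rhs = semiring-solve 2 (λ a b → a ⋆ a ⊹ b ⋆ b ⊹ (# 2 ⋆ a ⊹ # 2 ⋆ b ⊹ # 2) , 1⊹ a ⋆ 1⊹ a ⊹ 1⊹ b ⋆ 1⊹ b) refl
    by-z : ∀ n → z ≡ n → ⊥
    by-z zero z≡0 = <⇒≱ f₀ (≤-trans value (≤-trans (≤-reflexive (trans (cong (λ n → p * p + 4 * Q * (2 * b + p) + 5 * (b * n)) z≡0) (arith p Q b))) (≤-reflexive (cong (λ n → (p + n) * (p + n) + 4 * Q * (2 * b + p + n)) (sym z≡0)))))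
      where
      arith = semiring-solve 3 (λ p Q b → p ⋆ p ⊹ # 4 ⋆ Q ⋆ (# 2 ⋆ b ⊹ p) ⊹ # 5 ⋆ (b ⋆ # 0) , (p ⊹ # 0) ⋆ (p ⊹ # 0) ⊹ # 4 ⋆ Q ⋆ (# 2 ⋆ b ⊹ p ⊹ # 0)) refl
    -- Convexity, multiplied by `M`: since `p² M ≤ p M²`, the total is at most `p` times the value
    -- in `f₀` plus `z` times that in `f₁`, and the second bound is strict with positive weight.
    by-z (suc n) z≡ = 1+n≰n (≤-trans (≤-trans (≤-reflexive (+-comm 1 _)) (+-monoʳ-≤ _ (subst (1 ≤_) (sym z≡) (s≤s z≤n)))) (begin
      M * (10 * (Q * Q)) + z ≤⟨ +-monoˡ-≤ z (*-monoʳ-≤ M value) ⟩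
      M * (p * p + 4 * Q * (2 * b + p) + 5 * (b * z)) + z ≤⟨ m≤m+n _ (z * p * M) ⟩
      M * (p * p + 4 * Q * (2 * b + p) + 5 * (b * z)) + z + z * p * M ≡⟨ arith p Q b z ⟩
      p * (M * M + 4 * Q * S) + z * suc (b * (8 * Q + 5 * M)) ≤⟨ +-mono-≤ (*-monoʳ-≤ p (<⇒≤ f₀)) (*-monoʳ-≤ z f₁) ⟩
      p * (10 * (Q * Q)) + z * (10 * (Q * Q)) ≡⟨ *-distribʳ-+ (10 * (Q * Q)) p z ⟨
      M * (10 * (Q * Q)) ∎))
      where
      arith = semiring-solve 4 (λ p Q b z → (p ⊹ z) ⋆ (p ⋆ p ⊹ # 4 ⋆ Q ⋆ (# 2 ⋆ b ⊹ p) ⊹ # 5 ⋆ (b ⋆ z)) ⊹ z ⊹ z ⋆ p ⋆ (p ⊹ z) , p ⋆ ((p ⊹ z) ⋆ (p ⊹ z) ⊹ # 4 ⋆ Q ⋆ (# 2 ⋆ b ⊹ p ⊹ z)) ⊹ z ⋆ 1⊹ (b ⋆ (# 8 ⋆ Q ⊹ # 5 ⋆ (p ⊹ z)))) refl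

  small-b : ∀ {b} → 7 * t ≤ v → 12 * b ≤ 7 * u → b ≤ v
  small-b {b} 7t≤v le = *-cancelˡ-≤ 12 (≤-trans le (by-slack v (arith v t) (*-monoʳ-≤ 4 7t≤v)))
    where
    arith : ∀ v t → 7 * (v + 4 * t) + 4 * v + v ≡ 12 * v + 4 * (7 * t)
    arith = semiring-solve 2 (λ v t → # 7 ⋆ (v ⊹ # 4 ⋆ t) ⊹ # 4 ⋆ v ⊹ v , # 12 ⋆ v ⊹ # 4 ⋆ (# 7 ⋆ t)) refl

  -- Two regimes: if the second class exceeds `7/12` of `u`, the coarse count fails; otherwise the
  -- fine count gives `A v ≤ b (z + b′)`, left to the two cases for `q`.
  spread : ∀ {q W R} b′ p z → 1 ≤ t → 7 * t ≤ v → q * t ≡ u → let b = suc b′ ; a = b + p in a ≤ 2 * θ′ →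
    W ≤ b * (z + b′) → R ≤ b * z →
    (∀ A → A + a ≡ 2 * θ′ → A * (Q * (q * Q)) ≤ q * (θ′ * W) + A * (Q * a)) →
    10 * (Q * Q) + 2 * (a * b) ≤ pr a + pr b + 4 * (Q * (a + b)) + 5 * R →
    24 * (2 * b + p + z) + 41 * t ≤ 53 * u →
    (12 * b ≤ 7 * u → ∀ A → A + a ≡ 2 * θ′ → A * v ≤ b * (z + b′) → ⊥) → ⊥
  spread {q} {W} {R} b′ p z 1≤t 7t≤v qt a≤ W≤ R≤ fine coarse sum small with 12 * suc b′ ≤? 7 * u
  ... | no large = coarse-contradiction (suc b′) p z R (s≤s z≤n) 7t≤v (≰⇒> large) sum coarse R≤
  ... | yes le = small le A₀ A+a (fine-simplified {q} {A₀} {W} 1≤t qt (fine A₀ A+a) W≤ a≤)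
    where
    A₀ = 2 * θ′ ∸ (suc b′ + p)
    A+a : A₀ + (suc b′ + p) ≡ 2 * θ′
    A+a = m∸n+n≡m a≤

positive-clash : ∀ {a b} e → a ≤ b → a ≡ b + e → 1 ≤ e → ⊥
positive-clash (suc s) le eq _ = clash s le eq

-- Here q is prime and G = 2.
module Prime-case (t v : ℕ) (1≤t : 1 ≤ t) (7t≤v : 7 * t ≤ v) (a b Y : ℕ)
  (sum : 24 * (a + Y) + 41 * t + 91 ≤ 48 * (v + 4 * t + 1) + 5 * (v + 4 * t))
  (few : v + 4 * t + 4 * (v + 4 * t + 1) + b ≤ 2 * a + 4 * Y + 2 + t) where

  -- `sum` plus twelve times `few` eliminates `a`: the classes other than the largest carry a
  -- substantial part `Y` of the excess.
  Y-large : 7 * (v + 4 * t) + 12 * b + 29 * t + 67 ≤ 24 * Y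
  Y-large = by-slack 0 (arith t v a b Y) (+-mono-≤ sum (*-monoʳ-≤ 12 few))
    where
    arith = semiring-solve 5 (λ t v a b Y → # 7 ⋆ (v ⊹ # 4 ⋆ t) ⊹ # 12 ⋆ b ⊹ # 29 ⋆ t ⊹ # 67 ⊹ (# 48 ⋆ (v ⊹ # 4 ⋆ t ⊹ # 1) ⊹ # 5 ⋆ (v ⊹ # 4 ⋆ t) ⊹ # 12 ⋆ (# 2 ⋆ a ⊹ # 4 ⋆ Y ⊹ # 2 ⊹ t)) ⊹ # 0 , # 24 ⋆ Y ⊹ (# 24 ⋆ (a ⊹ Y) ⊹ # 41 ⋆ t ⊹ # 91 ⊹ # 12 ⋆ (v ⊹ # 4 ⋆ t ⊹ # 4 ⋆ (v ⊹ # 4 ⋆ t ⊹ # 1) ⊹ b))) refl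

  -- Makes `A = 2 θ′ - a` a natural number.
  a-bound : a ≤ 2 * (v + 4 * t + 1)
  a-bound with a ≤? 2 * (v + 4 * t + 1)
  ... | yes le = le
  ... | no gt  = ⊥-elim (positive-clash (2 * (v + 4 * t) + 12 * b + 70 * t + 182) (+-mono-≤ (+-mono-≤ sum Y-large) (*-monoʳ-≤ 24 (≰⇒> gt))) (arith t v a b Y) (≤-trans (s≤s z≤n) (m≤n+m 182 _)))
    where
    arith = semiring-solve 5 (λ t v a b Y → # 24 ⋆ (a ⊹ Y) ⊹ # 41 ⋆ t ⊹ # 91 ⊹ (# 7 ⋆ (v ⊹ # 4 ⋆ t) ⊹ # 12 ⋆ b ⊹ # 29 ⋆ t ⊹ # 67) ⊹ # 24 ⋆ 1⊹ (# 2 ⋆ (v ⊹ # 4 ⋆ t ⊹ # 1)) , # 48 ⋆ (v ⊹ # 4 ⋆ t ⊹ # 1) ⊹ # 5 ⋆ (v ⊹ # 4 ⋆ t) ⊹ # 24 ⋆ Y ⊹ # 24 ⋆ a ⊹ (# 2 ⋆ (v ⊹ # 4 ⋆ t) ⊹ # 12 ⋆ b ⊹ # 70 ⋆ t ⊹ # 182)) refl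

  -- `A` is almost as large as `Y`, so `A v ≤ b Y` with `v = b + r` bounds `24 Y r` by `5 u v`,
  -- where `u = v + 4 t`. But `Y` is large, and so is `r`, because `b` is at most `7/12` of `u`.
  impossible : 1 ≤ b → 12 * b ≤ 7 * (v + 4 * t) → ∀ A → A + a ≡ 2 * (v + 4 * t + 1) → A * v ≤ b * Y → ⊥
  impossible 1≤b small A A+a fine = with-r (v ∸ b) (m+[n∸m]≡n {b} {v} (Spread.small-b t v 7t≤v small))
    where
    A-large : 24 * Y + 41 * t + 91 ≤ 24 * A + 5 * (v + 4 * t)
    A-large = +-cancelʳ-≤ (24 * a) _ _ (≤-trans (≤-reflexive (arith Y t a)) (≤-trans sum (≤-reflexive (trans (cong (_+ 5 * (v + 4 * t)) (trans (arith′ (v + 4 * t + 1)) (cong (24 *_) (sym A+a)))) (arith″ A a (v + 4 * t))))))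
      where
      arith = semiring-solve 3 (λ Y t a → # 24 ⋆ Y ⊹ # 41 ⋆ t ⊹ # 91 ⊹ # 24 ⋆ a , # 24 ⋆ (a ⊹ Y) ⊹ # 41 ⋆ t ⊹ # 91) refl
      arith′ : ∀ n → 48 * n ≡ 24 * (2 * n)
      arith′ = semiring-solve 1 (λ n → # 48 ⋆ n , # 24 ⋆ (# 2 ⋆ n)) refl
      arith″ = semiring-solve 3 (λ A a u → # 24 ⋆ (A ⊹ a) ⊹ # 5 ⋆ u , # 24 ⋆ A ⊹ # 5 ⋆ u ⊹ # 24 ⋆ a) refl
    with-r : ∀ r → b + r ≡ v → ⊥
    with-r r refl = positive-clash (10 * (b * r) + 10 * (r * r) + 5 * (t * r) + 790 * r + 455 * b)
        (+-mono-≤ (+-mono-≤ (+-mono-≤ (*-monoʳ-≤ 5 product) (*-monoʳ-≤ 5 (*-monoˡ-≤ b b-small))) (*-monoʳ-≤ (7 * t) b-small)) (*-monoʳ-≤ (28 * t) r-large))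
        (arith b r t) (≤-trans 1≤b (≤-trans (m≤n*m b 455) (m≤n+m (455 * b) (10 * (b * r) + 10 * (r * r) + 5 * (t * r) + 790 * r))))
      where
      b-small : 5 * b ≤ 7 * r + 28 * t
      b-small = by-slack 0 (arith₁ b r t) small
        where
        arith₁ = semiring-solve 3 (λ b r t → # 5 ⋆ b ⊹ # 7 ⋆ (b ⊹ r ⊹ # 4 ⋆ t) ⊹ # 0 , # 7 ⋆ r ⊹ # 28 ⋆ t ⊹ # 12 ⋆ b) refl
      r-large : 7 * t ≤ 12 * r
      r-large = by-slack 0 (arith₁ b r t) (+-mono-≤ (*-monoʳ-≤ 5 7t≤v) b-small)
        where
        arith₁ = semiring-solve 3 (λ b r t → # 7 ⋆ t ⊹ (# 5 ⋆ (b ⊹ r) ⊹ (# 7 ⋆ r ⊹ # 28 ⋆ t)) ⊹ # 0 , # 12 ⋆ r ⊹ (# 5 ⋆ (# 7 ⋆ t) ⊹ # 5 ⋆ b)) refl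
      product : (7 * (b + r + 4 * t) + 12 * b + 29 * t + 67) * r + (41 * t + 91) * (b + r) ≤ 5 * (b + r + 4 * t) * (b + r)
      product = by-slack 0 (arith₁ b r t Y A) (+-mono-≤ (+-mono-≤ (*-monoˡ-≤ (b + r) A-large) (*-monoʳ-≤ 24 fine)) (*-monoˡ-≤ r Y-large))
        where
        arith₁ = semiring-solve 5 (λ b r t Y A → (# 7 ⋆ (b ⊹ r ⊹ # 4 ⋆ t) ⊹ # 12 ⋆ b ⊹ # 29 ⋆ t ⊹ # 67) ⋆ r ⊹ (# 41 ⋆ t ⊹ # 91) ⋆ (b ⊹ r) ⊹ ((# 24 ⋆ A ⊹ # 5 ⋆ (b ⊹ r ⊹ # 4 ⋆ t)) ⋆ (b ⊹ r) ⊹ # 24 ⋆ (b ⋆ Y) ⊹ # 24 ⋆ Y ⋆ r) ⊹ # 0 , # 5 ⋆ (b ⊹ r ⊹ # 4 ⋆ t) ⋆ (b ⊹ r) ⊹ ((# 24 ⋆ Y ⊹ # 41 ⋆ t ⊹ # 91) ⋆ (b ⊹ r) ⊹ # 24 ⋆ (A ⋆ (b ⊹ r)) ⊹ (# 7 ⋆ (b ⊹ r ⊹ # 4 ⋆ t) ⊹ # 12 ⋆ b ⊹ # 29 ⋆ t ⊹ # 67) ⋆ r)) refl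
      arith = semiring-solve 3 (λ b r t → # 5 ⋆ ((# 7 ⋆ (b ⊹ r ⊹ # 4 ⋆ t) ⊹ # 12 ⋆ b ⊹ # 29 ⋆ t ⊹ # 67) ⋆ r ⊹ (# 41 ⋆ t ⊹ # 91) ⋆ (b ⊹ r)) ⊹ # 5 ⋆ (# 5 ⋆ b ⋆ b) ⊹ # 7 ⋆ t ⋆ (# 5 ⋆ b) ⊹ # 28 ⋆ t ⋆ (# 7 ⋆ t) , # 5 ⋆ (# 5 ⋆ (b ⊹ r ⊹ # 4 ⋆ t) ⋆ (b ⊹ r)) ⊹ # 5 ⋆ ((# 7 ⋆ r ⊹ # 28 ⋆ t) ⋆ b) ⊹ # 7 ⋆ t ⋆ (# 7 ⋆ r ⊹ # 28 ⋆ t) ⊹ # 28 ⋆ t ⋆ (# 12 ⋆ r) ⊹ (# 10 ⋆ (b ⋆ r) ⊹ # 10 ⋆ (r ⋆ r) ⊹ # 5 ⋆ (t ⋆ r) ⊹ # 790 ⋆ r ⊹ # 455 ⋆ b)) refl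

  total : 24 * (a + Y + 1) + 41 * t ≤ 53 * (v + 4 * t)
  total = by-slack 19 (arith a Y t v) sum
    where
    arith = semiring-solve 4 (λ a Y t v → # 24 ⋆ (a ⊹ Y ⊹ # 1) ⊹ # 41 ⋆ t ⊹ (# 48 ⋆ (v ⊹ # 4 ⋆ t ⊹ # 1) ⊹ # 5 ⋆ (v ⊹ # 4 ⋆ t)) ⊹ # 19 , # 53 ⋆ (v ⊹ # 4 ⋆ t) ⊹ (# 24 ⋆ (a ⊹ Y) ⊹ # 41 ⋆ t ⊹ # 91)) refl

-- Here q is not prime, G = q - 1 and s = θ_{k-2}.
module Composite-case (t v s G : ℕ) (1≤t : 1 ≤ t) (21t≤v : 21 * t ≤ v) (2≤G : 2 ≤ G) (Gt : G * t + t ≡ v + 4 * t) (a b Y : ℕ)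
  (sum : 2 * (a + Y) + 2 * s + 3 ≤ 4 * (v + 4 * t + 1) + t)
  (few : v + 4 * t + 2 + 2 * (G * (v + 4 * t + 1)) + G * b ≤ b + G * (a + 2 * Y + 2) + t) where

  -- Twice `few` plus `G` times `sum` eliminates `a`.
  Y-large : G * t + 4 + 2 * (G * b) + 2 * (G * s) ≤ 2 * b + 2 * (G * Y) + G
  Y-large = by-slack 0 (trans (arith t s G a b Y (v + 4 * t + 1)) (cong (λ n → 2 * b + 2 * (G * Y) + G + (2 * (n + 2 + 2 * (G * (v + 4 * t + 1)) + G * b) + G * (2 * (a + Y) + 2 * s + 3))) Gt)) (+-mono-≤ (*-monoʳ-≤ 2 few) (*-monoʳ-≤ G sum))
    where
    arith = semiring-solve 7 (λ t s G a b Y θ → G ⋆ t ⊹ # 4 ⊹ # 2 ⋆ (G ⋆ b) ⊹ # 2 ⋆ (G ⋆ s) ⊹ (# 2 ⋆ (b ⊹ G ⋆ (a ⊹ # 2 ⋆ Y ⊹ # 2) ⊹ t) ⊹ G ⋆ (# 4 ⋆ θ ⊹ t)) ⊹ # 0 , # 2 ⋆ b ⊹ # 2 ⋆ (G ⋆ Y) ⊹ G ⊹ (# 2 ⋆ (G ⋆ t ⊹ t ⊹ # 2 ⊹ # 2 ⋆ (G ⋆ θ) ⊹ G ⋆ b) ⊹ G ⋆ (# 2 ⋆ (a ⊹ Y) ⊹ # 2 ⋆ s ⊹ # 3))) refl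

  a-bound : a ≤ 2 * (v + 4 * t + 1)
  a-bound with a ≤? 2 * (v + 4 * t + 1)
  ... | yes le = le
  ... | no gt  = ⊥-elim (positive-clash (4 + 4 * (G * s) + 4 * G)
        (+-mono-≤ (+-mono-≤ (+-mono-≤ Y-large (*-monoʳ-≤ G sum)) (*-monoʳ-≤ (2 * G) (≰⇒> gt))) (*-monoˡ-≤ (2 * b) (≤-trans (s≤s z≤n) 2≤G)))
        (arith t s G a b Y (v + 4 * t + 1)) (≤-trans (s≤s z≤n) (≤-trans (m≤m+n 4 (4 * (G * s))) (m≤m+n _ (4 * G)))))
    where
    arith = semiring-solve 7 (λ t s G a b Y θ → G ⋆ t ⊹ # 4 ⊹ # 2 ⋆ (G ⋆ b) ⊹ # 2 ⋆ (G ⋆ s) ⊹ G ⋆ (# 2 ⋆ (a ⊹ Y) ⊹ # 2 ⋆ s ⊹ # 3) ⊹ # 2 ⋆ G ⋆ 1⊹ (# 2 ⋆ θ) ⊹ # 1 ⋆ (# 2 ⋆ b) , # 2 ⋆ b ⊹ # 2 ⋆ (G ⋆ Y) ⊹ G ⊹ G ⋆ (# 4 ⋆ θ ⊹ t) ⊹ # 2 ⋆ G ⋆ a ⊹ G ⋆ (# 2 ⋆ b) ⊹ (# 4 ⊹ # 4 ⋆ (G ⋆ s) ⊹ # 4 ⋆ G)) refl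

  -- Now `A ≥ Y - t / 2`, so `A v ≤ b Y` with `v = b + r` bounds `2 Y r` by `t v`. This contradicts
  -- `Y-large` and `77 t ≤ 12 r`, the latter a consequence of `21 t ≤ v`.
  impossible : 1 ≤ b → 12 * b ≤ 7 * (v + 4 * t) → ∀ A → A + a ≡ 2 * (v + 4 * t + 1) → A * v ≤ b * Y → ⊥
  impossible 1≤b small A A+a fine = with-r (v ∸ b) (m+[n∸m]≡n {b} {v} (Spread.small-b t v (≤-trans (*-monoˡ-≤ t 7≤21) 21t≤v) small))
    where
    7≤21 : 7 ≤ 21
    7≤21 = m≤m+n 7 14
    A-large : 2 * Y + 2 * s + 3 ≤ 2 * A + t
    A-large = +-cancelʳ-≤ (2 * a) _ _ (≤-trans (≤-reflexive (arith Y s a)) (≤-trans sum (≤-reflexive (trans (cong (_+ t) (trans (arith′ (v + 4 * t + 1)) (cong (2 *_) (sym A+a)))) (arith″ A a t)))))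
      where
      arith = semiring-solve 3 (λ Y s a → # 2 ⋆ Y ⊹ # 2 ⋆ s ⊹ # 3 ⊹ # 2 ⋆ a , # 2 ⋆ (a ⊹ Y) ⊹ # 2 ⋆ s ⊹ # 3) refl
      arith′ : ∀ n → 4 * n ≡ 2 * (2 * n)
      arith′ = semiring-solve 1 (λ n → # 4 ⋆ n , # 2 ⋆ (# 2 ⋆ n)) refl
      arith″ : ∀ A a t → 2 * (A + a) + t ≡ 2 * A + t + 2 * a
      arith″ = semiring-solve 3 (λ A a t → # 2 ⋆ (A ⊹ a) ⊹ t , # 2 ⋆ A ⊹ t ⊹ # 2 ⋆ a) refl
    with-r : ∀ r → b + r ≡ v → ⊥
    with-r r refl = positive-clash (308 * r + 65 * (G * (b * r)) + 308 * (G * (s * r)) + 154 * (G * (s * b)) + 231 * (G * b) + 154 * (G * r))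
        (+-mono-≤ (+-mono-≤ (*-monoʳ-≤ 77 product) (*-monoʳ-≤ (G * b) r-large)) (*-monoʳ-≤ (77 * (b * r)) 2≤G))
        (arith b r t s G) (≤-trans (*-mono-≤ (≤-trans (s≤s z≤n) 2≤G) 1≤b) (≤-trans (m≤n*m (G * b) 231) (≤-trans (m≤n+m (231 * (G * b)) (308 * r + 65 * (G * (b * r)) + 308 * (G * (s * r)) + 154 * (G * (s * b)))) (m≤m+n _ (154 * (G * r))))))
      where
      b-small : 5 * b ≤ 7 * r + 28 * t
      b-small = by-slack 0 (arith₁ b r t) small
        where
        arith₁ = semiring-solve 3 (λ b r t → # 5 ⋆ b ⊹ # 7 ⋆ (b ⊹ r ⊹ # 4 ⋆ t) ⊹ # 0 , # 7 ⋆ r ⊹ # 28 ⋆ t ⊹ # 12 ⋆ b) refl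
      r-large : 77 * t ≤ 12 * r
      r-large = by-slack 0 (arith₁ b r t) (+-mono-≤ (*-monoʳ-≤ 5 21t≤v) b-small)
        where
        arith₁ = semiring-solve 3 (λ b r t → # 77 ⋆ t ⊹ (# 5 ⋆ (b ⊹ r) ⊹ (# 7 ⋆ r ⊹ # 28 ⋆ t)) ⊹ # 0 , # 12 ⋆ r ⊹ (# 5 ⋆ (# 21 ⋆ t) ⊹ # 5 ⋆ b)) refl
      product : 4 * r + 2 * (G * (b * r)) + 4 * (G * (s * r)) + 2 * (G * (s * b)) + 3 * (G * b) + 2 * (G * r) ≤ G * (t * b) + 2 * (b * r)
      product = by-slack 0 (arith₁ b r t Y A s G) (+-mono-≤ (+-mono-≤ (*-monoʳ-≤ G (*-monoˡ-≤ (b + r) A-large)) (*-monoʳ-≤ (2 * G) fine)) (*-monoˡ-≤ r Y-large))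
        where
        arith₁ = semiring-solve 7 (λ b r t Y A s G → # 4 ⋆ r ⊹ # 2 ⋆ (G ⋆ (b ⋆ r)) ⊹ # 4 ⋆ (G ⋆ (s ⋆ r)) ⊹ # 2 ⋆ (G ⋆ (s ⋆ b)) ⊹ # 3 ⋆ (G ⋆ b) ⊹ # 2 ⋆ (G ⋆ r) ⊹ (G ⋆ ((# 2 ⋆ A ⊹ t) ⋆ (b ⊹ r)) ⊹ # 2 ⋆ G ⋆ (b ⋆ Y) ⊹ (# 2 ⋆ b ⊹ # 2 ⋆ (G ⋆ Y) ⊹ G) ⋆ r) ⊹ # 0 , G ⋆ (t ⋆ b) ⊹ # 2 ⋆ (b ⋆ r) ⊹ (G ⋆ ((# 2 ⋆ Y ⊹ # 2 ⋆ s ⊹ # 3) ⋆ (b ⊹ r)) ⊹ # 2 ⋆ G ⋆ (A ⋆ (b ⊹ r)) ⊹ (G ⋆ t ⊹ # 4 ⊹ # 2 ⋆ (G ⋆ b) ⊹ # 2 ⋆ (G ⋆ s)) ⋆ r)) refl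
      arith = semiring-solve 5 (λ b r t s G → # 77 ⋆ (# 4 ⋆ r ⊹ # 2 ⋆ (G ⋆ (b ⋆ r)) ⊹ # 4 ⋆ (G ⋆ (s ⋆ r)) ⊹ # 2 ⋆ (G ⋆ (s ⋆ b)) ⊹ # 3 ⋆ (G ⋆ b) ⊹ # 2 ⋆ (G ⋆ r)) ⊹ G ⋆ b ⋆ (# 77 ⋆ t) ⊹ # 77 ⋆ (b ⋆ r) ⋆ # 2 , # 77 ⋆ (G ⋆ (t ⋆ b) ⊹ # 2 ⋆ (b ⋆ r)) ⊹ G ⋆ b ⋆ (# 12 ⋆ r) ⊹ # 77 ⋆ (b ⋆ r) ⋆ G ⊹ (# 308 ⋆ r ⊹ # 65 ⋆ (G ⋆ (b ⋆ r)) ⊹ # 308 ⋆ (G ⋆ (s ⋆ r)) ⊹ # 154 ⋆ (G ⋆ (s ⋆ b)) ⊹ # 231 ⋆ (G ⋆ b) ⊹ # 154 ⋆ (G ⋆ r))) refl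

  total : 24 * (a + Y + 1) + 41 * t ≤ 53 * (v + 4 * t)
  total = by-slack (24 * s + 36) (arith a Y t v s) (+-mono-≤ (+-mono-≤ (*-monoʳ-≤ 12 sum) (*-monoʳ-≤ 5 21t≤v)) (*-monoʳ-≤ 72 1≤t))
    where
    arith = semiring-solve 5 (λ a Y t v s → # 24 ⋆ (a ⊹ Y ⊹ # 1) ⊹ # 41 ⋆ t ⊹ (# 12 ⋆ (# 4 ⋆ (v ⊹ # 4 ⋆ t ⊹ # 1) ⊹ t) ⊹ # 5 ⋆ v ⊹ # 72 ⋆ t) ⊹ (# 24 ⋆ s ⊹ # 36) , # 53 ⋆ (v ⊹ # 4 ⋆ t) ⊹ (# 12 ⋆ (# 2 ⋆ (a ⊹ Y) ⊹ # 2 ⋆ s ⊹ # 3) ⊹ # 5 ⋆ (# 21 ⋆ t) ⊹ # 72 ⋆ # 1)) refl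

argmax : ∀ {xs : List A} {x} (f : A → ℕ) → x ∈ xs → ∃[ y ] (y ∈ xs × (∀ z → z ∈ xs → f z ≤ f y))
argmax {xs = x ∷ []} f _ = x , here refl , λ { _ (here refl) → ≤-refl }
argmax {xs = x ∷ x′ ∷ xs} f _ with argmax {xs = x′ ∷ xs} f (here refl)
... | y , i , max with f x ≤? f y
...   | yes le = y , there i , λ { _ (here refl) → le ; z (there j) → max z j }
...   | no gt  = x , here refl , λ { _ (here refl) → ≤-refl ; z (there j) → ≤-trans (max z j) (<⇒≤ (≰⇒> gt)) }

-- The numerical condition under which a second colour class cannot contain an essential point.
Bounded : (q t p θ′ G D : ℕ) → Set
Bounded q t p θ′ G D = ∀ b′ e z W R → let b = suc b′ ; a = b + e in
  a + (z + b′) ≡ 1 + D → W ≤ b * (z + b′) → R ≤ b * z →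
  (∀ x → x + a ≡ 2 * θ′ → x * (p * (q * p)) ≤ q * (θ′ * W) + x * (p * a)) →
  10 * (p * p) + 2 * (a * b) ≤ pr a + pr b + 4 * (p * (a + b)) + 5 * R →
  t * q + 2 + G * (2 * θ′) ≤ b + G * (a + b + 2 * z) + t → ⊥

-- One colour for all essential points.

module Monochromatic {q : ℕ} (F : FiniteField q) (d : ℕ)
  (E : ℕ) (E-small : E + E < q) (2<q : 2 < q) (char : ∀ j → 1 ≤ j → j ≤ E → Field.ℕ→𝔽 F j ≢ Field.𝟘 F)
  (κ : ℕ) (κ-small : κ < 24 * E)
  (glue-inequality : ∀ t ε B → 1 ≤ t → 24 * ε ≤ κ * t → E * B ≤ ε * t →
    (2 * t + ε) * (2 + 2 * (q * t) + ε) + q * (t * t) + q * q * B < q * q * (t * t))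
  (G : ℕ) (1≤G : 1 ≤ G) (G-large : q ≤ G * E + 1) (G-small : (1 + G) * κ + 48 ≤ 24 * q)
  {N : ℕ} (c : Vec (Field.𝔽 F) d → Fin N) (c-scale : ∀ a v → a ≢ Field.𝟘 F → c (Vectors._·_ F a v) ≡ c v) where
  open Field F
  open Vectors F hiding (d)
  open PointSets F d
  open Fibres F d E E-small 2<q char
  open Subspaces F d E E-small 2<q char
  open Structure F d E E-small 2<q char κ κ-small glue-inequality
  open Pairs F d E E-small 2<q char κ κ-small glue-inequality G 1≤G G-large G-small
  open Colouring F d E E-small 2<q char c c-scale

  count-class : Fin N → ℕ
  count-class i = size (class i)

  excess : Fin N → ℕ
  excess i = count-class i ∸ 1

  ∑-at : ∀ j (f : Fin N → ℕ) → ∑ Fins (λ i → ⟦ does (i Fin.≟ j) ⟧ * f i) ≡ f j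
  ∑-at j f = trans (∑-cong Fins (λ i → pointwise i (true? (does (i Fin.≟ j))))) (trans (∑-*ʳ Fins (f j) _) (trans (cong (_* f j) (∑-allFin-δ j)) (+-identityʳ _)))
    where
    pointwise : ∀ i → does (i Fin.≟ j) ≡ true ⊎ does (i Fin.≟ j) ≡ false → ⟦ does (i Fin.≟ j) ⟧ * f i ≡ ⟦ does (i Fin.≟ j) ⟧ * f j
    pointwise i (inj₁ e) = cong (λ k → ⟦ does (i Fin.≟ j) ⟧ * f k) (does-true (i Fin.≟ j) e)
    pointwise i (inj₂ e) rewrite e = refl

  ∑-split : ∀ j (f : Fin N → ℕ) → ∑ Fins f ≡ f j + ∑ Fins (λ i → ⟦ other j i ⟧ * f i)
  ∑-split j f = trans (∑-cong Fins (λ i → trans (sym (+-identityʳ (f i))) (trans (cong (_* f i) (sym (⟦⟧-not (does (i Fin.≟ j))))) (*-distribʳ-+ (f i) ⟦ does (i Fin.≟ j) ⟧ _))))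
    (trans (∑-+ Fins _ _) (cong (_+ ∑ Fins (λ i → ⟦ other j i ⟧ * f i)) (∑-at j f)))

  ∑-split₂ : ∀ i₁ i₂ → i₂ ≢ i₁ → ∀ (f : Fin N → ℕ) → ∑ Fins (λ i → ⟦ other i₁ i ⟧ * f i) ≡ f i₂ + ∑ Fins (λ i → ⟦ other i₁ i ∧ other i₂ i ⟧ * f i)
  ∑-split₂ i₁ i₂ ne f = trans (∑-split i₂ (λ i → ⟦ other i₁ i ⟧ * f i)) (cong₂ _+_
    (trans (cong (λ b → ⟦ b ⟧ * f i₂) (other-≢ ne)) (+-identityʳ _))
    (∑-cong Fins (λ i → trans (sym (*-assoc ⟦ other i₂ i ⟧ ⟦ other i₁ i ⟧ (f i))) (cong (_* f i) (trans (*-comm ⟦ other i₂ i ⟧ ⟦ other i₁ i ⟧) (sym (⟦⟧-∧ (other i₁ i) (other i₂ i))))))))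

  other-sound : ∀ {j i} → other j i ≡ true → i ≢ j
  other-sound {j} {i} e = does-false (i Fin.≟ j) (not-true e)

  repeated : PSet
  mem repeated v = does (2 ≤? count-class (c v))
  inv repeated a v n = cong (λ i → does (2 ≤? count-class i)) (c-scale a v n)

  repeated-intro : ∀ v → 2 ≤ count-class (c v) → v ∈ˢ repeated
  repeated-intro v = does-intro (2 ≤? count-class (c v))

  repeated-size : size repeated ≡ ∑ Fins (λ i → ⟦ does (2 ≤? count-class i) ⟧ * count-class i)
  repeated-size = trans (∑-cong (pts d) (λ v → sym (trans (∑-cong Fins (λ i → *-comm _ ⟦ mem (class i) v ⟧)) (class-sum v)))) (trans (∑-swap (pts d) Fins _) (∑-cong Fins (λ i → ∑-*ˡ (pts d) ⟦ does (2 ≤? count-class i) ⟧ _)))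
    where
    class-sum : ∀ v → ∑ Fins (λ i → ⟦ mem (class i) v ⟧ * ⟦ does (2 ≤? count-class i) ⟧) ≡ ⟦ does (2 ≤? count-class (c v)) ⟧
    class-sum v = trans (∑-cong Fins (λ i → cong (λ b → ⟦ b ⟧ * ⟦ does (2 ≤? count-class i) ⟧) (flip i))) (∑-at (c v) (λ i → ⟦ does (2 ≤? count-class i) ⟧))
      where
      flip : ∀ i → does (c v Fin.≟ i) ≡ does (i Fin.≟ c v)
      flip i = bool-ext (λ e → does-intro (i Fin.≟ c v) (sym (does-true (c v Fin.≟ i) e))) (λ e → does-intro (c v Fin.≟ i) (sym (does-true (i Fin.≟ c v) e)))

  -- A class of at least two points is at most twice its excess; for the two distinguished classes
  -- the size itself is kept.
  repeated≤ : ∀ i₁ i₂ → i₂ ≢ i₁ → size repeated ≤ count-class i₁ + count-class i₂ + 2 * ∑ Fins (λ i → ⟦ other i₁ i ∧ other i₂ i ⟧ * excess i)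
  repeated≤ i₁ i₂ ne = begin
    size repeated ≡⟨ trans repeated-size (trans (∑-split i₁ f) (cong (f i₁ +_) (∑-split₂ i₁ i₂ ne f))) ⟩
    f i₁ + (f i₂ + ∑ Fins (λ i → ⟦ other i₁ i ∧ other i₂ i ⟧ * f i)) ≤⟨ +-mono-≤ (f≤ i₁) (+-mono-≤ (f≤ i₂) (∑-mono Fins (λ i → *-monoʳ-≤ ⟦ other i₁ i ∧ other i₂ i ⟧ (twice i (count-class i) (2 ≤? count-class i))))) ⟩
    count-class i₁ + (count-class i₂ + ∑ Fins (λ i → ⟦ other i₁ i ∧ other i₂ i ⟧ * (2 * excess i))) ≡⟨ trans (sym (+-assoc (count-class i₁) _ _)) (cong (count-class i₁ + count-class i₂ +_) (trans (∑-cong Fins (λ i → swap-* ⟦ other i₁ i ∧ other i₂ i ⟧ 2 (excess i))) (∑-*ˡ Fins 2 _))) ⟩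
    count-class i₁ + count-class i₂ + 2 * ∑ Fins (λ i → ⟦ other i₁ i ∧ other i₂ i ⟧ * excess i) ∎
    where
    open ≤-Reasoning
    f : Fin N → ℕ
    f i = ⟦ does (2 ≤? count-class i) ⟧ * count-class i
    f≤ : ∀ i → f i ≤ count-class i
    f≤ i = ≤-trans (*-monoˡ-≤ (count-class i) (⟦⟧≤1 (does (2 ≤? count-class i)))) (≤-reflexive (+-identityʳ _))
    swap-* : ∀ a b c → a * (b * c) ≡ b * (a * c)
    swap-* = semiring-solve 3 (λ a b c → a ⋆ (b ⋆ c) , b ⋆ (a ⋆ c)) refl
    twice : ∀ i n (D : Dec (2 ≤ n)) → ⟦ does D ⟧ * n ≤ 2 * (n ∸ 1)
    twice i n (no _) = z≤n
    twice i (suc (suc n)) (yes _) = ≤-trans (s≤s (s≤s (m≤m+n (n + 0) (n + 0)))) (≤-reflexive (arith n))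
      where
      arith : ∀ n → suc (suc (n + 0 + (n + 0))) ≡ 2 * suc n
      arith = semiring-solve 1 (λ n → 1⊹ (1⊹ (n ⊹ # 0 ⊹ (n ⊹ # 0))) , # 2 ⋆ 1⊹ n) refl
    twice i (suc zero) (yes (s≤s ()))

  module _ {j : ℕ} (rf : RainbowFreeᵏ (suc j)) where

    private
      K = suc j

    repeated-blocks : Blocks 2 K repeated
    repeated-blocks φ with rf φ
    ... | i , two = ≤-trans two (∩-mono {class i} {repeated} {ker φ} λ v e →
          repeated-intro v (subst (λ i → 2 ≤ count-class i) (sym (class-sound v e)) (≤-trans two (size-∩≤ (class i) (ker φ)))))

    -- Some colour repeats on a 2-secant of the repeated points, and only its two points can carry
    -- it. So the class of `P` contains all partners of `P`, as `partner-bound` demands.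
    repeated-partners : ∀ {P} → P ∈ pts d → P ∈ˢ repeated → Essential K repeated P →
      Θ K * q + 2 + G * (2 * Θ (suc K)) ≤ count-class (c P) + G * size repeated + Θ K
    repeated-partners {P} iP P∈ (φ , sec) = Fan.partner-bound j repeated repeated-blocks iP P∈ φ sec G 1≤G G-large (class (c P))
        (λ v e → repeated-intro v (subst (λ i → 2 ≤ count-class i) (sym (class-sound v e)) (does-true (2 ≤? count-class (c P)) P∈))) (class-self P) closed
      where
      closed : ∀ (χ : Vec V K) → Secant repeated χ P → 2 ≤ size (class (c P) ∩ ker χ)
      closed χ (kerP , two) with rf χ
      ... | i , pair with true? (mem (class i) P)
      ...   | inj₁ e = subst (λ i → 2 ≤ size (class i ∩ ker χ)) (sym (class-sound P e)) pair
      ...   | inj₂ out = ⊥-elim (1+n≰n (≤-trans (s≤s (≤-trans pair (size-⊆ {class i ∩ ker χ} {remove (repeated ∩ ker χ) iP} λ v iv e →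
                ∈-remove (repeated ∩ ker χ) iP iv (∧-intro (repeated-intro v (subst (λ i → 2 ≤ count-class i) (sym (class-sound v (proj₁ (∧-true e)))) (≤-trans pair (size-∩≤ (class i) (ker χ)))))
                  (proj₂ (∧-true {mem (class i) v} e))) λ { refl → false≢true out (proj₁ (∧-true e)) })))
                (≤-trans (≤-reflexive (sym (size-remove (repeated ∩ ker χ) iP (∧-intro P∈ kerP)))) two)))

    module _ (used : ∀ i → 1 ≤ count-class i) (D : ℕ) (D+N : D + N ≡ Θ d)
      (small-total : 24 * (1 + D) ≤ 48 * Θ (suc K) + κ * Θ K) (bounded : Bounded q (Θ K) (q ^ K) (Θ (suc K)) G D) where

      count≡ : ∀ i → count-class i ≡ suc (excess i)
      count≡ i = sym (m+[n∸m]≡n (used i))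

      -- `D`, the number of points minus the number of colours, is the quantity that the bound on
      -- `N` controls.
      ∑-excess : ∑ Fins excess ≡ D
      ∑-excess = +-cancelʳ-≡ N _ _ (trans (cong (∑ Fins excess +_) (sym (trans (∑-1 Fins) (Listₚ.length-tabulate id))))
        (trans (sym (∑-+ Fins excess _)) (trans (∑-cong Fins (λ i → trans (+-comm (excess i) 1) (sym (count≡ i)))) (trans classes-total (sym D+N)))))
    
      count≤ : ∀ i → count-class i ≤ 1 + D
      count≤ i = ≤-trans (≤-reflexive (count≡ i)) (s≤s (≤-trans (∑-∈ excess (∈-allFin i)) (≤-reflexive ∑-excess)))

      -- `many` would follow from an essential point in any class other than `i₁`. Sizes are
      -- rewritten through excesses, the form that `Bounded` refutes.
      second-class : ∀ i₁ i₂ → i₂ ≢ i₁ → count-class i₂ ≤ count-class i₁ → (∀ i → i ≢ i₁ → count-class i ≤ count-class i₂) →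
        Θ K * q + 2 + G * (2 * Θ (suc K)) ≤ count-class i₂ + G * size repeated + Θ K → ⊥
      second-class i₁ i₂ ne le max many = bounded b′ e z W R total W≤ R≤ fine′ coarse′ many′
        where
        b′ = excess i₂
        e = count-class i₁ ∸ count-class i₂
        z = ∑ Fins (λ i → ⟦ other i₁ i ∧ other i₂ i ⟧ * excess i)
        W = ∑ Fins (λ i → ⟦ other i₁ i ⟧ * pr (count-class i))
        R = ∑ Fins (λ i → ⟦ other i₁ i ∧ other i₂ i ⟧ * pr (count-class i))
        a≡ : suc b′ + e ≡ count-class i₁
        a≡ = trans (cong (_+ e) (sym (count≡ i₂))) (m+[n∸m]≡n le)
        b≡ : count-class i₂ ≡ suc b′
        b≡ = count≡ i₂
        total : suc b′ + e + (z + b′) ≡ 1 + D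
        total = trans (cong (_+ (z + b′)) (trans a≡ (count≡ i₁))) (cong suc (trans (cong (excess i₁ +_) (+-comm z b′))
          (trans (cong (excess i₁ +_) (sym (∑-split₂ i₁ i₂ ne excess))) (trans (sym (∑-split i₁ excess)) ∑-excess))))
        pr≤ : ∀ i → i ≢ i₁ → pr (count-class i) ≤ suc b′ * excess i
        pr≤ i n = *-monoˡ-≤ (excess i) (≤-trans (max i n) (≤-reflexive b≡))
        guarded : ∀ b {m n} → (b ≡ true → m ≤ n) → ⟦ b ⟧ * m ≤ ⟦ b ⟧ * n
        guarded true  f = *-monoʳ-≤ 1 (f refl)
        guarded false f = z≤n
        swap-* : ∀ a b c → a * (b * c) ≡ b * (a * c)
        swap-* = semiring-solve 3 (λ a b c → a ⋆ (b ⋆ c) , b ⋆ (a ⋆ c)) refl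
        W≤ : W ≤ suc b′ * (z + b′)
        W≤ = ≤-trans (∑-mono Fins (λ i → guarded (other i₁ i) (λ o → pr≤ i (other-sound o)))) (≤-reflexive (trans (∑-cong Fins (λ i → swap-* ⟦ other i₁ i ⟧ (suc b′) (excess i)))
          (trans (∑-*ˡ Fins (suc b′) _) (cong (suc b′ *_) (trans (∑-split₂ i₁ i₂ ne excess) (+-comm b′ z))))))
        R≤ : R ≤ suc b′ * z
        R≤ = ≤-trans (∑-mono Fins (λ i → guarded (other i₁ i ∧ other i₂ i) (λ o → pr≤ i (other-sound (proj₁ (∧-true o))))))
          (≤-reflexive (trans (∑-cong Fins (λ i → swap-* ⟦ other i₁ i ∧ other i₂ i ⟧ (suc b′) (excess i))) (∑-*ˡ Fins (suc b′) _)))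
        fine′ : ∀ x → x + (suc b′ + e) ≡ 2 * Θ (suc K) → x * (q ^ K * (q * q ^ K)) ≤ q * (Θ (suc K) * W) + x * (q ^ K * (suc b′ + e))
        fine′ x eq = subst (λ a → x * (q ^ K * (q * q ^ K)) ≤ q * (Θ (suc K) * W) + x * (q ^ K * a)) (sym a≡) (fine rf i₁ x (trans (cong (x +_) (sym a≡)) eq))
        coarse′ : 10 * (q ^ K * q ^ K) + 2 * ((suc b′ + e) * suc b′) ≤ pr (suc b′ + e) + pr (suc b′) + 4 * (q ^ K * ((suc b′ + e) + suc b′)) + 5 * R
        coarse′ = subst₂ (λ a b → 10 * (q ^ K * q ^ K) + 2 * (a * b) ≤ pr a + pr b + 4 * (q ^ K * (a + b)) + 5 * R) (sym a≡) b≡ (coarse rf i₁ i₂ (ne ∘ sym))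
        many′ : Θ K * q + 2 + G * (2 * Θ (suc K)) ≤ suc b′ + G * (suc b′ + e + suc b′ + 2 * z) + Θ K
        many′ = ≤-trans many (+-monoˡ-≤ (Θ K) (+-mono-≤ (≤-reflexive b≡) (*-monoʳ-≤ G (≤-trans (repeated≤ i₁ i₂ ne) (≤-reflexive (cong₂ (λ a b → a + b + 2 * z) (sym a≡) b≡))))))

      private
        Stray : Fin N → V → Set
        Stray i₁ P = P ∈ˢ repeated × c P ≢ i₁

        Dominated : Fin N → Set
        Dominated i₁ = ∀ P → P ∈ pts d → P ∈ˢ repeated → Essential K repeated P → c P ≡ i₁

        stray-none : ∀ i₁ → (∀ P → P ∈ pts d → P ∈ˢ repeated → c P ≡ i₁) → Slim K repeated × Dominated i₁
        stray-none i₁ all = small⇒slim {j} repeated (≤-trans (*-monoʳ-≤ 24 (≤-trans (size-⊆ {repeated} {class i₁} (λ v iv e → subst (λ i → v ∈ˢ class i) (all v iv e) (class-self v))) (count≤ i₁))) small-total)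
          , λ P iP P∈ _ → all P iP P∈

        stray-some : ∀ i₁ → (∀ i → count-class i ≤ count-class i₁) → ∀ P → P ∈ pts d → Stray i₁ P → Slim K repeated × Dominated i₁
        -- `i₂` is a largest class apart from `i₁`; the stray point shows that it has at least two
        -- points.
        stray-some i₁ max P iP (P∈ , P≢) = from-argmax (argmax {x = c P} (λ i → ⟦ other i₁ i ⟧ * count-class i) (∈-allFin (c P)))
          where
          from-argmax : ∃[ i₂ ] (i₂ ∈ Fins × (∀ i → i ∈ Fins → ⟦ other i₁ i ⟧ * count-class i ≤ ⟦ other i₁ i₂ ⟧ * count-class i₂)) → Slim K repeated × Dominated i₁
          from-argmax (i₂ , _ , max₂) = slim , dominated
            where
            value : ∀ {i} → i ≢ i₁ → ⟦ other i₁ i ⟧ * count-class i ≡ count-class i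
            value n = trans (cong (λ b → ⟦ b ⟧ * _) (other-≢ n)) (+-identityʳ _)
            two : 2 ≤ ⟦ other i₁ i₂ ⟧ * count-class i₂
            two = ≤-trans (does-true (2 ≤? count-class (c P)) P∈) (≤-trans (≤-reflexive (sym (value P≢))) (max₂ (c P) (∈-allFin (c P))))
            i₂≢i₁ : i₂ ≢ i₁
            i₂≢i₁ = other-sound (positive (other i₁ i₂) two)
              where
              positive : ∀ b {n} → 2 ≤ ⟦ b ⟧ * n → b ≡ true
              positive true _ = refl
            second-max : ∀ i → i ≢ i₁ → count-class i ≤ count-class i₂
            second-max i n = ≤-trans (≤-reflexive (sym (value n))) (≤-trans (max₂ i (∈-allFin i)) (≤-reflexive (value i₂≢i₁)))
            refuted : Θ K * q + 2 + G * (2 * Θ (suc K)) ≤ count-class i₂ + G * size repeated + Θ K → ⊥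
            refuted = second-class i₁ i₂ i₂≢i₁ (max i₂) second-max
            dominated : Dominated i₁
            dominated R iR R∈ ess with c R Fin.≟ i₁
            ... | yes e = e
            ... | no n = ⊥-elim (refuted (≤-trans (repeated-partners iR R∈ ess) (+-monoˡ-≤ (Θ K) (+-monoˡ-≤ (G * size repeated) (second-max (c R) n)))))
            -- The refuted inequality also bounds `repeated` from above: its negation, with two
            -- points in `i₂` and `q ≤ G E + 1`, is exactly what slimness takes. Counting colours
            -- alone would bound `repeated` only by about twice `D`.
            slim : Slim K repeated
            slim = *-cancelˡ-< G _ _ (+-cancelʳ-≤ (Θ K + 2) _ _ (begin
              suc (G * size repeated) + (Θ K + 2) ≡⟨ arith (G * size repeated) (Θ K) ⟩
              suc (2 + G * size repeated + Θ K) ≤⟨ s≤s (+-monoˡ-≤ (Θ K) (+-monoˡ-≤ (G * size repeated) (≤-trans two (≤-reflexive (value i₂≢i₁))))) ⟩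
              suc (count-class i₂ + G * size repeated + Θ K) ≤⟨ ≰⇒> refuted ⟩
              Θ K * q + 2 + G * (2 * Θ (suc K)) ≤⟨ +-monoˡ-≤ (G * (2 * Θ (suc K))) (+-monoˡ-≤ 2 (*-monoʳ-≤ (Θ K) G-large)) ⟩
              Θ K * (G * E + 1) + 2 + G * (2 * Θ (suc K)) ≡⟨ arith′ (Θ K) G E (Θ (suc K)) ⟩
              G * (2 * Θ (suc K) + E * Θ K) + (Θ K + 2) ∎))
              where
              open ≤-Reasoning
              arith : ∀ x t → suc x + (t + 2) ≡ suc (2 + x + t)
              arith = semiring-solve 2 (λ x t → 1⊹ x ⊹ (t ⊹ # 2) , 1⊹ (# 2 ⊹ x ⊹ t)) refl
              arith′ = semiring-solve 4 (λ t G E θ → t ⋆ (G ⋆ E ⊹ # 1) ⊹ # 2 ⊹ G ⋆ (# 2 ⋆ θ) , G ⋆ (# 2 ⋆ θ ⊹ E ⋆ t) ⊹ (t ⊹ # 2)) refl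

        dominant : ∃[ i ] (Slim K repeated × Dominated i)
        dominant with rf (replicate K 0ᵛ)
        ... | i₀ , _ with argmax {x = i₀} count-class (∈-allFin i₀)
        ...   | i₁ , _ , max with search (pts d) {Stray i₁} {λ P → P ∈ˢ repeated → c P ≡ i₁} decide
          where
          decide : ∀ P → P ∈ pts d → Stray i₁ P ⊎ (P ∈ˢ repeated → c P ≡ i₁)
          decide P _ with true? (mem repeated P) | c P Fin.≟ i₁
          ... | inj₂ out | _     = inj₂ (λ P∈ → ⊥-elim (false≢true out P∈))
          ... | inj₁ _   | yes e = inj₂ (λ _ → e)
          ... | inj₁ P∈  | no n  = inj₁ (P∈ , n)
        ...     | inj₁ (P , iP , stray) = i₁ , stray-some i₁ (λ i → max i (∈-allFin i)) P iP stray
        ...     | inj₂ none = i₁ , stray-none i₁ none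

      monochromatic-spaces : ∃[ i ] Disjoint-spaces K (class i)
      monochromatic-spaces = from-dominant dominant
        where
        from-dominant : ∃[ i ] (Slim K repeated × Dominated i) → ∃[ i ] Disjoint-spaces K (class i)
        from-dominant (i , slim , dominated) = i , from-core (find-core repeated repeated-blocks slim)
          where
          from-core : Core K repeated → Disjoint-spaces K (class i)
          from-core C = transfer (Final.disjoint-spaces γ (Core.core-blocks C) small-γ (λ P iP P∈ → proj₁ (Core.tight C P iP P∈)))
            where
            γ = Core.core C
            γ⊆class : ∀ P → P ∈ pts d → P ∈ˢ γ → P ∈ˢ class i
            γ⊆class P iP P∈ = subst (λ i → P ∈ˢ class i) (dominated P iP (Core.core⊆ C P P∈) (proj₂ (Core.tight C P iP P∈))) (class-self P)
            -- `repeated` is only known to be slim; the core lies in a single class, and this gives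
            -- the sharper bound.
            small-γ : Small K γ
            small-γ = ≤-trans (*-monoʳ-≤ 24 (≤-trans (size-⊆ {γ} {class i} γ⊆class) (count≤ i))) small-total
            inside : ∀ {m} (us : Vec V m) → Inside γ us → Inside (class i) us
            inside us in-γ as n = from-normal (normalise (comb as us) n)
              where
              from-normal : ∃[ X ] ∃[ c ] (X ∈ pts d × c ≢ 𝟘 × comb as us ≡ c · X) → comb as us ∈ˢ class i
              from-normal (X , a , iX , a≢0 , e) = subst (_∈ˢ class i) (sym e) (∈-scale (class i) a≢0 (γ⊆class X iX (trans (sym (inv γ a X a≢0)) (subst (_∈ˢ γ) e (in-γ as n)))))
            transfer : Disjoint-spaces K γ → Disjoint-spaces K (class i)
            transfer (us , ws , liu , liw , inu , inw , disjoint) = us , ws , liu , liw , inside us inu , inside ws inw , disjoint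

-- Translation to the geometry of the statement.

module Projective {q : ℕ} (F : FiniteField q) (n : ℕ)
  (E : ℕ) (E-small : E + E < q) (2<q : 2 < q) (char : ∀ j → 1 ≤ j → j ≤ E → Field.ℕ→𝔽 F j ≢ Field.𝟘 F)
  (κ : ℕ) (κ-small : κ < 24 * E)
  (glue-inequality : ∀ t ε B → 1 ≤ t → 24 * ε ≤ κ * t → E * B ≤ ε * t →
    (2 * t + ε) * (2 + 2 * (q * t) + ε) + q * (t * t) + q * q * B < q * q * (t * t))
  (G : ℕ) (1≤G : 1 ≤ G) (G-large : q ≤ G * E + 1) (G-small : (1 + G) * κ + 48 ≤ 24 * q)
  {N : ℕ} (c : Geometry.Coloring F n N) (strict : Geometry.StrictColoring F c) where
  open Field F
  open Vectors F hiding (d)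
  open PointSets F (suc n)
  open Geometry F using (linComb; Subspace; SamePoint; Rainbow; RainbowFree; Disjoint; ClassContains; ClassIs2Transversal)
  open Fibres F (suc n) E E-small 2<q char
  open Subspaces F (suc n) E E-small 2<q char
  open Dimension F (suc n) E E-small 2<q char
  open Pairs F (suc n) E E-small 2<q char κ κ-small glue-inequality G 1≤G G-large G-small using (Disjoint-spaces)

  private
    c-scale : ∀ a v → a ≢ 𝟘 → c (a · v) ≡ c v
    c-scale a v a≢0 with v ≟ᵛ 0ᵛ
    ... | yes refl = cong c (·-zeroʳ a)
    ... | no v≢0   = proj₁ strict (a · v) v (λ e → v≢0 (·-cancel-0 a≢0 e)) v≢0 (a , refl)

  open Colouring F (suc n) E E-small 2<q char c c-scale
  open Monochromatic F (suc n) E E-small 2<q char κ κ-small glue-inequality G 1≤G G-large G-small c c-scale using (count-class; monochromatic-spaces)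

  used : ∀ i → 1 ≤ count-class i
  used i with proj₂ strict i
  ... | v , v≢0 , e = 1≤size′ (class i) v≢0 (does-intro (c v Fin.≟ i) e)

  -- Makes the truncated subtraction that defines the excess `D` exact.
  colours≤points : N ≤ Θ (suc n)
  colours≤points = begin
    N ≡⟨ trans (∑-1 Fins) (Listₚ.length-tabulate id) ⟨
    ∑ Fins (λ _ → 1) ≤⟨ ∑-mono Fins used ⟩
    ∑ Fins count-class ≡⟨ classes-total ⟩
    Θ (suc n) ∎
    where open ≤-Reasoning

  linComb≡comb : ∀ as (bs : Vec V m) → linComb as bs ≡ comb as bs
  linComb≡comb []       []       = refl
  linComb≡comb (a ∷ as) (b ∷ bs) = cong (a · b +ᵛ_) (linComb≡comb as bs)

  subspace : ∀ {e} (bs : Vec V (suc e)) → LI bs → Subspace n e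
  subspace bs li = record { basis = bs ; indep = λ as e → li as (trans (sym (linComb≡comb as bs)) e) }

  basis-LI : ∀ {e} (W : Subspace n e) → LI (Subspace.basis W)
  basis-LI W as e = Subspace.indep W as (trans (linComb≡comb as (Subspace.basis W)) e)

  same-point : ∀ β → size β ≤ 1 → ∀ {u v} → u ≢ 0ᵛ → v ≢ 0ᵛ → u ∈ˢ β → v ∈ˢ β → SamePoint u v
  same-point β le {u} {v} u≢0 v≢0 u∈ v∈ with normalise u u≢0 | normalise v v≢0
  ... | x , a , ix , a≢0 , refl | y , b , iy , b≢0 , refl with size≤1-unique β le ix iy (trans (sym (inv β a x a≢0)) u∈) (trans (sym (inv β b y b≢0)) v∈) | inverse b b≢0
  ...   | refl | b⁻¹ , bb = a ⊗ b⁻¹ , trans (cong (_· x) (trans (sym (⊗-identityʳ a)) (trans (cong (a ⊗_) (trans (sym bb) (⊗-comm b b⁻¹))) (sym (⊗-assoc a b⁻¹ b))))) (sym (·-assoc (a ⊗ b⁻¹) b x))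

  module _ {j : ℕ} (K<n : suc j < n) (rf : RainbowFree (n ∸ suc j) c) where

    private
      K = suc j

    -- The common kernel contains an `(n - K)`-dimensional subspace, which would be rainbow if no
    -- class met the kernel twice.
    rainbow-freeᵏ : RainbowFreeᵏ K
    rainbow-freeᵏ φ = from-basis (kernel-basis φ (suc (n ∸ K)) (s≤s (≤-reflexive (m∸n+n≡m (<⇒≤ K<n)))))
      where
      from-basis : ∃[ bs ] (LI {suc (n ∸ K)} bs × (∀ as → ev φ (comb as bs) ≡ 0ᵛ)) → ∃[ i ] (2 ≤ size (class i ∩ ker φ))
      from-basis (bs , li , zeros) with search Fins {λ i → 2 ≤ size (class i ∩ ker φ)} {λ i → size (class i ∩ ker φ) ≤ 1} decide
        where
        decide : ∀ i → i ∈ Fins → 2 ≤ size (class i ∩ ker φ) ⊎ size (class i ∩ ker φ) ≤ 1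
        decide i _ with 2 ≤? size (class i ∩ ker φ)
        ... | yes two = inj₁ two
        ... | no few  = inj₂ (s≤s⁻¹ (≰⇒> few))
      ... | inj₁ (i , _ , two) = i , two
      ... | inj₂ few = ⊥-elim (rf (subspace bs li) rainbow)
        where
        in-kernel : ∀ {v} → ∃[ as ] (linComb as bs ≡ v) → v ∈ˢ ker φ
        in-kernel (as , refl) = trans (ker-ev φ _) (eqᵛ-complete (trans (cong (ev φ) (linComb≡comb as bs)) (zeros as)))
        rainbow : Rainbow c (subspace bs li)
        rainbow u v iu iv u≢0 v≢0 same = same-point (class (c u) ∩ ker φ) (few (c u) (∈-allFin (c u))) u≢0 v≢0 (∧-intro (class-self u) (in-kernel iu))
          (∧-intro (does-intro (c v Fin.≟ c u) (sym same)) (in-kernel iv))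

    module _ {i : Fin N} (spaces : Disjoint-spaces K (class i)) where

      private
        U W : Vec V (suc K)
        U = proj₁ spaces
        W = proj₁ (proj₂ spaces)
        U-LI : LI U
        U-LI = proj₁ (proj₂ (proj₂ spaces))
        W-LI : LI W
        W-LI = proj₁ (proj₂ (proj₂ (proj₂ spaces)))
        U-inside : Inside (class i) U
        U-inside = proj₁ (proj₂ (proj₂ (proj₂ (proj₂ spaces))))
        W-inside : Inside (class i) W
        W-inside = proj₁ (proj₂ (proj₂ (proj₂ (proj₂ (proj₂ spaces)))))
        skew : ∀ as bs → comb as U ≡ comb bs W → comb as U ≡ 0ᵛ
        skew = proj₂ (proj₂ (proj₂ (proj₂ (proj₂ (proj₂ spaces)))))

      contained : ∀ (bs : Vec V (suc K)) li → Inside (class i) bs → ClassContains c i (subspace bs li)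
      contained bs li inside v (as , refl) v≢0 = trans (cong c (linComb≡comb as bs)) (class-sound _ (inside as (v≢0 ∘ trans (linComb≡comb as bs))))

      disjoint : Disjoint (subspace U U-LI) (subspace W W-LI)
      disjoint v (as , refl) (bs , e) = trans (linComb≡comb as U) (skew as bs (trans (sym (linComb≡comb as U)) (trans (sym e) (linComb≡comb bs W))))

      -- Each of the two K-spaces meets every `(n - K)`-space for reasons of dimension, and since
      -- they are disjoint the two points differ.
      transversal : ClassIs2Transversal (n ∸ K) c i
      transversal X = from-meets (meets U (Subspace.basis X) U-LI (basis-LI X) large) (meets W (Subspace.basis X) W-LI (basis-LI X) large)
        where
        large : suc n < suc K + suc (n ∸ K)
        large = s≤s (≤-reflexive (sym (trans (+-suc K (n ∸ K)) (cong suc (m+[n∸m]≡n (<⇒≤ K<n))))))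
        Meet : Vec V (suc K) → Set
        Meet us = ∃[ as ] ∃[ bs ] (as ≢ 0ᵛ × comb as us ≡ comb bs (Subspace.basis X))
        from-meets : Meet U → Meet W → _
        from-meets (as , as′ , as≢0 , e) (bs , bs′ , bs≢0 , e′) = comb as U , comb bs W
          , (as′ , trans (linComb≡comb as′ (Subspace.basis X)) (sym e)) , (bs′ , trans (linComb≡comb bs′ (Subspace.basis X)) (sym e′)) , u≢0 , w≢0
          , (λ { (a , eq) → u≢0 (skew as (a · bs) (trans eq (sym (comb-· a bs W)))) }) , class-sound _ (U-inside as u≢0) , class-sound _ (W-inside bs w≢0)
          where
          u≢0 = as≢0 ∘ U-LI as
          w≢0 = bs≢0 ∘ W-LI bs

      dimension-bound : n ≤ 2 * K → ⊥
      dimension-bound le with meets U W U-LI W-LI (s≤s (≤-trans (s≤s le) (≤-reflexive (trans (cong (λ x → suc (K + x)) (+-identityʳ K)) (sym (+-suc K K))))))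
      ... | as , bs , as≢0 , e = as≢0 (U-LI as (skew as bs e))

    module _ (D : ℕ) (D+N : D + N ≡ Θ (suc n)) (small-total : 24 * (1 + D) ≤ 48 * Θ (suc K) + κ * Θ K)
      (bounded : Bounded q (Θ K) (q ^ K) (Θ (suc K)) G D) where

      spaces : ∃[ i ] Disjoint-spaces K (class i)
      spaces = monochromatic-spaces rainbow-freeᵏ used D D+N small-total bounded

      conclusionA : ∃[ i ] (Σ (Subspace n K) λ U → Σ (Subspace n K) λ W → Disjoint U W × ClassContains c i U × ClassContains c i W)
        × ∃[ i ] ClassIs2Transversal (n ∸ K) c i
      conclusionA = from-spaces spaces
        where
        from-spaces : ∃[ i ] Disjoint-spaces K (class i) → _
        from-spaces (i , us , ws , liu , liw , inu , inw , skew) = i , (subspace us liu , subspace ws liw , disjoint S , contained S us liu inu , contained S ws liw inw) , i , transversal S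
          where
          S : Disjoint-spaces K (class i)
          S = us , ws , liu , liw , inu , inw , skew

      conclusionB : n ≤ 2 * K → ⊥
      conclusionB le = dimension-bound (proj₂ spaces) le

-- The constants for prime q and for prime powers.

-- If j · 1 = 0 then 1 = 0 by Bézout.
prime-char : ∀ {q} (F : FiniteField q) → Prime q → ∀ j → 1 ≤ j → j < q → Field.ℕ→𝔽 F j ≢ Field.𝟘 F
prime-char {q} F prime-q j 1≤j j<q j≡0 = from-Bézout (coprime-Bézout (prime⇒coprime prime-q {{>-nonZero 1≤j}} j<q))
  where
  open Field F
  open Polynomials F using (q·1≡0)
  multiple : ∀ x {m} → ℕ→𝔽 m ≡ 𝟘 → ℕ→𝔽 (x * m) ≡ 𝟘
  multiple x {m} e = trans (×1-homo-* x m) (trans (cong (ℕ→𝔽 x ⊗_) e) (⊗-zeroʳ _))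
  unit : ∀ {m n} → ℕ→𝔽 m ≡ 𝟘 → ℕ→𝔽 n ≡ 𝟘 → 1 + m ≡ n → ⊥
  unit {m} {n} em en e = 1≢0 (trans (sym (⊕-identityʳ 𝟙)) (trans (cong (𝟙 ⊕_) (sym em)) (trans (cong ℕ→𝔽 e) en)))
  from-Bézout : Bézout.Identity 1 q j → ⊥
  from-Bézout (Bézout.+- x y e) = unit (multiple y j≡0) (multiple x q·1≡0) e
  from-Bézout (Bézout.-+ x y e) = unit (multiple x q·1≡0) (multiple y j≡0) e

even⊎odd : ∀ n → (∃[ e ] (n ≡ 2 * e)) ⊎ (∃[ e ] (n ≡ 1 + 2 * e))
even⊎odd zero = inj₁ (0 , refl)
even⊎odd (suc n) with even⊎odd n
... | inj₁ (e , refl) = inj₂ (e , refl)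
... | inj₂ (e , refl) = inj₁ (suc e , cong suc (sym (+-suc e (e + 0))))

odd-prime : ∀ {q} → Prime q → 11 ≤ q → ∃[ e ] (q ≡ 2 * (5 + e) + 1)
odd-prime {q} prime-q 11≤q with q ∸ 11 | m+[n∸m]≡n 11≤q
... | r | refl with even⊎odd r
...   | inj₁ (e , refl) = e , arith e
  where
  arith : ∀ e → 11 + 2 * e ≡ 2 * (5 + e) + 1
  arith = semiring-solve 1 (λ e → # 11 ⊹ # 2 ⋆ e , # 2 ⋆ (# 5 ⊹ e) ⊹ # 1) refl
...   | inj₂ (e , refl) with prime⇒irreducible prime-q {2} (divides (6 + e) (arith e))
  where
  arith : ∀ e → 11 + (1 + 2 * e) ≡ (6 + e) * 2
  arith = semiring-solve 1 (λ e → # 11 ⊹ (# 1 ⊹ # 2 ⋆ e) , (# 6 ⊹ e) ⋆ # 2) refl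
...     | inj₁ ()
...     | inj₂ ()

-- Here κ = 2 w.
prime-glue : ∀ {E w} → w + 18 ≡ 5 * E → let q = 2 * E + 1 in ∀ t ε B → 1 ≤ t → 12 * ε ≤ w * t → E * B ≤ ε * t →
  (2 * t + ε) * (2 + 2 * (q * t) + ε) + q * (t * t) + q * q * B < q * q * (t * t)
-- Adding `216 q² t²`, that is `12 · 18 q² t²`, completes `w` to `w + 18 = 5 E` without subtraction.
prime-glue {E} {w} w≡ t ε B 1≤t ε≤ B≤ = *-cancelˡ-< (144 * E) _ _ (+-cancelʳ-< (216 * (q * q * (t * t))) _ _ (begin-strict
  144 * E * ((2 * t + ε) * (2 + 2 * (q * t) + ε) + q * (t * t) + q * q * B) + 216 * (q * q * (t * t))
    ≡⟨ arith t ε B q E ⟩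
  E * ((24 * t + 12 * ε) * (24 + 24 * (q * t) + 12 * ε)) + 144 * E * (q * (t * t)) + 144 * (q * q) * (E * B) + 216 * (q * q * (t * t))
    ≤⟨ +-monoˡ-≤ (216 * (q * q * (t * t))) (+-mono-≤ (+-monoˡ-≤ (144 * E * (q * (t * t))) (*-monoʳ-≤ E (*-mono-≤ first second))) third) ⟩
  E * (((5 * E + 6) * t) * ((53 * E + 30) * t)) + 144 * E * (q * (t * t)) + 12 * (q * q) * (w * t * t) + 216 * (q * q * (t * t))
    ≡⟨ trans (arith′ (E * (((5 * E + 6) * t) * ((53 * E + 30) * t)) + 144 * E * (q * (t * t))) q w t) (cong (λ n → E * (((5 * E + 6) * t) * ((53 * E + 30) * t)) + 144 * E * (q * (t * t)) + 12 * (q * q * (n * (t * t)))) w≡) ⟩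
  E * (((5 * E + 6) * t) * ((53 * E + 30) * t)) + 144 * E * (q * (t * t)) + 12 * (q * q * (5 * E * (t * t)))
    -- The cubic in `E`, times `t²`, is the exact gap between the two sides.
    <⟨ m<m+n _ (≤-trans (*-mono-≤ 1≤t 1≤t) (m≤n*m (t * t) (216 + 624 * E + 444 * (E * E) + 71 * (E * E * E)))) ⟩
  E * (((5 * E + 6) * t) * ((53 * E + 30) * t)) + 144 * E * (q * (t * t)) + 12 * (q * q * (5 * E * (t * t))) + (216 + 624 * E + 444 * (E * E) + 71 * (E * E * E)) * (t * t)
    ≡⟨ arith″ E t ⟩
  144 * E * (q * q * (t * t)) + 216 * (q * q * (t * t))
    ∎))
  where
  open ≤-Reasoning
  q = 2 * E + 1
  first : 24 * t + 12 * ε ≤ (5 * E + 6) * t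
  first = ≤-trans (+-monoʳ-≤ (24 * t) ε≤) (≤-reflexive (trans (arith₁ t w) (cong (λ n → (n + 6) * t) w≡)))
    where
    arith₁ : ∀ t w → 24 * t + w * t ≡ (w + 18 + 6) * t
    arith₁ = semiring-solve 2 (λ t w → # 24 ⋆ t ⊹ w ⋆ t , (w ⊹ # 18 ⊹ # 6) ⋆ t) refl
  second : 24 + 24 * (q * t) + 12 * ε ≤ (53 * E + 30) * t
  second = ≤-trans (+-mono-≤ (+-monoˡ-≤ (24 * (q * t)) (*-monoʳ-≤ 24 1≤t)) ε≤) (≤-reflexive (trans (arith₁ t E w) (trans (cong (λ n → (48 * E + 30 + n) * t) w≡) (arith₂ E t))))
    where
    arith₁ = semiring-solve 3 (λ t E w → # 24 ⋆ t ⊹ # 24 ⋆ ((# 2 ⋆ E ⊹ # 1) ⋆ t) ⊹ w ⋆ t , (# 48 ⋆ E ⊹ # 30 ⊹ (w ⊹ # 18)) ⋆ t) refl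
    arith₂ : ∀ E t → (48 * E + 30 + 5 * E) * t ≡ (53 * E + 30) * t
    arith₂ = semiring-solve 2 (λ E t → (# 48 ⋆ E ⊹ # 30 ⊹ # 5 ⋆ E) ⋆ t , (# 53 ⋆ E ⊹ # 30) ⋆ t) refl
  third : 144 * (q * q) * (E * B) ≤ 12 * (q * q) * (w * t * t)
  third = ≤-trans (*-monoʳ-≤ (144 * (q * q)) B≤) (≤-trans (≤-reflexive (arith₁ q ε t)) (*-monoʳ-≤ (12 * (q * q)) (*-monoˡ-≤ t ε≤)))
    where
    arith₁ = semiring-solve 3 (λ q ε t → # 144 ⋆ (q ⋆ q) ⋆ (ε ⋆ t) , # 12 ⋆ (q ⋆ q) ⋆ (# 12 ⋆ ε ⋆ t)) refl
  arith = semiring-solve 5 (λ t ε B q E → # 144 ⋆ E ⋆ ((# 2 ⋆ t ⊹ ε) ⋆ (# 2 ⊹ # 2 ⋆ (q ⋆ t) ⊹ ε) ⊹ q ⋆ (t ⋆ t) ⊹ q ⋆ q ⋆ B) ⊹ # 216 ⋆ (q ⋆ q ⋆ (t ⋆ t)) , E ⋆ ((# 24 ⋆ t ⊹ # 12 ⋆ ε) ⋆ (# 24 ⊹ # 24 ⋆ (q ⋆ t) ⊹ # 12 ⋆ ε)) ⊹ # 144 ⋆ E ⋆ (q ⋆ (t ⋆ t)) ⊹ # 144 ⋆ (q ⋆ q) ⋆ (E ⋆ B) ⊹ # 216 ⋆ (q ⋆ q ⋆ (t ⋆ t))) refl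
  arith′ = semiring-solve 4 (λ x q w t → x ⊹ # 12 ⋆ (q ⋆ q) ⋆ (w ⋆ t ⋆ t) ⊹ # 216 ⋆ (q ⋆ q ⋆ (t ⋆ t)) , x ⊹ # 12 ⋆ (q ⋆ q ⋆ ((w ⊹ # 18) ⋆ (t ⋆ t)))) refl
  arith″ = semiring-solve 2 (λ E t → E ⋆ (((# 5 ⋆ E ⊹ # 6) ⋆ t) ⋆ ((# 53 ⋆ E ⊹ # 30) ⋆ t)) ⊹ # 144 ⋆ E ⋆ ((# 2 ⋆ E ⊹ # 1) ⋆ (t ⋆ t)) ⊹ # 12 ⋆ ((# 2 ⋆ E ⊹ # 1) ⋆ (# 2 ⋆ E ⊹ # 1) ⋆ (# 5 ⋆ E ⋆ (t ⋆ t))) ⊹ (# 216 ⊹ # 624 ⋆ E ⊹ # 444 ⋆ (E ⋆ E) ⊹ # 71 ⋆ (E ⋆ E ⋆ E)) ⋆ (t ⋆ t) , # 144 ⋆ E ⋆ ((# 2 ⋆ E ⊹ # 1) ⋆ (# 2 ⋆ E ⊹ # 1) ⋆ (t ⋆ t)) ⊹ # 216 ⋆ ((# 2 ⋆ E ⊹ # 1) ⋆ (# 2 ⋆ E ⊹ # 1) ⋆ (t ⋆ t))) refl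

-- With `E = 1` and `2 ε ≤ t` the bad fibres may cost half of `q² t²`. The remaining terms, about
-- `6 q t²`, fit into the other half.
composite-glue : ∀ e → let q = 25 + e in ∀ t ε B → 1 ≤ t → 24 * ε ≤ 12 * t → 1 * B ≤ ε * t →
  (2 * t + ε) * (2 + 2 * (q * t) + ε) + q * (t * t) + q * q * B < q * q * (t * t)
composite-glue e t ε B 1≤t ε≤ B≤ = *-cancelˡ-< 4 _ _ (begin-strict
  4 * ((2 * t + ε) * (2 + 2 * (q * t) + ε) + q * (t * t) + q * q * B)
    ≡⟨ arith t ε B q ⟩
  (4 * t + 2 * ε) * (4 + 4 * (q * t) + 2 * ε) + 4 * (q * (t * t)) + 4 * (q * q) * (1 * B)
    ≤⟨ +-mono-≤ (+-monoˡ-≤ _ (*-mono-≤ (+-monoʳ-≤ (4 * t) ε≤′) (+-mono-≤ (+-monoˡ-≤ (4 * (q * t)) (*-monoʳ-≤ 4 1≤t)) ε≤′))) (≤-trans (*-monoʳ-≤ (4 * (q * q)) B≤) (≤-trans (≤-reflexive (arith″ q ε t)) (*-monoʳ-≤ (2 * (q * q)) (*-monoˡ-≤ t ε≤′)))) ⟩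
  (4 * t + t) * (4 * t + 4 * (q * t) + t) + 4 * (q * (t * t)) + 2 * (q * q) * (t * t)
    <⟨ m<m+n _ (≤-trans (*-mono-≤ 1≤t 1≤t) (m≤n*m (t * t) (625 + 76 * e + 2 * (e * e)))) ⟩
  (4 * t + t) * (4 * t + 4 * (q * t) + t) + 4 * (q * (t * t)) + 2 * (q * q) * (t * t) + (625 + 76 * e + 2 * (e * e)) * (t * t)
    ≡⟨ arith‴ e t ⟩
  4 * (q * q * (t * t))
    ∎)
  where
  open ≤-Reasoning
  q = 25 + e
  ε≤′ : 2 * ε ≤ t
  ε≤′ = *-cancelˡ-≤ 12 (≤-trans (≤-reflexive (sym (*-assoc 12 2 ε))) ε≤)
  arith = semiring-solve 4 (λ t ε B q → # 4 ⋆ ((# 2 ⋆ t ⊹ ε) ⋆ (# 2 ⊹ # 2 ⋆ (q ⋆ t) ⊹ ε) ⊹ q ⋆ (t ⋆ t) ⊹ q ⋆ q ⋆ B) , (# 4 ⋆ t ⊹ # 2 ⋆ ε) ⋆ (# 4 ⊹ # 4 ⋆ (q ⋆ t) ⊹ # 2 ⋆ ε) ⊹ # 4 ⋆ (q ⋆ (t ⋆ t)) ⊹ # 4 ⋆ (q ⋆ q) ⋆ (# 1 ⋆ B)) refl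
  arith″ = semiring-solve 3 (λ q ε t → # 4 ⋆ (q ⋆ q) ⋆ (ε ⋆ t) , # 2 ⋆ (q ⋆ q) ⋆ (# 2 ⋆ ε ⋆ t)) refl
  arith‴ = semiring-solve 2 (λ e t → (# 4 ⋆ t ⊹ t) ⋆ (# 4 ⋆ t ⊹ # 4 ⋆ ((# 25 ⊹ e) ⋆ t) ⊹ t) ⊹ # 4 ⋆ ((# 25 ⊹ e) ⋆ (t ⋆ t)) ⊹ # 2 ⋆ ((# 25 ⊹ e) ⋆ (# 25 ⊹ e)) ⋆ (t ⋆ t) ⊹ (# 625 ⊹ # 76 ⋆ e ⊹ # 2 ⋆ (e ⋆ e)) ⋆ (t ⋆ t) , # 4 ⋆ ((# 25 ⊹ e) ⋆ (# 25 ⊹ e) ⋆ (t ⋆ t))) refl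

prime-bounded : ∀ {q t v D} → 1 ≤ t → 7 * t ≤ v → q * t ≡ v + 4 * t → 24 * (1 + D) + 41 * t + 91 ≤ 48 * (v + 4 * t + 1) + 5 * (v + 4 * t) →
  Bounded q t (v + 3 * t + 1) (v + 4 * t + 1) 2 D
prime-bounded {q} {t} {v} {D} 1≤t 7t≤v qt small b′ p z W R total W≤ R≤ fine coarse many =
  Spread.spread t v {q} {W} {R} b′ p z 1≤t 7t≤v qt C.a-bound W≤ R≤ fine coarse
    (≤-trans (≤-reflexive (cong (λ n → 24 * n + 41 * t) (arith b′ p z))) C.total) (C.impossible (s≤s z≤n))
  where
  a = suc b′ + p
  few : v + 4 * t + 4 * (v + 4 * t + 1) + suc b′ ≤ 2 * a + 4 * (z + b′) + 2 + t
  few = by-slack 0 (trans (arith₁ b′ p z t (v + 4 * t)) (cong (λ m → 2 * (suc b′ + p) + 4 * (z + b′) + 2 + t + (m + 2 + 2 * (2 * (v + 4 * t + 1)))) (trans (sym qt) (*-comm q t)))) many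
    where
    arith₁ = semiring-solve 5 (λ b′ p z t u → u ⊹ # 4 ⋆ (u ⊹ # 1) ⊹ 1⊹ b′ ⊹ (1⊹ b′ ⊹ # 2 ⋆ (1⊹ b′ ⊹ p ⊹ 1⊹ b′ ⊹ # 2 ⋆ z) ⊹ t) ⊹ # 0 , # 2 ⋆ (1⊹ b′ ⊹ p) ⊹ # 4 ⋆ (z ⊹ b′) ⊹ # 2 ⊹ t ⊹ (u ⊹ # 2 ⊹ # 2 ⋆ (# 2 ⋆ (u ⊹ # 1)))) refl
  arith = semiring-solve 3 (λ b′ p z → # 2 ⋆ 1⊹ b′ ⊹ p ⊹ z , 1⊹ b′ ⊹ p ⊹ (z ⊹ b′) ⊹ # 1) refl
  module C = Prime-case t v 1≤t 7t≤v a (suc b′) (z + b′) (≤-trans (≤-reflexive (cong (λ n → 24 * n + 41 * t + 91) total)) small) few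

composite-bounded : ∀ {q t v s G D} → 1 ≤ t → 21 * t ≤ v → 2 ≤ G → q ≡ G + 1 → q * t ≡ v + 4 * t → 2 * (1 + D) + 2 * s + 3 ≤ 4 * (v + 4 * t + 1) + t →
  Bounded q t (v + 3 * t + 1) (v + 4 * t + 1) G D
composite-bounded {t = t} {v} {s} {G} {D} 1≤t 21t≤v 2≤G refl qt small b′ p z W R total W≤ R≤ fine coarse many =
  Spread.spread t v {G + 1} {W} {R} b′ p z 1≤t (≤-trans (*-monoˡ-≤ t (m≤m+n 7 14)) 21t≤v) qt C.a-bound W≤ R≤ fine coarse
    (≤-trans (≤-reflexive (cong (λ n → 24 * n + 41 * t) (arith b′ p z))) C.total) (C.impossible (s≤s z≤n))
  where
  a = suc b′ + p
  Gt : G * t + t ≡ v + 4 * t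
  Gt = trans (arith₀ G t) qt
    where
    arith₀ : ∀ G t → G * t + t ≡ (G + 1) * t
    arith₀ = semiring-solve 2 (λ G t → G ⋆ t ⊹ t , (G ⊹ # 1) ⋆ t) refl
  few : v + 4 * t + 2 + 2 * (G * (v + 4 * t + 1)) + G * suc b′ ≤ suc b′ + G * (a + 2 * (z + b′) + 2) + t
  few = by-slack 0 (trans (arith₁ b′ p z t G (v + 4 * t)) (cong (λ m → suc b′ + G * (suc b′ + p + 2 * (z + b′) + 2) + t + (m + 2 + G * (2 * (v + 4 * t + 1)))) (trans (sym qt) (*-comm (G + 1) t)))) many
    where
    arith₁ = semiring-solve 6 (λ b′ p z t G u → u ⊹ # 2 ⊹ # 2 ⋆ (G ⋆ (u ⊹ # 1)) ⊹ G ⋆ 1⊹ b′ ⊹ (1⊹ b′ ⊹ G ⋆ (1⊹ b′ ⊹ p ⊹ 1⊹ b′ ⊹ # 2 ⋆ z) ⊹ t) ⊹ # 0 , 1⊹ b′ ⊹ G ⋆ (1⊹ b′ ⊹ p ⊹ # 2 ⋆ (z ⊹ b′) ⊹ # 2) ⊹ t ⊹ (u ⊹ # 2 ⊹ G ⋆ (# 2 ⋆ (u ⊹ # 1)))) refl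
  arith = semiring-solve 3 (λ b′ p z → # 2 ⋆ 1⊹ b′ ⊹ p ⊹ z , 1⊹ b′ ⊹ p ⊹ (z ⊹ b′) ⊹ # 1) refl
  module C = Composite-case t v s G 1≤t 21t≤v 2≤G Gt a (suc b′) (z + b′) (≤-trans (≤-reflexive (cong (λ n → 2 * n + 2 * s + 3) total)) small) few

-- √2 < 17/12, as 289 > 288.
sqrt2-bound : ∀ τ Q → τ * τ ≤ 2 * (Q * Q) → 12 * τ ≤ 17 * Q
sqrt2-bound τ Q le with 12 * τ ≤? 17 * Q
... | yes small = small
... | no large  = ⊥-elim (<⇒≱ (*-mono-< (≰⇒> large) (≰⇒> large)) (begin
  12 * τ * (12 * τ) ≡⟨ arith τ ⟩
  144 * (τ * τ) ≤⟨ *-monoʳ-≤ 144 le ⟩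
  144 * (2 * (Q * Q)) ≤⟨ m≤m+n _ (Q * Q) ⟩
  144 * (2 * (Q * Q)) + Q * Q ≡⟨ arith′ Q ⟩
  17 * Q * (17 * Q) ∎))
  where
  open ≤-Reasoning
  arith : ∀ τ → 12 * τ * (12 * τ) ≡ 144 * (τ * τ)
  arith = semiring-solve 1 (λ τ → # 12 ⋆ τ ⋆ (# 12 ⋆ τ) , # 144 ⋆ (τ ⋆ τ)) refl
  arith′ : ∀ Q → 144 * (2 * (Q * Q)) + Q * Q ≡ 17 * Q * (17 * Q)
  arith′ = semiring-solve 1 (λ Q → # 144 ⋆ (# 2 ⋆ (Q ⋆ Q)) ⊹ Q ⋆ Q , # 17 ⋆ Q ⋆ (# 17 ⋆ Q)) refl

-- Replaces `X - Y ≤ √2 Q` by the rational bound `17/12`, cleared of denominators and subtraction.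
difference-bound : ∀ X Y Q → let T = int X ℤ.- int Y in (T ℤ.≤ int 0) ⊎ (T ℤ.* T ℤ.≤ int 2 ℤ.* (int Q ℤ.* int Q)) → 12 * X ≤ 17 * Q + 12 * Y
difference-bound X Y Q bound with X ≤? Y
... | yes le = ≤-trans (*-monoʳ-≤ 12 le) (m≤n+m (12 * Y) (17 * Q))
... | no gt  = excess (X ∸ Y) (m∸n+n≡m (<⇒≤ (≰⇒> gt))) (m<n⇒0<n∸m (≰⇒> gt)) bound
  where
  open IntegerSolver ℤₚ.+-*-commutativeRing
  cancel : ∀ x y → (x ℤ.+ y) ℤ.- y ≡ x
  cancel = ring-solve 2 (λ x y → (x :+ y) :- y := x) refl
  excess : ∀ τ → τ + Y ≡ X → 1 ≤ τ → let T = int X ℤ.- int Y in (T ℤ.≤ int 0) ⊎ (T ℤ.* T ℤ.≤ int 2 ℤ.* (int Q ℤ.* int Q)) → 12 * X ≤ 17 * Q + 12 * Y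
  excess τ refl 1≤τ (inj₁ le) = ⊥-elim (<⇒≱ 1≤τ (ℤₚ.drop‿+≤+ (subst (ℤ._≤ int 0) (cancel (int τ) (int Y)) le)))
  excess τ refl _ (inj₂ le) = ≤-trans (≤-reflexive (*-distribˡ-+ 12 τ Y)) (+-monoˡ-≤ (12 * Y) (sqrt2-bound τ Q (ℤₚ.drop‿+≤+
    (subst₂ ℤ._≤_ (trans (cong (λ T → T ℤ.* T) (cancel (int τ) (int Y))) (sym (ℤₚ.pos-* τ τ))) (trans (cong (int 2 ℤ.*_) (sym (ℤₚ.pos-* Q Q))) (sym (ℤₚ.pos-* 2 (Q * Q)))) le))))

above-bound-i : ∀ {q n k N} D → D + N ≡ θ q n → AboveBound-i q n k N → 12 * (2 * D + q ^ k + 3 * θ q (k ∸ 1) + 10) ≤ 17 * q ^ k + 12 * (4 * θ q k)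
above-bound-i {q} {n} {k} {N} D D+N bound = difference-bound _ (4 * θ q k) (q ^ k) (subst (λ T → (T ℤ.≤ int 0) ⊎ (T ℤ.* T ℤ.≤ int 2 ℤ.* (int (q ^ k) ℤ.* int (q ^ k)))) T≡ bound)
  where
  open IntegerSolver ℤₚ.+-*-commutativeRing
  regroup : ∀ a b c e D N θ′ Q t → a ℤ.* (D ℤ.+ N) ℤ.- b ℤ.* θ′ ℤ.+ Q ℤ.+ c ℤ.* t ℤ.+ e ℤ.- a ℤ.* N ≡ a ℤ.* D ℤ.+ Q ℤ.+ c ℤ.* t ℤ.+ e ℤ.- b ℤ.* θ′
  regroup = ring-solve 9 (λ a b c e D N θ′ Q t → a :* (D :+ N) :- b :* θ′ :+ Q :+ c :* t :+ e :- a :* N := a :* D :+ Q :+ c :* t :+ e :- b :* θ′) refl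
  T≡ : int 2 ℤ.* int (θ q n) ℤ.- int 4 ℤ.* int (θ q k) ℤ.+ int (q ^ k) ℤ.+ int 3 ℤ.* int (θ q (k ∸ 1)) ℤ.+ int 10 ℤ.- int 2 ℤ.* int N ≡ int (2 * D + q ^ k + 3 * θ q (k ∸ 1) + 10) ℤ.- int (4 * θ q k)
  T≡ = trans (cong (λ m → int 2 ℤ.* int m ℤ.- int 4 ℤ.* int (θ q k) ℤ.+ int (q ^ k) ℤ.+ int 3 ℤ.* int (θ q (k ∸ 1)) ℤ.+ int 10 ℤ.- int 2 ℤ.* int N) (sym D+N))
    (trans (regroup (int 2) (int 4) (int 3) (int 10) (int D) (int N) (int (θ q k)) (int (q ^ k)) (int (θ q (k ∸ 1))))
      (cong₂ ℤ._-_ (cong₂ (λ x y → x ℤ.+ int (q ^ k) ℤ.+ y ℤ.+ int 10) (sym (ℤₚ.pos-* 2 D)) (sym (ℤₚ.pos-* 3 (θ q (k ∸ 1))))) (sym (ℤₚ.pos-* 4 (θ q k)))))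

θ≡Θ : ∀ {q} (F : FiniteField q) m → θ q m ≡ Vectors.Θ F (suc m)
θ≡Θ {q} F zero    = refl
θ≡Θ {q} F (suc m) = cong (_+ q ^ suc m) (θ≡Θ F m)

θ-suc : ∀ q m → θ q (suc m) ≡ 1 + q * θ q m
θ-suc q zero    = refl
θ-suc q (suc m) = trans (cong (_+ q ^ suc (suc m)) (θ-suc q m)) (cong suc (sym (*-distribˡ-+ q (θ q m) (q ^ suc m))))

1≤θ : ∀ q m → 1 ≤ θ q m
1≤θ q zero    = ≤-refl
1≤θ q (suc m) = ≤-trans (1≤θ q m) (m≤m+n _ _)

module _ {q j v : ℕ} (qt : q * θ q j ≡ v + 4 * θ q j) where

  θ-next : θ q (suc j) ≡ v + 4 * θ q j + 1
  θ-next = trans (θ-suc q j) (trans (cong suc qt) (+-comm 1 _))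

  power : q ^ suc j ≡ v + 3 * θ q j + 1
  power = +-cancelˡ-≡ (θ q j) _ _ (trans θ-next (arith (θ q j) v))
    where
    arith : ∀ t v → v + 4 * t + 1 ≡ t + (v + 3 * t + 1)
    arith = semiring-solve 2 (λ t v → v ⊹ # 4 ⋆ t ⊹ # 1 , t ⊹ (v ⊹ # 3 ⋆ t ⊹ # 1)) refl

Conclusions : ∀ {q} → FiniteField q → (n k : ℕ) → (ℕ → Set) → Set
Conclusions F n k AboveBound = ConclusionA F n k AboveBound × (n ≤ 2 * k → ConclusionB F n k AboveBound)

module _ {q : ℕ} (F : FiniteField q)
  (E : ℕ) (E-small : E + E < q) (2<q : 2 < q) (char : ∀ j → 1 ≤ j → j ≤ E → Field.ℕ→𝔽 F j ≢ Field.𝟘 F)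
  (κ : ℕ) (κ-small : κ < 24 * E)
  (glue-inequality : ∀ t ε B → 1 ≤ t → 24 * ε ≤ κ * t → E * B ≤ ε * t →
    (2 * t + ε) * (2 + 2 * (q * t) + ε) + q * (t * t) + q * q * B < q * q * (t * t))
  (G : ℕ) (1≤G : 1 ≤ G) (G-large : q ≤ G * E + 1) (G-small : (1 + G) * κ + 48 ≤ 24 * q) where

  conclusions : ∀ {n j v} (AboveBound : ℕ → Set) → suc j < n → (let t = θ q j) → q * t ≡ v + 4 * t →
    (∀ {D N} → D + N ≡ θ q n → AboveBound N → 24 * (1 + D) ≤ 48 * θ q (suc j) + κ * t × Bounded q t (v + 3 * t + 1) (v + 4 * t + 1) G D) →
    Conclusions F n (suc j) AboveBound
  conclusions {n} {j} {v} AboveBound K<n qt bounds = (λ N c strict rf above → Numbers.monochromatic c strict above rf)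
      , λ le N c strict rf above → Numbers.dimension c strict above rf le
    where
    open Vectors F using (Θ)
    module Numbers {N} (c : Geometry.Coloring F n N) (strict : Geometry.StrictColoring F c) (above : AboveBound N) where
      module P = Projective F n E E-small 2<q char κ κ-small glue-inequality G 1≤G G-large G-small c strict
      D : ℕ
      D = Θ (suc n) ∸ N
      D+N : D + N ≡ Θ (suc n)
      D+N = m∸n+n≡m P.colours≤points
      both : 24 * (1 + D) ≤ 48 * θ q (suc j) + κ * θ q j × Bounded q (θ q j) (v + 3 * θ q j + 1) (v + 4 * θ q j + 1) G D
      both = bounds {D} {N} (trans D+N (sym (θ≡Θ F n))) above
      small-total : 24 * (1 + D) ≤ 48 * Θ (suc (suc j)) + κ * Θ (suc j)
      small-total = subst₂ (λ x y → 24 * (1 + D) ≤ 48 * x + κ * y) (θ≡Θ F (suc j)) (θ≡Θ F j) (proj₁ both)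
      bounded : Bounded q (Θ (suc j)) (q ^ suc j) (Θ (suc (suc j))) G D
      bounded = subst₂ (λ x y → Bounded q x (q ^ suc j) y G D) (θ≡Θ F j) (θ≡Θ F (suc j))
        (subst₂ (λ x y → Bounded q (θ q j) x y G D) (sym (power {q} {j} {v} qt)) (sym (θ-next {q} {j} {v} qt)) (proj₂ both))
      monochromatic = λ rf → P.conclusionA K<n rf D D+N small-total bounded
      dimension = λ rf → P.conclusionB K<n rf D D+N small-total bounded

-- `E = (q - 1) / 2` is the largest value with `2 E < q`, and `G = 2` is then the least with
-- `q ≤ G E + 1`. The bound on `N` becomes `24 (1 + D) + 41 t + 91 ≤ 48 θ_k + 5 q t`, whence
-- `κ = 5 q - 41`, and `q ≥ 11` gives `v = (q - 4) t ≥ 7 t`.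
prime-conclusions : ∀ e (let q = 2 * (5 + e) + 1) (F : FiniteField q) → Prime q → ∀ {n j} → suc j < n → Conclusions F n (suc j) (AboveBound-i q n (suc j))
prime-conclusions e F prime-q {n} {j} K<n = conclusions F (5 + e) (≤-reflexive (arith₁ e)) (≤-trans (m≤m+n 3 (8 + 2 * e)) (≤-reflexive (arith₂ e)))
  (λ i 1≤i i≤E → prime-char F prime-q i 1≤i (≤-trans (s≤s i≤E) (≤-trans (m≤m+n (6 + e) (5 + e)) (≤-reflexive (arith₃ e)))))
  (2 * (7 + 5 * e)) (≤-trans (m≤m+n _ (105 + 14 * e)) (≤-reflexive (arith₄ e)))
  (λ t ε B 1≤t ε≤ B≤ → prime-glue {5 + e} {7 + 5 * e} (arith₅ e) t ε B 1≤t (*-cancelˡ-≤ 2 (≤-trans (≤-reflexive (sym (*-assoc 2 12 ε))) (≤-trans ε≤ (≤-reflexive (*-assoc 2 (7 + 5 * e) t))))) B≤)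
  2 (s≤s z≤n) ≤-refl (≤-trans (m≤m+n _ (174 + 18 * e)) (≤-reflexive (arith₆ e)))
  {n} {j} {(7 + 2 * e) * t} (AboveBound-i q n (suc j)) K<n qt bounds
  where
  q = 2 * (5 + e) + 1
  t = θ q j
  v = (7 + 2 * e) * t
  arith₁ : ∀ e → suc (5 + e + (5 + e)) ≡ 2 * (5 + e) + 1
  arith₁ = semiring-solve 1 (λ e → 1⊹ (# 5 ⊹ e ⊹ (# 5 ⊹ e)) , # 2 ⋆ (# 5 ⊹ e) ⊹ # 1) refl
  arith₂ : ∀ e → 3 + (8 + 2 * e) ≡ 2 * (5 + e) + 1
  arith₂ = semiring-solve 1 (λ e → # 3 ⊹ (# 8 ⊹ # 2 ⋆ e) , # 2 ⋆ (# 5 ⊹ e) ⊹ # 1) refl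
  arith₃ : ∀ e → 6 + e + (5 + e) ≡ 2 * (5 + e) + 1
  arith₃ = semiring-solve 1 (λ e → # 6 ⊹ e ⊹ (# 5 ⊹ e) , # 2 ⋆ (# 5 ⊹ e) ⊹ # 1) refl
  arith₄ : ∀ e → suc (2 * (7 + 5 * e)) + (105 + 14 * e) ≡ 24 * (5 + e)
  arith₄ = semiring-solve 1 (λ e → 1⊹ (# 2 ⋆ (# 7 ⊹ # 5 ⋆ e)) ⊹ (# 105 ⊹ # 14 ⋆ e) , # 24 ⋆ (# 5 ⊹ e)) refl
  arith₅ : ∀ e → 7 + 5 * e + 18 ≡ 5 * (5 + e)
  arith₅ = semiring-solve 1 (λ e → # 7 ⊹ # 5 ⋆ e ⊹ # 18 , # 5 ⋆ (# 5 ⊹ e)) refl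
  arith₆ = semiring-solve 1 (λ e → (# 1 ⊹ # 2) ⋆ (# 2 ⋆ (# 7 ⊹ # 5 ⋆ e)) ⊹ # 48 ⊹ (# 174 ⊹ # 18 ⋆ e) , # 24 ⋆ (# 2 ⋆ (# 5 ⊹ e) ⊹ # 1)) refl
  qt : q * t ≡ v + 4 * t
  qt = arith₇ e t
    where
    arith₇ : ∀ e t → (2 * (5 + e) + 1) * t ≡ (7 + 2 * e) * t + 4 * t
    arith₇ = semiring-solve 2 (λ e t → (# 2 ⋆ (# 5 ⊹ e) ⊹ # 1) ⋆ t , (# 7 ⊹ # 2 ⋆ e) ⋆ t ⊹ # 4 ⋆ t) refl
  bounds : ∀ {D N} → D + N ≡ θ q n → AboveBound-i q n (suc j) N →
    24 * (1 + D) ≤ 48 * θ q (suc j) + 2 * (7 + 5 * e) * t × Bounded q t (v + 3 * t + 1) (v + 4 * t + 1) 2 D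
  bounds {D} {N} D+N above = subst (λ θ′ → 24 * (1 + D) ≤ 48 * θ′ + 2 * (7 + 5 * e) * t) (sym (θ-next {q} {j} {v} qt)) (by-slack 91 (arith₉ D t e (v + 4 * t + 1)) small)
      , prime-bounded {q} {t} {v} {D} (1≤θ q j) (*-monoˡ-≤ t (m≤m+n 7 (2 * e))) qt small
    where
    arith₈ = semiring-solve 3 (λ D t v → # 24 ⋆ (# 1 ⊹ D) ⊹ # 41 ⋆ t ⊹ # 91 ⊹ (# 17 ⋆ (v ⊹ # 3 ⋆ t ⊹ # 1) ⊹ # 12 ⋆ (# 4 ⋆ (v ⊹ # 4 ⋆ t ⊹ # 1))) ⊹ # 0 , # 48 ⋆ (v ⊹ # 4 ⋆ t ⊹ # 1) ⊹ # 5 ⋆ (v ⊹ # 4 ⋆ t) ⊹ # 12 ⋆ (# 2 ⋆ D ⊹ (v ⊹ # 3 ⋆ t ⊹ # 1) ⊹ # 3 ⋆ t ⊹ # 10)) refl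
    arith₉ = semiring-solve 4 (λ D t e θ′ → # 24 ⋆ (# 1 ⊹ D) ⊹ (# 48 ⋆ θ′ ⊹ # 5 ⋆ ((# 7 ⊹ # 2 ⋆ e) ⋆ t ⊹ # 4 ⋆ t)) ⊹ # 91 , # 48 ⋆ θ′ ⊹ # 2 ⋆ (# 7 ⊹ # 5 ⋆ e) ⋆ t ⊹ (# 24 ⋆ (# 1 ⊹ D) ⊹ # 41 ⋆ t ⊹ # 91)) refl
    small : 24 * (1 + D) + 41 * t + 91 ≤ 48 * (v + 4 * t + 1) + 5 * (v + 4 * t)
    small = by-slack 0 (arith₈ D t v) (subst₂ (λ Q θ′ → 12 * (2 * D + Q + 3 * t + 10) ≤ 17 * Q + 12 * (4 * θ′)) (power {q} {j} {v} qt) (θ-next {q} {j} {v} qt) (above-bound-i {q} {n} {suc j} {N} D D+N above))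

-- In small characteristic only the multiple 1 is certain to be nonzero, so `E = 1`, and
-- `q ≤ G E + 1` makes `G = q - 1` the least choice. The bound on `N` gives `1 + D ≤ 2 θ_k + t / 2`,
-- whence `κ = 12`.
composite-conclusions : ∀ e (let q = 25 + e) (F : FiniteField q) {n i} → suc (suc i) < n → Conclusions F n (suc (suc i)) (AboveBound-ii q n (suc (suc i)))
composite-conclusions e F {n} {i} K<n = conclusions F 1 (m≤m+n 3 (22 + e)) (m≤m+n 3 (22 + e))
  (λ { (suc zero) _ _ e → 1≢0 (trans (sym (⊕-identityʳ 𝟙)) e) ; (suc (suc _)) _ (s≤s ()) })
  12 (m≤m+n 13 11) (composite-glue e)
  (24 + e) (s≤s z≤n) (≤-reflexive (arith₁ e)) (≤-trans (m≤m+n _ (252 + 12 * e)) (≤-reflexive (arith₂ e)))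
  {n} {suc i} {v} (AboveBound-ii q n (suc (suc i))) K<n qt bounds
  where
  open Field F using (1≢0; ⊕-identityʳ; 𝟙)
  q = 25 + e
  t = θ q (suc i)
  s = θ q i
  v = (21 + e) * t
  arith₁ : ∀ e → 25 + e ≡ (24 + e) * 1 + 1
  arith₁ = semiring-solve 1 (λ e → # 25 ⊹ e , (# 24 ⊹ e) ⋆ # 1 ⊹ # 1) refl
  arith₂ = semiring-solve 1 (λ e → (# 1 ⊹ (# 24 ⊹ e)) ⋆ # 12 ⊹ # 48 ⊹ (# 252 ⊹ # 12 ⋆ e) , # 24 ⋆ (# 25 ⊹ e)) refl
  qt : q * t ≡ v + 4 * t
  qt = arith₃ e t
    where
    arith₃ : ∀ e t → (25 + e) * t ≡ (21 + e) * t + 4 * t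
    arith₃ = semiring-solve 2 (λ e t → (# 25 ⊹ e) ⋆ t , (# 21 ⊹ e) ⋆ t ⊹ # 4 ⋆ t) refl
  bounds : ∀ {D N} → D + N ≡ θ q n → AboveBound-ii q n (suc (suc i)) N →
    24 * (1 + D) ≤ 48 * θ q (suc (suc i)) + 12 * t × Bounded q t (v + 3 * t + 1) (v + 4 * t + 1) (24 + e) D
  bounds {D} {N} D+N above = by-slack (24 * s + 36) (arith₅ D s t (θ q (suc (suc i)))) (*-monoʳ-≤ 12 small)
      , composite-bounded {q} {t} {v} {s} {24 + e} {D} (1≤θ q (suc i)) (*-monoˡ-≤ t (m≤m+n 21 e)) (s≤s (s≤s z≤n)) (+-comm 1 (24 + e)) qt (subst (λ θ′ → 2 * (1 + D) + 2 * s + 3 ≤ 4 * θ′ + t) (θ-next {q} {suc i} {v} qt) small)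
    where
    arith₄ = semiring-solve 5 (λ D N s p θ′ → # 2 ⋆ (# 1 ⊹ D) ⊹ # 2 ⋆ s ⊹ # 3 ⊹ (# 2 ⋆ N ⊹ # 4 ⋆ θ′ ⊹ p) ⊹ # 0 , # 4 ⋆ θ′ ⊹ (s ⊹ p) ⊹ (# 2 ⋆ (D ⊹ N) ⊹ s ⊹ # 5)) refl
    arith₅ = semiring-solve 4 (λ D s t θ′ → # 24 ⋆ (# 1 ⊹ D) ⊹ # 12 ⋆ (# 4 ⋆ θ′ ⊹ t) ⊹ (# 24 ⋆ s ⊹ # 36) , # 48 ⋆ θ′ ⊹ # 12 ⋆ t ⊹ # 12 ⋆ (# 2 ⋆ (# 1 ⊹ D) ⊹ # 2 ⋆ s ⊹ # 3)) refl
    small : 2 * (1 + D) + 2 * s + 3 ≤ 4 * θ q (suc (suc i)) + t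
    small = by-slack 0 (arith₄ D N s (q ^ suc i) (θ q (suc (suc i)))) (subst (λ m → 2 * m + s + 5 ≤ 2 * N + 4 * θ q (suc (suc i)) + q ^ suc i) (sym D+N) above)

theorem1p7 : ∀ (n p h k q : ℕ) (F : FiniteField q) →
  2 ≤ n → Prime p → 1 ≤ h → q ≡ p ^ h → 1 ≤ k → k < n →
  ((h ≡ 1 × 11 ≤ q × DeltaNonneg-i q k) →
     (2 * k < n → ConclusionA F n k (AboveBound-i q n k))
     × (n ≤ 2 * k → ConclusionB F n k (AboveBound-i q n k)))
  × ((2 ≤ h × 2 ≤ k × 25 ≤ q) →
     (2 * k < n → ConclusionA F n k (AboveBound-ii q n k))
     × (n ≤ 2 * k → ConclusionB F n k (AboveBound-ii q n k)))
theorem1p7 n p h k q F _ prime-p _ q≡pʰ 1≤k k<n = prime-power-1 , higher-power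
  where
  split : ∀ {AboveBound} → Conclusions F n k AboveBound → (2 * k < n → ConclusionA F n k AboveBound) × (n ≤ 2 * k → ConclusionB F n k AboveBound)
  split (a , b) = (λ _ → a) , b
  prime-power-1 : (h ≡ 1 × 11 ≤ q × DeltaNonneg-i q k) → _
  prime-power-1 (refl , 11≤q , _) = split (from-e F k 1≤k k<n (odd-prime prime-q 11≤q) prime-q)
    where
    prime-q : Prime q
    prime-q = subst Prime (sym (trans q≡pʰ (*-identityʳ p))) prime-p
    from-e : ∀ {q} (F : FiniteField q) k → 1 ≤ k → k < n → ∃[ e ] (q ≡ 2 * (5 + e) + 1) → Prime q → Conclusions F n k (AboveBound-i q n k)
    from-e F (suc j) _ k<n (e , refl) prime-q = prime-conclusions e F prime-q k<n
  higher-power : (2 ≤ h × 2 ≤ k × 25 ≤ q) → _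
  higher-power (_ , 2≤k , 25≤q) = split (from-e F k 2≤k k<n (q ∸ 25) (sym (m+[n∸m]≡n 25≤q)))
    where
    from-e : ∀ {q} (F : FiniteField q) k → 2 ≤ k → k < n → ∀ e → q ≡ 25 + e → Conclusions F n k (AboveBound-ii q n k)
    from-e F (suc (suc i)) _ k<n e refl = composite-conclusions e F k<n
    from-e F (suc zero) (s≤s ())
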